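{- Consider smooth heaps and slim heaps, with the operations make-heap, find-min, insert, meld, delete-min, decrease-key and delete implemented as described in the context. For every finite sequence of these operations, starting with no heaps, the total running time is $O\big(\sum_i c_i\big)$, where for the $i$-th operation, performed on a heap (or, for meld, producing a heap) containing $n_i$ nodes at the time of the operation, $c_i = 1+\lg n_i$ if the operation is delete-min or delete, $c_i = \max(1,\lg\lg n_i)$ if it is decrease-key, and $c_i = 1$ if it is make-heap, find-min, insert or meld. That is, delete-min and delete take $O(\lg n)$ amortized time, decrease-key takes $O(\lg\lg n)$ amortized time, and make-heap, find-min, insert and meld take $O(1)$ amortized time.
   Context: $\lg$ denotes the base-two logarithm. A heap stores a set of nodes, each with a real key, as a forest of rooted ordered trees in heap order (a child's key is at least its parent's key). The roots form a root list (identify front with "left"), with a root of minimum key (the min-root) first; each node has an ordered list of children. A heap also has a buffer (a set of roots, initially empty), stores its number of nodes $n$, and maintains the minimum-key root among the buffer and among the root list. Key comparisons use the strict total order $\prec$: $a \prec b$ iff $\mathrm{key}(a)<\mathrm{key}(b)$, or the keys are equal and $a$ lies to the right of $b$ in the current list. A link of two nodes adjacent in a list (root list or sibling list) makes the $\prec$-smaller one (the winner) the parent of the other (the loser), removing the loser from the list; it is a left link if the loser was left of the winner, a right link otherwise. In a slim heap the loser always becomes the new leftmost child of the winner; in a smooth heap the loser becomes the new leftmost child after a left link and the new rightmost child after a right link. Each link costs $O(1)$ time. Leftmost locally maximum linking of a list: while more than one node remains, let $v$ be the leftmost node that is $\prec$-larger than each of its existing neighbours in the list, and link $v$ with whichever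 existing neighbour is $\prec$-larger. Operations: make-heap creates an empty heap; find-min returns the minimum-key root (over root list and buffer); insert$(x,h)$ makes $x$ a one-node tree placed first in the root list if its key is smaller than the min-root's, second otherwise (no links); meld$(h,h')$ first empties the buffer of the heap with fewer nodes, then concatenates the root lists, keeps the buffer of the larger heap, and sets the min-root. Emptying a buffer: sort its roots in non-increasing key order (comparison sort), apply leftmost locally maximum linking to that sorted list, and add the resulting root to the root list. delete-min$(h)$: empty the buffer; delete the min-root $x$ and replace it in the root list by its children in their list order (so they precede the remaining roots); apply leftmost locally maximum linking to the whole root list until one root remains, which becomes the min-root. decrease-key$(x,k,h)$ (given a pointer to $x$ and $k \le \mathrm{key}(x)$): set $\mathrm{key}(x)=k$; if $x$ is not a root, cut $x$ (with its subtree) from its sibling list $L$, and if $x$ has a child, cut its leftmost child $y$ (with its subtree) from $x$ and put $y$ in $x$'s former place in $L$; then add $x$ to the buffer, and if the buffer contains at least $\lg n$ roots, empty it; finally update the minimum. delete$(x,h)$: if $x$ is the min-root, do delete-min; otherwise repeatedly link adjacent children of $x$ by leftmost locally maximum linking until $x$ has at most one child, and replace $x$ by that child (if any) in the list containing $x$. All operations other than links and buffer sorting take $O(1)$ time per elementary pointer step. -}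

module Defs where

open import Level using (0ℓ)
open import Data.Bool using (Bool; true; false; not; if_then_else_)
open import Data.Nat using (ℕ; zero; suc; _+_; _*_; _∸_; _^_; _≡ᵇ_; _⊔_)
  renaming (_≤_ to _≤ℕ_; _<_ to _<ℕ_)
open import Data.Nat.Logarithm using (⌈log₂_⌉)
open import Data.List using (List; []; _∷_; _++_; length; take; drop; [_])
open import Data.List.Relation.Unary.Linked using (Linked)
open import Data.List.Relation.Binary.Permutation.Propositional using (_↭_)
open import Data.Maybe using (Maybe; just; nothing)
open import Data.Product using (_×_; _,_)
open import Relation.Binary.Bundles using (DecTotalOrder)
open import Relation.Binary.PropositionalEquality using (_≡_; _≢_)
open import Relation.Nullary using (does; ¬_)

-- Amortized charges c_i (natural-number versions, equal up to constant
-- factors to the real quantities 1 + lg n and max(1, lg lg n)).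
chargeDel : ℕ → ℕ
chargeDel n = 1 + ⌈log₂ n ⌉

chargeDK : ℕ → ℕ
chargeDK n = 1 ⊔ ⌈log₂ ⌈log₂ n ⌉ ⌉

-- Cost charged for comparison-sorting b items (worst case of merge sort,
-- O(b lg b)).
sortCost : ℕ → ℕ
sortCost b = b * (1 + ⌈log₂ b ⌉)

data Variant : Set where
  smooth slim : Variant

module Heaps (O : DecTotalOrder 0ℓ 0ℓ 0ℓ) where

  open DecTotalOrder O using (_≤?_) renaming (Carrier to Key; _≤_ to _≤ₖ_)

  Id : Set
  Id = ℕ

  data Tree : Set where
    node : Id → Key → List Tree → Tree

  key : Tree → Key
  key (node _ k _) = k

  _<ₖ_ : Key → Key → Bool
  k <ₖ k' = not (does (k' ≤? k))

  -- For a adjacent-left of b:  a ≺ b  iff key a < key b.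
  leftSmaller : Tree → Tree → Bool
  leftSmaller a b = key a <ₖ key b

  attachLeft : Tree → Tree → Tree
  attachLeft (node i k cs) t = node i k (t ∷ cs)

  attachRight : Tree → Tree → Tree
  attachRight (node i k cs) t = node i k (cs ++ [ t ])

  linkPair : Variant → Tree → Tree → Tree
  linkPair slim   a b = if leftSmaller a b then attachLeft a b else attachLeft b a
  linkPair smooth a b = if leftSmaller a b then attachRight a b else attachLeft b a

  -- One step of leftmost locally maximum linking.
  -- step' v l x rest : list  l ∷ x ∷ rest  in which l ≺ x is known.
  step' : Variant → Tree → Tree → List Tree → List Tree
  step' v l x [] = [ linkPair v l x ]
  step' v l x (r ∷ rest) =
    if not (leftSmaller x r)           -- r ≺ x : x is locally maximum
    then (if leftSmaller l r            -- l ≺ r : r is the larger neighbour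
          then l ∷ linkPair v x r ∷ rest
          else linkPair v l x ∷ r ∷ rest)
    else l ∷ step' v x r rest

  step : Variant → List Tree → List Tree
  step v [] = []
  step v (a ∷ []) = a ∷ []
  step v (a ∷ b ∷ rest) =
    if not (leftSmaller a b) then linkPair v a b ∷ rest else step' v a b rest

  linkFuel : Variant → ℕ → List Tree → List Tree
  linkFuel v zero xs = xs
  linkFuel v (suc f) xs = linkFuel v f (step v xs)

  -- leftmost locally maximum linking of a whole list (each step removes one
  -- root, so length-many steps suffice)
  linkAll : Variant → List Tree → List Tree
  linkAll v xs = linkFuel v (length xs) xs

  linkCost : Variant → List Tree → ℕ
  linkCost v xs = length xs ∸ length (linkAll v xs)

  addRoot : Tree → List Tree → List Tree
  addRoot y [] = [ y ]
  addRoot y (r ∷ rs) = if key y <ₖ key r then y ∷ r ∷ rs else r ∷ y ∷ rs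

  addAll : List Tree → List Tree → List Tree
  addAll [] rs = rs
  addAll (y ∷ _) rs = addRoot y rs

  meldRoots : List Tree → List Tree → List Tree
  meldRoots [] l' = l'
  meldRoots (r ∷ l) [] = r ∷ l
  meldRoots (r ∷ l) (r' ∷ l') =
    if key r' <ₖ key r then r' ∷ (r ∷ l) ++ l' else r ∷ l ++ (r' ∷ l')

  cutIn : Id → List Tree → Maybe (List Tree × Tree)
  cutIn x [] = nothing
  cutIn x (node i k cs ∷ ts) with i ≡ᵇ x
  ... | true = just (take 1 cs ++ ts , node i k (drop 1 cs))
  ... | false with cutIn x cs
  ...   | just (cs' , t) = just (node i k cs' ∷ ts , t)
  ...   | nothing with cutIn x ts
  ...     | just (ts' , t) = just (node i k cs ∷ ts' , t)
  ...     | nothing = nothing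

  cutBelow : Id → List Tree → Maybe (List Tree × Tree)
  cutBelow x [] = nothing
  cutBelow x (node i k cs ∷ ts) with cutIn x cs
  ... | just (cs' , t) = just (node i k cs' ∷ ts , t)
  ... | nothing with cutBelow x ts
  ...   | just (ts' , t) = just (node i k cs ∷ ts' , t)
  ...   | nothing = nothing

  delIn : Variant → Id → List Tree → Maybe (List Tree × ℕ)
  delIn v x [] = nothing
  delIn v x (node i k cs ∷ ts) with i ≡ᵇ x
  ... | true = just (linkAll v cs ++ ts , linkCost v cs)
  ... | false with delIn v x cs
  ...   | just (cs' , c) = just (node i k cs' ∷ ts , c)
  ...   | nothing with delIn v x ts
  ...     | just (ts' , c) = just (node i k cs ∷ ts' , c)
  ...     | nothing = nothing

  record Heap : Set where
    constructor mkHeap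
    field
      roots  : List Tree   -- root list, min-root first
      buffer : List Tree
      size   : ℕ
  open Heap public

  emptyHeap : Heap
  emptyHeap = mkHeap [] [] 0

  NonIncreasing : List Tree → Set
  NonIncreasing = Linked (λ a b → key b ≤ₖ key a)

  -- Emptying the buffer: any comparison sort into non-increasing key order
  -- (ties in any order), then leftmost locally maximum linking, then adding the
  -- resulting root to the root list.  Last index = cost.
  data Empties (v : Variant) : Heap → Heap → ℕ → Set where
    empties : ∀ {H} (s : List Tree) → s ↭ buffer H → NonIncreasing s →
      Empties v H (mkHeap (addAll (linkAll v s) (roots H)) [] (size H))
                  (1 + sortCost (length s) + linkCost v s)

  -- empty the buffer iff it contains at least lg n roots (i.e. n ≤ 2^b)
  data MaybeEmpty (v : Variant) : Heap → Heap → ℕ → Set where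
    full : ∀ {H H' c} → size H ≤ℕ 2 ^ length (buffer H) → Empties v H H' c →
      MaybeEmpty v H H' c
    notFull : ∀ {H} → 2 ^ length (buffer H) <ℕ size H → MaybeEmpty v H H 0

  -- Deleting a root x (with children cs) from the root list after emptying
  -- the buffer; x is either the (old) min-root or the first root of the
  -- buffer-emptied list.
  data DelRoot (v : Variant) (x : Id) : Heap → Heap → ℕ → Set where
    delRoot : ∀ {H H₁ e} pre k cs rest → Empties v H H₁ e →
      roots H₁ ≡ pre ++ node x k cs ∷ rest → length pre ≤ℕ 1 →
      DelRoot v x H (mkHeap (linkAll v (cs ++ pre ++ rest)) [] (size H ∸ 1))
                    (1 + e + linkCost v (cs ++ pre ++ rest))

  record World : Set where
    constructor mkWorld
    field
      heaps : ℕ → Maybe Heap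
      nextH : ℕ
      nextN : ℕ
  open World public

  initWorld : World
  initWorld = mkWorld (λ _ → nothing) 0 0

  upd : (ℕ → Maybe Heap) → ℕ → Maybe Heap → ℕ → Maybe Heap
  upd f i m j = if j ≡ᵇ i then m else f j

  setHeap : World → ℕ → Maybe Heap → World
  setHeap W i m = mkWorld (upd (heaps W) i m) (nextH W) (nextN W)

  data Op : Set where
    makeHeap    : Op
    findMin     : ℕ → Op
    insert      : Key → ℕ → Op
    meld        : ℕ → ℕ → Op          -- result stored under the first handle
    deleteMin   : ℕ → Op
    decreaseKey : Id → Key → ℕ → Op
    delete      : Id → ℕ → Op

  -- Step v W op W' cost charge : performing op in W gives W', with actual
  -- cost (1 per operation + links + sorting) and amortized charge c_i.
  data Step (v : Variant) : World → Op → World → ℕ → ℕ → Set where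
    s-make : ∀ {W} →
      Step v W makeHeap
        (mkWorld (upd (heaps W) (nextH W) (just emptyHeap)) (suc (nextH W)) (nextN W)) 1 1
    s-find : ∀ {W h H} → heaps W h ≡ just H → Step v W (findMin h) W 1 1
    s-insert : ∀ {W h H k} → heaps W h ≡ just H →
      Step v W (insert k h)
        (mkWorld (upd (heaps W) h (just (mkHeap (addRoot (node (nextN W) k []) (roots H))
                                                 (buffer H) (suc (size H)))))
                 (nextH W) (suc (nextN W))) 1 1
    -- meld: empty the buffer of the heap with fewer nodes (either if equal)
    s-meld₁ : ∀ {W h h' H H' H'' e} → h ≢ h' → heaps W h ≡ just H → heaps W h' ≡ just H' →
      size H' ≤ℕ size H → Empties v H' H'' e →
      Step v W (meld h h')
        (setHeap (setHeap W h' nothing) h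
          (just (mkHeap (meldRoots (roots H) (roots H'')) (buffer H) (size H + size H'))))
        (1 + e) 1
    s-meld₂ : ∀ {W h h' H H' H'' e} → h ≢ h' → heaps W h ≡ just H → heaps W h' ≡ just H' →
      size H ≤ℕ size H' → Empties v H H'' e →
      Step v W (meld h h')
        (setHeap (setHeap W h' nothing) h
          (just (mkHeap (meldRoots (roots H'') (roots H')) (buffer H') (size H + size H'))))
        (1 + e) 1
    s-delmin : ∀ {W h H H₁ e x k cs rs} → heaps W h ≡ just H → Empties v H H₁ e →
      roots H₁ ≡ node x k cs ∷ rs →
      Step v W (deleteMin h)
        (setHeap W h (just (mkHeap (linkAll v (cs ++ rs)) [] (size H ∸ 1))))
        (1 + e + linkCost v (cs ++ rs)) (chargeDel (size H))
    s-dk-min : ∀ {W h H x kx k cs rs} → heaps W h ≡ just H →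
      roots H ≡ node x kx cs ∷ rs → k ≤ₖ kx →
      Step v W (decreaseKey x k h)
        (setHeap W h (just (mkHeap (node x k cs ∷ rs) (buffer H) (size H))))
        1 (chargeDK (size H))
    s-dk-root : ∀ {W h H x kx k cs r pre post} → heaps W h ≡ just H →
      roots H ≡ r ∷ pre ++ node x kx cs ∷ post → k ≤ₖ kx →
      Step v W (decreaseKey x k h)
        (setHeap W h (just (mkHeap
          (if k <ₖ key r then node x k cs ∷ r ∷ pre ++ post
                         else r ∷ pre ++ node x k cs ∷ post)
          (buffer H) (size H))))
        1 (chargeDK (size H))
    s-dk-buf : ∀ {W h H x kx k cs pre post} → heaps W h ≡ just H →
      buffer H ≡ pre ++ node x kx cs ∷ post → k ≤ₖ kx →
      Step v W (decreaseKey x k h)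
        (setHeap W h (just (mkHeap (roots H) (pre ++ node x k cs ∷ post) (size H))))
        1 (chargeDK (size H))
    s-dk-cutR : ∀ {W h H H' e x kx k cs rs'} → heaps W h ≡ just H →
      cutBelow x (roots H) ≡ just (rs' , node x kx cs) → k ≤ₖ kx →
      MaybeEmpty v (mkHeap rs' (node x k cs ∷ buffer H) (size H)) H' e →
      Step v W (decreaseKey x k h) (setHeap W h (just H')) (1 + e) (chargeDK (size H))
    s-dk-cutB : ∀ {W h H H' e x kx k cs bs'} → heaps W h ≡ just H →
      cutBelow x (buffer H) ≡ just (bs' , node x kx cs) → k ≤ₖ kx →
      MaybeEmpty v (mkHeap (roots H) (node x k cs ∷ bs') (size H)) H' e →
      Step v W (decreaseKey x k h) (setHeap W h (just H')) (1 + e) (chargeDK (size H))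
    s-del-min : ∀ {W h H H' c x k cs rs} → heaps W h ≡ just H →
      roots H ≡ node x k cs ∷ rs → DelRoot v x H H' c →
      Step v W (delete x h) (setHeap W h (just H')) c (chargeDel (size H))
    s-del-roots : ∀ {W h H x i k cs rs rs' c} → heaps W h ≡ just H →
      roots H ≡ node i k cs ∷ rs → i ≢ x → delIn v x (roots H) ≡ just (rs' , c) →
      Step v W (delete x h)
        (setHeap W h (just (mkHeap rs' (buffer H) (size H ∸ 1))))
        (1 + c) (chargeDel (size H))
    s-del-buf : ∀ {W h H x bs' c} → heaps W h ≡ just H →
      delIn v x (buffer H) ≡ just (bs' , c) →
      Step v W (delete x h)
        (setHeap W h (just (mkHeap (roots H) bs' (size H ∸ 1))))
        (1 + c) (chargeDel (size H))

  data Run (v : Variant) : World → List Op → World → ℕ → ℕ → Set where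
    done : ∀ {W} → Run v W [] W 0 0
    next : ∀ {W W₁ W₂ o os c a cs as} → Step v W o W₁ c a → Run v W₁ os W₂ cs as →
      Run v W (o ∷ os) W₂ (c + cs) (a + as)

{-# OPTIONS --safe #-}
module Submission where

-- The potential depends on the future as well as on the past.  Backwards
-- through the run, every edge is marked with the mass that stays with the
-- parent when the child is cut or deleted; the mass of a node then survives
-- cuts below it and only grows, and its bit length is the node's rank.  An edge
-- is real if it carries the whole mass of the child, and phantom otherwise.
-- Forwards, every edge records the level ρ of its parent's rank at the link and
-- a charge ν below its class, the class being the bit length of the rank
-- difference, hence O(log log n).  Real edges store a multiple of their class,
-- and nodes that will be deleted store the variation of the charges of their
-- children, whose levels fall and then rise from left to right.
--
-- When children are linked, the gaps between them inherit levels.  A link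
-- closes a gap: either the charge of the new edge exceeds that of its winner,
-- or the potential N of the levels around the winner drops.  All other terms
-- telescope to O(log n) per deletion.  A phantom link costs O(log log n) and is
-- booked as a debt G(n, u) for the current number u of phantom edges; a cut
-- lowers u by at most 2, and at the end of the run no edge is phantom.  In a
-- sorted buffer every link is made at the front and costs the class of one gap.

open import Defs
open import Level using (0ℓ)
open import Data.Bool using (Bool; true; false; if_then_else_; _∧_; not; T)
open import Data.Bool.Properties using (∧-comm)
open import Data.Empty using (⊥-elim)
open import Data.List using (List; []; _∷_; _++_; length; [_])
open import Data.List.Properties using (++-identityʳ)
open import Data.List.Relation.Binary.Permutation.Propositional using (_↭_; prep; swap; ↭-sym; ↭-trans; ↭-refl)
open import Data.List.Relation.Binary.Permutation.Propositional.Properties using (shift; ++-comm; ↭-length)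
open import Data.List.Relation.Unary.Linked using ([]; [-]; _∷_)
open import Data.Maybe using (Maybe; just; nothing)
open import Data.Nat
open import Data.Nat.Logarithm
open import Data.Nat.Properties
open import Data.Product using (_×_; _,_; proj₁; proj₂; Σ; Σ-syntax)
open import Data.Sum using (_⊎_; inj₁; inj₂)
open import Data.Unit using (⊤; tt)
open import Relation.Binary.Bundles using (DecTotalOrder)
open import Relation.Binary.PropositionalEquality hiding ([_])
open import Relation.Nullary using (Dec; yes; no)
open import Relation.Nullary.Decidable using (dec-true)

-- A rank computed from current sizes would fall along a whole path of ancestors at every cut and
-- invalidate the levels recorded there. Marks drawn from the future avoid this: an edit leaves the
-- total mass of the sibling list as it was (`Edited.masses≡`), and only edges next to the edit can
-- become phantom.
--
-- During one round of linking a node wins at most once on each side. The winner is the larger of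
-- the two neighbours of a local maximum, so it is larger than its next neighbour on that side. Two
-- flags and a bounded `credit` therefore suffice. When N does not drop, the new edge receives a
-- larger charge than its winner had; the charges of neighbours telescope, so only their variation
-- along the list has to be prepaid.
--
-- The potential is signed and is kept as a difference of natural numbers. Hence every estimate
-- reads: cost + new `pos` + old `neg` is at most old `pos` + new `neg` + allowance. The
-- coefficients fit each other: 64 = 40 + 12 + 12, 18 = 12 + 6, 130 = 2 * 64 + 2, 116 = 2 * 40 + 3 *
-- 12, 53 = 1 + 40 + 12.

-- Deciding linear arithmetic over the natural numbers

module LinearArithmetic where

  open import Data.Bool using (Bool; true; false; if_then_else_; T; _∧_; _∨_; not)
  open import Data.Nat
  open import Data.Nat.Properties
  open import Data.Fin using (Fin; zero; suc)
  open import Data.List using (List; []; _∷_; _++_; length; replicate; upTo)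
  open import Data.Vec using (Vec; []; _∷_; lookup; allFin)
  import Data.Vec as Vec
  open import Data.Vec.N-ary using (N-ary; ∀ⁿ; curryⁿ; _$ⁿ_)
  open import Data.Product using (_×_; _,_; proj₁; proj₂)
  open import Data.Sum using (_⊎_; inj₁; inj₂)
  open import Data.Maybe using (Maybe; just; nothing)
  open import Data.Empty using (⊥; ⊥-elim)
  open import Data.Unit using (⊤; tt)
  open import Data.List.Relation.Unary.All using (All; []; _∷_)
  open import Relation.Binary.PropositionalEquality
  open import Relation.Nullary using (yes; no)

  infixl 6 _⊕_ _⊖_
  infixl 7 _⊛_
  infix 4 _≲_ _≐_
  infixr 1 _⇒_
  infixr 2 _and_
  infixr 2 _or_

  data Tm (n : ℕ) : Set where
    var : Fin n → Tm n
    # : ℕ → Tm n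
    _⊕_ _⊖_ : Tm n → Tm n → Tm n
    _⊛_ : ℕ → Tm n → Tm n
    mx mn : Tm n → Tm n → Tm n

  data Fm (n : ℕ) : Set where
    _≲_ _≐_ : Tm n → Tm n → Fm n
    _⇒_ _and_ _or_ : Fm n → Fm n → Fm n

  Env : ℕ → Set
  Env n = Vec ℕ n

  ⟦_⟧ : ∀ {n} → Tm n → Env n → ℕ
  ⟦ var x ⟧ ρ = lookup ρ x
  ⟦ # k ⟧ ρ = k
  ⟦ s ⊕ t ⟧ ρ = ⟦ s ⟧ ρ + ⟦ t ⟧ ρ
  ⟦ s ⊖ t ⟧ ρ = ⟦ s ⟧ ρ ∸ ⟦ t ⟧ ρ
  ⟦ k ⊛ t ⟧ ρ = k * ⟦ t ⟧ ρ
  ⟦ mx s t ⟧ ρ = ⟦ s ⟧ ρ ⊔ ⟦ t ⟧ ρ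
  ⟦ mn s t ⟧ ρ = ⟦ s ⟧ ρ ⊓ ⟦ t ⟧ ρ

  ⟪_⟫ : ∀ {n} → Fm n → Env n → Set
  ⟪ s ≲ t ⟫ ρ = ⟦ s ⟧ ρ ≤ ⟦ t ⟧ ρ
  ⟪ s ≐ t ⟫ ρ = ⟦ s ⟧ ρ ≡ ⟦ t ⟧ ρ
  ⟪ F ⇒ G ⟫ ρ = ⟪ F ⟫ ρ → ⟪ G ⟫ ρ
  ⟪ F and G ⟫ ρ = ⟪ F ⟫ ρ × ⟪ G ⟫ ρ
  ⟪ F or G ⟫ ρ = ⟪ F ⟫ ρ ⊎ ⟪ G ⟫ ρ

  data L (n : ℕ) : Set where
    lf : Vec ℕ n → ℕ → L n

  dot : ∀ {n} → Vec ℕ n → Env n → ℕ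
  dot [] [] = 0
  dot (c ∷ cs) (x ∷ ρ) = c * x + dot cs ρ

  ev : ∀ {n} → L n → Env n → ℕ
  ev (lf cs k) ρ = dot cs ρ + k

  _+L_ : ∀ {n} → L n → L n → L n
  lf c k +L lf d l = lf (Vec.zipWith _+_ c d) (k + l)

  _*L_ : ∀ {n} → ℕ → L n → L n
  m *L lf c k = lf (Vec.map (m *_) c) (m * k)

  0L : ∀ {n} → L n
  0L = lf (Vec.replicate _ 0) 0

  kL : ∀ {n} → ℕ → L n
  kL k = lf (Vec.replicate _ 0) k

  xL : ∀ {n} → Fin n → L n
  xL i = lf (unit i) 0
    where
    unit : ∀ {n} → Fin n → Vec ℕ n
    unit zero = 1 ∷ Vec.replicate _ 0
    unit (suc i) = 0 ∷ unit i

  Row : ℕ → Set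
  Row n = L n × L n

  Ctx : ℕ → Set
  Ctx n = List (Row n)

  _⊨_ : ∀ {n} → Env n → Row n → Set
  ρ ⊨ (l , r) = ev l ρ ≤ ev r ρ

  -- Fourier–Motzkin elimination.  Its output is only a list of multipliers,
  -- which `refutes` checks.
  module Search where

    data Coef : Set where
      pos neg : ℕ → Coef

    record FRow : Set where
      constructor frow
      field
        cf : List Coef
        ct : Coef
        pv : List ℕ
    open FRow

    isPos isNeg isZero : Coef → Bool
    isPos (pos zero) = false
    isPos (pos (suc _)) = true
    isPos (neg _) = false
    isNeg (neg zero) = false
    isNeg (neg (suc _)) = true
    isNeg (pos _) = false
    isZero c = not (isPos c ∨ isNeg c)

    mag : Coef → ℕ
    mag (pos n) = n
    mag (neg n) = n

    minus : ℕ → ℕ → Coef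
    minus m n = if n ≤ᵇ m then pos (m ∸ n) else neg (n ∸ m)

    lincomb : ℕ → ℕ → Coef → Coef → Coef
    lincomb a b (pos x) (pos y) = pos (a * x + b * y)
    lincomb a b (neg x) (neg y) = neg (a * x + b * y)
    lincomb a b (pos x) (neg y) = minus (a * x) (b * y)
    lincomb a b (neg x) (pos y) = minus (b * y) (a * x)

    allNonNeg allNonPos : List Coef → Bool
    allNonNeg [] = true
    allNonNeg (c ∷ cs) = if isNeg c then false else allNonNeg cs
    allNonPos [] = true
    allNonPos (c ∷ cs) = if isPos c then false else allNonPos cs

    get : ℕ → List Coef → Coef
    get _ [] = pos 0
    get zero (c ∷ _) = c
    get (suc i) (_ ∷ cs) = get i cs

    clear : ℕ → List Coef → List Coef
    clear _ [] = []
    clear zero (_ ∷ cs) = pos 0 ∷ cs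
    clear (suc i) (c ∷ cs) = c ∷ clear i cs

    zipC : ℕ → ℕ → List Coef → List Coef → List Coef
    zipC a b (x ∷ xs) (y ∷ ys) = lincomb a b x y ∷ zipC a b xs ys
    zipC _ _ _ _ = []

    zipN : ℕ → ℕ → List ℕ → List ℕ → List ℕ
    zipN a b (x ∷ xs) (y ∷ ys) = (a * x + b * y) ∷ zipN a b xs ys
    zipN _ _ _ _ = []

    contra : List FRow → Maybe (List ℕ)
    contra [] = nothing
    contra (r ∷ rs) = if isPos (ct r) then (if allNonNeg (cf r) then just (pv r) else contra rs) else contra rs

    useful : FRow → Bool
    useful r = if isPos (ct r) then true else not (allNonPos (cf r))

    keep : List FRow → List FRow
    keep [] = []
    keep (r ∷ rs) = if useful r then r ∷ keep rs else keep rs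

    combine : ℕ → FRow → FRow → FRow
    combine i p q = frow (zipC b a (cf p) (cf q)) (lincomb b a (ct p) (ct q)) (zipN b a (pv p) (pv q))
      where
      a = mag (get i (cf p))
      b = mag (get i (cf q))

    positives negatives : ℕ → List FRow → List FRow
    positives i [] = []
    positives i (r ∷ rs) = if isPos (get i (cf r)) then r ∷ positives i rs else positives i rs
    negatives i [] = []
    negatives i (r ∷ rs) = if isNeg (get i (cf r)) then r ∷ negatives i rs else negatives i rs

    -- Rows without x remain; in rows bounding x from above x is dropped, as 0 ≤ x.
    dropped : ℕ → List FRow → List FRow
    dropped i [] = []
    dropped i (r ∷ rs) = if isNeg (get i (cf r)) then dropped i rs else frow (clear i (cf r)) (ct r) (pv r) ∷ dropped i rs

    combineAll : ℕ → List FRow → List FRow → List FRow → List FRow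
    combineAll i [] qs acc = acc
    combineAll i (p ∷ ps) qs acc = combineAll i ps qs (row qs)
      where
      row : List FRow → List FRow
      row [] = acc
      row (q ∷ qs) = combine i p q ∷ row qs

    elimVar : ℕ → List FRow → List FRow
    elimVar i rs = keep (combineAll i (positives i rs) (negatives i rs) (dropped i rs))

    -- The value 0 is reserved for a variable without negative coefficients. Such a variable cannot
    -- block `contra`, so `best` passes it over and `loop` stops when only such variables are left.
    cost : ℕ → List FRow → ℕ
    cost i rs = let q = length (negatives i rs) in if q ≡ᵇ 0 then 0 else suc (length (positives i rs) * q)

    best : List ℕ → List FRow → ℕ × ℕ
    best [] rs = 0 , 0
    best (i ∷ is) rs = pick (cost i rs) (best is rs)
      where
      pick : ℕ → ℕ × ℕ → ℕ × ℕ
      pick zero m = m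
      pick c (j , zero) = i , c
      pick c (j , d) = if c <ᵇ d then (i , c) else (j , d)

    loop : ℕ → List ℕ → List FRow → Maybe (List ℕ)
    loop fuel is rs with contra rs
    ... | just c = just c
    ... | nothing with fuel
    ...   | zero = nothing
    ...   | suc f with best is rs
    ...     | _ , zero = nothing
    ...     | i , suc _ = loop f is (elimVar i rs)

    unit : ℕ → ℕ → List ℕ
    unit zero _ = []
    unit (suc n) zero = 1 ∷ replicate n 0
    unit (suc n) (suc i) = 0 ∷ unit n i

    toF : ∀ {n} → ℕ → ℕ → Row n → FRow
    toF N i (lf c k , lf d l) = frow (Vec.toList (Vec.zipWith minus c d)) (minus k l) (unit N i)

    toFs : ∀ {n} → ℕ → ℕ → Ctx n → List FRow
    toFs N i [] = []
    toFs N i (r ∷ rs) = toF N i r ∷ toFs N (suc i) rs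

    meets : List Bool → List Coef → Bool
    meets (b ∷ bs) (c ∷ cs) = if b ∧ not (isZero c) then true else meets bs cs
    meets _ _ = false

    join : List Bool → List Coef → List Bool
    join (b ∷ bs) (c ∷ cs) = (b ∨ not (isZero c)) ∷ join bs cs
    join _ _ = []

    -- Only rows linked to the first one through common variables are used.
    component : ℕ → List Bool → List FRow → List FRow → List FRow
    component zero vs rs out = rs ++ out
    component (suc f) vs rs out = pass vs rs [] out false
      where
      pass : List Bool → List FRow → List FRow → List FRow → Bool → List FRow
      pass vs [] rest out again = if again then component f vs rest out else out
      pass vs (r ∷ rs) rest out again =
        if meets vs (cf r) then pass (join vs (cf r)) rs rest (r ∷ out) true else pass vs rs (r ∷ rest) out again

    search : ∀ {n} → Ctx n → Maybe (List ℕ)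
    search {n} Γ with toFs (length Γ) 0 Γ
    ... | [] = nothing
    ... | r ∷ rs = loop n (upTo n) (keep (component (length Γ) (Vec.toList (Vec.map (λ _ → false) (Vec.replicate n 0)) ⊹ cf r) rs (r ∷ [])))
      where
      _⊹_ : List Bool → List Coef → List Bool
      _⊹_ = join

  sumRows : ∀ {n} → List ℕ → Ctx n → Row n
  sumRows (m ∷ ms) ((l , r) ∷ Γ) with sumRows ms Γ
  ... | L , R = (m *L l) +L L , (m *L r) +L R
  sumRows _ _ = 0L , 0L

  geqV : ∀ {n} → Vec ℕ n → Vec ℕ n → Bool
  geqV [] [] = true
  geqV (c ∷ cs) (d ∷ ds) = (d ≤ᵇ c) ∧ geqV cs ds

  -- Variables range over natural numbers, so a combination L ≤ R of the rows is absurd as soon as L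
  -- dominates R in every coefficient and exceeds it in the constant.
  refutes : ∀ {n} → List ℕ → Ctx n → Bool
  refutes ms Γ with sumRows ms Γ
  ... | lf c k , lf d l = geqV c d ∧ (suc l ≤ᵇ k)

  unsat : ∀ {n} → Ctx n → Bool
  unsat Γ with Search.search Γ
  ... | nothing = false
  ... | just ms = refutes ms Γ

  ltRow : ∀ {n} → L n → L n → L n → L n → Row n
  ltRow p q p' q' = ((kL 1 +L p') +L q) , (p +L q')

  leRow : ∀ {n} → L n → L n → L n → L n → Row n
  leRow p q p' q' = (p +L q') , (p' +L q)

  -- A term is passed on as a difference p - q of two linear forms, which keeps all coefficients
  -- natural. Truncated subtraction, maximum and minimum split into cases, and the continuation is
  -- run in the context of each case.
  elim : ∀ {n} → Tm n → Ctx n → (L n → L n → Ctx n → Bool) → Bool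
  branch : ∀ {n} → Row n → Ctx n → (Ctx n → Bool) → Bool
  branch r Γ k = unsat (r ∷ Γ) ∨ k (r ∷ Γ)

  -- A comparison that the context already decides adds no row.
  decide : ∀ {n} → L n → L n → L n → L n → Ctx n → (Ctx n → Bool) → (Ctx n → Bool) → Bool
  decide p q p' q' Γ k₁ k₂ =
    if unsat (ltRow p q p' q' ∷ Γ) then k₁ Γ
    else if unsat (ltRow p' q' p q ∷ Γ) then k₂ Γ
    else k₁ (leRow p q p' q' ∷ Γ) ∧ k₂ (leRow p' q' p q ∷ Γ)

  elim (var x) Γ k = k (xL x) 0L Γ
  elim (# c) Γ k = k (kL c) 0L Γ
  elim (s ⊕ t) Γ k = elim s Γ λ p q Γ → elim t Γ λ p' q' Γ → k (p +L p') (q +L q') Γ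
  elim (s ⊖ t) Γ k = elim s Γ λ p q Γ → elim t Γ λ p' q' Γ →
    decide p q p' q' Γ (k 0L 0L) (k (p +L q') (q +L p'))
  elim (c ⊛ t) Γ k = elim t Γ λ p q Γ → k (c *L p) (c *L q) Γ
  elim (mx s t) Γ k = elim s Γ λ p q Γ → elim t Γ λ p' q' Γ →
    decide p q p' q' Γ (k p' q') (k p q)
  elim (mn s t) Γ k = elim s Γ λ p q Γ → elim t Γ λ p' q' Γ →
    decide p q p' q' Γ (k p q) (k p' q')

  prove : ∀ {n} → Ctx n → Fm n → Bool
  assume : ∀ {n} → Ctx n → Fm n → (Ctx n → Bool) → Bool

  prove Γ (s ≲ t) = elim s Γ λ p q Γ → elim t Γ λ p' q' Γ → unsat (ltRow p q p' q' ∷ Γ)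
  prove Γ (s ≐ t) = elim s Γ λ p q Γ → elim t Γ λ p' q' Γ →
    unsat (ltRow p q p' q' ∷ Γ) ∧ unsat (ltRow p' q' p q ∷ Γ)
  prove Γ (F ⇒ G) = assume Γ F (λ Γ → prove Γ G)
  prove Γ (F and G) = prove Γ F ∧ prove Γ G
  prove Γ (F or G) = prove Γ F ∨ prove Γ G

  assume Γ (s ≲ t) k = elim s Γ λ p q Γ → elim t Γ λ p' q' Γ → branch (leRow p q p' q') Γ k
  assume Γ (s ≐ t) k = elim s Γ λ p q Γ → elim t Γ λ p' q' Γ → k (leRow p q p' q' ∷ leRow p' q' p q ∷ Γ)
  -- An implication is used only if its premise is provable at this point, and is dropped otherwise.
  -- Hypotheses that decide an ordering must therefore precede the implications that depend on it.
  assume Γ (F ⇒ G) k = if prove Γ F then assume Γ G k else k Γ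
  assume Γ (F and G) k = assume Γ F (λ Γ → assume Γ G k)
  assume Γ (F or G) k = assume Γ F k ∧ assume Γ G k

  -- Soundness of the decision procedure

  private
    T-∧ : ∀ {a b} → T (a ∧ b) → T a × T b
    T-∧ {true} {true} _ = tt , tt

    T-∨ : ∀ {a b} → T (a ∨ b) → T a ⊎ T b
    T-∨ {true} _ = inj₁ tt
    T-∨ {false} h = inj₂ h

    swap4 : ∀ a b c d → (a + b) + (c + d) ≡ (a + c) + (b + d)
    swap4 a b c d = begin
      (a + b) + (c + d) ≡⟨ +-assoc a b (c + d) ⟩
      a + (b + (c + d)) ≡⟨ cong (a +_) (+-assoc b c d) ⟨
      a + ((b + c) + d) ≡⟨ cong (λ z → a + (z + d)) (+-comm b c) ⟩
      a + ((c + b) + d) ≡⟨ cong (a +_) (+-assoc c b d) ⟩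
      a + (c + (b + d)) ≡⟨ +-assoc a c (b + d) ⟨
      (a + c) + (b + d) ∎
      where open ≡-Reasoning

    ev-+ : ∀ {n} (l m : L n) ρ → ev (l +L m) ρ ≡ ev l ρ + ev m ρ
    ev-+ (lf [] k) (lf [] l) [] = refl
    ev-+ (lf (c ∷ cs) k) (lf (d ∷ ds) l) (x ∷ ρ) with ev-+ (lf cs k) (lf ds l) ρ
    ... | ih = begin
      _ ≡⟨ +-assoc ((c + d) * x) _ _ ⟩
      (c + d) * x + _ ≡⟨ cong₂ _+_ (*-distribʳ-+ x c d) ih ⟩
      (c * x + d * x) + ((dot cs ρ + k) + (dot ds ρ + l)) ≡⟨ swap4 (c * x) (d * x) _ _ ⟩
      _ ≡⟨ cong₂ _+_ (sym (+-assoc (c * x) (dot cs ρ) k)) (sym (+-assoc (d * x) (dot ds ρ) l)) ⟩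
      _ ∎
      where open ≡-Reasoning

    ev-* : ∀ {n} m (l : L n) ρ → ev (m *L l) ρ ≡ m * ev l ρ
    ev-* m (lf [] k) [] = refl
    ev-* m (lf (c ∷ cs) k) (x ∷ ρ) with ev-* m (lf cs k) ρ
    ... | ih = begin
      _ ≡⟨ +-assoc (m * c * x) _ _ ⟩
      m * c * x + _ ≡⟨ cong₂ _+_ (*-assoc m c x) ih ⟩
      m * (c * x) + m * _ ≡⟨ *-distribˡ-+ m (c * x) _ ⟨
      m * (c * x + _) ≡⟨ cong (m *_) (sym (+-assoc (c * x) _ k)) ⟩
      _ ∎
      where open ≡-Reasoning

    ev-k : ∀ {n} k (ρ : Env n) → ev (kL k) ρ ≡ k
    ev-k k [] = refl
    ev-k k (x ∷ ρ) = ev-k k ρ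

    ev-x : ∀ {n} (i : Fin n) ρ → ev (xL i) ρ ≡ lookup ρ i
    ev-x zero (x ∷ ρ) = begin
      (x + 0 + _) + 0 ≡⟨ +-assoc (x + 0) _ 0 ⟩
      (x + 0) + _ ≡⟨ cong₂ _+_ (+-identityʳ x) (ev-k 0 ρ) ⟩
      x + 0 ≡⟨ +-identityʳ x ⟩
      x ∎
      where open ≡-Reasoning
    ev-x (suc i) (x ∷ ρ) = ev-x i ρ

    sumRows-sound : ∀ {n} ms (Γ : Ctx n) {ρ} → All (ρ ⊨_) Γ → ρ ⊨ sumRows ms Γ
    sumRows-sound [] Γ h = ≤-refl
    sumRows-sound (m ∷ ms) [] h = ≤-refl
    sumRows-sound (m ∷ ms) ((l , r) ∷ Γ) {ρ} (h ∷ hs) with sumRows ms Γ | sumRows-sound ms Γ hs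
    ... | L , R | ih = begin
      ev ((m *L l) +L L) ρ ≡⟨ ev-+ (m *L l) L ρ ⟩
      ev (m *L l) ρ + ev L ρ ≡⟨ cong (_+ ev L ρ) (ev-* m l ρ) ⟩
      m * ev l ρ + ev L ρ ≤⟨ +-mono-≤ (*-monoʳ-≤ m h) ih ⟩
      m * ev r ρ + ev R ρ ≡⟨ cong (_+ ev R ρ) (ev-* m r ρ) ⟨
      ev (m *L r) ρ + ev R ρ ≡⟨ ev-+ (m *L r) R ρ ⟨
      ev ((m *L r) +L R) ρ ∎
      where open ≤-Reasoning

    geqV-sound : ∀ {n} (c d : Vec ℕ n) {k l} ρ → T (geqV c d) → l < k → ev (lf d l) ρ < ev (lf c k) ρ
    geqV-sound [] [] [] _ l<k = l<k
    geqV-sound (c ∷ cs) (d ∷ ds) {k} {l} (x ∷ ρ) h l<k with T-∧ {d ≤ᵇ c} h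
    ... | d≤c , h' = subst₂ _<_ (sym (+-assoc (d * x) _ l)) (sym (+-assoc (c * x) _ k))
                       (+-mono-≤-< (*-monoˡ-≤ x (≤ᵇ⇒≤ d c d≤c)) (geqV-sound cs ds ρ h' l<k))

    refutes-sound : ∀ {n} ms (Γ : Ctx n) {ρ} → T (refutes ms Γ) → All (ρ ⊨_) Γ → ⊥
    refutes-sound ms Γ {ρ} t h with sumRows ms Γ | sumRows-sound ms Γ h
    ... | lf c k , lf d l | s with T-∧ {geqV c d} t
    ... | g , kl = <⇒≱ (geqV-sound c d ρ g (≤ᵇ⇒≤ (suc l) k kl)) s

    unsat-sound : ∀ {n} (Γ : Ctx n) {ρ} → T (unsat Γ) → All (ρ ⊨_) Γ → ⊥
    unsat-sound Γ t h with Search.search Γ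
    ... | just ms = refutes-sound ms Γ t h

    branch-sound : ∀ {n} (r : Row n) Γ k {ρ} {P : Set} → T (branch r Γ k) → ρ ⊨ r → All (ρ ⊨_) Γ →
                   (∀ {Γ} → T (k Γ) → All (ρ ⊨_) Γ → P) → P
    branch-sound r Γ k t hr h f with T-∨ {unsat (r ∷ Γ)} t
    ... | inj₁ u = ⊥-elim (unsat-sound (r ∷ Γ) u (hr ∷ h))
    ... | inj₂ g = f g (hr ∷ h)

    Den : ∀ {n} → Env n → ℕ → L n → L n → Set
    Den ρ v p q = v + ev q ρ ≡ ev p ρ

    Den-+ : ∀ {n} {ρ : Env n} {v w} p q p' q' → Den ρ v p q → Den ρ w p' q' → Den ρ (v + w) (p +L p') (q +L q')
    Den-+ {ρ = ρ} {v} {w} p q p' q' d e = begin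
      (v + w) + ev (q +L q') ρ ≡⟨ cong ((v + w) +_) (ev-+ q q' ρ) ⟩
      (v + w) + (ev q ρ + ev q' ρ) ≡⟨ swap4 v w _ _ ⟩
      (v + ev q ρ) + (w + ev q' ρ) ≡⟨ cong₂ _+_ d e ⟩
      ev p ρ + ev p' ρ ≡⟨ ev-+ p p' ρ ⟨
      ev (p +L p') ρ ∎
      where open ≡-Reasoning

    cross : ∀ {n} {ρ : Env n} {v w} p q p' q' → Den ρ v p q → Den ρ w p' q' → v ≤ w → ρ ⊨ (leRow p q p' q')
    cross {ρ = ρ} {v} {w} p q p' q' d e v≤w = begin
      ev (p +L q') ρ ≡⟨ ev-+ p q' ρ ⟩
      ev p ρ + ev q' ρ ≡⟨ cong (_+ ev q' ρ) d ⟨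
      (v + ev q ρ) + ev q' ρ ≡⟨ +-assoc v _ _ ⟩
      v + (ev q ρ + ev q' ρ) ≤⟨ +-monoˡ-≤ _ v≤w ⟩
      w + (ev q ρ + ev q' ρ) ≡⟨ cong (w +_) (+-comm (ev q ρ) _) ⟩
      w + (ev q' ρ + ev q ρ) ≡⟨ +-assoc w _ _ ⟨
      (w + ev q' ρ) + ev q ρ ≡⟨ cong (_+ ev q ρ) e ⟩
      ev p' ρ + ev q ρ ≡⟨ ev-+ p' q ρ ⟨
      ev (p' +L q) ρ ∎
      where open ≤-Reasoning

    Den-k : ∀ {n} (ρ : Env n) k → Den ρ k (kL k) 0L
    Den-k ρ k = trans (cong (k +_) (ev-k 0 ρ)) (trans (+-identityʳ k) (sym (ev-k k ρ)))

    uncross : ∀ {n} {ρ : Env n} {v w} p q p' q' → Den ρ v p q → Den ρ w p' q' →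
              (ρ ⊨ ltRow p q p' q' → ⊥) → v ≤ w
    uncross {ρ = ρ} {v} {w} p q p' q' d e n with v ≤? w
    ... | yes h = h
    ... | no h = ⊥-elim (n (cross (kL 1 +L p') q' p q suc-e d (≰⇒> h)))
      where
      suc-e : Den ρ (suc w) (kL 1 +L p') q'
      suc-e = trans (cong suc e) (sym (trans (ev-+ (kL 1) p' ρ) (cong (_+ ev p' ρ) (ev-k 1 ρ))))

    decideSound : ∀ {n} p q p' q' (Γ : Ctx n) k₁ k₂ {ρ} {P : Set} {v w} → T (decide p q p' q' Γ k₁ k₂) →
                    Den ρ v p q → Den ρ w p' q' → All (ρ ⊨_) Γ →
                    (v ≤ w → ∀ {Γ} → T (k₁ Γ) → All (ρ ⊨_) Γ → P) →
                    (w ≤ v → ∀ {Γ} → T (k₂ Γ) → All (ρ ⊨_) Γ → P) → P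
    decideSound p q p' q' Γ k₁ k₂ {v = v} {w} t d e h f g with unsat (ltRow p q p' q' ∷ Γ) in eq₁
    ... | true = f (uncross p q p' q' d e λ x → unsat-sound (ltRow p q p' q' ∷ Γ) (subst T (sym eq₁) tt) (x ∷ h)) t h
    ... | false with unsat (ltRow p' q' p q ∷ Γ) in eq₂
    ...   | true = g (uncross p' q' p q e d λ x → unsat-sound (ltRow p' q' p q ∷ Γ) (subst T (sym eq₂) tt) (x ∷ h)) t h
    ...   | false with T-∧ {k₁ (leRow p q p' q' ∷ Γ)} t | ≤-total v w
    ...     | t₁ , t₂ | inj₁ lq = f lq t₁ (cross p q p' q' d e lq ∷ h)
    ...     | t₁ , t₂ | inj₂ lq = g lq t₂ (cross p' q' p q e d lq ∷ h)

    elim-sound : ∀ {n} (t : Tm n) Γ k {ρ} {P : Set} → T (elim t Γ k) → All (ρ ⊨_) Γ →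
                 (∀ p q {Γ} → Den ρ (⟦ t ⟧ ρ) p q → T (k p q Γ) → All (ρ ⊨_) Γ → P) → P
    elim-sound (var x) Γ k {ρ} t h f =
      f _ _ (trans (cong (lookup ρ x +_) (ev-k 0 ρ)) (trans (+-identityʳ _) (sym (ev-x x ρ)))) t h
    elim-sound (# c) Γ k {ρ} t h f = f _ _ (Den-k ρ c) t h
    elim-sound (s ⊕ r) Γ k t h f =
      elim-sound s Γ _ t h λ p q d t h → elim-sound r _ _ t h λ p' q' e t h →
      f _ _ (Den-+ p q p' q' d e) t h
    elim-sound (s ⊖ r) Γ k {ρ} t h f =
      elim-sound s Γ _ t h λ p q d t h → elim-sound r _ _ t h λ p' q' {Γ} e t h →
      decideSound p q p' q' Γ _ _ t d e h
        (λ lq t h → f 0L 0L (cong (_+ ev 0L ρ) (m≤n⇒m∸n≡0 lq)) t h)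
        (λ lq t h → f (p +L q') (q +L p') (den p q p' q' d e lq) t h)
      where
      open ≡-Reasoning
      v = ⟦ s ⟧ ρ
      w = ⟦ r ⟧ ρ
      den : ∀ p q p' q' → Den ρ v p q → Den ρ w p' q' → w ≤ v → Den ρ (v ∸ w) (p +L q') (q +L p')
      den p q p' q' d e lq = begin
        (v ∸ w) + ev (q +L p') ρ ≡⟨ cong ((v ∸ w) +_) (ev-+ q p' ρ) ⟩
        (v ∸ w) + (ev q ρ + ev p' ρ) ≡⟨ cong (λ z → (v ∸ w) + (ev q ρ + z)) e ⟨
        (v ∸ w) + (ev q ρ + (w + ev q' ρ)) ≡⟨ cong ((v ∸ w) +_) (+-comm (ev q ρ) _) ⟩
        (v ∸ w) + ((w + ev q' ρ) + ev q ρ) ≡⟨ cong ((v ∸ w) +_) (+-assoc w _ _) ⟩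
        (v ∸ w) + (w + (ev q' ρ + ev q ρ)) ≡⟨ +-assoc (v ∸ w) w _ ⟨
        ((v ∸ w) + w) + (ev q' ρ + ev q ρ) ≡⟨ cong₂ _+_ (m∸n+n≡m lq) (+-comm (ev q' ρ) _) ⟩
        v + (ev q ρ + ev q' ρ) ≡⟨ +-assoc v _ _ ⟨
        (v + ev q ρ) + ev q' ρ ≡⟨ cong (_+ ev q' ρ) d ⟩
        ev p ρ + ev q' ρ ≡⟨ ev-+ p q' ρ ⟨
        ev (p +L q') ρ ∎
    elim-sound (c ⊛ r) Γ k {ρ} t h f =
      elim-sound r Γ _ t h λ p q d t h → f _ _ (den p q d) t h
      where
      den : ∀ p q → Den ρ (⟦ r ⟧ ρ) p q → Den ρ (c * ⟦ r ⟧ ρ) (c *L p) (c *L q)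
      den p q d = trans (cong (c * ⟦ r ⟧ ρ +_) (ev-* c q ρ))
                    (trans (sym (*-distribˡ-+ c (⟦ r ⟧ ρ) _)) (trans (cong (c *_) d) (sym (ev-* c p ρ))))
    elim-sound (mx s r) Γ k {ρ} t h f =
      elim-sound s Γ _ t h λ p q d t h → elim-sound r _ _ t h λ p' q' {Γ} e t h →
      decideSound p q p' q' Γ _ _ t d e h
        (λ lq t h → f p' q' (trans (cong (_+ ev q' ρ) (m≤n⇒m⊔n≡n lq)) e) t h)
        (λ lq t h → f p q (trans (cong (_+ ev q ρ) (m≥n⇒m⊔n≡m lq)) d) t h)
    elim-sound (mn s r) Γ k {ρ} t h f =
      elim-sound s Γ _ t h λ p q d t h → elim-sound r _ _ t h λ p' q' {Γ} e t h →
      decideSound p q p' q' Γ _ _ t d e h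
        (λ lq t h → f p q (trans (cong (_+ ev q ρ) (m≤n⇒m⊓n≡m lq)) d) t h)
        (λ lq t h → f p' q' (trans (cong (_+ ev q' ρ) (m≥n⇒m⊓n≡n lq)) e) t h)

    prove-sound : ∀ {n} Γ (F : Fm n) {ρ} → T (prove Γ F) → All (ρ ⊨_) Γ → ⟪ F ⟫ ρ
    assume-sound : ∀ {n} Γ (F : Fm n) k {ρ} {P : Set} → T (assume Γ F k) → All (ρ ⊨_) Γ → ⟪ F ⟫ ρ →
                   (∀ {Γ} → T (k Γ) → All (ρ ⊨_) Γ → P) → P

    prove-sound Γ (s ≲ r) t h =
      elim-sound s Γ _ t h λ p q d t h → elim-sound r _ _ t h λ p' q' {Γ} e t h →
      uncross p q p' q' d e λ x → unsat-sound (ltRow p q p' q' ∷ Γ) t (x ∷ h)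
    prove-sound Γ (s ≐ r) t h =
      elim-sound s Γ _ t h λ p q d t h → elim-sound r _ _ t h λ p' q' {Γ} e t h →
      let t₁ , t₂ = T-∧ {unsat (ltRow p q p' q' ∷ Γ)} t in
      ≤-antisym (uncross p q p' q' d e λ x → unsat-sound (ltRow p q p' q' ∷ Γ) t₁ (x ∷ h))
                (uncross p' q' p q e d λ x → unsat-sound (ltRow p' q' p q ∷ Γ) t₂ (x ∷ h))
    prove-sound Γ (F ⇒ G) t h hF = assume-sound Γ F _ t h hF λ t h → prove-sound _ G t h
    prove-sound Γ (F and G) t h = let t₁ , t₂ = T-∧ {prove Γ F} t in prove-sound Γ F t₁ h , prove-sound Γ G t₂ h
    prove-sound Γ (F or G) t h with T-∨ {prove Γ F} t
    ... | inj₁ t₁ = inj₁ (prove-sound Γ F t₁ h)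
    ... | inj₂ t₂ = inj₂ (prove-sound Γ G t₂ h)

    assume-sound Γ (s ≲ r) k t h hF f =
      elim-sound s Γ _ t h λ p q d t h → elim-sound r _ _ t h λ p' q' {Γ} e t h →
      branch-sound (leRow p q p' q') Γ k t (cross p q p' q' d e hF) h f
    assume-sound Γ (s ≐ r) k t h hF f =
      elim-sound s Γ _ t h λ p q d t h → elim-sound r _ _ t h λ p' q' {Γ} e t h →
      f t (cross p q p' q' d e (≤-reflexive hF) ∷ cross p' q' p q e d (≤-reflexive (sym hF)) ∷ h)
    assume-sound Γ (F ⇒ G) k t h hF f with prove Γ F in eq
    ... | true = assume-sound Γ G k t h (hF (prove-sound Γ F (subst T (sym eq) tt) h)) f
    ... | false = f t h
    assume-sound Γ (F and G) k t h (hF , hG) f =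
      assume-sound Γ F _ t h hF λ t h → assume-sound _ G k t h hG f
    assume-sound Γ (F or G) k t h (inj₁ x) f = assume-sound Γ F k (proj₁ (T-∧ {assume Γ F k} t)) h x f
    assume-sound Γ (F or G) k t h (inj₂ y) f = assume-sound Γ G k (proj₂ (T-∧ {assume Γ F k} t)) h y f

    ∀ⁿ-intro : ∀ n {P : Vec ℕ n → Set} → (∀ ρ → P ρ) → ∀ⁿ n (curryⁿ P)
    ∀ⁿ-intro zero h = h []
    ∀ⁿ-intro (suc n) h x = ∀ⁿ-intro n (λ ρ → h (x ∷ ρ))

  -- linear n (λ x₁ … xₙ → F) decides the formula F of linear arithmetic.
  linear : ∀ n (F : N-ary n (Tm n) (Fm n)) → let G = F $ⁿ Vec.map var (allFin n) in
           {_ : T (prove [] G)} → ∀ⁿ n (curryⁿ ⟪ G ⟫)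
  linear n F {t} = ∀ⁿ-intro n λ ρ → prove-sound [] (F $ⁿ Vec.map var (allFin n)) t []

open LinearArithmetic using (Tm; #; _⊕_; _⊖_; _⊛_; mx; mn; _≲_; _≐_; _⇒_; _and_; _or_; linear)

-- Bit lengths

abstract
  -- The number of binary digits, with value 0 at 0. Being abstract, it stays opaque during type
  -- checking, and only the laws listed here are used.
  bits : ℕ → ℕ
  bits n = ⌊log₂ (2 * n) ⌋

  bits-def : ∀ n → bits n ≡ ⌊log₂ (2 * n) ⌋
  bits-def n = refl

  bits-mono : ∀ {m n} → m ≤ n → bits m ≤ bits n
  bits-mono h = ⌊log₂⌋-mono-≤ (*-monoʳ-≤ 2 h)

  bits-double : ∀ n .{{_ : NonZero n}} → bits (2 * n) ≡ suc (bits n)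
  bits-double (suc n) = ⌊log₂[2*b]⌋≡1+⌊log₂b⌋ (2 * suc n)

  bits0 : bits 0 ≡ 0
  bits0 = refl

  bits1 : bits 1 ≡ 1
  bits1 = refl

-- Doubling gains a bit, and m + n doubles the smaller summand.
bits-grow : ∀ {m n} → 1 ≤ m → m ≤ n → suc (bits m) ≤ bits (m + n)
bits-grow {m} {n} 1≤m m≤n = ≤-trans (≤-reflexive (sym (bits-double m {{>-nonZero 1≤m}})))
  (bits-mono (linear 2 (λ m n → m ≲ n ⇒ 2 ⊛ m ≲ m ⊕ n) m n m≤n))

bits-pos : ∀ {n} → 1 ≤ n → 1 ≤ bits n
bits-pos {n} h = ≤-trans (≤-reflexive (sym bits1)) (bits-mono h)

bits-zero : ∀ n → bits n ≤ 0 → n ≡ 0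
bits-zero zero _ = refl
bits-zero (suc n) h = ⊥-elim (<⇒≱ (bits-pos {suc n} (s≤s z≤n)) h)

bits-+ : ∀ m n → bits (m + n) ≤ bits m + bits n
bits-+ zero n = m≤n+m _ _
bits-+ m zero = ≤-trans (≤-reflexive (cong bits (+-identityʳ m))) (m≤m+n _ _)
bits-+ m@(suc _) n@(suc _) with ≤-total m n
... | inj₁ h = begin
    bits (m + n) ≤⟨ bits-mono (linear 2 (λ m n → m ≲ n ⇒ m ⊕ n ≲ 2 ⊛ n) m n h) ⟩
    bits (2 * n) ≡⟨ bits-double n ⟩
    1 + bits n ≤⟨ +-monoˡ-≤ (bits n) (bits-pos {m} (s≤s z≤n)) ⟩
    bits m + bits n ∎
    where open ≤-Reasoning
... | inj₂ h = begin
    bits (m + n) ≤⟨ bits-mono (linear 2 (λ m n → n ≲ m ⇒ m ⊕ n ≲ 2 ⊛ m) m n h) ⟩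
    bits (2 * m) ≡⟨ bits-double m ⟩
    1 + bits m ≤⟨ +-monoˡ-≤ (bits m) (bits-pos {n} (s≤s z≤n)) ⟩
    bits n + bits m ≡⟨ +-comm (bits n) (bits m) ⟩
    bits m + bits n ∎
    where open ≤-Reasoning

bits-sub : ∀ {k} m n → k ≤ m + n → bits k ≤ bits m + bits n
bits-sub m n h = ≤-trans (bits-mono h) (bits-+ m n)

bits≤n : ∀ n → bits n ≤ n
bits≤n zero = ≤-reflexive bits0
bits≤n (suc n) = ≤-trans (bits-+ 1 n) (+-mono-≤ (≤-reflexive bits1) (bits≤n n))

-- A sum is at least twice its smaller summand. If that were x, the sum would be a bit longer than
-- x; so it is y, and y is a bit shorter than the sum.
bits-absorb : ∀ x y → 1 ≤ x → bits (x + y) ≤ bits x → bits y < bits x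
bits-absorb x y 1≤x h with suc (bits y) ≤? bits x
... | yes p = p
... | no p with ≤-total x y
...   | inj₁ q = ⊥-elim (<⇒≱ (bits-grow 1≤x q) h)
...   | inj₂ q with y
...     | zero = ⊥-elim (p (≤-trans (≤-reflexive (cong suc bits0)) (bits-pos 1≤x)))
...     | suc y' = ⊥-elim (p (≤-trans (bits-grow {suc y'} (s≤s z≤n) q)
                     (≤-trans (≤-reflexive (cong bits (+-comm (suc y') x))) h)))

-- The potential of a pair of levels

dist : ℕ → ℕ → ℕ
dist x y = (x ∸ y) + (y ∸ x)

-- Potential of a list element whose two levels lie x and y above its rank.
Nh : ℕ → ℕ → ℕ
Nh x y = bits (x ⊓ y) + bits (dist x y)

dst : ∀ {n} → Tm n → Tm n → Tm n
dst x y = (x ⊖ y) ⊕ (y ⊖ x)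

Nh-shift : ∀ x y p → Nh (x ∸ p) (y ∸ p) ≤ Nh x y
Nh-shift x y p = +-mono-≤
  (bits-mono (linear 3 (λ x y p → mn (x ⊖ p) (y ⊖ p) ≲ mn x y) x y p))
  (bits-mono (linear 3 (λ x y p → dst (x ⊖ p) (y ⊖ p) ≲ dst x y) x y p))

-- Monotonicity and subadditivity of `bits` are handed over as implications between arguments. In
-- each ordering of x, y, z exactly those instances fire whose premise `linear` can prove there. The
-- next lemmas have the same form.
Nh-inner : ∀ x y z → y ≤ x → Nh x z ≤ bits (x ∸ y) + Nh y z
Nh-inner x y z y≤x = linear 8 (λ x y z m₁ d₁ e m₂ d₂ →
    (x ≲ z or z ≲ x) ⇒ (y ≲ z or z ≲ y) ⇒ y ≲ x ⇒
    (mn x z ≲ mn y z ⇒ m₁ ≲ m₂) ⇒ (mn x z ≲ mn y z ⊕ dst y z ⇒ m₁ ≲ m₂ ⊕ d₂) ⇒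
    (mn x z ≲ mn y z ⊕ (x ⊖ y) ⇒ m₁ ≲ m₂ ⊕ e) ⇒
    (dst x z ≲ (x ⊖ y) ⊕ dst y z ⇒ d₁ ≲ e ⊕ d₂) ⇒ (dst x z ≲ dst y z ⇒ d₁ ≲ d₂) ⇒
    (dst x z ≲ x ⊖ y ⇒ d₁ ≲ e) ⇒ m₁ ⊕ d₁ ≲ e ⊕ (m₂ ⊕ d₂))
  x y z (bits (x ⊓ z)) (bits (dist x z)) (bits (x ∸ y)) (bits (y ⊓ z)) (bits (dist y z))
  (≤-total x z) (≤-total y z) y≤x bits-mono (bits-sub (y ⊓ z) (dist y z)) (bits-sub (y ⊓ z) (x ∸ y))
  (bits-sub (x ∸ y) (dist y z)) bits-mono bits-mono

-- Lowering the near level from y to x costs the bit length of the step, but releases the difference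
-- of the bit lengths of y and x. That release is the second part of the gain in `light`.
Nh-outer : ∀ x y z → x ≤ y → bits y + Nh x z ≤ bits x + (bits (y ∸ x) + Nh y z)
Nh-outer x y z x≤y = linear 10 (λ x y z m₁ d₁ e m₂ d₂ X Y →
    (x ≲ z or z ≲ x) ⇒ (y ≲ z or z ≲ y) ⇒ x ≲ y ⇒
    (mn x z ≲ x ⇒ m₁ ≲ X) ⇒ (mn x z ≲ mn y z ⇒ m₁ ≲ m₂) ⇒
    (y ≲ mn y z ⇒ Y ≲ m₂) ⇒ (y ≲ x ⊕ (y ⊖ x) ⇒ Y ≲ X ⊕ e) ⇒ (y ≲ mn y z ⊕ dst y z ⇒ Y ≲ m₂ ⊕ d₂) ⇒
    (dst x z ≲ (y ⊖ x) ⊕ dst y z ⇒ d₁ ≲ e ⊕ d₂) ⇒ (dst x z ≲ dst y z ⇒ d₁ ≲ d₂) ⇒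
    (dst x z ≲ y ⊖ x ⇒ d₁ ≲ e) ⇒ Y ⊕ (m₁ ⊕ d₁) ≲ X ⊕ (e ⊕ (m₂ ⊕ d₂)))
  x y z (bits (x ⊓ z)) (bits (dist x z)) (bits (y ∸ x)) (bits (y ⊓ z)) (bits (dist y z)) (bits x) (bits y)
  (≤-total x z) (≤-total y z) x≤y bits-mono bits-mono bits-mono (bits-sub x (y ∸ x)) (bits-sub (y ⊓ z) (dist y z))
  (bits-sub (y ∸ x) (dist y z)) bits-mono bits-mono

-- A triangle inequality with a surplus: when the middle level disappears, its bit length is saved.
-- This surplus is the source of the gain of a link.
Nh-middle : ∀ x y z → Nh x z + bits y ≤ Nh x y + Nh y z
Nh-middle x y z = linear 11 (λ x y z m₁ d₁ m d m₂ d₂ Y D →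
    (x ≲ z or z ≲ x) ⇒ (y ≲ z or z ≲ y) ⇒ (x ≲ y or y ≲ x) ⇒
    (mn x z ≲ mn y z ⇒ m₁ ≲ m₂) ⇒ (mn x z ≲ mn x y ⇒ m₁ ≲ m) ⇒
    (mn x z ≲ y ⊕ dst x y ⇒ m₁ ≲ Y ⊕ d) ⇒ (mn x z ≲ y ⊕ dst y z ⇒ m₁ ≲ Y ⊕ d₂) ⇒
    (dst x z ≲ dst x y ⊕ dst y z ⇒ d₁ ≲ d ⊕ d₂) ⇒ (dst x z ≲ dst y z ⇒ d₁ ≲ d₂) ⇒
    (dst x z ≲ dst x y ⇒ d₁ ≲ d) ⇒
    (y ≲ mn x y ⇒ Y ≲ m) ⇒ (y ≲ mn y z ⇒ Y ≲ m₂) ⇒ (y ≲ mn x y ⊕ dst x y ⇒ Y ≲ m ⊕ d) ⇒ (y ≲ mn y z ⊕ dst y z ⇒ Y ≲ m₂ ⊕ d₂) ⇒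
    (m₁ ⊕ d₁) ⊕ Y ≲ (m ⊕ d) ⊕ (m₂ ⊕ d₂))
  x y z (bits (x ⊓ z)) (bits (dist x z)) (bits (x ⊓ y)) (bits (dist x y)) (bits (y ⊓ z)) (bits (dist y z)) (bits y) 0
  (≤-total x z) (≤-total y z) (≤-total x y) bits-mono bits-mono (bits-sub y (dist x y)) (bits-sub y (dist y z))
  (bits-sub (dist x y) (dist y z)) bits-mono bits-mono bits-mono bits-mono
  (bits-sub (x ⊓ y) (dist x y)) (bits-sub (y ⊓ z) (dist y z))

Nh≥near : ∀ y z → bits y ≤ Nh y z
Nh≥near y z = linear 5 (λ y z m d Y → (y ≲ z or z ≲ y) ⇒ (y ≲ mn y z ⇒ Y ≲ m) ⇒ (y ≲ mn y z ⊕ dst y z ⇒ Y ≲ m ⊕ d) ⇒ Y ≲ m ⊕ d)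
  y z (bits (y ⊓ z)) (bits (dist y z)) (bits y) (≤-total y z) bits-mono (bits-sub (y ⊓ z) (dist y z))

Nh≥far : ∀ y z → bits z ≤ Nh y z
Nh≥far y z = linear 5 (λ y z m d Z → (y ≲ z or z ≲ y) ⇒ (z ≲ mn y z ⇒ Z ≲ m) ⇒ (z ≲ mn y z ⊕ dst y z ⇒ Z ≲ m ⊕ d) ⇒ Z ≲ m ⊕ d)
  y z (bits (y ⊓ z)) (bits (dist y z)) (bits z) (≤-total y z) bits-mono (bits-sub (y ⊓ z) (dist y z))

Nh-zero : ∀ z → Nh 0 z ≤ bits z
Nh-zero z = ≤-trans (≤-reflexive (cong₂ (λ p q → bits p + bits q) refl refl)) (+-mono-≤ (≤-reflexive bits0) (bits-mono {dist 0 z} {z} (linear 1 (λ z → dst (# 0) z ≲ z) z)))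

-- The drop of the level potential at a link

-- What a link pays for: the class of T, the height of the winner below the
-- vanishing gap, is recovered from the potential drop D unless the loser
-- keeps a class above it.
record Gain (T ℓ D : ℕ) : Set where
  field
    gain₁ : bits T ≤ bits ℓ + 2 * D
    gain₂ : D ≡ 0 → T ≡ 0 ⊎ bits T < bits ℓ
open Gain public

module _ (y z ε : ℕ) where
  private
    y₁ = y ∸ ε
    z₁ = z ∸ ε

    mo : (y₁ ⊓ z₁ ≤ y ⊓ z)
    mo = linear 3 (λ y z ε → mn (y ⊖ ε) (z ⊖ ε) ≲ mn y z) y z ε
    dd : dist y₁ z₁ ≤ dist y z
    dd = linear 3 (λ y z ε → dst (y ⊖ ε) (z ⊖ ε) ≲ dst y z) y z ε

  -- Raising the rank by ε either leaves the near level about as high, so that its own bit length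
  -- remains available to `Nh-middle`, or lowers the potential. The factor 2 is needed because y may
  -- be split between the common height and the jump.
  Nh-raise : bits y + 2 * Nh y₁ z₁ ≤ 2 * bits y₁ + 2 * Nh y z
  Nh-raise with ≤-total y z | ≤-total ε z
  ... | inj₁ p | _ = linear 6 (λ m d m₁ d₁ Y Y₁ → m₁ ≲ Y₁ ⇒ d₁ ≲ d ⇒ Y ≲ m ⇒ Y ⊕ 2 ⊛ (m₁ ⊕ d₁) ≲ 2 ⊛ Y₁ ⊕ 2 ⊛ (m ⊕ d))
    (bits (y ⊓ z)) (bits (dist y z)) (bits (y₁ ⊓ z₁)) (bits (dist y₁ z₁)) (bits y) (bits y₁)
    (bits-mono (m⊓n≤m y₁ z₁)) (bits-mono dd) (bits-mono (≤-reflexive (sym (m≤n⇒m⊓n≡m p))))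
  ... | inj₂ p | inj₁ q = linear 6 (λ m d m₁ d₁ Y Y₁ → m₁ ≲ Y₁ ⇒ d₁ ≲ d ⇒ m₁ ≲ m ⇒ Y ≲ m ⊕ Y₁ ⇒ Y ⊕ 2 ⊛ (m₁ ⊕ d₁) ≲ 2 ⊛ Y₁ ⊕ 2 ⊛ (m ⊕ d))
    (bits (y ⊓ z)) (bits (dist y z)) (bits (y₁ ⊓ z₁)) (bits (dist y₁ z₁)) (bits y) (bits y₁)
    (bits-mono (m⊓n≤m y₁ z₁)) (bits-mono dd) (bits-mono mo)
    (bits-sub (y ⊓ z) y₁ (linear 3 (λ y z ε → z ≲ y ⇒ ε ≲ z ⇒ y ≲ mn y z ⊕ (y ⊖ ε)) y z ε p q))
  ... | inj₂ p | inj₂ q = linear 6 (λ m d m₁ d₁ Y Y₁ → m₁ ≲ # 0 ⇒ d₁ ≲ Y₁ ⇒ Y ≲ m ⊕ d ⇒ Y ⊕ 2 ⊛ (m₁ ⊕ d₁) ≲ 2 ⊛ Y₁ ⊕ 2 ⊛ (m ⊕ d))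
    (bits (y ⊓ z)) (bits (dist y z)) (bits (y₁ ⊓ z₁)) (bits (dist y₁ z₁)) (bits y) (bits y₁)
    (≤-trans (bits-mono {_} {0} (linear 3 (λ y z ε → z ≲ ε ⇒ mn (y ⊖ ε) (z ⊖ ε) ≲ # 0) y z ε q)) (≤-reflexive bits0))
    (bits-mono (linear 3 (λ y z ε → z ≲ ε ⇒ dst (y ⊖ ε) (z ⊖ ε) ≲ y ⊖ ε) y z ε q))
    (Nh≥near y z)

-- D is the entire drop, so the first bound is an equality. `Nh-middle` at y ∸ ε saves the bit
-- length of that level, and `Nh-raise` supplies what is missing to half the bit length of y.
heavy : ∀ x y z ε → Σ[ D ∈ ℕ ] (Nh x (z ∸ ε) + D ≤ Nh x (y ∸ ε) + Nh y z) × Gain y 0 D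
heavy x y z ε = D , ≤-reflexive (m+[n∸m]≡n le) , record { gain₁ = ≤-trans g (m≤n+m (2 * D) (bits 0)) ; gain₂ = λ D0 → inj₁ (bits-zero y (subst (λ D → bits y ≤ 2 * D) D0 g)) }
  where
  S = Nh x (y ∸ ε) + Nh y z
  D = S ∸ Nh x (z ∸ ε)
  g : bits y ≤ 2 * D
  g = linear 7 (λ Y Y₁ n₁ n xz xy D → Y ⊕ 2 ⊛ n₁ ≲ 2 ⊛ Y₁ ⊕ 2 ⊛ n ⇒ xz ⊕ Y₁ ≲ xy ⊕ n₁ ⇒ Y ≲ 2 ⊛ ((xy ⊕ n) ⊖ xz))
        (bits y) (bits (y ∸ ε)) (Nh (y ∸ ε) (z ∸ ε)) (Nh y z) (Nh x (z ∸ ε)) (Nh x (y ∸ ε)) 0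
        (Nh-raise y z ε) (Nh-middle x (y ∸ ε) (z ∸ ε))
  le : Nh x (z ∸ ε) ≤ S
  le = linear 5 (λ n₁ n xz xy Y₁ → xz ⊕ Y₁ ≲ xy ⊕ n₁ ⇒ n₁ ≲ n ⇒ xz ≲ xy ⊕ n)
        (Nh (y ∸ ε) (z ∸ ε)) (Nh y z) (Nh x (z ∸ ε)) (Nh x (y ∸ ε)) (bits (y ∸ ε))
        (Nh-middle x (y ∸ ε) (z ∸ ε)) (Nh-shift y z ε)

-- The winner's rank exceeds the loser's by δ; the near gap is T above the
-- winner.
light : ∀ x z T δ → 1 ≤ δ → Σ[ D ∈ ℕ ] (bits δ + Nh (x ∸ δ) z + D ≤ Nh x (T + δ) + Nh T z) × Gain T δ D
light x z T δ 1≤δ with ≤-total (T + δ) x | ≤-total δ x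
... | inj₁ y≤x | _ = D , le , gn
  where
  D = bits (δ + T) ∸ bits δ
  gn : Gain T δ D
  gn .gain₁ = ≤-trans (bits-mono (m≤n+m T δ)) (linear 2 (λ a b → a ≲ b ⊕ 2 ⊛ (a ⊖ b)) (bits (δ + T)) (bits δ))
  gn .gain₂ e = inj₂ (bits-absorb δ T 1≤δ (m∸n≡0⇒m≤n e))
  le : bits δ + Nh (x ∸ δ) z + D ≤ Nh x (T + δ) + Nh T z
  le = linear 8 (λ T' d n e nt m₁ d₁ dd →
        n ≲ e ⊕ nt ⇒ d ≲ T' ⇒ T' ≲ m₁ ⇒ e ≲ d₁ ⇒ d ⊕ n ⊕ (T' ⊖ d) ≲ (m₁ ⊕ d₁) ⊕ nt)
      (bits (δ + T)) (bits δ) (Nh (x ∸ δ) z) (bits ((x ∸ δ) ∸ T)) (Nh T z) (bits (x ⊓ (T + δ))) (bits (dist x (T + δ))) 0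
      (Nh-inner (x ∸ δ) T z (linear 3 (λ x T δ → T ⊕ δ ≲ x ⇒ T ≲ x ⊖ δ) x T δ y≤x))
      (bits-mono (m≤m+n δ T))
      (bits-mono (linear 3 (λ x T δ → T ⊕ δ ≲ x ⇒ δ ⊕ T ≲ mn x (T ⊕ δ)) x T δ y≤x))
      (bits-mono (linear 3 (λ x T δ → (x ⊖ δ) ⊖ T ≲ dst x (T ⊕ δ)) x T δ))
... | inj₂ x≤y | inj₂ x≤δ = D , le , gn
  where
  D = bits (δ + T) ∸ bits δ
  gn : Gain T δ D
  gn .gain₁ = ≤-trans (bits-mono (m≤n+m T δ)) (linear 2 (λ a b → a ≲ b ⊕ 2 ⊛ (a ⊖ b)) (bits (δ + T)) (bits δ))
  gn .gain₂ e = inj₂ (bits-absorb δ T 1≤δ (m∸n≡0⇒m≤n e))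
  x' : x ∸ δ ≡ 0
  x' = m≤n⇒m∸n≡0 x≤δ
  le : bits δ + Nh (x ∸ δ) z + D ≤ Nh x (T + δ) + Nh T z
  le = linear 6 (λ T' d n nt nx zz →
        n ≲ zz ⇒ zz ≲ nt ⇒ d ≲ T' ⇒ T' ≲ nx ⇒ d ⊕ n ⊕ (T' ⊖ d) ≲ nx ⊕ nt)
      (bits (δ + T)) (bits δ) (Nh (x ∸ δ) z) (Nh T z) (Nh x (T + δ)) (bits z)
      (subst (λ v → Nh v z ≤ bits z) (sym x') (Nh-zero z)) (Nh≥far T z)
      (bits-mono (m≤m+n δ T)) (subst (λ v → bits v ≤ Nh x (T + δ)) (+-comm T δ) (Nh≥far x (T + δ)))
... | inj₂ x≤y | inj₁ δ≤x = D , le , gn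
  where
  x' = x ∸ δ
  x'≤T : x' ≤ T
  x'≤T = linear 3 (λ x T δ → x ≲ T ⊕ δ ⇒ x ⊖ δ ≲ T) x T δ x≤y
  -- The loser's height x exceeds the class of the new edge by the first summand; the second one
  -- comes from `Nh-outer`. If both vanish, x has no more bits than δ, so x ∸ δ has fewer bits than
  -- δ, and with it T.
  D = (bits x ∸ bits δ) + (bits T ∸ bits x')
  bx : bits x' ≤ bits x
  bx = bits-mono (m∸n≤m x δ)
  gn : Gain T δ D
  gn .gain₁ = linear 4 (λ t d x x' → x' ≲ x ⇒ t ≲ d ⊕ 2 ⊛ ((x ⊖ d) ⊕ (t ⊖ x'))) (bits T) (bits δ) (bits x) (bits x') bx
  gn .gain₂ e = inj₂ (≤-<-trans (m∸n≡0⇒m≤n (m+n≡0⇒n≡0 (bits x ∸ bits δ) e))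
                  (bits-absorb δ x' 1≤δ (≤-trans (≤-reflexive (cong bits (m+[n∸m]≡n δ≤x))) (m∸n≡0⇒m≤n (m+n≡0⇒m≡0 (bits x ∸ bits δ) e)))))
  le : bits δ + Nh x' z + D ≤ Nh x (T + δ) + Nh T z
  le = linear 10 (λ d n X T' X' e nt m₁ d₁ dd →
        T' ⊕ n ≲ X' ⊕ (e ⊕ nt) ⇒ X' ≲ T' ⇒ d ≲ X ⇒ X ≲ m₁ ⇒ e ≲ d₁ ⇒ d ⊕ n ⊕ ((X ⊖ d) ⊕ (T' ⊖ X')) ≲ (m₁ ⊕ d₁) ⊕ nt)
      (bits δ) (Nh x' z) (bits x) (bits T) (bits x') (bits (T ∸ x')) (Nh T z) (bits (x ⊓ (T + δ))) (bits (dist x (T + δ))) 0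
      (Nh-outer x' T z x'≤T) (bits-mono x'≤T) (bits-mono δ≤x)
      (bits-mono (linear 3 (λ x T δ → x ≲ T ⊕ δ ⇒ x ≲ mn x (T ⊕ δ)) x T δ x≤y))
      (bits-mono (linear 3 (λ x T δ → δ ≲ x ⇒ T ⊖ (x ⊖ δ) ≲ dst x (T ⊕ δ)) x T δ δ≤x))

N : ℕ → ℕ → ℕ → ℕ
N a b r = Nh (a ∸ r) (b ∸ r)

N-raise : ∀ a b {r r'} → r ≤ r' → N a b r' ≤ N a b r
N-raise a b {r} {r'} h = ≤-trans (≤-reflexive (cong₂ Nh (e a) (e b))) (Nh-shift (a ∸ r) (b ∸ r) (r' ∸ r))
  where
  e : ∀ c → c ∸ r' ≡ (c ∸ r) ∸ (r' ∸ r)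
  e c = linear 3 (λ c r r' → r ≲ r' ⇒ c ⊖ r' ≐ (c ⊖ r) ⊖ (r' ⊖ r)) c r r' h

-- The loser has far level a, near level b and rank r₁; the winner has near
-- level b, far level c and rank r₂ ≤ b.
module _ (a b c : ℕ) {r₁ r₂ r' : ℕ} (h₁ : r₁ ≤ r') (h₂ : r₂ ≤ r') where

  -- The bit length of r₂ ∸ r₁ is the class of the new edge. One unit of N thus pays for one unit of
  -- class, and D is left over.
  LinkGain : Set
  LinkGain = Σ[ D ∈ ℕ ] (bits (r₂ ∸ r₁) + N a c r' + D ≤ N a b r₁ + N b c r₂) × Gain (b ∸ r₂) (r₂ ∸ r₁) D

  private
    shift-∸ : ∀ x → r₂ ≤ r₁ → x ∸ r₁ ≡ (x ∸ r₂) ∸ (r₁ ∸ r₂)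
    shift-∸ x q = linear 3 (λ c r r' → r ≲ r' ⇒ c ⊖ r' ≐ (c ⊖ r) ⊖ (r' ⊖ r)) x r₂ r₁ q

    gain-heavy : r₂ ≤ r₁ → LinkGain
    gain-heavy q = D , le' , subst (λ v → Gain (b ∸ r₂) v D) (sym (m≤n⇒m∸n≡0 q)) (proj₂ (proj₂ hv))
      where
      open ≤-Reasoning
      hv = heavy (a ∸ r₁) (b ∸ r₂) (c ∸ r₂) (r₁ ∸ r₂)
      D = proj₁ hv
      le' : bits (r₂ ∸ r₁) + N a c r' + D ≤ N a b r₁ + N b c r₂
      le' = begin
        bits (r₂ ∸ r₁) + N a c r' + D ≡⟨ cong (λ v → v + N a c r' + D) (trans (cong bits (m≤n⇒m∸n≡0 q)) bits0) ⟩
        N a c r' + D ≤⟨ +-monoˡ-≤ D (N-raise a c h₁) ⟩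
        Nh (a ∸ r₁) (c ∸ r₁) + D ≡⟨ cong (λ v → Nh (a ∸ r₁) v + D) (shift-∸ c q) ⟩
        Nh (a ∸ r₁) ((c ∸ r₂) ∸ (r₁ ∸ r₂)) + D ≤⟨ proj₁ (proj₂ hv) ⟩
        Nh (a ∸ r₁) ((b ∸ r₂) ∸ (r₁ ∸ r₂)) + N b c r₂ ≡⟨ cong (λ v → Nh (a ∸ r₁) v + N b c r₂) (shift-∸ b q) ⟨
        N a b r₁ + N b c r₂ ∎

    gain-light : r₁ < r₂ → r₂ ≤ b → LinkGain
    gain-light q r₂≤b = D , le' , proj₂ (proj₂ lt')
      where
      open ≤-Reasoning
      lt' = light (a ∸ r₁) (c ∸ r₂) (b ∸ r₂) (r₂ ∸ r₁) (m<n⇒0<n∸m q)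
      D = proj₁ lt'
      ea : a ∸ r₂ ≡ (a ∸ r₁) ∸ (r₂ ∸ r₁)
      ea = linear 3 (λ a r₁ r₂ → (# 1) ⊕ r₁ ≲ r₂ ⇒ a ⊖ r₂ ≐ (a ⊖ r₁) ⊖ (r₂ ⊖ r₁)) a r₁ r₂ q
      eb : (b ∸ r₂) + (r₂ ∸ r₁) ≡ b ∸ r₁
      eb = linear 3 (λ b r₁ r₂ → (# 1) ⊕ r₁ ≲ r₂ ⇒ r₂ ≲ b ⇒ (b ⊖ r₂) ⊕ (r₂ ⊖ r₁) ≐ b ⊖ r₁) b r₁ r₂ q r₂≤b
      le' : bits (r₂ ∸ r₁) + N a c r' + D ≤ N a b r₁ + N b c r₂
      le' = begin
        bits (r₂ ∸ r₁) + N a c r' + D ≤⟨ +-monoˡ-≤ D (+-monoʳ-≤ (bits (r₂ ∸ r₁)) (N-raise a c h₂)) ⟩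
        bits (r₂ ∸ r₁) + N a c r₂ + D ≡⟨ cong (λ v → bits (r₂ ∸ r₁) + Nh v (c ∸ r₂) + D) ea ⟩
        bits (r₂ ∸ r₁) + Nh ((a ∸ r₁) ∸ (r₂ ∸ r₁)) (c ∸ r₂) + D ≤⟨ proj₁ (proj₂ lt') ⟩
        Nh (a ∸ r₁) ((b ∸ r₂) + (r₂ ∸ r₁)) + N b c r₂ ≡⟨ cong (λ v → Nh (a ∸ r₁) v + N b c r₂) eb ⟩
        N a b r₁ + N b c r₂ ∎

  link-gain : r₂ ≤ b → LinkGain
  link-gain r₂≤b with r₂ ≤? r₁
  ... | yes q = gain-heavy q
  ... | no q = gain-light (≰⇒> q) r₂≤b

  private
    core : N a c r' ≤ N a b r₁ + N b c r₂
    core with ≤-total r₁ r₂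
    ... | inj₁ p = ≤-trans (N-raise a c h₂) (≤-trans (m+n≤o⇒m≤o (N a c r₂) (Nh-middle (a ∸ r₂) (b ∸ r₂) (c ∸ r₂))) (+-monoˡ-≤ (N b c r₂) (N-raise a b p)))
    ... | inj₂ p = ≤-trans (N-raise a c h₁) (≤-trans (m+n≤o⇒m≤o (N a c r₁) (Nh-middle (a ∸ r₁) (b ∸ r₁) (c ∸ r₁))) (+-monoʳ-≤ (N a b r₁) (N-raise b c p)))

    far : b ≤ r₂ → r₁ ≤ b → bits (b ∸ r₁) + bits (a ∸ r₂) ≤ N a b r₁
    far q r₁≤b with ≤-total b a
    ... | inj₁ p = +-mono-≤ (bits-mono (linear 3 (λ a b r₁ → b ≲ a ⇒ b ⊖ r₁ ≲ mn (a ⊖ r₁) (b ⊖ r₁)) a b r₁ p))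
                     (bits-mono (linear 4 (λ a b r₁ r₂ → b ≲ r₂ ⇒ r₁ ≲ b ⇒ b ≲ a ⇒ a ⊖ r₂ ≲ dst (a ⊖ r₁) (b ⊖ r₁)) a b r₁ r₂ q r₁≤b p))
    ... | inj₂ p = ≤-trans (+-monoʳ-≤ (bits (b ∸ r₁)) (≤-reflexive (trans (cong bits (m≤n⇒m∸n≡0 (≤-trans p q))) bits0)))
                     (≤-trans (≤-reflexive (+-identityʳ _)) (Nh≥far (a ∸ r₁) (b ∸ r₁)))

  -- The same without a gain, for a winner of arbitrary rank.
  link-weak : bits ((r₂ ⊓ b) ∸ r₁) + N a c r' ≤ N a b r₁ + N b c r₂
  link-weak with ≤-total r₂ b | ≤-total r₁ b
  ... | inj₁ q | _ = ≤-trans (≤-reflexive (cong (λ v → bits (v ∸ r₁) + N a c r') (m≤n⇒m⊓n≡m q)))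
                       (≤-trans (m≤m+n (bits (r₂ ∸ r₁) + N a c r') (proj₁ lg)) (proj₁ (proj₂ lg)))
    where lg = link-gain q
  ... | inj₂ q | inj₂ b≤r₁ = ≤-trans (≤-reflexive (cong (_+ N a c r') (trans (cong bits
          (linear 3 (λ r₁ r₂ b → b ≲ r₂ ⇒ b ≲ r₁ ⇒ mn r₂ b ⊖ r₁ ≐ # 0) r₁ r₂ b q b≤r₁)) bits0))) core
  ... | inj₂ q | inj₁ r₁≤b = begin
      bits ((r₂ ⊓ b) ∸ r₁) + N a c r' ≤⟨ +-mono-≤ (bits-mono {_} {b ∸ r₁} (linear 3 (λ r₁ r₂ b → mn r₂ b ⊖ r₁ ≲ b ⊖ r₁) r₁ r₂ b)) (N-raise a c h₂) ⟩
      bits (b ∸ r₁) + N a c r₂ ≤⟨ +-monoʳ-≤ (bits (b ∸ r₁)) (Nh-inner (a ∸ r₂) 0 (c ∸ r₂) z≤n) ⟩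
      bits (b ∸ r₁) + (bits (a ∸ r₂) + Nh 0 (c ∸ r₂)) ≡⟨ +-assoc (bits (b ∸ r₁)) _ _ ⟨
      bits (b ∸ r₁) + bits (a ∸ r₂) + Nh 0 (c ∸ r₂) ≤⟨ +-monoˡ-≤ (Nh 0 (c ∸ r₂)) (far q r₁≤b) ⟩
      N a b r₁ + Nh 0 (c ∸ r₂) ≡⟨ cong (λ v → N a b r₁ + Nh v (c ∸ r₂)) (m≤n⇒m∸n≡0 q) ⟨
      N a b r₁ + N b c r₂ ∎
    where open ≤-Reasoning

-- Funds and reserves when two elements merge

-- F pays for future rises of class across the jump between the two levels.
Fund : ℕ → ℕ → ℕ → ℕ → Set
Fund a b r F = bits ((a ⊔ b) ∸ ((a ⊓ b) ⊔ r)) ≤ F + (r ∸ (a ⊓ b))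

gapT : ∀ {n} → Tm n → Tm n → Tm n → Tm n
gapT a b r = mx a b ⊖ mx (mn a b) r

-- If b lies below both outer levels, removing it shortens the path of levels by twice the depth of
-- the dent. One copy of the depth goes to the winner's fund and one to its reserve.
dist-merge : ∀ a b c → dist a c + 2 * ((a ⊓ c) ∸ b) ≤ dist a b + dist b c
dist-merge = linear 3 (λ a b c → dst a c ⊕ 2 ⊛ (mn a c ⊖ b) ≲ dst a b ⊕ dst b c)

module _ (a b c r₁ r₂ r' : ℕ) (h₁ : r₁ ≤ r') (h₂ : r₂ ≤ r') where

  private
    d₁ = (a ⊔ b) ∸ ((a ⊓ b) ⊔ r₁)
    d₂ = (b ⊔ c) ∸ ((b ⊓ c) ⊔ r₂)
    d' = (a ⊔ c) ∸ ((a ⊓ c) ⊔ r')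
    t₁ = (a ⊓ b) ∸ r₁
    t₂ = (b ⊓ c) ∸ r₂
    ℓ = (r₂ ⊓ b) ∸ r₁
    h = (a ⊓ c) ∸ b

  -- Here u is what the loser's fund spends on a higher sentinel. It can be positive only if both b
  -- and r₂ exceed a, and then the part of the jump from a to b that it pays for lies below the new
  -- rank, where `Fund` no longer counts it.
  fund-merge : ∀ {F₁ F₂ u} → Fund a b r₁ F₁ → Fund b c r₂ F₂ → u ≤ F₁ → u ≤ bits ℓ ∸ bits t₁ →
               Fund a c r' ((F₁ + F₂ ∸ u) + h)
  fund-merge {F₁} {F₂} {u} f₁ f₂ uF uℓ with ≤-total b a
  ... | inj₁ b≤a = goal u0
    where
    u0 : u ≡ 0
    u0 = n≤0⇒n≡0 (≤-trans uℓ (≤-reflexive (m≤n⇒m∸n≡0 (bits-mono {ℓ} {t₁}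
           (linear 4 (λ a b r₁ r₂ → b ≲ a ⇒ mn r₂ b ⊖ r₁ ≲ mn a b ⊖ r₁) a b r₁ r₂ b≤a)))))
    core : bits d' ≤ (F₁ + F₂) + h + (r' ∸ (a ⊓ c))
    core with ≤-total c b | ≤-total a c | ≤-total r₁ b
    ... | inj₁ c≤b | _ | inj₁ r₁≤b = begin
          bits d' ≤⟨ bits-sub d₁ d₂ (linear 6 (λ a b c r₁ r₂ r' → b ≲ a ⇒ c ≲ b ⇒ r₁ ≲ b ⇒ r₂ ≲ r' ⇒ gapT a c r' ≲ gapT a b r₁ ⊕ gapT b c r₂) a b c r₁ r₂ r' b≤a c≤b r₁≤b h₂) ⟩
          bits d₁ + bits d₂ ≤⟨ +-mono-≤ f₁ f₂ ⟩
          (F₁ + (r₁ ∸ (a ⊓ b))) + (F₂ + (r₂ ∸ (b ⊓ c))) ≤⟨ linear 8 (λ a b c r₁ r₂ r' F₁ F₂ → b ≲ a ⇒ c ≲ b ⇒ r₁ ≲ b ⇒ r₂ ≲ r' ⇒ (F₁ ⊕ (r₁ ⊖ mn a b)) ⊕ (F₂ ⊕ (r₂ ⊖ mn b c)) ≲ (F₁ ⊕ F₂) ⊕ (mn a c ⊖ b) ⊕ (r' ⊖ mn a c)) a b c r₁ r₂ r' F₁ F₂ b≤a c≤b r₁≤b h₂ ⟩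
          (F₁ + F₂) + h + (r' ∸ (a ⊓ c)) ∎
      where open ≤-Reasoning
    ... | inj₁ c≤b | _ | inj₂ b≤r₁ = begin
          bits d' ≤⟨ bits-mono (linear 5 (λ a b c r₁ r' → b ≲ a ⇒ c ≲ b ⇒ b ≲ r₁ ⇒ r₁ ≲ r' ⇒ gapT a c r' ≲ gapT a b r₁) a b c r₁ r' b≤a c≤b b≤r₁ h₁) ⟩
          bits d₁ ≤⟨ f₁ ⟩
          F₁ + (r₁ ∸ (a ⊓ b)) ≤⟨ linear 7 (λ a b c r₁ r' F₁ F₂ → b ≲ a ⇒ c ≲ b ⇒ b ≲ r₁ ⇒ r₁ ≲ r' ⇒ F₁ ⊕ (r₁ ⊖ mn a b) ≲ (F₁ ⊕ F₂) ⊕ (mn a c ⊖ b) ⊕ (r' ⊖ mn a c)) a b c r₁ r' F₁ F₂ b≤a c≤b b≤r₁ h₁ ⟩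
          (F₁ + F₂) + h + (r' ∸ (a ⊓ c)) ∎
      where open ≤-Reasoning
    ... | inj₂ b≤c | inj₁ a≤c | _ = begin
          bits d' ≤⟨ bits-mono (linear 5 (λ a b c r₂ r' → b ≲ a ⇒ b ≲ c ⇒ a ≲ c ⇒ r₂ ≲ r' ⇒ gapT a c r' ≲ gapT b c r₂) a b c r₂ r' b≤a b≤c a≤c h₂) ⟩
          bits d₂ ≤⟨ f₂ ⟩
          F₂ + (r₂ ∸ (b ⊓ c)) ≤⟨ linear 7 (λ a b c r₂ r' F₁ F₂ → b ≲ a ⇒ b ≲ c ⇒ a ≲ c ⇒ r₂ ≲ r' ⇒ F₂ ⊕ (r₂ ⊖ mn b c) ≲ (F₁ ⊕ F₂) ⊕ (mn a c ⊖ b) ⊕ (r' ⊖ mn a c)) a b c r₂ r' F₁ F₂ b≤a b≤c a≤c h₂ ⟩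
          (F₁ + F₂) + h + (r' ∸ (a ⊓ c)) ∎
      where open ≤-Reasoning
    ... | inj₂ b≤c | inj₂ c≤a | _ = begin
          bits d' ≤⟨ bits-mono (linear 5 (λ a b c r₁ r' → b ≲ a ⇒ b ≲ c ⇒ c ≲ a ⇒ r₁ ≲ r' ⇒ gapT a c r' ≲ gapT a b r₁) a b c r₁ r' b≤a b≤c c≤a h₁) ⟩
          bits d₁ ≤⟨ f₁ ⟩
          F₁ + (r₁ ∸ (a ⊓ b)) ≤⟨ linear 7 (λ a b c r₁ r' F₁ F₂ → b ≲ a ⇒ b ≲ c ⇒ c ≲ a ⇒ r₁ ≲ r' ⇒ F₁ ⊕ (r₁ ⊖ mn a b) ≲ (F₁ ⊕ F₂) ⊕ (mn a c ⊖ b) ⊕ (r' ⊖ mn a c)) a b c r₁ r' F₁ F₂ b≤a b≤c c≤a h₁ ⟩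
          (F₁ + F₂) + h + (r' ∸ (a ⊓ c)) ∎
      where open ≤-Reasoning
    goal : u ≡ 0 → Fund a c r' ((F₁ + F₂ ∸ u) + h)
    goal e = subst (λ v → bits d' ≤ (F₁ + F₂ ∸ v) + h + (r' ∸ (a ⊓ c))) (sym e) core
  ... | inj₂ a≤b = ≤-trans core' (+-monoˡ-≤ (r' ∸ (a ⊓ c)) (m≤m+n (F₁ + F₂ ∸ u) h))
    where
    open ≤-Reasoning
    main : bits d' + u ≤ (F₁ + F₂) + (r' ∸ (a ⊓ c))
    core' : bits d' ≤ (F₁ + F₂ ∸ u) + (r' ∸ (a ⊓ c))
    core' = linear 5 (λ d u F₁ F₂ x → d ⊕ u ≲ (F₁ ⊕ F₂) ⊕ x ⇒ u ≲ F₁ ⇒ d ≲ (F₁ ⊕ F₂ ⊖ u) ⊕ x)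
              (bits d') u F₁ F₂ (r' ∸ (a ⊓ c)) main uF
    -- c is at most a: the jump of the winner covers that of the result.
    main with ≤-total c a
    ... | inj₁ c≤a = begin
          bits d' + u ≤⟨ +-mono-≤ (bits-mono {d'} {d₂} (linear 5 (λ a b c r₂ r' → a ≲ b ⇒ c ≲ a ⇒ r₂ ≲ r' ⇒ gapT a c r' ≲ gapT b c r₂) a b c r₂ r' a≤b c≤a h₂)) uF ⟩
          bits d₂ + F₁ ≤⟨ +-monoˡ-≤ F₁ f₂ ⟩
          F₂ + (r₂ ∸ (b ⊓ c)) + F₁ ≤⟨ linear 7 (λ a b c r₂ r' F₁ F₂ → a ≲ b ⇒ c ≲ a ⇒ r₂ ≲ r' ⇒ F₂ ⊕ (r₂ ⊖ mn b c) ⊕ F₁ ≲ (F₁ ⊕ F₂) ⊕ (r' ⊖ mn a c)) a b c r₂ r' F₁ F₂ a≤b c≤a h₂ ⟩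
          (F₁ + F₂) + (r' ∸ (a ⊓ c)) ∎
    ... | inj₂ a≤c with ≤-total r₂ a
    ...   | inj₁ r₂≤a = begin
          bits d' + u ≡⟨ cong (bits d' +_) u0 ⟩
          bits d' + 0 ≡⟨ +-identityʳ _ ⟩
          bits d' ≤⟨ bits-sub d₁ d₂ (linear 6 (λ a b c r₁ r₂ r' → a ≲ b ⇒ a ≲ c ⇒ r₁ ≲ r' ⇒ r₂ ≲ a ⇒ gapT a c r' ≲ gapT a b r₁ ⊕ gapT b c r₂) a b c r₁ r₂ r' a≤b a≤c h₁ r₂≤a) ⟩
          bits d₁ + bits d₂ ≤⟨ +-mono-≤ f₁ f₂ ⟩
          (F₁ + (r₁ ∸ (a ⊓ b))) + (F₂ + (r₂ ∸ (b ⊓ c))) ≤⟨ linear 8 (λ a b c r₁ r₂ r' F₁ F₂ → a ≲ b ⇒ a ≲ c ⇒ r₁ ≲ r' ⇒ r₂ ≲ a ⇒ (F₁ ⊕ (r₁ ⊖ mn a b)) ⊕ (F₂ ⊕ (r₂ ⊖ mn b c)) ≲ (F₁ ⊕ F₂) ⊕ (r' ⊖ mn a c)) a b c r₁ r₂ r' F₁ F₂ a≤b a≤c h₁ r₂≤a ⟩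
          (F₁ + F₂) + (r' ∸ (a ⊓ c)) ∎
          where
          u0 : u ≡ 0
          u0 = n≤0⇒n≡0 (≤-trans uℓ (≤-reflexive (m≤n⇒m∸n≡0 (bits-mono {ℓ} {t₁}
                 (linear 4 (λ a b r₁ r₂ → a ≲ b ⇒ r₂ ≲ a ⇒ mn r₂ b ⊖ r₁ ≲ mn a b ⊖ r₁) a b r₁ r₂ a≤b r₂≤a)))))
    ...   | inj₂ a≤r₂ with ≤-total b c | ≤-total b r₂
    ...     | inj₁ b≤c | inj₁ b≤r₂ = begin
          bits d' + u ≤⟨ +-mono-≤ (bits-mono {d'} {d₂} (linear 5 (λ a b c r₂ r' → a ≲ b ⇒ b ≲ c ⇒ b ≲ r₂ ⇒ r₂ ≲ r' ⇒ gapT a c r' ≲ gapT b c r₂) a b c r₂ r' a≤b b≤c b≤r₂ h₂)) uF ⟩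
          bits d₂ + F₁ ≤⟨ +-monoˡ-≤ F₁ f₂ ⟩
          F₂ + (r₂ ∸ (b ⊓ c)) + F₁ ≤⟨ linear 7 (λ a b c r₂ r' F₁ F₂ → a ≲ b ⇒ b ≲ c ⇒ r₂ ≲ r' ⇒ F₂ ⊕ (r₂ ⊖ mn b c) ⊕ F₁ ≲ (F₁ ⊕ F₂) ⊕ (r' ⊖ mn a c)) a b c r₂ r' F₁ F₂ a≤b b≤c h₂ ⟩
          (F₁ + F₂) + (r' ∸ (a ⊓ c)) ∎
    ...     | inj₁ b≤c | inj₂ r₂≤b = begin
          bits d' + u ≤⟨ +-monoˡ-≤ u split ⟩
          bits d₂ + bits e + u ≤⟨ linear 6 (λ D e u F₁ F₂ x → D ≲ F₂ ⇒ e ⊕ u ≲ F₁ ⊕ x ⇒ D ⊕ e ⊕ u ≲ (F₁ ⊕ F₂) ⊕ x) (bits d₂) (bits e) u F₁ F₂ (r' ∸ (a ⊓ c)) f₂' eu ⟩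
          (F₁ + F₂) + (r' ∸ (a ⊓ c)) ∎
          where
          e = b ∸ (r₁ ⊔ r₂)
          split : bits d' ≤ bits d₂ + bits e
          split = bits-sub d₂ e (linear 6 (λ a b c r₁ r₂ r' → a ≲ b ⇒ b ≲ c ⇒ a ≲ r₂ ⇒ r₂ ≲ b ⇒ r₁ ≲ r' ⇒ r₂ ≲ r' ⇒ gapT a c r' ≲ gapT b c r₂ ⊕ (b ⊖ mx r₁ r₂)) a b c r₁ r₂ r' a≤b b≤c a≤r₂ r₂≤b h₁ h₂)
          f₂' : bits d₂ ≤ F₂
          f₂' = ≤-trans f₂ (linear 4 (λ b c r₂ F₂ → b ≲ c ⇒ r₂ ≲ b ⇒ F₂ ⊕ (r₂ ⊖ mn b c) ≲ F₂) b c r₂ F₂ b≤c r₂≤b)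
          be : bits e ≤ F₁ + (r₁ ∸ a)
          be = ≤-trans (bits-mono {e} {d₁} (linear 4 (λ a b r₁ r₂ → a ≲ b ⇒ a ≲ r₂ ⇒ (b ⊖ mx r₁ r₂) ≲ gapT a b r₁) a b r₁ r₂ a≤b a≤r₂))
                 (≤-trans f₁ (linear 4 (λ a b r₁ F₁ → a ≲ b ⇒ F₁ ⊕ (r₁ ⊖ mn a b) ≲ F₁ ⊕ (r₁ ⊖ a)) a b r₁ F₁ a≤b))
          bu : u ≤ r₂ ∸ (a ⊔ r₁)
          bu = ≤-trans uℓ (≤-trans (m≤n+o⇒m∸n≤o (bits ℓ) (bits t₁) (bits-sub t₁ (r₂ ∸ (a ⊔ r₁))
                 (linear 4 (λ a b r₁ r₂ → a ≲ b ⇒ a ≲ r₂ ⇒ mn r₂ b ⊖ r₁ ≲ (mn a b ⊖ r₁) ⊕ (r₂ ⊖ mx a r₁)) a b r₁ r₂ a≤b a≤r₂)))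
                 (bits≤n (r₂ ∸ (a ⊔ r₁))))
          eu : bits e + u ≤ F₁ + (r' ∸ (a ⊓ c))
          eu = linear 8 (λ a c r₁ r₂ r' F₁ e u → e ≲ F₁ ⊕ (r₁ ⊖ a) ⇒ u ≲ r₂ ⊖ mx a r₁ ⇒ a ≲ c ⇒ r₁ ≲ r' ⇒ r₂ ≲ r' ⇒ e ⊕ u ≲ F₁ ⊕ (r' ⊖ mn a c))
                 a c r₁ r₂ r' F₁ (bits e) u be bu a≤c h₁ h₂
    ...     | inj₂ c≤b | _ = begin
          bits d' + u ≤⟨ linear 8 (λ a c r₁ r₂ r' F₁ e u → e ≲ F₁ ⊕ (r₁ ⊖ a) ⇒ u ≲ r₂ ⊖ mx a r₁ ⇒ a ≲ c ⇒ r₁ ≲ r' ⇒ r₂ ≲ r' ⇒ e ⊕ u ≲ F₁ ⊕ (r' ⊖ mn a c))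
                 a c r₁ r₂ r' F₁ (bits d') u be bu a≤c h₁ h₂ ⟩
          F₁ + (r' ∸ (a ⊓ c)) ≤⟨ +-monoˡ-≤ (r' ∸ (a ⊓ c)) (m≤m+n F₁ F₂) ⟩
          (F₁ + F₂) + (r' ∸ (a ⊓ c)) ∎
          where
          be : bits d' ≤ F₁ + (r₁ ∸ a)
          be = ≤-trans (bits-mono {d'} {d₁} (linear 5 (λ a b c r₁ r' → a ≲ c ⇒ c ≲ b ⇒ r₁ ≲ r' ⇒ gapT a c r' ≲ gapT a b r₁) a b c r₁ r' a≤c c≤b h₁))
                 (≤-trans f₁ (linear 4 (λ a b r₁ F₁ → a ≲ b ⇒ F₁ ⊕ (r₁ ⊖ mn a b) ≲ F₁ ⊕ (r₁ ⊖ a)) a b r₁ F₁ a≤b))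
          bu : u ≤ r₂ ∸ (a ⊔ r₁)
          bu = ≤-trans uℓ (≤-trans (m≤n+o⇒m∸n≤o (bits ℓ) (bits t₁) (bits-sub t₁ (r₂ ∸ (a ⊔ r₁))
                 (linear 4 (λ a b r₁ r₂ → a ≲ b ⇒ a ≲ r₂ ⇒ mn r₂ b ⊖ r₁ ≲ (mn a b ⊖ r₁) ⊕ (r₂ ⊖ mx a r₁)) a b r₁ r₂ a≤b a≤r₂)))
                 (bits≤n (r₂ ∸ (a ⊔ r₁))))

  low-merge : ∀ {R₂} → bits t₂ ≤ R₂ → bits ((a ⊓ c) ∸ r') ≤ R₂ + h
  low-merge {R₂} i₂ = begin
    bits ((a ⊓ c) ∸ r') ≤⟨ bits-sub t₂ h (linear 5 (λ a b c r₂ r' → r₂ ≲ r' ⇒ mn a c ⊖ r' ≲ (mn b c ⊖ r₂) ⊕ (mn a c ⊖ b)) a b c r₂ r' h₂) ⟩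
    bits t₂ + bits h ≤⟨ +-mono-≤ i₂ (bits≤n h) ⟩
    R₂ + h ∎
    where open ≤-Reasoning

  -- R' must exceed R₂ and the excess of r' over the vanishing gap.
  high-merge : ∀ {F₁ F₂ F' R₂ R'} → Fund a b r₁ F₁ → bits t₂ ≤ R₂ → bits ((b ⊔ c) ∸ r₂) ≤ F₂ + R₂ →
               F₂ ≤ F' → (b ≤ a → F₁ + F₂ ≤ F') → R₂ ≤ R' → r' ∸ b ≤ R' → bits ((a ⊔ c) ∸ r') ≤ F' + R'
  high-merge {F₁} {F₂} {F'} {R₂} {R'} f₁ i₂ i₄ F₂≤ F≤ R₂≤ b≤R' with ≤-total a (b ⊔ c)
  ... | inj₁ p = ≤-trans (bits-mono {_} {(b ⊔ c) ∸ r₂} (linear 5 (λ a b c r₂ r' → a ≲ mx b c ⇒ r₂ ≲ r' ⇒ mx a c ⊖ r' ≲ mx b c ⊖ r₂) a b c r₂ r' p h₂))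
                   (≤-trans i₄ (+-mono-≤ F₂≤ R₂≤))
  ... | inj₂ p with ≤-total r₁ b
  ...   | inj₂ b≤r₁ = begin
          bits ((a ⊔ c) ∸ r') ≤⟨ bits-mono {_} {d₁} (linear 5 (λ a b c r₁ r' → mx b c ≲ a ⇒ b ≲ r₁ ⇒ r₁ ≲ r' ⇒ mx a c ⊖ r' ≲ gapT a b r₁) a b c r₁ r' p b≤r₁ h₁) ⟩
          bits d₁ ≤⟨ f₁ ⟩
          F₁ + (r₁ ∸ (a ⊓ b)) ≤⟨ linear 9 (λ a b c r₁ r' F₁ F₂ F' R' → F₁ ⊕ F₂ ≲ F' ⇒ mx b c ≲ a ⇒ r₁ ≲ r' ⇒ r' ⊖ b ≲ R' ⇒ F₁ ⊕ (r₁ ⊖ mn a b) ≲ F' ⊕ R') a b c r₁ r' F₁ F₂ F' R' (F≤ b≤a) p h₁ b≤R' ⟩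
          F' + R' ∎
    where
    open ≤-Reasoning
    b≤a = m⊔n≤o⇒m≤o b c p
  ...   | inj₁ r₁≤b with ≤-total c b
  ...     | inj₁ c≤b = begin
          bits ((a ⊔ c) ∸ r') ≤⟨ bits-sub d₁ ((b ⊔ c) ∸ r₂) (linear 6 (λ a b c r₁ r₂ r' → mx b c ≲ a ⇒ r₁ ≲ b ⇒ r₂ ≲ r' ⇒ mx a c ⊖ r' ≲ gapT a b r₁ ⊕ (mx b c ⊖ r₂)) a b c r₁ r₂ r' p r₁≤b h₂) ⟩
          bits d₁ + bits ((b ⊔ c) ∸ r₂) ≤⟨ +-mono-≤ f₁ i₄ ⟩
          F₁ + (r₁ ∸ (a ⊓ b)) + (F₂ + R₂) ≤⟨ linear 9 (λ a b c r₁ R₂ F₁ F₂ F' R' → F₁ ⊕ F₂ ≲ F' ⇒ mx b c ≲ a ⇒ r₁ ≲ b ⇒ R₂ ≲ R' ⇒ F₁ ⊕ (r₁ ⊖ mn a b) ⊕ (F₂ ⊕ R₂) ≲ F' ⊕ R') a b c r₁ R₂ F₁ F₂ F' R' (F≤ (m⊔n≤o⇒m≤o b c p)) p r₁≤b R₂≤ ⟩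
          F' + R' ∎
    where open ≤-Reasoning
  ...     | inj₂ b≤c = begin
          bits ((a ⊔ c) ∸ r') ≤⟨ bits-sub d₁ t₂ (linear 6 (λ a b c r₁ r₂ r' → mx b c ≲ a ⇒ r₁ ≲ b ⇒ b ≲ c ⇒ r₂ ≲ r' ⇒ mx a c ⊖ r' ≲ gapT a b r₁ ⊕ (mn b c ⊖ r₂)) a b c r₁ r₂ r' p r₁≤b b≤c h₂) ⟩
          bits d₁ + bits t₂ ≤⟨ +-mono-≤ f₁ i₂ ⟩
          F₁ + (r₁ ∸ (a ⊓ b)) + R₂ ≤⟨ linear 9 (λ a b c r₁ R₂ F₁ F₂ F' R' → F₁ ⊕ F₂ ≲ F' ⇒ mx b c ≲ a ⇒ r₁ ≲ b ⇒ R₂ ≲ R' ⇒ F₁ ⊕ (r₁ ⊖ mn a b) ⊕ R₂ ≲ F' ⊕ R') a b c r₁ R₂ F₁ F₂ F' R' (F≤ (m⊔n≤o⇒m≤o b c p)) p r₁≤b R₂≤ ⟩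
          F' + R' ∎
    where open ≤-Reasoning

-- Credit for a second win

when unless : Bool → ℕ → ℕ
when b n = if b then n else 0
unless b n = if b then 0 else n

-- Prepayment for the links an element may still win.
credit : Bool → Bool → Bool → ℕ → ℕ → ℕ → ℕ
credit mt fl fr zero o r = unless fl 1 + unless fr 1
credit mt false false (suc _) o r = 0
credit mt true true (suc _) o r = 0
-- One side has been won. A first win with D = 0 gains 3, of which 2 are kept. If the rank has grown
-- by one, the next charge may miss R₀ by one, hence 6 for a mortal winner; if it has grown by two
-- or more, 9 R₀ settles the second win outright.
credit mt _ _ R₀@(suc _) o r = 2 + when mt (6 * (1 ⊓ (r ∸ o))) + (if suc (suc o) ≤ᵇ r then 9 * R₀ else 0)

if-≤ : ∀ m n x → (if m ≤ᵇ n then x else 0) ≤ x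
if-≤ m n x with m ≤ᵇ n
... | true = ≤-refl
... | false = z≤n

if-no : ∀ {m n} x → n < m → (if m ≤ᵇ n then x else 0) ≡ 0
if-no {m} {n} x h with m ≤ᵇ n in eq
... | false = refl
... | true = ⊥-elim (<⇒≱ h (≤ᵇ⇒≤ m n (subst T (sym eq) _)))

if-yes : ∀ {m n} x → m ≤ n → (if m ≤ᵇ n then x else 0) ≡ x
if-yes {m} {n} x h with m ≤ᵇ n in eq
... | true = refl
... | false = ⊥-elim (subst T eq (≤⇒≤ᵇ h))

credit-sym : ∀ mt fl fr R₀ o r → credit mt fl fr R₀ o r ≡ credit mt fr fl R₀ o r
credit-sym mt fl fr zero o r = +-comm (unless fl 1) (unless fr 1)
credit-sym mt false false (suc _) o r = refl
credit-sym mt false true (suc _) o r = refl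
credit-sym mt true false (suc _) o r = refl
credit-sym mt true true (suc _) o r = refl

when-≤ : ∀ b x → when b x ≤ x
when-≤ true x = ≤-refl
when-≤ false x = z≤n

module _ (mt : Bool) {o b r₁ r₂ r' ν : ℕ} where

  -- On the left stand the link itself, the growth of the variation of the winner's children and the
  -- winner's old charge. On the right stand the charge of the new edge, the drop of N and 6 of the
  -- 18 units that a mortal winner borrows per unit of rank.
  WinPay : ℕ → Bool → ℕ → ℕ → Set
  WinPay R₀ fr ν' D = 1 + 6 * when mt (R₀ ∸ ν') + 3 * ν + credit mt true fr R₀ o r' ≤ credit mt false fr R₀ o r₂ + 3 * ν' + 40 * D + 6 * when mt (r' ∸ r₂)

  private
    growth₂ : r₂ ≤ suc o → bits (b ∸ o) ≤ bits (b ∸ r₂) + (r₂ ∸ o)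
    growth₂ h = ≤-trans (bits-sub (b ∸ r₂) (r₂ ∸ o) (linear 3 (λ o b r → b ⊖ o ≲ (b ⊖ r) ⊕ (r ⊖ o)) o b r₂))
                  (+-monoʳ-≤ (bits (b ∸ r₂)) (bits≤n (r₂ ∸ o)))

    slope : ∀ x → when mt (6 * (1 ⊓ x)) ≤ 6 * when mt x
    slope x = by mt
      where
      by : ∀ m → when m (6 * (1 ⊓ x)) ≤ 6 * when m x
      by true = *-monoʳ-≤ 6 (m⊓n≤n 1 x)
      by false = z≤n

    exempt : ∀ (fr : Bool) d g → 1 + 6 * when mt 0 + 3 * 0 + unless fr 1 ≤ (1 + unless fr 1) + 3 * 0 + d + g
    exempt fr d g = linear 4 (λ w d g u → w ≲ # 0 ⇒ # 1 ⊕ 6 ⊛ w ⊕ # 0 ⊕ u ≲ (# 1 ⊕ u) ⊕ # 0 ⊕ d ⊕ g) (when mt 0) d g (unless fr 1) (when-≤ mt 0)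

  -- A positive D outweighs everything through its factor 40. If D = 0, `gain₂` makes the class of
  -- the new edge larger than that of the gap above the winner, so that ν' reaches R₀, or R₀ - 1 at
  -- a second win after growth by one. The remaining case is a gap of height 0, which leaves at most
  -- R₀ = 1.
  win-gain : ∀ R₀ fr {D} → R₀ ≤ bits (b ∸ o) → ν ≤ R₀ ∸ 1 → (fr ≡ false → r₂ ≡ o) → r₂ ≤ b → r' ≤ suc (r₁ ⊔ r₂) → Gain (b ∸ r₂) (r₂ ∸ r₁) D →
             WinPay R₀ fr (R₀ ⊓ (bits (r₂ ∸ r₁) ∸ 1)) D
  win-gain zero fr _ z≤n fresh r₂≤b hr' gn = exempt fr _ _
  win-gain R@(suc R-) false {D} cl ν≤ fresh r₂≤b hr' gn with suc (suc o) ≤? r'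
  -- Before its first win the winner still has rank o, so a rise by two is possible only below a
  -- loser of larger rank. The new edge then has class 0, and `gain₁` bounds R by 2 D, which also
  -- finances the credit 9 R.
  ... | yes big = subst (λ w → 1 + 6 * when mt (R ∸ ν') + 3 * ν + (2 + sl + w) ≤ 3 * ν' + 40 * D + gr) (sym (if-yes {suc (suc o)} (9 * R) big))
        (linear 7 (λ R ν ν' D p s g → ν ≲ R ⊖ # 1 ⇒ # 1 ≲ R ⇒ R ≲ 2 ⊛ D ⇒ p ≲ R ⊖ ν' ⇒ s ≲ g ⇒ # 1 ⊕ 6 ⊛ p ⊕ 3 ⊛ ν ⊕ (# 2 ⊕ s ⊕ 9 ⊛ R) ≲ 3 ⊛ ν' ⊕ 40 ⊛ D ⊕ g)
          R ν ν' D (when mt (R ∸ ν')) sl gr ν≤ (s≤s z≤n) R≤ (when-≤ mt (R ∸ ν')) sl≤)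
    where
    ν' = R ⊓ (bits (r₂ ∸ r₁) ∸ 1)
    sl = when mt (6 * (1 ⊓ (r' ∸ o)))
    gr = 6 * when mt (r' ∸ r₂)
    sl≤ : sl ≤ gr
    sl≤ = subst (λ z → sl ≤ 6 * when mt (r' ∸ z)) (sym (fresh refl)) (slope (r' ∸ o))
    ℓ0 : r₂ ∸ r₁ ≡ 0
    ℓ0 = linear 4 (λ r₁ r₂ r' o → r₂ ≐ o ⇒ r' ≲ # 1 ⊕ mx r₁ r₂ ⇒ # 2 ⊕ o ≲ r' ⇒ r₂ ⊖ r₁ ≐ # 0) r₁ r₂ r' o (fresh refl) hr' big
    R≤ : R ≤ 2 * D
    R≤ = ≤-trans cl (≤-trans (≤-reflexive (cong (λ v → bits (b ∸ v)) (sym (fresh refl))))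
           (≤-trans (gain₁ gn) (≤-reflexive (cong (_+ 2 * D) (trans (cong bits ℓ0) bits0)))))
  ... | no small = subst (λ w → 1 + 6 * when mt (R ∸ ν') + 3 * ν + (2 + sl + w) ≤ 3 * ν' + 40 * D + gr) (sym (if-no {suc (suc o)} (9 * R) (≰⇒> small))) go
    where
    g = bits (r₂ ∸ r₁)
    ν' = R ⊓ (g ∸ 1)
    τ = bits (b ∸ r₂)
    sl = when mt (6 * (1 ⊓ (r' ∸ o)))
    gr = 6 * when mt (r' ∸ r₂)
    sl≤ : sl ≤ gr
    sl≤ = subst (λ z → sl ≤ 6 * when mt (r' ∸ z)) (sym (fresh refl)) (slope (r' ∸ o))
    R≤τ : R ≤ τ
    R≤τ = ≤-trans cl (≤-reflexive (cong (λ v → bits (b ∸ v)) (sym (fresh refl))))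
    go : 1 + 6 * when mt (R ∸ ν') + 3 * ν + (2 + sl + 0) ≤ 3 * ν' + 40 * D + gr
    go with D ≟ 0
    ... | no D≢0 = linear 8 (λ R ν g τ D p s gr → ν ≲ R ⊖ # 1 ⇒ # 1 ≲ R ⇒ R ≲ τ ⇒ τ ≲ g ⊕ 2 ⊛ D ⇒ # 1 ≲ D ⇒ p ≲ R ⊖ mn R (g ⊖ # 1) ⇒ s ≲ gr ⇒
              # 1 ⊕ 6 ⊛ p ⊕ 3 ⊛ ν ⊕ (# 2 ⊕ s ⊕ # 0) ≲ 3 ⊛ mn R (g ⊖ # 1) ⊕ 40 ⊛ D ⊕ gr)
            R ν g τ D (when mt (R ∸ ν')) sl gr ν≤ (s≤s z≤n) R≤τ (gain₁ gn) (n≢0⇒n>0 D≢0) (when-≤ mt (R ∸ ν')) sl≤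
    ... | yes D≡0 with gain₂ gn D≡0
    ...   | inj₁ T0 = ⊥-elim (<⇒≱ {0} {R} (s≤s z≤n) (≤-trans R≤τ (≤-reflexive (trans (cong bits T0) bits0))))
    ...   | inj₂ τ<g = linear 8 (λ R ν g τ D p s gr → ν ≲ R ⊖ # 1 ⇒ # 1 ≲ R ⇒ R ≲ τ ⇒ # 1 ⊕ τ ≲ g ⇒ p ≲ R ⊖ mn R (g ⊖ # 1) ⇒ s ≲ gr ⇒
              # 1 ⊕ 6 ⊛ p ⊕ 3 ⊛ ν ⊕ (# 2 ⊕ s ⊕ # 0) ≲ 3 ⊛ mn R (g ⊖ # 1) ⊕ 40 ⊛ D ⊕ gr)
            R ν g τ D (when mt (R ∸ ν')) sl gr ν≤ (s≤s z≤n) R≤τ τ<g (when-≤ mt (R ∸ ν')) sl≤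
  win-gain R@(suc R-) true {D} cl ν≤ fresh r₂≤b hr' gn with suc (suc o) ≤? r₂
  ... | yes big = subst (λ w → 1 + 6 * when mt (R ∸ ν') + 3 * ν + 0 ≤ (2 + sl + w) + 3 * ν' + 40 * D + gr) (sym (if-yes {suc (suc o)} (9 * R) big))
        (linear 7 (λ R ν ν' D p s g → ν ≲ R ⊖ # 1 ⇒ p ≲ R ⊖ ν' ⇒ # 1 ⊕ 6 ⊛ p ⊕ 3 ⊛ ν ⊕ # 0 ≲ (# 2 ⊕ s ⊕ 9 ⊛ R) ⊕ 3 ⊛ ν' ⊕ 40 ⊛ D ⊕ g)
          R ν ν' D (when mt (R ∸ ν')) sl gr ν≤ (when-≤ mt (R ∸ ν')))
    where
    ν' = R ⊓ (bits (r₂ ∸ r₁) ∸ 1)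
    sl = when mt (6 * (1 ⊓ (r₂ ∸ o)))
    gr = 6 * when mt (r' ∸ r₂)
  ... | no small = subst (λ w → 1 + 6 * when mt (R ∸ ν') + 3 * ν + 0 ≤ (2 + sl mt + w) + 3 * ν' + 40 * D + gr) (sym (if-no {suc (suc o)} (9 * R) (≰⇒> small))) (go mt)
    where
    g = bits (r₂ ∸ r₁)
    ν' = R ⊓ (g ∸ 1)
    τ = bits (b ∸ r₂)
    d = r₂ ∸ o
    sl : Bool → ℕ
    sl m = when m (6 * (1 ⊓ d))
    gr = 6 * when mt (r' ∸ r₂)
    R≤τ : R ≤ τ + d
    R≤τ = ≤-trans cl (growth₂ (s≤s⁻¹ (≰⇒> small)))
    d≤1 : d ≤ 1
    d≤1 = linear 2 (λ r o → r ≲ # 1 ⊕ o ⇒ r ⊖ o ≲ # 1) r₂ o (s≤s⁻¹ (≰⇒> small))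
    go : ∀ m → 1 + 6 * when m (R ∸ ν') + 3 * ν + 0 ≤ (2 + sl m + 0) + 3 * ν' + 40 * D + gr
    go m with D ≟ 0
    ... | no D≢0 = linear 9 (λ R ν g τ D p d s gr → ν ≲ R ⊖ # 1 ⇒ # 1 ≲ R ⇒ R ≲ τ ⊕ d ⇒ τ ≲ g ⊕ 2 ⊛ D ⇒ # 1 ≲ D ⇒ p ≲ R ⊖ mn R (g ⊖ # 1) ⇒ d ≲ # 1 ⇒
              # 1 ⊕ 6 ⊛ p ⊕ 3 ⊛ ν ⊕ # 0 ≲ (# 2 ⊕ s ⊕ # 0) ⊕ 3 ⊛ mn R (g ⊖ # 1) ⊕ 40 ⊛ D ⊕ gr)
            R ν g τ D (when m (R ∸ ν')) d (sl m) gr ν≤ (s≤s z≤n) R≤τ (gain₁ gn) (n≢0⇒n>0 D≢0) (when-≤ m (R ∸ ν')) d≤1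
    ... | yes D≡0 with gain₂ gn D≡0
    ...   | inj₁ T0 = at-bottom m (≤-reflexive (trans (cong bits T0) bits0))
      where
      at-bottom : ∀ m → τ ≤ 0 → 1 + 6 * when m (R ∸ ν') + 3 * ν + 0 ≤ (2 + sl m + 0) + 3 * ν' + 40 * D + gr
      at-bottom true = linear 7 (λ R ν g τ D d gr → ν ≲ R ⊖ # 1 ⇒ # 1 ≲ R ⇒ R ≲ τ ⊕ d ⇒ d ≲ # 1 ⇒ τ ≲ # 0 ⇒
              # 1 ⊕ 6 ⊛ (R ⊖ mn R (g ⊖ # 1)) ⊕ 3 ⊛ ν ⊕ # 0 ≲ (# 2 ⊕ 6 ⊛ mn (# 1) d ⊕ # 0) ⊕ 3 ⊛ mn R (g ⊖ # 1) ⊕ 40 ⊛ D ⊕ gr)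
            R ν g τ D d gr ν≤ (s≤s z≤n) R≤τ d≤1
      at-bottom false = linear 7 (λ R ν g τ D d gr → ν ≲ R ⊖ # 1 ⇒ # 1 ≲ R ⇒ R ≲ τ ⊕ d ⇒ d ≲ # 1 ⇒ τ ≲ # 0 ⇒
              # 1 ⊕ # 0 ⊕ 3 ⊛ ν ⊕ # 0 ≲ (# 2 ⊕ # 0 ⊕ # 0) ⊕ 3 ⊛ mn R (g ⊖ # 1) ⊕ 40 ⊛ D ⊕ gr)
            R ν g τ D d gr ν≤ (s≤s z≤n) R≤τ d≤1
    ...   | inj₂ τ<g = above m
      where
      above : ∀ m → 1 + 6 * when m (R ∸ ν') + 3 * ν + 0 ≤ (2 + sl m + 0) + 3 * ν' + 40 * D + gr
      above true = linear 7 (λ R ν g τ D d gr → ν ≲ R ⊖ # 1 ⇒ # 1 ≲ R ⇒ R ≲ τ ⊕ d ⇒ d ≲ # 1 ⇒ # 1 ⊕ τ ≲ g ⇒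
              # 1 ⊕ 6 ⊛ (R ⊖ mn R (g ⊖ # 1)) ⊕ 3 ⊛ ν ⊕ # 0 ≲ (# 2 ⊕ 6 ⊛ mn (# 1) d ⊕ # 0) ⊕ 3 ⊛ mn R (g ⊖ # 1) ⊕ 40 ⊛ D ⊕ gr)
            R ν g τ D d gr ν≤ (s≤s z≤n) R≤τ d≤1 τ<g
      above false = linear 7 (λ R ν g τ D d gr → ν ≲ R ⊖ # 1 ⇒ # 1 ≲ R ⇒ R ≲ τ ⊕ d ⇒ d ≲ # 1 ⇒ # 1 ⊕ τ ≲ g ⇒
              # 1 ⊕ # 0 ⊕ 3 ⊛ ν ⊕ # 0 ≲ (# 2 ⊕ # 0 ⊕ # 0) ⊕ 3 ⊛ mn R (g ⊖ # 1) ⊕ 40 ⊛ D ⊕ gr)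
            R ν g τ D d gr ν≤ (s≤s z≤n) R≤τ d≤1 τ<g

  -- Above the near gap the link is paid by credit alone.
  win-weak : ∀ R₀ fr ν' → R₀ ≤ bits (b ∸ o) → ν ≤ R₀ ∸ 1 → ν' ≤ R₀ → (fr ≡ false → r₂ ≡ o) → b < r₂ → WinPay R₀ fr ν' 0
  win-weak zero fr zero _ z≤n z≤n fresh b<r = exempt fr _ _
  win-weak R@(suc R-) fr ν' cl ν≤ _ fresh b<r with suc (suc o) ≤? r₂ | fr
  ... | no small | _ = ⊥-elim (<⇒≱ {0} {R} (s≤s z≤n) (≤-trans cl (≤-reflexive (trans (cong bits
          (linear 3 (λ o b r → # 1 ⊕ b ≲ r ⇒ r ≲ # 1 ⊕ o ⇒ b ⊖ o ≐ # 0) o b r₂ b<r (s≤s⁻¹ (≰⇒> small)))) bits0))))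
  ... | yes big | false = ⊥-elim (<⇒≱ big (≤-trans (≤-reflexive (fresh refl)) (n≤1+n o)))
  ... | yes big | true = subst (λ w → 1 + 6 * when mt (R ∸ ν') + 3 * ν + 0 ≤ (2 + sl + w) + 3 * ν' + 40 * 0 + gr) (sym (if-yes {suc (suc o)} (9 * R) big))
        (linear 6 (λ R ν ν' p s g → ν ≲ R ⊖ # 1 ⇒ p ≲ R ⊖ ν' ⇒ # 1 ⊕ 6 ⊛ p ⊕ 3 ⊛ ν ⊕ # 0 ≲ (# 2 ⊕ s ⊕ 9 ⊛ R) ⊕ 3 ⊛ ν' ⊕ # 0 ⊕ g)
          R ν ν' (when mt (R ∸ ν')) sl gr ν≤ (when-≤ mt (R ∸ ν')))
    where
    sl = when mt (6 * (1 ⊓ (r₂ ∸ o)))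
    gr = 6 * when mt (r' ∸ r₂)

-- Elements of a list during linking

-- The numerical state of an element of a list being linked: the levels a and
-- b of the gaps to its left and right, whether it has won a link across them,
-- its rank r (o at the start), its class R₀ and charge ν when the linking
-- started, and the reserve R and fund F for rises of its class.
record El : Set where
  constructor el
  field
    mort fl fr : Bool
    a b o r R₀ ν R F : ℕ

over : El → ℕ
over e = unless fl (o ∸ a) + unless fr (o ∸ b) where open El e

-- The reserve starts no lower than R₀, and 12 R₀ in `debt` lends that amount. When the element
-- loses, its reserve repays the loan and pays 12 for each unit by which the new sentinel exceeds
-- R₀.
value debt : El → ℕ
value e = 40 * N a b r + 12 * when mort R + 12 * F + 12 * dist a b + 64 * over e + credit mort fl fr R₀ o r where open El e
debt e = 3 * ν + 12 * when mort R₀ where open El e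

record Inv (Γ : ℕ) (e : El) : Set where
  constructor inv
  open El e
  field
    o≤r : o ≤ r
    fresh : fl ≡ false → fr ≡ false → r ≡ o
    left : fl ≡ false → R₀ ≤ bits (a ∸ o)
    right : fr ≡ false → R₀ ≤ bits (b ∸ o)
    ν≤ : ν ≤ R₀ ∸ 1
    fund : Fund a b r F
    res₁ : mort ≡ true → R₀ + (r ∸ o) ≤ R
    res₂ : mort ≡ true → bits ((a ⊓ b) ∸ r) ≤ R
    res₃ : mort ≡ true → bits ((a ⊔ b) ∸ r) ≤ F + R
    a≤Γ : bits a ≤ Γ
    b≤Γ : bits b ≤ Γ
    R₀≤Γ : R₀ ≤ Γ

merge : El → El → ℕ → ℕ → ℕ → El
merge x y r' R' F' = record y { a = El.a x ; fl = true ; r = r' ; R = R' ; F = F' }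

-- Level and class of a new child, for a near gap of level g.
newρ : ℕ → ℕ → ℕ → ℕ
newρ o r g = o ⊔ (r ⊓ g)

when-mono : ∀ b {x y} → x ≤ y → when b x ≤ when b y
when-mono true h = h
when-mono false h = z≤n

flip : El → El
flip (el m fl fr a b o r R₀ ν R F) = el m fr fl b a o r R₀ ν R F

dist-comm : ∀ x y → dist x y ≡ dist y x
dist-comm x y = +-comm (x ∸ y) (y ∸ x)

N-comm : ∀ a b r → N a b r ≡ N b a r
N-comm a b r = cong₂ _+_ (cong bits (⊓-comm (a ∸ r) (b ∸ r))) (cong bits (dist-comm (a ∸ r) (b ∸ r)))

value-flip : ∀ e → value (flip e) ≡ value e
value-flip (el m fl fr a b o r R₀ ν R F)
  rewrite N-comm b a r | dist-comm b a | +-comm (unless fr (o ∸ b)) (unless fl (o ∸ a)) | credit-sym m fr fl R₀ o r = refl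

inv-flip : ∀ {Γ} e → Inv Γ e → Inv Γ (flip e)
inv-flip {Γ} (el m fl fr a b o r R₀ ν R F) (inv i₁ i₂ i₃ i₄ i₅ i₆ i₇ i₈ i₉ i₁₀ i₁₁ i₁₂) =
  inv i₁ (λ p q → i₂ q p) i₄ i₃ i₅ (subst₂ (λ x y → bits (x ∸ (y ⊔ r)) ≤ F + (r ∸ y)) (⊔-comm a b) (⊓-comm a b) i₆) i₇
    (λ p → subst (λ x → bits (x ∸ r) ≤ R) (⊓-comm a b) (i₈ p))
    (λ p → subst (λ x → bits (x ∸ r) ≤ F + R) (⊔-comm a b) (i₉ p)) i₁₁ i₁₀ i₁₂

module _ {Γ : ℕ} (x y : El) (ix : Inv Γ x) (iy : Inv Γ y) (adj : El.b x ≡ El.a y) (unfl : El.fl y ≡ false)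
         (r' : ℕ) (h₂ : El.r y ≤ r') where
  private
    module X = El x
    module Y = El y
    module IX = Inv ix
    module IY = Inv iy
    e = Y.o ∸ Y.a
    ρ = newρ Y.o Y.r Y.a
    ℓ = ρ ∸ X.r
    ℓ₀ = (Y.r ⊓ Y.a) ∸ X.r
    h = (X.a ⊓ Y.b) ∸ X.b
    g = r' ∸ Y.r

    ℓ≤ : ℓ ≤ ℓ₀ + e
    ℓ≤ = linear 4 (λ o r a x → o ≲ r ⇒ mx o (mn r a) ⊖ x ≲ (mn r a ⊖ x) ⊕ (o ⊖ a)) Y.o Y.r Y.a X.r IY.o≤r

    over-y : over y ≡ e + unless Y.fr (Y.o ∸ Y.b)
    over-y rewrite unfl = refl

    fundY : Fund X.b Y.b Y.r Y.F
    fundY = subst (λ v → Fund v Y.b Y.r Y.F) (sym adj) IY.fund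

    cl : Y.R₀ ≤ bits (Y.a ∸ Y.o)
    cl = IY.left unfl

    mx-bits : ∀ m n → bits m ≤ Γ → bits n ≤ Γ → bits (m ⊔ n) ≤ Γ
    mx-bits m n p q with ≤-total m n
    ... | inj₁ le' = subst (λ v → bits v ≤ Γ) (sym (m≤n⇒m⊔n≡n le')) q
    ... | inj₂ le' = subst (λ v → bits v ≤ Γ) (sym (m≥n⇒m⊔n≡m le')) p

    merged-inv : ∀ R' F' → Fund X.a Y.b r' F' → (Y.mort ≡ true → Y.R₀ + (r' ∸ Y.o) ≤ R') →
                 (Y.mort ≡ true → bits ((X.a ⊓ Y.b) ∸ r') ≤ R') →
                 (Y.mort ≡ true → bits ((X.a ⊔ Y.b) ∸ r') ≤ F' + R') → Inv Γ (merge x y r' R' F')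
    merged-inv R' F' f p₁ p₂ p₃ = inv (≤-trans IY.o≤r h₂) (λ ()) (λ ()) IY.right IY.ν≤ f p₁ p₂ p₃ IX.a≤Γ IY.b≤Γ IY.R₀≤Γ

  -- Every increase has its own source. N pays for the new class; reserve, fund and e for the
  -- loser's sentinel; growth g, shortfall e and dent h for the winner's reserve. The factor 18 of g
  -- is 12 for the reserve plus 6 for `WinPay`, and the two copies of h come from `dist-merge`.
  link-real : X.r ≤ r' → r' ≤ suc (X.r ⊔ Y.r) → let ν' = Y.R₀ ⊓ (bits ℓ ∸ 1) in
    Σ[ R' ∈ ℕ ] Σ[ F' ∈ ℕ ] Inv Γ (merge x y r' R' F') ×
    (1 + 6 * when Y.mort (Y.R₀ ∸ ν') + 40 * bits ℓ + 12 * when X.mort (X.R₀ ⊔ bits ℓ) + value (merge x y r' R' F') + 3 * Y.ν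
      ≤ value x + value y + 3 * ν' + 18 * when Y.mort g)
  link-real h₁ hr' = R' , F' , merged-inv R' F' fund' p₁ p₂ p₃ , total
    where
    ν' = Y.R₀ ⊓ (bits ℓ ∸ 1)
    -- The part of the loser's new class that its reserve does not cover; `res₃` guarantees that the
    -- fund can supply it.
    u = when X.mort (bits ℓ₀ ∸ X.R)
    R' = Y.R + g + e + h
    F' = (X.F + Y.F ∸ u) + h

    top₁ : ℓ₀ ≤ (X.a ⊔ X.b) ∸ X.r
    top₁ = subst (λ v → (Y.r ⊓ v) ∸ X.r ≤ (X.a ⊔ X.b) ∸ X.r) adj (linear 4 (λ a b r s → mn s b ⊖ r ≲ mx a b ⊖ r) X.a X.b X.r Y.r)

    u≤F : u ≤ X.F
    u≤F with X.mort in eq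
    ... | false = z≤n
    ... | true = m≤n+o⇒m∸n≤o (bits ℓ₀) X.R (≤-trans (bits-mono top₁) (≤-trans (IX.res₃ eq) (≤-reflexive (+-comm X.F X.R))))

    u≤ℓ : u ≤ bits ((Y.r ⊓ X.b) ∸ X.r) ∸ bits ((X.a ⊓ X.b) ∸ X.r)
    u≤ℓ with X.mort in eq
    ... | false = z≤n
    ... | true = ∸-mono (≤-reflexive (cong (λ v → bits ((Y.r ⊓ v) ∸ X.r)) (sym adj))) (IX.res₂ eq)

    fund' : Fund X.a Y.b r' F'
    fund' = fund-merge X.a X.b Y.b X.r Y.r r' h₁ h₂ IX.fund fundY u≤F u≤ℓ

    p₁ : Y.mort ≡ true → Y.R₀ + (r' ∸ Y.o) ≤ R'
    p₁ m = linear 8 (λ R₀ o r R r' e h g → R₀ ⊕ (r ⊖ o) ≲ R ⇒ o ≲ r ⇒ r ≲ r' ⇒ R₀ ⊕ (r' ⊖ o) ≲ R ⊕ (r' ⊖ r) ⊕ e ⊕ h)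
             Y.R₀ Y.o Y.r Y.R r' e h 0 (IY.res₁ m) IY.o≤r h₂

    p₂ : Y.mort ≡ true → bits ((X.a ⊓ Y.b) ∸ r') ≤ R'
    p₂ m = ≤-trans (low-merge X.a X.b Y.b X.r Y.r r' h₁ h₂ {Y.R} (subst (λ v → bits ((v ⊓ Y.b) ∸ Y.r) ≤ Y.R) (sym adj) (IY.res₂ m)))
             (+-monoˡ-≤ h (≤-trans (m≤m+n Y.R g) (m≤m+n (Y.R + g) e)))

    p₃ : Y.mort ≡ true → bits ((X.a ⊔ Y.b) ∸ r') ≤ F' + R'
    p₃ m = high-merge X.a X.b Y.b X.r Y.r r' h₁ h₂ {X.F} {Y.F} {F'} {Y.R} {R'} IX.fund
             (subst (λ v → bits ((v ⊓ Y.b) ∸ Y.r) ≤ Y.R) (sym adj) (IY.res₂ m))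
             (subst (λ v → bits ((v ⊔ Y.b) ∸ Y.r) ≤ Y.F + Y.R) (sym adj) (IY.res₃ m))
             (linear 4 (λ x y u h → u ≲ x ⇒ y ≲ (x ⊕ y ⊖ u) ⊕ h) X.F Y.F u h u≤F)
             (λ b≤a → ≤-trans (≤-reflexive (cong (X.F + Y.F ∸_) (sym (u0 b≤a)))) (m≤m+n (X.F + Y.F ∸ u) h))
             (linear 4 (λ R g e h → R ≲ R ⊕ g ⊕ e ⊕ h) Y.R g e h)
             (subst (λ v → r' ∸ v ≤ R') (sym adj)
               (linear 7 (λ R₀ o r R r' a h → R₀ ⊕ (r ⊖ o) ≲ R ⇒ o ≲ r ⇒ r ≲ r' ⇒ r' ⊖ a ≲ R ⊕ (r' ⊖ r) ⊕ (o ⊖ a) ⊕ h)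
                 Y.R₀ Y.o Y.r Y.R r' Y.a h (IY.res₁ m) IY.o≤r h₂))
      where
      u0 : X.b ≤ X.a → u ≡ 0
      u0 b≤a = n≤0⇒n≡0 (≤-trans u≤ℓ (≤-reflexive (m≤n⇒m∸n≡0 (bits-mono
                 (linear 4 (λ a b r s → b ≲ a ⇒ mn s b ⊖ r ≲ mn a b ⊖ r) X.a X.b X.r Y.r b≤a)))))

    ℓ-bits : bits ℓ ≤ bits ℓ₀ + e
    ℓ-bits = ≤-trans (bits-sub ℓ₀ e ℓ≤) (+-monoʳ-≤ (bits ℓ₀) (bits≤n e))

    sentinel : when X.mort (X.R₀ ⊔ bits ℓ) ≤ when X.mort X.R + u + e
    sentinel with X.mort in eq
    ... | false = z≤n
    ... | true = linear 5 (λ R₀ bl b₀ R e → R₀ ≲ R ⇒ bl ≲ b₀ ⊕ e ⇒ mx R₀ bl ≲ R ⊕ (b₀ ⊖ R) ⊕ e)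
                   X.R₀ (bits ℓ) (bits ℓ₀) X.R e (m+n≤o⇒m≤o X.R₀ (IX.res₁ eq)) ℓ-bits

    reserve : when Y.mort R' ≤ when Y.mort Y.R + when Y.mort g + (e + h)
    reserve with Y.mort
    ... | false = z≤n
    ... | true = ≤-reflexive (+-assoc (Y.R + g) e h)

    jump : dist X.a Y.b + 2 * h ≤ dist X.a X.b + dist Y.a Y.b
    jump = subst (λ v → dist X.a Y.b + 2 * h ≤ dist X.a X.b + dist v Y.b) adj (dist-merge X.a X.b Y.b)

    pay : Σ[ D ∈ ℕ ] (bits ℓ + N X.a Y.b r' + D ≤ N X.a X.b X.r + N Y.a Y.b Y.r + e) ×
            (1 + 6 * when Y.mort (Y.R₀ ∸ ν') + 3 * Y.ν + credit Y.mort true Y.fr Y.R₀ Y.o r' ≤ credit Y.mort false Y.fr Y.R₀ Y.o Y.r + 3 * ν' + 40 * D + 6 * when Y.mort g)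
    -- If the gap lies above the winner's rank, the full gain is available. If the winner has
    -- outgrown it, the recorded level is capped and the credit pays. If the gap lies below the
    -- initial rank, then R₀ = 0, and one unit of credit together with the shortfall is enough.
    pay with Y.o ≤? Y.a | Y.r ≤? Y.a
    ... | yes o≤a | yes r≤a = proj₁ lg , subst₂ _≤_ (cong (λ v → bits v + N X.a Y.b r' + proj₁ lg) (sym ℓ≡))
              (cong (λ v → N X.a X.b X.r + N v Y.b Y.r + e) adj) (≤-trans (proj₁ (proj₂ lg)) (m≤m+n _ e)) ,
            subst (λ v → WinPay Y.mort {Y.o} {Y.a} {X.r} {Y.r} {r'} {Y.ν} Y.R₀ Y.fr (Y.R₀ ⊓ (bits v ∸ 1)) (proj₁ lg)) (sym ℓ≡)
              (win-gain Y.mort {Y.o} {Y.a} {X.r} {Y.r} {r'} {Y.ν} Y.R₀ Y.fr cl IY.ν≤ (IY.fresh unfl) r≤a hr'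
                (subst (λ v → Gain (v ∸ Y.r) (Y.r ∸ X.r) (proj₁ lg)) adj (proj₂ (proj₂ lg))))
      where
      lg = link-gain X.a X.b Y.b h₁ h₂ (subst (Y.r ≤_) (sym adj) r≤a)
      ℓ≡ : ℓ ≡ Y.r ∸ X.r
      ℓ≡ = linear 4 (λ o r a x → o ≲ r ⇒ r ≲ a ⇒ mx o (mn r a) ⊖ x ≐ r ⊖ x) Y.o Y.r Y.a X.r IY.o≤r r≤a
    ... | yes o≤a | no r≰a = 0 , weak ℓ≡ , win-weak Y.mort {Y.o} {Y.a} {X.r} {Y.r} {r'} {Y.ν} Y.R₀ Y.fr ν' cl IY.ν≤ (m⊓n≤m Y.R₀ _) (IY.fresh unfl) (≰⇒> r≰a)
      where
      ℓ≡ : ℓ ≤ ℓ₀ + 0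
      ℓ≡ = linear 4 (λ o r a x → o ≲ r ⇒ o ≲ a ⇒ mx o (mn r a) ⊖ x ≲ (mn r a ⊖ x) ⊕ # 0) Y.o Y.r Y.a X.r IY.o≤r o≤a
      weak : ℓ ≤ ℓ₀ + 0 → bits ℓ + N X.a Y.b r' + 0 ≤ N X.a X.b X.r + N Y.a Y.b Y.r + e
      weak q = subst (λ v → bits ℓ + N X.a Y.b r' + 0 ≤ N X.a X.b X.r + N v Y.b Y.r + e) adj
        (linear 5 (λ l l₀ n s e → l ≲ l₀ ⇒ l₀ ⊕ n ≲ s ⇒ l ⊕ n ⊕ # 0 ≲ s ⊕ e)
          (bits ℓ) (bits ((Y.r ⊓ X.b) ∸ X.r)) (N X.a Y.b r') (N X.a X.b X.r + N X.b Y.b Y.r) e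
          (bits-mono (≤-trans q (≤-reflexive (trans (+-identityʳ ℓ₀) (cong (λ v → (Y.r ⊓ v) ∸ X.r) (sym adj))))))
          (link-weak X.a X.b Y.b h₁ h₂))
    ... | no o≰a | _ = 0 , weak , exempt
      where
      R₀0 : Y.R₀ ≡ 0
      R₀0 = n≤0⇒n≡0 (≤-trans cl (≤-reflexive (trans (cong bits (m≤n⇒m∸n≡0 (≰⇒≥ o≰a))) bits0)))
      weak : bits ℓ + N X.a Y.b r' + 0 ≤ N X.a X.b X.r + N Y.a Y.b Y.r + e
      weak = subst (λ v → bits ℓ + N X.a Y.b r' + 0 ≤ N X.a X.b X.r + N v Y.b Y.r + e) adj
        (linear 5 (λ l l₀ n s e → l ≲ l₀ ⊕ e ⇒ l₀ ⊕ n ≲ s ⇒ l ⊕ n ⊕ # 0 ≲ s ⊕ e)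
          (bits ℓ) (bits ((Y.r ⊓ X.b) ∸ X.r)) (N X.a Y.b r') (N X.a X.b X.r + N X.b Y.b Y.r) e
          (≤-trans ℓ-bits (≤-reflexive (cong (λ v → bits ((Y.r ⊓ v) ∸ X.r) + e) (sym adj))))
          (link-weak X.a X.b Y.b h₁ h₂))
      exempt : 1 + 6 * when Y.mort (Y.R₀ ∸ ν') + 3 * Y.ν + credit Y.mort true Y.fr Y.R₀ Y.o r' ≤ credit Y.mort false Y.fr Y.R₀ Y.o Y.r + 3 * ν' + 40 * 0 + 6 * when Y.mort g
      exempt = subst (λ R₀ → Y.ν ≤ R₀ ∸ 1 → 1 + 6 * when Y.mort (R₀ ∸ (R₀ ⊓ (bits ℓ ∸ 1))) + 3 * Y.ν + credit Y.mort true Y.fr R₀ Y.o r' ≤ credit Y.mort false Y.fr R₀ Y.o Y.r + 3 * (R₀ ⊓ (bits ℓ ∸ 1)) + 40 * 0 + 6 * when Y.mort g)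
                 (sym R₀0) (λ q → linear 4 (λ ν f w g → ν ≲ # 0 ⇒ w ≲ # 0 ⇒ # 1 ⊕ 6 ⊛ w ⊕ 3 ⊛ ν ⊕ f ≲ (# 1 ⊕ f) ⊕ # 0 ⊕ # 0 ⊕ g) Y.ν (unless Y.fr 1) (when Y.mort 0) (6 * when Y.mort g) q (when-≤ Y.mort 0)) IY.ν≤

    total : 1 + 6 * when Y.mort (Y.R₀ ∸ ν') + 40 * bits ℓ + 12 * when X.mort (X.R₀ ⊔ bits ℓ) + value (merge x y r' R' F') + 3 * Y.ν
              ≤ value x + value y + 3 * ν' + 18 * when Y.mort g
    total = assemble (over-y) (proj₁ (proj₂ pay)) (proj₂ (proj₂ pay))
      where
      D = proj₁ pay
      q = unless Y.fr (Y.o ∸ Y.b)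
      assemble : over y ≡ e + q → bits ℓ + N X.a Y.b r' + D ≤ N X.a X.b X.r + N Y.a Y.b Y.r + e →
        1 + 6 * when Y.mort (Y.R₀ ∸ ν') + 3 * Y.ν + credit Y.mort true Y.fr Y.R₀ Y.o r' ≤ credit Y.mort false Y.fr Y.R₀ Y.o Y.r + 3 * ν' + 40 * D + 6 * when Y.mort g →
        1 + 6 * when Y.mort (Y.R₀ ∸ ν') + 40 * bits ℓ + 12 * when X.mort (X.R₀ ⊔ bits ℓ) + value (merge x y r' R' F') + 3 * Y.ν
              ≤ value x + value y + 3 * ν' + 18 * when Y.mort g
      assemble oy n w = subst (λ w → LHS ≤ value x + w + 3 * ν' + 18 * when Y.mort g)
          (cong₂ (λ o c → 40 * N Y.a Y.b Y.r + 12 * when Y.mort Y.R + 12 * Y.F + 12 * dist Y.a Y.b + 64 * o + c) (sym oy)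
            (cong (λ f → credit Y.mort f Y.fr Y.R₀ Y.o Y.r) (sym unfl))) step₁
        where
        LHS = 1 + 6 * when Y.mort (Y.R₀ ∸ ν') + 40 * bits ℓ + 12 * when X.mort (X.R₀ ⊔ bits ℓ) + value (merge x y r' R' F') + 3 * Y.ν
        step₁ : 1 + 6 * when Y.mort (Y.R₀ ∸ ν') + 40 * bits ℓ + 12 * when X.mort (X.R₀ ⊔ bits ℓ) + value (merge x y r' R' F') + 3 * Y.ν
              ≤ ((40 * N X.a X.b X.r + 12 * when X.mort X.R + 12 * X.F + 12 * dist X.a X.b + 64 * over x) + credit X.mort X.fl X.fr X.R₀ X.o X.r) + (40 * N Y.a Y.b Y.r + 12 * when Y.mort Y.R + 12 * Y.F + 12 * dist Y.a Y.b + 64 * (e + q) + credit Y.mort false Y.fr Y.R₀ Y.o Y.r) + 3 * ν' + 18 * when Y.mort g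
        step₁ = linear 29 (λ Rν bl s n' R' F' d' q W' ν nx Rx Fx dx ox cx ny Ry Fy dy e Wy ν' g h u D f _ →
            bl ⊕ n' ⊕ D ≲ nx ⊕ ny ⊕ e ⇒ # 1 ⊕ 6 ⊛ Rν ⊕ 3 ⊛ ν ⊕ W' ≲ Wy ⊕ 3 ⊛ ν' ⊕ 40 ⊛ D ⊕ 6 ⊛ g ⇒
            s ≲ Rx ⊕ u ⊕ e ⇒ R' ≲ Ry ⊕ g ⊕ (e ⊕ h) ⇒ F' ⊕ u ≲ Fx ⊕ Fy ⊕ h ⇒ d' ⊕ 2 ⊛ h ≲ dx ⊕ dy ⇒
            # 1 ⊕ 6 ⊛ Rν ⊕ 40 ⊛ bl ⊕ 12 ⊛ s ⊕ (40 ⊛ n' ⊕ 12 ⊛ R' ⊕ 12 ⊛ F' ⊕ 12 ⊛ d' ⊕ 64 ⊛ q ⊕ W') ⊕ 3 ⊛ ν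
            ≲ ((40 ⊛ nx ⊕ 12 ⊛ Rx ⊕ 12 ⊛ Fx ⊕ 12 ⊛ dx ⊕ 64 ⊛ ox) ⊕ cx) ⊕ (40 ⊛ ny ⊕ 12 ⊛ Ry ⊕ 12 ⊛ Fy ⊕ 12 ⊛ dy ⊕ 64 ⊛ (e ⊕ q) ⊕ Wy) ⊕ 3 ⊛ ν' ⊕ 18 ⊛ g)
          (when Y.mort (Y.R₀ ∸ ν')) (bits ℓ) (when X.mort (X.R₀ ⊔ bits ℓ)) (N X.a Y.b r') (when Y.mort R') F' (dist X.a Y.b) q (credit Y.mort true Y.fr Y.R₀ Y.o r') Y.ν
          (N X.a X.b X.r) (when X.mort X.R) X.F (dist X.a X.b) (over x) (credit X.mort X.fl X.fr X.R₀ X.o X.r)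
          (N Y.a Y.b Y.r) (when Y.mort Y.R) Y.F (dist Y.a Y.b) e (credit Y.mort false Y.fr Y.R₀ Y.o Y.r) ν' (when Y.mort g) h u D 0 0
          n w sentinel reserve
          (linear 4 (λ x y u h → u ≲ x ⇒ ((x ⊕ y ⊖ u) ⊕ h) ⊕ u ≲ x ⊕ y ⊕ h) X.F Y.F u h u≤F) jump

  -- A phantom link leaves the winner with an arbitrary jump between its
  -- levels; it pays O(Γ).
  link-phantom :
    Σ[ R' ∈ ℕ ] Σ[ F' ∈ ℕ ] Inv Γ (merge x y r' R' F') ×
    (1 + 6 * Y.R₀ + 12 * when X.mort X.R₀ + value (merge x y r' R' F') + 3 * Y.ν
      ≤ value x + value y + 18 * when Y.mort g + (200 * Γ + 20))
  link-phantom = R' , F' , merged-inv R' F' (≤-trans (bits-mono (m∸n≤m (X.a ⊔ Y.b) ((X.a ⊓ Y.b) ⊔ r'))) (≤-trans tp (m≤m+n Γ _))) p₁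
      (λ _ → ≤-trans (bits-mono (≤-trans (m∸n≤m (X.a ⊓ Y.b) r') (≤-trans (m⊓n≤m X.a Y.b) (m≤m⊔n X.a Y.b)))) (≤-trans tp (m≤n+m Γ (Y.R + g))))
      (λ _ → ≤-trans (bits-mono (m∸n≤m (X.a ⊔ Y.b) r')) (≤-trans tp (m≤m+n Γ _))) , total
    where
    -- All levels have bit length at most Γ, so adding Γ to the reserve and setting the fund to Γ
    -- restores every bound, whatever the new jump is.
    R' = Y.R + g + Γ
    F' = Γ
    tp : bits (X.a ⊔ Y.b) ≤ Γ
    tp = mx-bits X.a Y.b IX.a≤Γ IY.b≤Γ
    p₁ : Y.mort ≡ true → Y.R₀ + (r' ∸ Y.o) ≤ R'
    p₁ m = linear 6 (λ R₀ o r R r' G → R₀ ⊕ (r ⊖ o) ≲ R ⇒ o ≲ r ⇒ r ≲ r' ⇒ R₀ ⊕ (r' ⊖ o) ≲ R ⊕ (r' ⊖ r) ⊕ G)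
             Y.R₀ Y.o Y.r Y.R r' Γ (IY.res₁ m) IY.o≤r h₂
    n' : N X.a Y.b r' ≤ 2 * Γ
    n' = ≤-trans (+-mono-≤ (≤-trans (bits-mono (≤-trans (m⊓n≤m _ _) (≤-trans (m∸n≤m X.a r') (m≤m⊔n X.a Y.b)))) tp)
                   (≤-trans (bits-mono (linear 3 (λ a b r → dst (a ⊖ r) (b ⊖ r) ≲ mx a b) X.a Y.b r')) tp))
           (linear 1 (λ G → G ⊕ G ≲ 2 ⊛ G) Γ)
    cr : credit Y.mort true Y.fr Y.R₀ Y.o r' ≤ 8 + 9 * Γ
    cr = by Y.R₀ Y.fr IY.R₀≤Γ
      where
      by : ∀ R fr → R ≤ Γ → credit Y.mort true fr R Y.o r' ≤ 8 + 9 * Γ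
      by zero true _ = z≤n
      by zero false _ = s≤s z≤n
      by (suc R) true _ = z≤n
      by (suc R) false q = +-mono-≤ (+-monoʳ-≤ 2 (≤-trans (when-≤ Y.mort _) (*-monoʳ-≤ 6 (m⊓n≤m 1 (r' ∸ Y.o)))))
        (≤-trans (if-≤ (suc (suc Y.o)) r' (9 * suc R)) (*-monoʳ-≤ 9 q))
    keepR : when X.mort X.R₀ ≤ when X.mort X.R
    keepR with X.mort in eq
    ... | false = z≤n
    ... | true = m+n≤o⇒m≤o X.R₀ (IX.res₁ eq)
    reserve : when Y.mort R' ≤ when Y.mort Y.R + when Y.mort g + Γ
    reserve with Y.mort
    ... | false = z≤n
    ... | true = ≤-refl
    jump : dist X.a Y.b ≤ dist X.a X.b + dist Y.a Y.b
    jump = subst (λ v → dist X.a Y.b ≤ dist X.a X.b + dist v Y.b) adj (m+n≤o⇒m≤o (dist X.a Y.b) (dist-merge X.a X.b Y.b))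
    total : 1 + 6 * Y.R₀ + 12 * when X.mort X.R₀ + value (merge x y r' R' F') + 3 * Y.ν
      ≤ value x + value y + 18 * when Y.mort g + (200 * Γ + 20)
    total = linear 24 (λ R₀ sx n' R' G d' q W' ν nx Rx Fx dx ox cx ny Ry Fy dy oy Wy g _ _ →
            R₀ ≲ G ⇒ ν ≲ R₀ ⊖ # 1 ⇒ n' ≲ 2 ⊛ G ⇒ W' ≲ # 8 ⊕ 9 ⊛ G ⇒ sx ≲ Rx ⇒ R' ≲ Ry ⊕ g ⊕ G ⇒ d' ≲ dx ⊕ dy ⇒ q ≲ oy ⇒
            # 1 ⊕ 6 ⊛ R₀ ⊕ 12 ⊛ sx ⊕ (40 ⊛ n' ⊕ 12 ⊛ R' ⊕ 12 ⊛ G ⊕ 12 ⊛ d' ⊕ 64 ⊛ q ⊕ W') ⊕ 3 ⊛ ν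
            ≲ (40 ⊛ nx ⊕ 12 ⊛ Rx ⊕ 12 ⊛ Fx ⊕ 12 ⊛ dx ⊕ 64 ⊛ ox ⊕ cx) ⊕ (40 ⊛ ny ⊕ 12 ⊛ Ry ⊕ 12 ⊛ Fy ⊕ 12 ⊛ dy ⊕ 64 ⊛ oy ⊕ Wy) ⊕ 18 ⊛ g ⊕ (200 ⊛ G ⊕ # 20))
          Y.R₀ (when X.mort X.R₀) (N X.a Y.b r') (when Y.mort R') Γ (dist X.a Y.b) (unless Y.fr (Y.o ∸ Y.b)) (credit Y.mort true Y.fr Y.R₀ Y.o r') Y.ν
          (N X.a X.b X.r) (when X.mort X.R) X.F (dist X.a X.b) (over x) (credit X.mort X.fl X.fr X.R₀ X.o X.r)
          (N Y.a Y.b Y.r) (when Y.mort Y.R) Y.F (dist Y.a Y.b) (over y) (credit Y.mort Y.fl Y.fr Y.R₀ Y.o Y.r) (when Y.mort g) 0 0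
          IY.R₀≤Γ IY.ν≤ n' cr keepR reserve jump (≤-trans (m≤n+m _ e) (≤-reflexive (sym over-y)))

-- Logarithms and the charges

⌈log₂⌉-bound : ∀ c n → ⌈log₂ n ⌉ ≤ c → n ≤ 2 ^ c
⌈log₂⌉-bound zero zero _ = z≤n
⌈log₂⌉-bound zero (suc zero) _ = s≤s z≤n
⌈log₂⌉-bound zero (suc (suc n)) h = ⊥-elim (<⇒≱ (s≤s z≤n) (≤-trans (⌈log₂⌉-mono-≤ {2} {suc (suc n)} (s≤s (s≤s z≤n))) h))
⌈log₂⌉-bound (suc c) n h = linear 4 (λ n f g p → f ⊕ g ≐ n ⇒ f ≲ g ⇒ g ≲ p ⇒ n ≲ 2 ⊛ p) n ⌊ n /2⌋ ⌈ n /2⌉ (2 ^ c)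
  (⌊n/2⌋+⌈n/2⌉≡n n) (⌊n/2⌋≤⌈n/2⌉ n) (⌈log₂⌉-bound c ⌈ n /2⌉ (≤-trans (≤-reflexive (⌈log₂⌈n/2⌉⌉≡⌈log₂n⌉∸1 n)) (∸-monoˡ-≤ 1 h)))

⌊log₂⌋-bound : ∀ k m → 1 ≤ m → k ≤ ⌊log₂ m ⌋ → 2 ^ k ≤ m
⌊log₂⌋-bound zero m h _ = h
⌊log₂⌋-bound (suc k) (suc zero) h ()
⌊log₂⌋-bound (suc k) m@(suc (suc m')) h q = linear 4 (λ p f g m → p ≲ f ⇒ f ≲ g ⇒ f ⊕ g ≐ m ⇒ 2 ⊛ p ≲ m) (2 ^ k) ⌊ m /2⌋ ⌈ m /2⌉ m
  (⌊log₂⌋-bound k ⌊ m /2⌋ (s≤s z≤n) (≤-trans (∸-monoˡ-≤ 1 q) (≤-reflexive (sym (⌊log₂⌊n/2⌋⌋≡⌊log₂n⌋∸1 m)))))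
  (⌊n/2⌋≤⌈n/2⌉ m) (⌊n/2⌋+⌈n/2⌉≡n m)

bits-2^ : ∀ k → bits (2 ^ k) ≡ suc k
bits-2^ zero = bits1
bits-2^ (suc k) = trans (bits-double (2 ^ k) {{m^n≢0 2 k}}) (cong suc (bits-2^ k))

n<2^bits : ∀ n → n < 2 ^ bits n
n<2^bits n with n <? 2 ^ bits n
... | yes h = h
... | no h = ⊥-elim (<⇒≱ (n<1+n (bits n)) (≤-trans (≤-reflexive (sym (bits-2^ (bits n)))) (bits-mono (≮⇒≥ h))))

2^bits≤ : ∀ n → 1 ≤ n → 2 ^ bits n ≤ 2 * n
2^bits≤ n h = ⌊log₂⌋-bound (bits n) (2 * n) (≤-trans h (m≤m+n n _)) (≤-reflexive (bits-def n))

⌈log₂⌉≤bits : ∀ n → ⌈log₂ n ⌉ ≤ bits n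
⌈log₂⌉≤bits n = ≤-trans (⌈log₂⌉-mono-≤ (<⇒≤ (n<2^bits n))) (≤-reflexive (⌈log₂2^n⌉≡n (bits n)))

bits≤⌈log₂⌉ : ∀ n → bits n ≤ chargeDel n
bits≤⌈log₂⌉ n = ≤-trans (bits-mono (⌈log₂⌉-bound ⌈log₂ n ⌉ n ≤-refl)) (≤-reflexive (bits-2^ ⌈log₂ n ⌉))

bits-suc : ∀ n → bits (suc n) ≤ suc (bits n)
bits-suc n = ≤-trans (bits-+ 1 n) (≤-reflexive (cong (_+ bits n) bits1))

Λ : ℕ → ℕ
Λ n = suc (bits (bits n))

Λ-mono : ∀ {m n} → m ≤ n → Λ m ≤ Λ n
Λ-mono h = s≤s (bits-mono (bits-mono h))

Λ≤chargeDK : ∀ n → Λ n ≤ 4 * chargeDK n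
Λ≤chargeDK n = linear 5 (λ b a c l k → b ≲ a ⇒ a ≲ # 1 ⊕ c ⇒ c ≲ # 1 ⊕ l ⇒ # 1 ⊕ b ≲ 4 ⊛ mx (# 1) l)
  (bits (bits n)) (bits (suc ⌈log₂ n ⌉)) (bits ⌈log₂ n ⌉) ⌈log₂ ⌈log₂ n ⌉ ⌉ 0
  (bits-mono (bits≤⌈log₂⌉ n)) (bits-suc ⌈log₂ n ⌉) (bits≤⌈log₂⌉ ⌈log₂ n ⌉)

Λ≤chargeDel : ∀ n → Λ n ≤ 1 + chargeDel n
Λ≤chargeDel n = s≤s (≤-trans (bits≤n (bits n)) (bits≤⌈log₂⌉ n))

Λ-double : ∀ n k → k ≤ n + n → Λ k ≤ suc (Λ n)
Λ-double zero k h = ≤-trans (Λ-mono h) (n≤1+n _)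
Λ-double n@(suc _) k h = s≤s (≤-trans (bits-mono (≤-trans (bits-mono (≤-trans h (≤-reflexive (cong (n +_) (sym (+-identityʳ n)))))) (≤-reflexive (bits-double n)))) (bits-suc (bits n)))

-- Debt for phantom edges

-- The debt allowed to u phantom edges among n nodes.
G : ℕ → ℕ → ℕ
G n zero = 0
-- With equal summands Λ n, one deletion at which Λ drops would remove a unit from all u of them.
-- With shifted arguments a change of n affects only the two end terms.
G n (suc u) = G n u + Λ (n + suc u)

G-step : ∀ n u q → G n u + q * Λ n ≤ G n (u + q)
G-step n u zero = ≤-reflexive (trans (+-identityʳ _) (cong (G n) (sym (+-identityʳ u))))
G-step n u (suc q) = subst (λ z → G n u + suc q * Λ n ≤ G n z) (sym (+-suc u q))
  (linear 5 (λ g q l g' l' → g ⊕ q ≲ g' ⇒ l ≲ l' ⇒ g ⊕ (l ⊕ q) ≲ g' ⊕ l') (G n u) (q * Λ n) (Λ n) (G n (u + q)) (Λ (n + suc (u + q))) (G-step n u q) (Λ-mono (m≤m+n n _)))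

G-mono : ∀ {n n'} u → n ≤ n' → G n u ≤ G n' u
G-mono zero h = z≤n
G-mono (suc u) h = +-mono-≤ (G-mono u h) (Λ-mono (+-monoˡ-≤ (suc u) h))

G-monoᵘ : ∀ n {u u'} → u ≤ u' → G n u ≤ G n u'
G-monoᵘ n {u} {u'} h = ≤-trans (m≤m+n _ _) (≤-trans (G-step n u (u' ∸ u)) (≤-reflexive (cong (G n) (m+[n∸m]≡n h))))

-- Both sides add up the values of Λ from n + 1 to n + u + 1.
G-shift : ∀ n u → G (suc n) u + Λ (suc n) ≡ G n u + Λ (suc (n + u))
G-shift n zero = cong (λ z → Λ (suc z)) (sym (+-identityʳ n))
G-shift n (suc u) = trans
  (linear 5 (λ g l l₁ g₀ l₀ → g ⊕ l ≐ g₀ ⊕ l₀ ⇒ (g ⊕ l₁) ⊕ l ≐ (g₀ ⊕ l₀) ⊕ l₁) (G (suc n) u) (Λ (suc n)) (Λ (suc n + suc u)) (G n u) (Λ (suc (n + u))) (G-shift n u))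
  (cong (λ z → G n u + Λ z + Λ (suc n + suc u)) (sym (+-suc n u)))

-- By `G-shift` the two debts differ by end terms whose arguments are within a factor of two, and
-- doubling the argument raises Λ by at most one.
G-pred : ∀ n u → u ≤ suc n → G (suc n) u ≤ suc (G n u)
G-pred n u h = linear 4 (λ g l g₀ l₀ → g ⊕ l ≐ g₀ ⊕ l₀ ⇒ l₀ ≲ # 1 ⊕ l ⇒ g ≲ # 1 ⊕ g₀) (G (suc n) u) (Λ (suc n)) (G n u) (Λ (suc (n + u))) (G-shift n u)
  (Λ-double (suc n) (suc (n + u)) (s≤s (+-monoʳ-≤ n h)))

G-two : ∀ n u → u ≤ n → 1 ≤ n → G n (u + 2) ≤ G n u + (2 * Λ n + 4)
G-two n u h p = ≤-trans (≤-reflexive (cong (G n) (+-comm u 2)))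
  (linear 4 (λ g a b l → a ≲ # 2 ⊕ l ⇒ b ≲ # 2 ⊕ l ⇒ (g ⊕ a) ⊕ b ≲ g ⊕ (2 ⊛ l ⊕ # 4)) (G n u) (Λ (n + suc u)) (Λ (n + suc (suc u))) (Λ n) (by 1 (s≤s z≤n)) (by 2 ≤-refl))
  where
  by : ∀ i → i ≤ 2 → Λ (n + (i + u)) ≤ 2 + Λ n
  by i q = ≤-trans (Λ-double (n + n) (n + (i + u)) (linear 3 (λ n i u → i ≲ # 2 ⇒ u ≲ n ⇒ # 1 ≲ n ⇒ n ⊕ (i ⊕ u) ≲ (n ⊕ n) ⊕ (n ⊕ n)) n i u q h p)) (s≤s (Λ-double n (n + n) ≤-refl))

-- Cost of sorting

-- Pays for sorting a buffer of size b.
Sort : ℕ → ℕ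
Sort zero = 0
Sort (suc b) = Sort b + (3 + bits (suc b))

-- Each time the bit length rises, all earlier summands of `Sort` become one too small. The deficit
-- is a geometric sum of powers of two, hence at most 2 * b for positive b; this is why the summands
-- start from 3 and not from 1.
Sort-bits : ∀ b → b * (3 + bits b) ≤ Sort b + 2 ^ bits b
Sort-bits zero = z≤n
Sort-bits (suc b) with bits (suc b) ≟ bits b
... | yes e = subst (λ k → suc b * (3 + k) ≤ Sort b + (3 + k) + 2 ^ k) (sym e)
  (linear 4 (λ m t p k → m ≲ t ⊕ p ⇒ (k ⊕ m) ≲ (t ⊕ k) ⊕ p) (b * (3 + bits b)) (Sort b) (2 ^ bits b) (3 + bits b) (Sort-bits b))
... | no ne = subst (λ k → suc b * (3 + k) ≤ Sort b + (3 + k) + 2 ^ k) (sym e)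
  (subst (λ z → (3 + suc k) + z ≤ Sort b + (3 + suc k) + (2 ^ k + (2 ^ k + 0))) (sym (trans (cong (b *_) (+-suc 3 k)) (*-suc b (3 + k))))
    (linear 5 (λ m t p k b → m ≲ t ⊕ p ⇒ b ≲ p ⇒ k ⊕ (b ⊕ m) ≲ (t ⊕ k) ⊕ (p ⊕ (p ⊕ # 0))) (b * (3 + k)) (Sort b) (2 ^ k) (3 + suc k) b (Sort-bits b) (<⇒≤ (n<2^bits b))))
  where
  k = bits b
  e : bits (suc b) ≡ suc k
  e = ≤-antisym (bits-suc b) (≤∧≢⇒< (bits-mono (n≤1+n b)) (λ q → ne (sym q)))

sortCost≤Sort : ∀ b → sortCost b ≤ Sort b
sortCost≤Sort zero = z≤n
sortCost≤Sort b@(suc _) = ≤-trans (*-monoʳ-≤ b (s≤s (⌈log₂⌉≤bits b)))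
  (linear 4 (λ m t p b → b ⊕ (b ⊕ m) ≲ t ⊕ p ⇒ p ≲ 2 ⊛ b ⇒ m ≲ t) (b * (1 + bits b)) (Sort b) (2 ^ bits b) b
    (≤-trans (≤-reflexive (trans (cong (b +_) (sym (*-suc b (1 + bits b)))) (sym (*-suc b (2 + bits b))))) (Sort-bits b)) (2^bits≤ b (s≤s z≤n)))

-- Labelled lists of children

-- Label of the edge to a child: whether it hangs left of the children that
-- were there before it, the rank ρ of its parent when it was linked, its
-- charge ν, and the mass m it contributes to its parent.
record Lab : Set where
  constructor lab
  field
    isLeft : Bool
    ρ ν m : ℕ

-- A child whose rank is not below its level starts a round with gaps that may lie below its rank.
-- The excess measures this shortfall, and the round pays 130 for each unit.
excess : List Lab → ℕ
excess [] = 0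
excess (lab _ ρ _ m ∷ fs) = (suc (bits m) ∸ ρ) + excess fs

-- Chosen generously: the most expensive operations, decrease-key with an emptied buffer and
-- deletion of a root, use less than 13000 per unit of charge.
K : ℕ
K = 20000

-- Along the children the levels ρ fall and then rise.
data Asc (top : ℕ) : ℕ → List Lab → Set where
  [] : ∀ {lo} → Asc top lo []
  right : ∀ {lo ρ ν m fs} → lo ≤ ρ → ρ ≤ top → Asc top ρ fs → Asc top lo (lab false ρ ν m ∷ fs)

data Valley (top : ℕ) : ℕ → List Lab → Set where
  left : ∀ {hi ρ ν m fs} → ρ ≤ hi → Valley top ρ fs → Valley top hi (lab true ρ ν m ∷ fs)
  asc : ∀ {hi fs} → Asc top 0 fs → Valley top hi fs

V : ℕ → List Lab → Set
V top fs = Valley top top fs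

asc-mono : ∀ {top top' lo fs} → top ≤ top' → Asc top lo fs → Asc top' lo fs
asc-mono h [] = []
asc-mono h (right p q a) = right p (≤-trans q h) (asc-mono h a)

valley-mono : ∀ {top top' hi hi' fs} → top ≤ top' → hi ≤ hi' → Valley top hi fs → Valley top' hi' fs
valley-mono h k (left p v) = left (≤-trans p k) (valley-mono h ≤-refl v)
valley-mono h k (asc a) = asc (asc-mono h a)

V-mono : ∀ {top top' fs} → top ≤ top' → V top fs → V top' fs
V-mono h = valley-mono h h

V-front : ∀ {top ρ ν m fs} → top ≤ ρ → V top fs → V ρ (lab true ρ ν m ∷ fs)
V-front h v = left ≤-refl (V-mono h v)

asc-back : ∀ {top lo ρ ν m fs} → top ≤ ρ → lo ≤ ρ → Asc top lo fs → Asc ρ lo (fs ++ lab false ρ ν m ∷ [])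
asc-back h l [] = right l ≤-refl []
asc-back h l (right p q a) = right p (≤-trans q h) (asc-back h (≤-trans q h) a)

valley-back : ∀ {top hi ρ ν m fs} → top ≤ ρ → Valley top hi fs → Valley ρ hi (fs ++ lab false ρ ν m ∷ [])
valley-back h (left p v) = left p (valley-back h v)
valley-back h (asc a) = asc (asc-back h z≤n a)

V-back : ∀ {top ρ ν m fs} → top ≤ ρ → V top fs → V ρ (fs ++ lab false ρ ν m ∷ [])
V-back h v = valley-mono ≤-refl h (valley-back h v)

asc-lower : ∀ {top lo lo' fs} → lo' ≤ lo → Asc top lo fs → Asc top lo' fs
asc-lower h [] = []
asc-lower h (right p q a) = right (≤-trans h p) q a

-- Positive variation of the charges outward from the centre, up to the
-- sentinel σ on both sides.
upA upD : ℕ → ℕ → List Lab → ℕ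
upA σ p [] = σ ∸ p
upA σ p (lab _ _ ν _ ∷ fs) = (ν ∸ p) + upA σ ν fs
upD σ p [] = 0
upD σ p (lab true _ ν _ ∷ fs) = (p ∸ ν) + upD σ ν fs
-- The step across the centre, from the innermost left child to the innermost right child, is left
-- out; in `tv-up` it is absorbed by the term with `bits top`.
upD σ p (lab false _ ν _ ∷ fs) = upA σ ν fs

up : ℕ → List Lab → ℕ
up σ fs = upD σ σ fs

upA-σ : ∀ σ τ p fs → upA τ p fs ≤ upA σ p fs + (τ ∸ σ)
upA-σ σ τ p [] = linear 3 (λ s t p → t ⊖ p ≲ (s ⊖ p) ⊕ (t ⊖ s)) σ τ p
upA-σ σ τ p (lab _ _ ν _ ∷ fs) = ≤-trans (+-monoʳ-≤ (ν ∸ p) (upA-σ σ τ ν fs)) (≤-reflexive (sym (+-assoc (ν ∸ p) _ _)))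

upD-σ : ∀ σ τ p fs → upD τ p fs ≤ upD σ p fs + (τ ∸ σ)
upD-σ σ τ p [] = z≤n
upD-σ σ τ p (lab true _ ν _ ∷ fs) = ≤-trans (+-monoʳ-≤ (p ∸ ν) (upD-σ σ τ ν fs)) (≤-reflexive (sym (+-assoc (p ∸ ν) _ _)))
upD-σ σ τ p (lab false _ ν _ ∷ fs) = upA-σ σ τ ν fs

upD-p : ∀ σ p q fs → upD σ p fs ≤ upD σ q fs + (p ∸ q)
upD-p σ p q [] = z≤n
upD-p σ p q (lab true _ ν _ ∷ fs) = linear 4 (λ p q n u → (p ⊖ n) ⊕ u ≲ ((q ⊖ n) ⊕ u) ⊕ (p ⊖ q)) p q ν (upD σ ν fs)
upD-p σ p q (lab false _ ν _ ∷ fs) = m≤m+n _ _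

upA-p : ∀ σ p q fs → upA σ p fs ≤ upA σ q fs + (q ∸ p)
upA-p σ p q [] = linear 3 (λ s p q → s ⊖ p ≲ (s ⊖ q) ⊕ (q ⊖ p)) σ p q
upA-p σ p q (lab _ _ ν _ ∷ fs) = linear 4 (λ p q n u → (n ⊖ p) ⊕ u ≲ ((n ⊖ q) ⊕ u) ⊕ (q ⊖ p)) p q ν (upA σ ν fs)

up-σ : ∀ σ τ fs → up τ fs ≤ up σ fs + 2 * (τ ∸ σ)
up-σ σ τ fs = ≤-trans (upD-p τ τ σ fs) (≤-trans (+-monoˡ-≤ (τ ∸ σ) (upD-σ σ τ σ fs))
  (linear 2 (λ u d → u ⊕ d ⊕ d ≲ u ⊕ 2 ⊛ d) (upD σ σ fs) (τ ∸ σ)))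

up-front : ∀ σ ρ ν m fs → ν ≤ σ → up σ (lab true ρ ν m ∷ fs) ≤ up σ fs + (σ ∸ ν)
up-front σ ρ ν m fs h = ≤-trans (+-monoʳ-≤ (σ ∸ ν) (upD-p σ ν σ fs))
  (linear 3 (λ s n u → n ≲ s ⇒ (s ⊖ n) ⊕ (u ⊕ (n ⊖ s)) ≲ u ⊕ (s ⊖ n)) σ ν (upD σ σ fs) h)

upA-back : ∀ σ p l ρ ν m fs → ν ≤ σ → upA σ p (fs ++ lab l ρ ν m ∷ []) ≤ upA σ p fs + (σ ∸ ν)
upA-back σ p l ρ ν m [] h = linear 3 (λ s n p → n ≲ s ⇒ (n ⊖ p) ⊕ (s ⊖ n) ≲ (s ⊖ p) ⊕ (s ⊖ n)) σ ν p h
upA-back σ p l ρ ν m (lab _ _ ν' _ ∷ fs) h = ≤-trans (+-monoʳ-≤ (ν' ∸ p) (upA-back σ ν' l ρ ν m fs h)) (≤-reflexive (sym (+-assoc (ν' ∸ p) _ _)))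

upD-back : ∀ σ p ρ ν m fs → ν ≤ σ → upD σ p (fs ++ lab false ρ ν m ∷ []) ≤ upD σ p fs + (σ ∸ ν)
upD-back σ p ρ ν m [] h = ≤-refl
upD-back σ p ρ ν m (lab true _ ν' _ ∷ fs) h = ≤-trans (+-monoʳ-≤ (p ∸ ν') (upD-back σ ν' ρ ν m fs h)) (≤-reflexive (sym (+-assoc (p ∸ ν') _ _)))
upD-back σ p ρ ν m (lab false _ ν' _ ∷ fs) h = upA-back σ ν' false ρ ν m fs h

excess-back : ∀ fs l ρ ν m → excess (fs ++ lab l ρ ν m ∷ []) ≡ (suc (bits m) ∸ ρ) + excess fs
excess-back [] l ρ ν m = refl
excess-back (lab _ ρ' _ m' ∷ fs) l ρ ν m = begin
  x + excess (fs ++ lab l ρ ν m ∷ []) ≡⟨ cong (x +_) (excess-back fs l ρ ν m) ⟩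
  x + (y + excess fs) ≡⟨ +-assoc x y _ ⟨
  x + y + excess fs ≡⟨ cong (_+ excess fs) (+-comm x y) ⟩
  y + x + excess fs ≡⟨ +-assoc y x _ ⟩
  y + (x + excess fs) ∎
  where
  open ≡-Reasoning
  x = suc (bits m') ∸ ρ'
  y = suc (bits m) ∸ ρ

data Sub : List Lab → List Lab → Set where
  same : ∀ {fs} → Sub fs fs
  drop : ∀ {f fs} → Sub (f ∷ fs) fs
  keep : ∀ {f fs fs'} → Sub fs fs' → Sub (f ∷ fs) (f ∷ fs')

sub-asc : ∀ {top lo fs fs'} → Sub fs fs' → Asc top lo fs → Asc top lo fs'
sub-asc same a = a
sub-asc drop (right p q a) = asc-lower p a
sub-asc (keep s) (right p q a) = right p q (sub-asc s a)

sub-valley : ∀ {top hi fs fs'} → Sub fs fs' → Valley top hi fs → Valley top hi fs'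
sub-valley same v = v
sub-valley drop (left p v) = valley-mono ≤-refl p v
sub-valley drop (asc (right p q a)) = asc (asc-lower z≤n a)
sub-valley (keep s) (left p v) = left p (sub-valley s v)
sub-valley (keep s) (asc a) = asc (sub-asc (keep s) a)

sub-excess : ∀ {fs fs'} → Sub fs fs' → excess fs' ≤ excess fs
sub-excess same = ≤-refl
sub-excess drop = m≤n+m _ _
sub-excess (keep s) = +-monoʳ-≤ _ (sub-excess s)

sub-upA : ∀ {fs fs'} σ p → Sub fs fs' → upA σ p fs' ≤ upA σ p fs
sub-upA σ p same = ≤-refl
sub-upA σ p (drop {lab _ _ ν _} {fs}) = ≤-trans (upA-p σ p ν fs) (≤-reflexive (+-comm (upA σ ν fs) _))
sub-upA σ p (keep {lab _ _ ν _} s) = +-monoʳ-≤ _ (sub-upA σ ν s)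

sub-upD : ∀ {top hi fs fs'} σ p → Valley top hi fs → Sub fs fs' → upD σ p fs' ≤ upD σ p fs
sub-upD σ p v same = ≤-refl
sub-upD σ p v (drop {lab true _ ν _} {fs}) = ≤-trans (upD-p σ p ν fs) (≤-reflexive (+-comm (upD σ ν fs) _))
sub-upD σ p (asc (right _ _ [])) (drop {lab false _ ν _} {[]}) = z≤n
sub-upD σ p (asc (right _ _ (right _ _ a))) (drop {lab false _ ν _} {lab false _ ν' _ ∷ fs}) = m≤n+m _ _
sub-upD σ p (left _ v) (keep {lab true _ ν _} s) = +-monoʳ-≤ _ (sub-upD σ ν v s)
sub-upD σ p (asc ()) (keep {lab true _ ν _} s)
sub-upD σ p v (keep {lab false _ ν _} s) = sub-upA σ ν s

-- Leaving out an intermediate value cannot increase a positive variation. The valley is used for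
-- the first right child: whatever follows it is again a right child, so the centre does not move.
sub-up : ∀ {top fs fs'} σ → V top fs → Sub fs fs' → up σ fs' ≤ up σ fs
sub-up σ v s = sub-upD σ σ v s

-- A child lighter than the rest raises the sum at least one bit above its own rank. A heavier one
-- raises the sum at least one bit above s and at least to its own rank; the factor 2 then absorbs
-- the extra unit. So excess is charged to the growth of the parent's rank.
excess-new : ∀ {o s m ρ} → 1 ≤ o → o ≤ bits s → o ≤ ρ → suc (bits m) ∸ ρ ≤ 2 * (bits (m + s) ∸ o)
excess-new {o} {s} {zero} {ρ} 1≤o h hρ = subst (λ z → suc z ∸ ρ ≤ 2 * (bits s ∸ o)) (sym bits0)
  (≤-trans (≤-reflexive (m≤n⇒m∸n≡0 (≤-trans 1≤o hρ))) z≤n)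
excess-new {o} {s} {m@(suc _)} {ρ} 1≤o h hρ with ≤-total m s
... | inj₁ p = linear 4 (λ bm r o B → o ≲ r ⇒ # 1 ⊕ bm ≲ B ⇒ (# 1 ⊕ bm) ⊖ r ≲ 2 ⊛ (B ⊖ o)) (bits m) ρ o (bits (m + s)) hρ (bits-grow (s≤s z≤n) p)
... | inj₂ p with s
...   | zero = linear 5 (λ bm r o B z → z ≲ # 0 ⇒ # 1 ≲ o ⇒ o ≲ z ⇒ o ≲ r ⇒ (# 1 ⊕ bm) ⊖ r ≲ 2 ⊛ (B ⊖ o)) (bits m) ρ o (bits (m + 0)) (bits 0) (≤-reflexive bits0) 1≤o h hρ
...   | suc s' = linear 5 (λ bm r o B bs → o ≲ r ⇒ o ≲ bs ⇒ # 1 ⊕ bs ≲ B ⇒ bm ≲ B ⇒ (# 1 ⊕ bm) ⊖ r ≲ 2 ⊛ (B ⊖ o)) (bits m) ρ o (bits (m + suc s')) (bits (suc s'))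
        hρ h (subst (λ z → suc (bits (suc s')) ≤ bits z) (+-comm (suc s') m) (bits-grow (s≤s z≤n) p)) (bits-mono (m≤m+n m (suc s')))

-- Marks, annotations and the potential of a tree

module Analysis (O : DecTotalOrder 0ℓ 0ℓ 0ℓ) where
  open Heaps O

  cnt : Tree → ℕ
  cnts : List Tree → ℕ
  cnt (node _ _ cs) = suc (cnts cs)
  cnts [] = 0
  cnts (t ∷ ts) = cnt t + cnts ts

  -- Marks depend on the rest of the run: a node is mortal if it will be deleted,
  -- and an edge carries the mass that is going to stay with the parent.
  data Mark : Tree → Set
  data Marks : List Tree → Set

  data Mark where
    mk : ∀ {i k cs} → Bool → Marks cs → Mark (node i k cs)

  data Marks where
    [] : Marks []
    edge : ∀ {t ts} (m : ℕ) → m ≤ cnt t → Mark t → Marks ts → Marks (t ∷ ts)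

  mass : ∀ {t} → Mark t → ℕ
  masses : ∀ {ts} → Marks ts → ℕ
  mass (mk _ ms) = suc (masses ms)
  masses [] = 0
  masses (edge m _ _ ms) = m + masses ms

  masses≤cnts : ∀ {ts} (ms : Marks ts) → masses ms ≤ cnts ts
  masses≤cnts [] = z≤n
  masses≤cnts (edge m p _ ms) = +-mono-≤ p (masses≤cnts ms)

  mass≤cnt : ∀ {t} (mt : Mark t) → mass mt ≤ cnt t
  mass≤cnt (mk _ ms) = s≤s (masses≤cnts ms)

  -- An edge is real if it carries the whole mass of its child, and phantom
  -- otherwise.
  phantom : ℕ → ℕ → ℕ
  phantom m s = if m ≡ᵇ s then 0 else 1

  phantomT : ∀ {t} → Mark t → ℕ
  phantomF : ∀ {ts} → Marks ts → ℕ
  phantomT (mk _ ms) = phantomF ms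
  phantomF [] = 0
  phantomF (edge m _ mt ms) = phantom m (mass mt) + phantomT mt + phantomF ms

  phantom≤1 : ∀ m s → phantom m s ≤ 1
  phantom≤1 m s with m ≡ᵇ s
  ... | true = z≤n
  ... | false = ≤-refl

  phantomT≤ : ∀ {t} (mt : Mark t) → suc (phantomT mt) ≤ cnt t
  phantomF≤ : ∀ {ts} (ms : Marks ts) → phantomF ms ≤ cnts ts
  phantomT≤ (mk _ ms) = s≤s (phantomF≤ ms)
  phantomF≤ [] = z≤n
  phantomF≤ (edge m _ mt ms) = +-mono-≤ (≤-trans (+-monoˡ-≤ _ (phantom≤1 m (mass mt))) (phantomT≤ mt)) (phantomF≤ ms)

  -- Annotations, which depend on the past.
  data Ann : ∀ {t} → Mark t → Set
  data Anns : ∀ {ts} → Marks ts → List Lab → Set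

  data Ann where
    ann : ∀ {i k cs b} {ms : Marks cs} {fs} → Anns ms fs → V (bits (suc (masses ms))) fs →
          excess fs ≤ 4 * bits (suc (masses ms)) → Ann (mk {i} {k} b ms)

  data Anns where
    [] : Anns [] []
    edge : ∀ {t ts m p} {mt : Mark t} {ms : Marks ts} {fs} (l : Bool) (ρ ν : ℕ) → ν ≤ bits (ρ ∸ bits m) ∸ 1 →
           Ann mt → Anns ms fs → Anns (edge m p mt ms) (lab l ρ ν m ∷ fs)

  -- Sentinel of a child: the class of its edge if that is real.
  sent : ℕ → ℕ → ℕ → ℕ
  sent ρ m s = if m ≡ᵇ s then bits (ρ ∸ bits m) else 0

  charge : ℕ → ℕ → ℕ → ℕ
  charge ν m s = if m ≡ᵇ s then 3 * ν else 0

  -- The potential of a tree is `pos` minus `neg`. The argument σ is the sentinel supplied by the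
  -- edge above, and is 0 at a root. The weight 40 of a class is the weight of N in `value`, so that
  -- the two can be exchanged at a link.
  pos : ∀ {t} {mt : Mark t} → ℕ → Ann mt → ℕ
  posF : ∀ {ts} {ms : Marks ts} {fs} → Anns ms fs → ℕ
  pos σ (ann {b = b} {fs = fs} af _ _) = 6 * when b (up σ fs) + posF af
  posF [] = 0
  posF (edge {m = m} {mt = mt} l ρ ν _ a af) = 40 * sent ρ m (mass mt) + pos (sent ρ m (mass mt)) a + posF af

  neg : ∀ {t} {mt : Mark t} → Ann mt → ℕ
  negF : ∀ {ts} {ms : Marks ts} {fs} → Anns ms fs → ℕ
  neg (ann {b = b} {ms = ms} af _ _) = 18 * when b (bits (suc (masses ms))) + negF af
  negF [] = 0
  negF (edge {m = m} {mt = mt} l ρ ν _ a af) = charge ν m (mass mt) + neg a + negF af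

  pos-σ : ∀ {t} {mt : Mark t} σ (a : Ann mt) → pos σ a ≤ pos 0 a + 12 * σ
  pos-σ σ (ann {b = true} {fs = fs} af _ _) = linear 4 (λ u u₀ p s → u ≲ u₀ ⊕ 2 ⊛ s ⇒ 6 ⊛ u ⊕ p ≲ (6 ⊛ u₀ ⊕ p) ⊕ 12 ⊛ s) (up σ fs) (up 0 fs) (posF af) σ (up-σ 0 σ fs)
  pos-σ σ (ann {b = false} af _ _) = m≤m+n _ _

  -- Hanging one more child below a node, in front of its children or behind
  -- them.
  record Ext {cs} (ms : Marks cs) {t} (m : ℕ) (mt : Mark t) (cs⁺ : List Tree) : Set where
    field
      ms⁺ : Marks cs⁺
      side : Bool
      ins : Lab → List Lab → List Lab
      masses⁺ : masses ms⁺ ≡ m + masses ms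
      phantom⁺ : phantomF ms⁺ ≡ phantom m (mass mt) + phantomT mt + phantomF ms
      V⁺ : ∀ {top ρ ν fs} → top ≤ ρ → V top fs → V ρ (ins (lab side ρ ν m) fs)
      up⁺ : ∀ σ ρ ν fs → ν ≤ σ → up σ (ins (lab side ρ ν m) fs) ≤ up σ fs + (σ ∸ ν)
      excess⁺ : ∀ ρ ν fs → excess (ins (lab side ρ ν m) fs) ≡ (suc (bits m) ∸ ρ) + excess fs
      anns⁺ : ∀ {fs} ρ ν → ν ≤ bits (ρ ∸ bits m) ∸ 1 → (a : Ann mt) (af : Anns ms fs) →
              Σ[ af⁺ ∈ Anns ms⁺ (ins (lab side ρ ν m) fs) ]
                posF af⁺ ≡ 40 * sent ρ m (mass mt) + pos (sent ρ m (mass mt)) a + posF af ×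
                negF af⁺ ≡ charge ν m (mass mt) + neg a + negF af

  frontExt : ∀ {cs} (ms : Marks cs) {t} m (p : m ≤ cnt t) (mt : Mark t) → Ext ms m mt (t ∷ cs)
  frontExt ms m p mt = record
    { ms⁺ = edge m p mt ms ; side = true ; ins = _∷_ ; masses⁺ = refl ; phantom⁺ = refl ; V⁺ = V-front
    ; up⁺ = λ σ ρ ν fs → up-front σ ρ ν m fs ; excess⁺ = λ _ _ _ → refl
    ; anns⁺ = λ ρ ν h a af → edge true ρ ν h a af , refl , refl }

  snoc : ∀ {cs} (ms : Marks cs) {t} m (p : m ≤ cnt t) (mt : Mark t) → Marks (cs ++ [ t ])
  snoc [] m p mt = edge m p mt []
  snoc (edge m' p' mt' ms) m p mt = edge m' p' mt' (snoc ms m p mt)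

  masses-snoc : ∀ {cs} (ms : Marks cs) {t} m (p : m ≤ cnt t) (mt : Mark t) → masses (snoc ms m p mt) ≡ m + masses ms
  masses-snoc [] m p mt = refl
  masses-snoc (edge m' _ _ ms) m p mt = trans (cong (m' +_) (masses-snoc ms m p mt))
    (linear 3 (λ a b c → a ⊕ (b ⊕ c) ≐ b ⊕ (a ⊕ c)) m' m (masses ms))

  phantom-snoc : ∀ {cs} (ms : Marks cs) {t} m (p : m ≤ cnt t) (mt : Mark t) →
                 phantomF (snoc ms m p mt) ≡ phantom m (mass mt) + phantomT mt + phantomF ms
  phantom-snoc [] m p mt = refl
  phantom-snoc (edge m' _ mt' ms) m p mt = trans (cong (phantom m' (mass mt') + phantomT mt' +_) (phantom-snoc ms m p mt))
    (linear 3 (λ a b c → a ⊕ (b ⊕ c) ≐ b ⊕ (a ⊕ c)) (phantom m' (mass mt') + phantomT mt') (phantom m (mass mt) + phantomT mt) (phantomF ms))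

  anns-snoc : ∀ {cs} {ms : Marks cs} {fs} {t} {m} (p : m ≤ cnt t) {mt : Mark t} ρ ν → ν ≤ bits (ρ ∸ bits m) ∸ 1 →
              (a : Ann mt) (af : Anns ms fs) →
              Σ[ af⁺ ∈ Anns (snoc ms m p mt) (fs ++ [ lab false ρ ν m ]) ]
                posF af⁺ ≡ 40 * sent ρ m (mass mt) + pos (sent ρ m (mass mt)) a + posF af ×
                negF af⁺ ≡ charge ν m (mass mt) + neg a + negF af
  anns-snoc p ρ ν h a [] = edge false ρ ν h a [] , refl , refl
  anns-snoc {m = m} p {mt} ρ ν h a (edge {m = m'} {mt = mt'} l ρ' ν' h' a' af) with anns-snoc p ρ ν h a af
  ... | af⁺ , e , e' = edge l ρ' ν' h' a' af⁺ ,
      trans (cong (40 * sent ρ' m' (mass mt') + pos (sent ρ' m' (mass mt')) a' +_) e)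
        (linear 3 (λ a b c → a ⊕ (b ⊕ c) ≐ b ⊕ (a ⊕ c)) (40 * sent ρ' m' (mass mt') + pos (sent ρ' m' (mass mt')) a') (40 * sent ρ m (mass mt) + pos (sent ρ m (mass mt)) a) (posF af)) ,
      trans (cong (charge ν' m' (mass mt') + neg a' +_) e')
        (linear 3 (λ a b c → a ⊕ (b ⊕ c) ≐ b ⊕ (a ⊕ c)) (charge ν' m' (mass mt') + neg a') (charge ν m (mass mt) + neg a) (negF af))

  data SnocView {cs t} : Marks (cs ++ [ t ]) → Set where
    snoc-of : (ms : Marks cs) (m : ℕ) (p : m ≤ cnt t) (mt : Mark t) → SnocView (snoc ms m p mt)

  snocView : ∀ cs {t} (ms : Marks (cs ++ [ t ])) → SnocView {cs} ms
  snocView [] (edge m p mt []) = snoc-of [] m p mt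
  snocView (c ∷ cs) (edge m' p' mt' ms) with snocView cs ms
  ... | snoc-of ms m p mt = snoc-of (edge m' p' mt' ms) m p mt

  backExt : ∀ {cs} (ms : Marks cs) {t} m (p : m ≤ cnt t) (mt : Mark t) → Ext ms m mt (cs ++ [ t ])
  backExt ms m p mt = record
    { ms⁺ = snoc ms m p mt ; side = false ; ins = λ f fs → fs ++ [ f ] ; masses⁺ = masses-snoc ms m p mt
    ; phantom⁺ = phantom-snoc ms m p mt ; V⁺ = V-back
    ; up⁺ = λ σ ρ ν fs → upD-back σ σ ρ ν m fs ; excess⁺ = λ ρ ν fs → excess-back fs false ρ ν m
    ; anns⁺ = λ ρ ν h a af → anns-snoc p ρ ν h a af }

  -- Trees during a round of linking

  -- A tree being linked.
  data Elem (Γ : ℕ) : ∀ {t} → Mark t → El → Set where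
    elem : ∀ {i k cs b} {ms : Marks cs} {fs e} → Anns ms fs → Inv Γ e → El.mort e ≡ b → El.r e ≡ bits (suc (masses ms)) → 1 ≤ El.o e →
           V (if El.fl e ∧ El.fr e then El.r e else El.o e) fs →
           excess fs ≤ 4 * El.o e + (2 * when (El.fl e) (El.r e ∸ El.o e) + 2 * when (El.fr e) (El.r e ∸ El.o e)) →
           Elem Γ (mk {i} {k} b ms) e

  posE negE : ∀ {Γ t} {mt : Mark t} {e} → Elem Γ mt e → ℕ
  posE {e = e} (elem {b = b} {fs = fs} af _ _ _ _ _ _) = 6 * when b (up (El.R₀ e) fs) + posF af + value e
  negE {e = e} (elem {b = b} {ms = ms} af _ _ _ _ _ _) = 18 * when b (bits (suc (masses ms))) + negF af + debt e

  elem-mass : ∀ {Γ t} {mt : Mark t} {e} → Elem Γ mt e → El.r e ≡ bits (mass mt)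
  elem-mass (elem _ _ _ h _ _ _) = h

  elem-inv : ∀ {Γ t} {mt : Mark t} {e} → Elem Γ mt e → Inv Γ e
  elem-inv (elem _ h _ _ _ _ _) = h

  lim≤ : ∀ fl fr {o r} → o ≤ r → (if fl ∧ fr then r else o) ≤ r
  lim≤ true true h = ≤-refl
  lim≤ true false h = h
  lim≤ false _ h = h

  excess-lim : ∀ fl fr {e o r} → o ≤ r → e ≤ 4 * o + (2 * when fl (r ∸ o) + 2 * when fr (r ∸ o)) → e ≤ 4 * r
  excess-lim fl fr {e} {o} {r} h x = linear 5 (λ e o r p q → o ≲ r ⇒ p ≲ r ⊖ o ⇒ q ≲ r ⊖ o ⇒ e ≲ 4 ⊛ o ⊕ (2 ⊛ p ⊕ 2 ⊛ q) ⇒ e ≲ 4 ⊛ r)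
    e o r (when fl (r ∸ o)) (when fr (r ∸ o)) h (when≤ fl) (when≤ fr) x
    where
    when≤ : ∀ b → when b (r ∸ o) ≤ r ∸ o
    when≤ true = ≤-refl
    when≤ false = z≤n

  -- The sentinel may occur at both ends of `up`, which has weight 6; this is the origin of the
  -- weight 12 of reserves and funds.
  settle-up : ∀ b σ R fs p v → 6 * when b (up σ fs) + p + v + 12 * when b R ≤ 6 * when b (up R fs) + p + v + 12 * when b (R ⊔ σ)
  settle-up false σ R fs p v = ≤-refl
  settle-up true σ R fs p v = linear 6 (λ u u₀ p v R s → u ≲ u₀ ⊕ 2 ⊛ (s ⊖ R) ⇒ 6 ⊛ u ⊕ p ⊕ v ⊕ 12 ⊛ R ≲ 6 ⊛ u₀ ⊕ p ⊕ v ⊕ 12 ⊛ mx R s)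
    (up σ fs) (up R fs) p v R σ (up-σ R σ fs)

  -- The annotation an element keeps after its loss, with sentinel σ.
  settle : ∀ {Γ t} {mt : Mark t} {e} (x : Elem Γ mt e) →
           Σ[ a ∈ Ann mt ] (∀ σ → pos σ a + value e + 12 * when (El.mort e) (El.R₀ e) ≤ posE x + 12 * when (El.mort e) (El.R₀ e ⊔ σ))
                         × neg a + debt e ≡ negE x
  settle {e = e} (elem {b = b} {ms = ms} {fs = fs} af i refl refl o≥1 v x) =
    ann af (V-mono (lim≤ (El.fl e) (El.fr e) (Inv.o≤r i)) v) (excess-lim (El.fl e) (El.fr e) (Inv.o≤r i) x) ,
    (λ σ → settle-up (El.mort e) σ (El.R₀ e) fs (posF af) (value e)) , refl

  module Amortized (v : Variant) where

    private
      Key : Set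
      Key = DecTotalOrder.Carrier O

    -- Price of a phantom link when all levels have class at most Γ.
    abstract
      price : ℕ → ℕ
      price Γ = 200 * Γ + 20

      price-def : ∀ Γ → price Γ ≡ 200 * Γ + 20
      price-def Γ = refl

    module _ {Γ : ℕ} where

      -- The terms 3 ν of winner and loser stand for the change in the adjacent gaps of the list.
      -- They make the balance of a link independent of its neighbours and are cancelled later by
      -- `gap-into-right` and its variants.
      Wins : ∀ {i k cs cs⁺ b} {ms : Marks cs} {ms⁺ : Marks cs⁺} {t} {mt : Mark t} {x y : El} →
             Elem Γ mt x → Elem Γ (mk {i} {k} b ms) y → ℕ → ℕ → Set
      Wins {i} {k} {b = b} {ms⁺ = ms⁺} {x = x} {y} ex ey q₀ q₁ = Σ[ r' ∈ ℕ ] Σ[ R' ∈ ℕ ] Σ[ F' ∈ ℕ ]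
        Σ[ ew ∈ Elem Γ (mk {i} {k} b ms⁺) (merge x y r' R' F') ]
          1 + posE ew + (negE ex + negE ey) + 3 * El.ν y + price Γ * q₀ ≤ posE ex + posE ey + negE ew + 3 * El.ν x + price Γ * q₁

      excess-win : ∀ fr {x e o r r'} → o ≤ r → r ≤ r' → x ≤ 2 * (r' ∸ o) →
                   e ≤ 4 * o + (0 + 2 * when fr (r ∸ o)) → x + e ≤ 4 * o + (2 * (r' ∸ o) + 2 * when fr (r' ∸ o))
      excess-win false {x} {e} {o} {r} {r'} = linear 5 (λ x e o r r' → o ≲ r ⇒ r ≲ r' ⇒ x ≲ 2 ⊛ (r' ⊖ o) ⇒ e ≲ 4 ⊛ o ⊕ (# 0 ⊕ # 0) ⇒ x ⊕ e ≲ 4 ⊛ o ⊕ (2 ⊛ (r' ⊖ o) ⊕ # 0)) x e o r r'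
      excess-win true {x} {e} {o} {r} {r'} = linear 5 (λ x e o r r' → o ≲ r ⇒ r ≲ r' ⇒ x ≲ 2 ⊛ (r' ⊖ o) ⇒ e ≲ 4 ⊛ o ⊕ (# 0 ⊕ 2 ⊛ (r ⊖ o)) ⇒ x ⊕ e ≲ 4 ⊛ o ⊕ (2 ⊛ (r' ⊖ o) ⊕ 2 ⊛ (r' ⊖ o))) x e o r r'

      -- A first win takes place at rank o and records level o, so the children still form a valley
      -- below o when the other side is won. Only then may levels rise above o.
      V-win : ∀ fr {o r r' ρ fs} → ρ ≤ r → r ≤ r' → (fr ≡ false → r ≡ o) → V ρ fs → V (if fr then r' else o) fs
      V-win true p q z w = V-mono (≤-trans p q) w
      V-win false p q z w = V-mono (≤-trans p (≤-reflexive (z refl))) w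

      sent-real : ∀ ρ m s → (m ≡ᵇ s) ≡ true → sent ρ m s ≡ bits (ρ ∸ bits m)
      sent-real ρ m s e = cong (λ b → if b then bits (ρ ∸ bits m) else 0) e
      sent-ph : ∀ ρ m s → (m ≡ᵇ s) ≡ false → sent ρ m s ≡ 0
      sent-ph ρ m s e = cong (λ b → if b then bits (ρ ∸ bits m) else 0) e
      charge-real : ∀ ν m s → (m ≡ᵇ s) ≡ true → charge ν m s ≡ 3 * ν
      charge-real ν m s e = cong (λ b → if b then 3 * ν else 0) e
      charge-ph : ∀ ν m s → (m ≡ᵇ s) ≡ false → charge ν m s ≡ 0
      charge-ph ν m s e = cong (λ b → if b then 3 * ν else 0) e
      phantom-real : ∀ m s → (m ≡ᵇ s) ≡ true → phantom m s ≡ 0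
      phantom-real m s e = cong (λ b → if b then 0 else 1) e
      phantom-ph : ∀ m s → (m ≡ᵇ s) ≡ false → phantom m s ≡ 1
      phantom-ph m s e = cong (λ b → if b then 0 else 1) e

      when-add : ∀ b {u u' d} → u' ≤ u + d → when b u' ≤ when b u + when b d
      when-add true h = h
      when-add false h = z≤n

      bits-sum : ∀ m s → bits (m + s) ≤ suc (bits m ⊔ bits s)
      bits-sum m s with ≤-total m s
      ... | inj₁ p = ≤-trans (bits-double-≤ s (m + s) (linear 2 (λ m s → m ≲ s ⇒ m ⊕ s ≲ 2 ⊛ s) m s p)) (s≤s (m≤n⊔m (bits m) (bits s)))
        where
        bits-double-≤ : ∀ a b → b ≤ 2 * a → bits b ≤ suc (bits a)
        bits-double-≤ zero b h = ≤-trans (bits-mono h) (≤-trans (≤-reflexive bits0) z≤n)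
        bits-double-≤ (suc a) b h = ≤-trans (bits-mono h) (≤-reflexive (bits-double (suc a)))
      ... | inj₂ p = ≤-trans (bits-double-≤ m (m + s) (linear 2 (λ m s → s ≲ m ⇒ m ⊕ s ≲ 2 ⊛ m) m s p)) (s≤s (m≤m⊔n (bits m) (bits s)))
        where
        bits-double-≤ : ∀ a b → b ≤ 2 * a → bits b ≤ suc (bits a)
        bits-double-≤ zero b h = ≤-trans (bits-mono h) (≤-trans (≤-reflexive bits0) z≤n)
        bits-double-≤ (suc a) b h = ≤-trans (bits-mono h) (≤-reflexive (bits-double (suc a)))

      win : ∀ {i k cs cs⁺ b} {ms : Marks cs} {t} {m} {mt : Mark t} (E : Ext ms m mt cs⁺) {x y : El}
            (ex : Elem Γ mt x) (ey : Elem Γ (mk {i} {k} b ms) y) → El.b x ≡ El.a y → El.fl y ≡ false →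
            Wins {ms⁺ = Ext.ms⁺ E} ex ey (phantomT mt + phantomF ms) (phantomF (Ext.ms⁺ E))
      win {i} {k} {b = b} {ms} {m = m} {mt} E {x} {y} ex ey@(elem {fs = fs} af iy refl refl o≥1 v xc) adj unfl = by-type (m ≡ᵇ mass mt) refl
        where
        module E = Ext E
        module X = El x
        module Y = El y
        ix = elem-inv ex
        module IY = Inv iy
        s = suc (masses ms)
        s' = suc (masses E.ms⁺)
        s'≡ : s' ≡ m + s
        s'≡ = trans (cong suc E.masses⁺) (sym (+-suc m (masses ms)))
        r' = bits s'
        h₂ : Y.r ≤ r'
        h₂ = bits-mono (≤-trans (m≤n+m s m) (≤-reflexive (sym s'≡)))
        ρ = newρ Y.o Y.r Y.a
        st = settle ex
        a = proj₁ st
        Vy : V Y.o fs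
        Vy = subst (λ f → V (if f ∧ Y.fr then Y.r else Y.o) fs) unfl v
        ρ≤r : ρ ≤ Y.r
        ρ≤r = linear 3 (λ o r a → o ≲ r ⇒ mx o (mn r a) ≲ r) Y.o Y.r Y.a IY.o≤r
        Vnew : ∀ ν → V (if true ∧ Y.fr then r' else Y.o) (E.ins (lab E.side ρ ν m) fs)
        Vnew ν = V-win Y.fr ρ≤r h₂ (IY.fresh unfl) (E.V⁺ (m≤m⊔n Y.o _) Vy)
        exnew : ∀ ν → excess (E.ins (lab E.side ρ ν m) fs) ≤ 4 * Y.o + (2 * (r' ∸ Y.o) + 2 * when Y.fr (r' ∸ Y.o))
        exnew ν = ≤-trans (≤-reflexive (E.excess⁺ ρ ν fs))
          (excess-win Y.fr IY.o≤r h₂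
            (≤-trans (excess-new {Y.o} {s} {m} {ρ} o≥1 IY.o≤r (m≤m⊔n Y.o _)) (≤-reflexive (cong (λ z → 2 * (bits z ∸ Y.o)) (sym s'≡))))
            (subst (λ f → excess fs ≤ 4 * Y.o + (2 * when f (Y.r ∸ Y.o) + 2 * when Y.fr (Y.r ∸ Y.o))) unfl xc))
        mk-elem : ∀ R' F' ν (h : ν ≤ bits (ρ ∸ bits m) ∸ 1) → Inv Γ (merge x y r' R' F') → Elem Γ (mk {i} {k} b E.ms⁺) (merge x y r' R' F')
        mk-elem R' F' ν h i' = elem (proj₁ (E.anns⁺ ρ ν h a af)) i' refl refl o≥1 (Vnew ν) (exnew ν)

        finish : ∀ {q R' F'} ν (h : ν ≤ bits (ρ ∸ bits m) ∸ 1) (i' : Inv Γ (merge x y r' R' F')) σ (c p : ℕ) → ν ≤ Y.R₀ →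
          sent ρ m (mass mt) ≡ σ → charge ν m (mass mt) ≡ c → phantom m (mass mt) ≡ p →
          1 + 6 * when b (Y.R₀ ∸ ν) + 40 * σ + 12 * when X.mort (X.R₀ ⊔ σ) + value (merge x y r' R' F') + 3 * Y.ν
            ≤ value x + value y + c + 18 * when b (r' ∸ Y.r) + q → q ≤ price Γ * p →
          1 + posE (mk-elem R' F' ν h i') + (negE ex + negE ey) + 3 * Y.ν + price Γ * (phantomT mt + phantomF ms)
            ≤ posE ex + posE ey + negE (mk-elem R' F' ν h i') + 3 * X.ν + price Γ * phantomF E.ms⁺
        finish {q} {R'} {F'} ν h i' σ c p ν≤ refl refl refl main qp =
          subst₂ (λ u w → 1 + (6 * when b (up Y.R₀ fs⁺) + u + value e') + (negE ex + negE ey) + 3 * Y.ν + price Γ * (phantomT mt + phantomF ms)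
              ≤ posE ex + posE ey + (18 * when b r' + w + debt y) + 3 * X.ν + price Γ * phantomF E.ms⁺)
            (sym (proj₁ (proj₂ an))) (sym (proj₂ (proj₂ an)))
            (subst₂ (λ z w → 1 + (6 * when b (up Y.R₀ fs⁺) + (40 * σ + pos σ a + posF af) + value e') + (z + negE ey) + 3 * Y.ν + price Γ * (phantomT mt + phantomF ms)
              ≤ posE ex + posE ey + (18 * when b r' + (c + neg a + negF af) + debt y) + 3 * X.ν + w)
              (proj₂ (proj₂ st)) (sym (trans (cong (price Γ *_) E.phantom⁺) (split (price Γ) p (phantomT mt) (phantomF ms))))
              (linear 26 (λ u⁺ s20 ps pf ve' na νx Rx bs nf dy νy Q px u vy br' c Rν mR vx g q pp _ _ →
                u⁺ ≲ u ⊕ Rν ⇒ ps ⊕ vx ⊕ 12 ⊛ Rx ≲ px ⊕ 12 ⊛ mR ⇒ # 1 ⊕ 6 ⊛ Rν ⊕ s20 ⊕ 12 ⊛ mR ⊕ ve' ⊕ 3 ⊛ νy ≲ vx ⊕ vy ⊕ c ⊕ 18 ⊛ g ⊕ q ⇒ q ≲ pp ⇒ bs ⊕ g ≲ br' ⇒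
                # 1 ⊕ (6 ⊛ u⁺ ⊕ (s20 ⊕ ps ⊕ pf) ⊕ ve') ⊕ ((na ⊕ (3 ⊛ νx ⊕ 12 ⊛ Rx)) ⊕ (18 ⊛ bs ⊕ nf ⊕ dy)) ⊕ 3 ⊛ νy ⊕ Q
                ≲ px ⊕ (6 ⊛ u ⊕ pf ⊕ vy) ⊕ (18 ⊛ br' ⊕ (c ⊕ na ⊕ nf) ⊕ dy) ⊕ 3 ⊛ νx ⊕ (pp ⊕ Q))
                (when b (up Y.R₀ fs⁺)) (40 * σ) (pos σ a) (posF af) (value e') (neg a) X.ν (when X.mort X.R₀) (when b Y.r) (negF af) (debt y) Y.ν (price Γ * (phantomT mt + phantomF ms))
                (posE ex) (when b (up Y.R₀ fs)) (value y) (when b r') c (when b (Y.R₀ ∸ ν)) (when X.mort (X.R₀ ⊔ σ)) (value x) (when b (r' ∸ Y.r)) q (price Γ * p) 0 0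
                (when-add b (E.up⁺ Y.R₀ ρ ν fs ν≤)) (proj₁ (proj₂ st) σ) main qp (growth b)))
          where
          e' = merge x y r' R' F'
          fs⁺ = E.ins (lab E.side ρ ν m) fs
          an = E.anns⁺ ρ ν h a af
          growth : ∀ b → when b Y.r + when b (r' ∸ Y.r) ≤ when b r'
          growth true = ≤-reflexive (m+[n∸m]≡n h₂)
          growth false = z≤n
          split : ∀ K p t f → K * (p + t + f) ≡ K * p + K * (t + f)
          split K p t f = trans (cong (K *_) (+-assoc p t f)) (*-distribˡ-+ K p (t + f))

        by-type : ∀ d → (m ≡ᵇ mass mt) ≡ d → Wins {ms⁺ = E.ms⁺} ex ey (phantomT mt + phantomF ms) (phantomF E.ms⁺)
        -- The edge carries the loser's whole mass, so the bit length of m is the loser's rank and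
        -- the class of the edge is the one treated in `link-real`.
        by-type true e = r' , proj₁ lr , proj₁ (proj₂ lr) , mk-elem _ _ ν' h i' ,
            finish {0} ν' h i' (bits ℓ) (3 * ν') 0 (m⊓n≤m Y.R₀ _) (trans (sent-real ρ m (mass mt) e) σ≡) (charge-real ν' m (mass mt) e) (phantom-real m (mass mt) e)
              (≤-trans (proj₂ (proj₂ (proj₂ lr))) (m≤m+n _ 0)) z≤n
          where
          m≡ : m ≡ mass mt
          m≡ = ≡ᵇ⇒≡ m (mass mt) (subst T (sym e) _)
          rx : X.r ≡ bits m
          rx = trans (elem-mass ex) (cong bits (sym m≡))
          h₁ : X.r ≤ r'
          h₁ = ≤-trans (≤-reflexive rx) (bits-mono (≤-trans (m≤m+n m s) (≤-reflexive (sym s'≡))))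
          hr : r' ≤ suc (X.r ⊔ Y.r)
          hr = ≤-trans (≤-reflexive (cong bits s'≡)) (≤-trans (bits-sum m s) (≤-reflexive (cong (λ z → suc (z ⊔ bits s)) (sym rx))))
          lr = link-real x y ix iy adj unfl r' h₂ h₁ hr
          ℓ = ρ ∸ X.r
          ν' = Y.R₀ ⊓ (bits ℓ ∸ 1)
          i' = proj₁ (proj₂ (proj₂ lr))
          σ≡ : bits (ρ ∸ bits m) ≡ bits ℓ
          σ≡ = cong (λ z → bits (ρ ∸ z)) (sym rx)
          h : ν' ≤ bits (ρ ∸ bits m) ∸ 1
          h = ≤-trans (m⊓n≤n Y.R₀ _) (≤-reflexive (cong (_∸ 1) (sym σ≡)))
        -- A phantom edge stores no class and counts no charge. With charge 0 the variation grows by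
        -- up to R₀ of the winner, which the price of the link includes.
        by-type false e = r' , proj₁ lp , proj₁ (proj₂ lp) , mk-elem _ _ 0 z≤n i' ,
            finish {200 * Γ + 20} 0 z≤n i' 0 0 1 z≤n (sent-ph ρ m (mass mt) e) (charge-ph 0 m (mass mt) e) (phantom-ph m (mass mt) e)
              (≤-trans (≤-reflexive (cong (λ q → 1 + 6 * when b Y.R₀ + 0 + 12 * when X.mort q + value (merge x y r' (proj₁ lp) (proj₁ (proj₂ lp))) + 3 * Y.ν) (⊔-identityʳ X.R₀)))
                (linear 9 (λ R s ve ν vx vy g q w → w ≲ R ⇒ # 1 ⊕ 6 ⊛ R ⊕ s ⊕ ve ⊕ ν ≲ vx ⊕ vy ⊕ g ⊕ q ⇒ # 1 ⊕ 6 ⊛ w ⊕ # 0 ⊕ s ⊕ ve ⊕ ν ≲ vx ⊕ vy ⊕ # 0 ⊕ g ⊕ q)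
                  Y.R₀ (12 * when X.mort X.R₀) (value (merge x y r' (proj₁ lp) (proj₁ (proj₂ lp)))) (3 * Y.ν) (value x) (value y) (18 * when b (r' ∸ Y.r)) (200 * Γ + 20) (when b Y.R₀) (when-≤ b Y.R₀) (proj₂ (proj₂ (proj₂ lp)))))
              (≤-reflexive (trans (sym (price-def Γ)) (sym (*-identityʳ (price Γ)))))
          where
          lp = link-phantom x y ix iy adj unfl r' h₂
          i' = proj₁ (proj₂ (proj₂ lp))

      flipE : ∀ {t} {mt : Mark t} {e} (x : Elem Γ mt e) → Σ[ x' ∈ Elem Γ mt (flip e) ] posE x' ≡ posE x × negE x' ≡ negE x
      flipE {e = e} (elem {fs = fs} af i refl r o≥1 v x) =
        elem af (inv-flip e i) refl r o≥1 (subst (λ z → V (if z then El.r e else El.o e) fs) (∧-comm (El.fl e) (El.fr e)) v)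
          (subst (λ z → excess fs ≤ 4 * El.o e + z) (+-comm (2 * when (El.fl e) (El.r e ∸ El.o e)) _) x) ,
        cong (6 * when (El.mort e) (up (El.R₀ e) fs) + posF af +_) (value-flip e) , refl

    -- Single linking steps

    data MR : List Tree → Set where
      [] : MR []
      _∷_ : ∀ {t ts} → Mark t → MR ts → MR (t ∷ ts)

    phantomR : ∀ {ts} → MR ts → ℕ
    phantomR [] = 0
    phantomR (mt ∷ ms) = phantomT mt + phantomR ms

    module Linking (Γ : ℕ) where

      -- An element that has won across a gap is smaller than its neighbour there,
      -- so it will not win across it again.
      record Adj (k : Key) (e : El) (k' : Key) (e' : El) : Set where
        constructor adj
        field
          gap≡ : El.b e ≡ El.a e'
          wonR : El.fr e ≡ true → (k <ₖ k') ≡ false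
          wonL : El.fl e' ≡ true → (k <ₖ k') ≡ true

      data RS : ∀ {ts} → MR ts → Key → El → Set where
        one : ∀ {t} {mt : Mark t} {e} → Elem Γ mt e → RS (mt ∷ []) (key t) e
        cons : ∀ {t ts} {mt : Mark t} {ms : MR ts} {e k' e'} → Elem Γ mt e → Adj (key t) e k' e' → RS ms k' e' → RS (mt ∷ ms) (key t) e

      -- Each summand is the excess of a prospective loser's charge over that of its prospective
      -- winner, and it is dropped once this winner has won across the gap.
      gap : El → El → ℕ
      gap e e' = unless (El.fr e) (El.ν e' ∸ El.ν e) + unless (El.fl e') (El.ν e ∸ El.ν e')

      posR negR : ∀ {ts} {ms : MR ts} {k e} → RS ms k e → ℕ
      posR (one x) = posE x
      posR (cons {e = e} {e' = e'} x _ rs) = posE x + 3 * gap e e' + posR rs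
      negR (one x) = negE x
      negR (cons x _ rs) = negE x + negR rs

      Pays : ∀ {ts ts'} {ms : MR ts} {ms' : MR ts'} {k e k' e'} → RS ms k e → RS ms' k' e' → ℕ → Set
      Pays {ms = ms} {ms'} rs rs' c = c + posR rs' + negR rs + price Γ * phantomR ms ≤ posR rs + negR rs' + price Γ * phantomR ms'

      kids : Variant → List Tree → Tree → List Tree
      kids slim cs x = x ∷ cs
      kids smooth cs x = cs ++ [ x ]

      rightLink : Tree → Tree → Tree
      rightLink (node i k cs) x = node i k (kids v cs x)

      kidsView : ∀ w cs x (ms' : Marks (kids w cs x)) →
                 Σ[ ms ∈ Marks cs ] Σ[ m ∈ ℕ ] Σ[ mt ∈ Mark x ] Σ[ E ∈ Ext ms m mt (kids w cs x) ] Ext.ms⁺ E ≡ ms'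
      kidsView slim cs x (edge m p mt ms) = ms , m , mt , frontExt ms m p mt , refl
      kidsView smooth cs x ms' with snocView cs ms'
      ... | snoc-of ms m p mt = ms , m , mt , backExt ms m p mt , refl

      cnts-++ : ∀ as bs → cnts (as ++ bs) ≡ cnts as + cnts bs
      cnts-++ [] bs = refl
      cnts-++ (a ∷ as) bs = trans (cong (cnt a +_) (cnts-++ as bs)) (sym (+-assoc (cnt a) (cnts as) (cnts bs)))

      kids-cnt : ∀ w cs x → cnts (kids w cs x) ≡ cnt x + cnts cs
      kids-cnt slim cs x = refl
      kids-cnt smooth cs x = trans (cnts-++ cs [ x ]) (trans (cong (cnts cs +_) (+-identityʳ (cnt x))) (+-comm (cnts cs) (cnt x)))

      -- The steps that keep the first node in place, so that nothing changes to its left. The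
      -- comparison of l with r is recorded because the winner is the larger of the two: it cannot
      -- win across the merged gap, which is what `Adj` demands of its flag.
      data Inner : List Tree → List Tree → Set where
        last : ∀ {l x} → leftSmaller l x ≡ true → Inner (l ∷ x ∷ []) (rightLink l x ∷ [])
        intoR : ∀ {l x r rest} → leftSmaller l x ≡ true → leftSmaller x r ≡ false → leftSmaller l r ≡ true →
                Inner (l ∷ x ∷ r ∷ rest) (l ∷ attachLeft r x ∷ rest)
        intoL : ∀ {l x r rest} → leftSmaller l x ≡ true → leftSmaller x r ≡ false → leftSmaller l r ≡ false →
                Inner (l ∷ x ∷ r ∷ rest) (rightLink l x ∷ r ∷ rest)
        skip : ∀ {l x r rest ts'} → Inner (x ∷ r ∷ rest) ts' → Inner (l ∷ x ∷ r ∷ rest) (l ∷ ts')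

      data Link : List Tree → List Tree → Set where
        first : ∀ {a b rest} → leftSmaller a b ≡ false → Link (a ∷ b ∷ rest) (attachLeft b a ∷ rest)
        inner : ∀ {ts ts'} → Inner ts ts' → Link ts ts'

      unflagged : ∀ {b c} → (b ≡ true → c ≡ true) → c ≡ false → b ≡ false
      unflagged {false} h e = refl
      unflagged {true} h e with trans (sym e) (h refl)
      ... | ()

      unflagged' : ∀ {b c} → (b ≡ true → c ≡ false) → c ≡ true → b ≡ false
      unflagged' {false} h e = refl
      unflagged' {true} h e with trans (sym e) (h refl)
      ... | ()

      winR : ∀ {i k cs cs⁺ b} {ms : Marks cs} {t} {m} {mt : Mark t} (E : Ext ms m mt cs⁺) {x y : El}
             (ex : Elem Γ mt x) (ey : Elem Γ (mk {i} {k} b ms) y) → El.b y ≡ El.a x → El.fr y ≡ false →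
             Σ[ y' ∈ El ] Σ[ ew ∈ Elem Γ (mk {i} {k} b (Ext.ms⁺ E)) y' ]
               (El.a y' ≡ El.a y × El.fl y' ≡ El.fl y × El.ν y' ≡ El.ν y × El.b y' ≡ El.b x × El.fr y' ≡ true) ×
               1 + posE ew + (negE ex + negE ey) + 3 * El.ν y + price Γ * (phantomT mt + phantomF ms)
                 ≤ posE ex + posE ey + negE ew + 3 * El.ν x + price Γ * phantomF (Ext.ms⁺ E)
      winR {ms = ms} {mt = mt} E {x} {y} ex ey ad unf with flipE ex | flipE ey
      ... | fx , px , nx | fy , py , ny with win E fx fy (sym ad) unf
      ... | r' , R' , F' , ew , pay with flipE ew
      ... | fw , pw , nw = flip (merge (flip x) (flip y) r' R' F') , fw , (refl , refl , refl , refl , refl) ,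
        subst₂ (λ u w → 1 + posE fw + (negE ex + negE ey) + 3 * El.ν y + price Γ * (phantomT mt + phantomF ms) ≤ u + w + 3 * El.ν x + price Γ * phantomF (Ext.ms⁺ E))
          (cong₂ _+_ px py) (sym nw)
          (subst₂ (λ u w → 1 + u + w + 3 * El.ν y + price Γ * (phantomT mt + phantomF ms) ≤ posE fx + posE fy + negE ew + 3 * El.ν x + price Γ * phantomF (Ext.ms⁺ E))
            (sym pw) (cong₂ _+_ nx ny) pay)

      keeps : El → El → Set
      keeps e e' = El.a e' ≡ El.a e × El.fl e' ≡ El.fl e × El.ν e' ≡ El.ν e

      clash : {A : Set} {b : Bool} → b ≡ true → b ≡ false → A
      clash refl ()

      -- A triangle inequality for charges in which the loser's charge v is exchanged for the
      -- winner's charge w. If w exceeds v, the outer step grows by at most w - v, which the right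
      -- side contains; otherwise the step v - w of the vanishing gap is released.
      gap-win : ∀ u v w (c d p : Bool) → unless c (w ∸ u) + 0 + v ≤ (unless c (v ∸ u) + unless d (u ∸ v)) + (unless p (w ∸ v) + (v ∸ w)) + w
      gap-win u v w false d p = linear 5 (λ u v w x y → ((w ⊖ u) ⊕ # 0) ⊕ v ≲ ((v ⊖ u) ⊕ x) ⊕ (y ⊕ (v ⊖ w)) ⊕ w) u v w (unless d (u ∸ v)) (unless p (w ∸ v))
      gap-win u v w true d p = linear 4 (λ v w x y → # 0 ⊕ # 0 ⊕ v ≲ (# 0 ⊕ x) ⊕ (y ⊕ (v ⊖ w)) ⊕ w) v w (unless d (u ∸ v)) (unless p (w ∸ v))

      gap-into-right : ∀ u x y y' → El.fl y ≡ false → El.fl y' ≡ true → El.ν y' ≡ El.ν y →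
                       gap u y' + El.ν x ≤ gap u x + gap x y + El.ν y
      gap-into-right (el _ _ fr _ _ _ _ _ u _ _) (el _ fl' fr' _ _ _ _ _ v _ _) (el _ _ _ _ _ _ _ _ w _ _) (el _ _ _ _ _ _ _ _ _ _ _) refl refl refl =
        gap-win u v w fr fl' fr'

      gap-flip : ∀ x y → gap (flip y) (flip x) ≡ gap x y
      gap-flip x y = +-comm (unless (El.fl y) (El.ν x ∸ El.ν y)) _

      gap-into-left : ∀ u x y y' → El.fr y ≡ false → El.fr y' ≡ true → El.ν y' ≡ El.ν y →
                      gap y' u + El.ν x ≤ gap x u + gap y x + El.ν y
      gap-into-left u x y y' p q r = subst₂ (λ g h → g + El.ν x ≤ h + El.ν y) (gap-flip y' u) (cong₂ _+_ (gap-flip x u) (gap-flip y x))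
        (gap-into-right (flip u) (flip x) (flip y) (flip y') p q r)

      gap-edge : ∀ x y → El.fl y ≡ false → El.ν x ≤ gap x y + El.ν y
      gap-edge (el _ _ fr _ _ _ _ _ v _ _) (el _ _ _ _ _ _ _ _ w _ _) refl =
        linear 3 (λ v w y → v ≲ (y ⊕ (v ⊖ w)) ⊕ w) v w (unless fr (w ∸ v))

      gap-edge' : ∀ x y → El.fr y ≡ false → El.ν x ≤ gap y x + El.ν y
      gap-edge' x y p = subst (λ g → El.ν x ≤ g + El.ν y) (gap-flip y x) (gap-edge (flip x) (flip y) p)

      gap-cong : ∀ x y y' → El.fl y' ≡ El.fl y → El.ν y' ≡ El.ν y → gap x y' ≡ gap x y
      gap-cong x (el _ _ _ _ _ _ _ _ _ _ _) (el _ _ _ _ _ _ _ _ _ _ _) refl refl = refl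

      headE : ∀ {t ts} {mt : Mark t} {ms : MR ts} {k e} → RS (mt ∷ ms) k e → Elem Γ mt e
      headE (one x) = x
      headE (cons x _ _) = x

      key≡ : ∀ {t ts} {mt : Mark t} {ms : MR ts} {k e} → RS (mt ∷ ms) k e → k ≡ key t
      key≡ (one x) = refl
      key≡ (cons x _ _) = refl

      Reheaded : ∀ {t ts t'} {mt : Mark t} {ms : MR ts} {mt' : Mark t'} {k e e'} → RS (mt ∷ ms) k e → Elem Γ mt' e' → Set
      Reheaded {ms = ms} {mt'} {k} {e' = e'} rs x =
        Σ[ rs' ∈ RS (mt' ∷ ms) k e' ] posR rs' + posE (headE rs) ≡ posR rs + posE x × negR rs' + negE (headE rs) ≡ negR rs + negE x

      rehead : ∀ {t ts t'} {mt : Mark t} {ms : MR ts} {mt' : Mark t'} {k e e'} (rs : RS (mt ∷ ms) k e) (x : Elem Γ mt' e') → k ≡ key t' →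
               El.b e' ≡ El.b e → (El.fr e' ≡ true → El.fr e ≡ true ) → (∀ z → gap e' z ≡ gap e z) → Reheaded rs x
      rehead {t' = t'} {mt' = mt'} {e' = e'} (one x) y ek _ _ _ = one' ek
        where
        one' : ∀ {k} → k ≡ key t' → Σ[ rs' ∈ RS (mt' ∷ []) k e' ] posR rs' + posE x ≡ posE x + posE y × negR rs' + negE x ≡ negE x + negE y
        one' refl = one y , +-comm (posE y) _ , +-comm (negE y) _
      rehead {t' = t'} {ms = ms} {mt' = mt'} {e = e} {e'} (cons {k' = kz} {e' = z} x ad rs) y ek pb pfr pg = cons' ek ad
        where
        cons' : ∀ {k} → k ≡ key t' → Adj k e kz z → Σ[ rs' ∈ RS (mt' ∷ ms) k e' ] posR rs' + posE x ≡ (posE x + 3 * gap e z + posR rs) + posE y × negR rs' + negE x ≡ (negE x + negR rs) + negE y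
        cons' refl (adj g wR wL) = cons y (adj (trans pb g) (λ q → wR (pfr q)) wL) rs ,
          linear 5 (λ x y g g' r → g' ≐ g ⇒ (y ⊕ 3 ⊛ g' ⊕ r) ⊕ x ≐ (x ⊕ 3 ⊛ g ⊕ r) ⊕ y) (posE x) (posE y) (gap e z) (gap e' z) (posR rs) (pg z) ,
          linear 3 (λ x y r → (y ⊕ r) ⊕ x ≐ (x ⊕ r) ⊕ y) (negE x) (negE y) (negR rs)

      spread : ∀ K {n a b} → n ≡ a + b → K * n ≡ K * a + K * b
      spread K {a = a} {b} refl = *-distribˡ-+ K a b

      ph-≤ : ∀ f t r {p F} → F ≡ p + t + f → f + (t + r) ≤ F + r
      ph-≤ f t r {p} refl = linear 4 (λ f t r p → f ⊕ (t ⊕ r) ≲ (p ⊕ t ⊕ f) ⊕ r) f t r p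

      -- The marks after the link determine those before it: the winner gives back the edge to its
      -- new child. The numerical states are carried in the opposite direction, over marks that are
      -- already fixed.
      step-inner : ∀ {ts ts'} → Inner ts ts' → (ms' : MR ts') → Σ[ ms ∈ MR ts ] phantomR ms ≤ phantomR ms' × (∀ {k e} (rs : RS ms k e) →
                   Σ[ e' ∈ El ] keeps e e' × Σ[ rs' ∈ RS ms' k e' ] Pays rs rs' 1)
      step-inner (last {l = node i kl cs} {x} l<x) (mk b ms' ∷ []) with kidsView v cs x ms'
      ... | ms , m , mt , E , refl = mk b ms ∷ mt ∷ [] , ph-≤ (phantomF ms) (phantomT mt) 0 (Ext.phantom⁺ E) , go
        where
        go : ∀ {k e} (rs : RS (mk b ms ∷ mt ∷ []) k e) → Σ[ e' ∈ El ] keeps e e' × Σ[ rs' ∈ RS (mk b (Ext.ms⁺ E) ∷ []) k e' ] Pays rs rs' 1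
        go (cons {e = y} {e' = x} ey (adj g wR wL) (one ex)) with unflagged' wR l<x
        ... | fry with winR E ex ey g fry
        ... | y' , ew , (pa , pfl , pν , pb , pfr) , pay = y' , (pa , pfl , pν) , one ew ,
          linear 13 (λ w nx ny νy νx Q₁ Q₂ px py nw Q gp Q' → # 1 ⊕ w ⊕ (nx ⊕ ny) ⊕ 3 ⊛ νy ⊕ Q₁ ≲ px ⊕ py ⊕ nw ⊕ 3 ⊛ νx ⊕ Q₂ ⇒ νx ≲ gp ⊕ νy ⇒ Q ≐ Q₁ ⇒ Q' ≐ Q₂ ⇒
            # 1 ⊕ w ⊕ (ny ⊕ nx) ⊕ Q ≲ (py ⊕ 3 ⊛ gp ⊕ px) ⊕ nw ⊕ Q')
            (posE ew) (negE ex) (negE ey) (El.ν y) (El.ν x) (price Γ * (phantomT mt + phantomF ms)) (price Γ * phantomF (Ext.ms⁺ E)) (posE ex) (posE ey) (negE ew)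
            (price Γ * (phantomF ms + (phantomT mt + 0))) (gap y x) (price Γ * (phantomF (Ext.ms⁺ E) + 0)) pay (gap-edge' x y fry)
            (cong (price Γ *_) (linear 2 (λ a b → a ⊕ (b ⊕ # 0) ≐ b ⊕ a) (phantomF ms) (phantomT mt)))
            (cong (price Γ *_) (+-identityʳ _))
      step-inner (intoR {l = l} {x} {node i kr cs} {rest} l<x x≮r l<r) (ml ∷ mk b (edge m p mt ms) ∷ mrest) = ml ∷ mt ∷ mk b ms ∷ mrest , +-monoʳ-≤ (phantomT ml) (≤-trans (≤-reflexive (sym (+-assoc (phantomT mt) (phantomF ms) _))) (+-monoˡ-≤ (phantomR mrest) (+-monoˡ-≤ (phantomF ms) (m≤n+m _ (phantom m (mass mt)))))) , go
        where
        E = frontExt ms m p mt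
        go : ∀ {k e} (rs : RS (ml ∷ mt ∷ mk b ms ∷ mrest) k e) → Σ[ e' ∈ El ] keeps e e' × Σ[ rs' ∈ RS (ml ∷ mk b (Ext.ms⁺ E) ∷ mrest) k e' ] Pays rs rs' 1
        go (cons {e = u} eu (adj g₁ wR₁ wL₁) (cons {e = x} {e' = y} ex (adj g₂ wR₂ wL₂) rs)) with key≡ rs
        ... | refl with unflagged wL₂ x≮r
        ... | fly with win E ex (headE rs) g₂ fly
        ... | r' , R' , F' , ew , pay with rehead {e' = merge x y r' R' F'} rs ew refl refl (λ q → q) (λ z → refl)
        ... | rs' , pp , nn = u , (refl , refl , refl) , cons eu (adj g₁ (λ q → clash l<x (wR₁ q)) (λ _ → l<r)) rs' ,
          linear 23 (λ w nx ny νy νx Q₁ Q₂ px py nw Q g₁ g₂ g' B Q' pr pr' nr nr' pu nu _ → # 1 ⊕ w ⊕ (nx ⊕ ny) ⊕ 3 ⊛ νy ⊕ Q₁ ≲ px ⊕ py ⊕ nw ⊕ 3 ⊛ νx ⊕ Q₂ ⇒ g' ⊕ νx ≲ g₁ ⊕ g₂ ⊕ νy ⇒ Q ≐ Q₁ ⊕ B ⇒ Q' ≐ Q₂ ⊕ B ⇒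
            pr' ⊕ py ≐ pr ⊕ w ⇒ nr' ⊕ ny ≐ nr ⊕ nw ⇒
            # 1 ⊕ (pu ⊕ 3 ⊛ g' ⊕ pr') ⊕ (nu ⊕ (nx ⊕ nr)) ⊕ Q ≲ (pu ⊕ 3 ⊛ g₁ ⊕ (px ⊕ 3 ⊛ g₂ ⊕ pr)) ⊕ (nu ⊕ nr') ⊕ Q')
            (posE ew) (negE ex) (negE (headE rs)) (El.ν y) (El.ν x) (price Γ * (phantomT mt + phantomF ms)) (price Γ * phantomF (Ext.ms⁺ E)) (posE ex) (posE (headE rs)) (negE ew)
            (price Γ * (phantomT ml + (phantomT mt + (phantomF ms + phantomR mrest)))) (gap u x) (gap x y) (gap u (merge x y r' R' F')) (price Γ * (phantomT ml + phantomR mrest))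
            (price Γ * (phantomT ml + (phantomF (Ext.ms⁺ E) + phantomR mrest))) (posR rs) (posR rs') (negR rs) (negR rs') (posE eu) (negE eu) 0
            pay (gap-into-right u x y (merge x y r' R' F') fly refl refl)
            (spread (price Γ) (linear 4 (λ l x m r → l ⊕ (x ⊕ (m ⊕ r)) ≐ (x ⊕ m) ⊕ (l ⊕ r)) (phantomT ml) (phantomT mt) (phantomF ms) (phantomR mrest)))
            (spread (price Γ) (linear 3 (λ l m r → l ⊕ (m ⊕ r) ≐ m ⊕ (l ⊕ r)) (phantomT ml) (phantomF (Ext.ms⁺ E)) (phantomR mrest)))
            pp nn
      step-inner (intoL {l = node i kl cs} {x} {r} {rest} l<x x≮r l≮r) (mk b ms' ∷ mr ∷ mrest) with kidsView v cs x ms'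
      ... | ms , m , mt , E , refl = mk b ms ∷ mt ∷ mr ∷ mrest , ph-≤ (phantomF ms) (phantomT mt) (phantomT mr + phantomR mrest) (Ext.phantom⁺ E) , go
        where
        go : ∀ {k e} (rs : RS (mk b ms ∷ mt ∷ mr ∷ mrest) k e) → Σ[ e' ∈ El ] keeps e e' × Σ[ rs' ∈ RS (mk b (Ext.ms⁺ E) ∷ mr ∷ mrest) k e' ] Pays rs rs' 1
        go (cons {e = y} ey (adj g₁ wR₁ wL₁) (cons {e = x} {e' = z} ex (adj g₂ wR₂ wL₂) rs)) with key≡ rs
        ... | refl with unflagged' wR₁ l<x
        ... | fry with winR E ex ey g₁ fry
        ... | y' , ew , (pa , pfl , pν , pb , pfr) , pay = y' , (pa , pfl , pν) , cons ew (adj (trans pb g₂) (λ _ → l≮r) (λ q → clash (wL₂ q) x≮r)) rs ,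
          linear 18 (λ w nx ny νy νx Q₁ Q₂ px py nw Q g₁ g₂ g' B Q' pr nr → # 1 ⊕ w ⊕ (nx ⊕ ny) ⊕ 3 ⊛ νy ⊕ Q₁ ≲ px ⊕ py ⊕ nw ⊕ 3 ⊛ νx ⊕ Q₂ ⇒ g' ⊕ νx ≲ g₂ ⊕ g₁ ⊕ νy ⇒ Q ≐ Q₁ ⊕ B ⇒ Q' ≐ Q₂ ⊕ B ⇒
            # 1 ⊕ (w ⊕ 3 ⊛ g' ⊕ pr) ⊕ (ny ⊕ (nx ⊕ nr)) ⊕ Q ≲ (py ⊕ 3 ⊛ g₁ ⊕ (px ⊕ 3 ⊛ g₂ ⊕ pr)) ⊕ (nw ⊕ nr) ⊕ Q')
            (posE ew) (negE ex) (negE ey) (El.ν y) (El.ν x) (price Γ * (phantomT mt + phantomF ms)) (price Γ * phantomF (Ext.ms⁺ E)) (posE ex) (posE ey) (negE ew)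
            (price Γ * (phantomF ms + (phantomT mt + (phantomT mr + phantomR mrest)))) (gap y x) (gap x z) (gap y' z) (price Γ * (phantomT mr + phantomR mrest))
            (price Γ * (phantomF (Ext.ms⁺ E) + (phantomT mr + phantomR mrest))) (posR rs) (negR rs)
            pay (gap-into-left z x y y' fry pfr pν)
            (spread (price Γ) (linear 4 (λ l x m r → l ⊕ (x ⊕ (m ⊕ r)) ≐ (x ⊕ l) ⊕ (m ⊕ r)) (phantomF ms) (phantomT mt) (phantomT mr) (phantomR mrest)))
            (spread (price Γ) refl)
      step-inner (skip inn) (ml ∷ ms') with step-inner inn ms'
      ... | ms , q , f = ml ∷ ms , +-monoʳ-≤ (phantomT ml) q , go
        where
        go : ∀ {k e} (rs : RS (ml ∷ ms) k e) → Σ[ e' ∈ El ] keeps e e' × Σ[ rs' ∈ RS (ml ∷ ms') k e' ] Pays rs rs' 1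
        go (cons {e = u} {e' = x} eu (adj g wR wL) rs) with f rs
        ... | x' , (pa , pfl , pν) , rs' , pay = u , (refl , refl , refl) , cons eu (adj (trans g (sym pa)) wR (λ q → wL (trans (sym pfl) q))) rs' ,
          linear 13 (λ pr pr' nr nr' Q₁ Q₂ Q Q' B g g' y z → # 1 ⊕ pr' ⊕ nr ⊕ Q₁ ≲ pr ⊕ nr' ⊕ Q₂ ⇒ g' ≐ g ⇒ Q ≐ B ⊕ Q₁ ⇒ Q' ≐ B ⊕ Q₂ ⇒
            # 1 ⊕ (y ⊕ 3 ⊛ g' ⊕ pr') ⊕ (z ⊕ nr) ⊕ Q ≲ (y ⊕ 3 ⊛ g ⊕ pr) ⊕ (z ⊕ nr') ⊕ Q')
            (posR rs) (posR rs') (negR rs) (negR rs') (price Γ * phantomR ms) (price Γ * phantomR ms')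
            (price Γ * (phantomT ml + phantomR ms)) (price Γ * (phantomT ml + phantomR ms')) (price Γ * phantomT ml) (gap u x) (gap u x') (posE eu) (negE eu)
            pay (gap-cong u x x' pfl pν) (spread (price Γ) refl) (spread (price Γ) refl)

      step-link : ∀ {ts ts'} → Link ts ts' → (ms' : MR ts') → Σ[ ms ∈ MR ts ] phantomR ms ≤ phantomR ms' × (∀ {k e} (rs : RS ms k e) →
                  Σ[ k' ∈ Key ] Σ[ e' ∈ El ] Σ[ rs' ∈ RS ms' k' e' ] Pays rs rs' 1)
      step-link (inner inn) ms' with step-inner inn ms'
      ... | ms , q , f = ms , q , λ {k} rs → k , proj₁ (f rs) , proj₂ (proj₂ (f rs))
      step-link (first {x} {node i kr cs} {rest} x≮r) (mk b (edge m p mt ms) ∷ mrest) = mt ∷ mk b ms ∷ mrest , ≤-trans (≤-reflexive (sym (+-assoc (phantomT mt) (phantomF ms) _))) (+-monoˡ-≤ (phantomR mrest) (+-monoˡ-≤ (phantomF ms) (m≤n+m _ (phantom m (mass mt))))) , go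
        where
        E = frontExt ms m p mt
        go : ∀ {k e} (rs : RS (mt ∷ mk b ms ∷ mrest) k e) → Σ[ k' ∈ Key ] Σ[ e' ∈ El ] Σ[ rs' ∈ RS (mk b (Ext.ms⁺ E) ∷ mrest) k' e' ] Pays rs rs' 1
        go (cons {e = x} {e' = y} ex (adj g₂ wR₂ wL₂) rs) with key≡ rs
        ... | refl with unflagged wL₂ x≮r
        ... | fly with win E ex (headE rs) g₂ fly
        ... | r' , R' , F' , ew , pay with rehead {e' = merge x y r' R' F'} rs ew refl refl (λ q → q) (λ z → refl)
        ... | rs' , pp , nn = kr , merge x y r' R' F' , rs' ,
          linear 18 (λ w nx ny νy νx Q₁ Q₂ px py nw Q g₂ B Q' pr pr' nr nr' → # 1 ⊕ w ⊕ (nx ⊕ ny) ⊕ 3 ⊛ νy ⊕ Q₁ ≲ px ⊕ py ⊕ nw ⊕ 3 ⊛ νx ⊕ Q₂ ⇒ νx ≲ g₂ ⊕ νy ⇒ Q ≐ Q₁ ⊕ B ⇒ Q' ≐ Q₂ ⊕ B ⇒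
            pr' ⊕ py ≐ pr ⊕ w ⇒ nr' ⊕ ny ≐ nr ⊕ nw ⇒
            # 1 ⊕ pr' ⊕ (nx ⊕ nr) ⊕ Q ≲ (px ⊕ 3 ⊛ g₂ ⊕ pr) ⊕ nr' ⊕ Q')
            (posE ew) (negE ex) (negE (headE rs)) (El.ν y) (El.ν x) (price Γ * (phantomT mt + phantomF ms)) (price Γ * phantomF (Ext.ms⁺ E)) (posE ex) (posE (headE rs)) (negE ew)
            (price Γ * (phantomT mt + (phantomF ms + phantomR mrest))) (gap x y) (price Γ * phantomR mrest)
            (price Γ * (phantomF (Ext.ms⁺ E) + phantomR mrest)) (posR rs) (posR rs') (negR rs) (negR rs')
            pay (gap-edge x y fly)
            (spread (price Γ) (sym (+-assoc (phantomT mt) (phantomF ms) (phantomR mrest)))) (spread (price Γ) refl)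
            pp nn

      inner-cnt : ∀ {ts ts'} → Inner ts ts' → cnts ts' ≡ cnts ts
      inner-cnt (last {node _ _ cs} {x} _) = cong suc (trans (cong (_+ 0) (kids-cnt v cs x)) (linear 2 (λ x c → x ⊕ c ⊕ # 0 ≐ c ⊕ (x ⊕ # 0)) (cnt x) (cnts cs)))
      inner-cnt (intoR {l} {x} {node _ _ cs} {rest} _ _ _) =
        linear 4 (λ l x c r → l ⊕ ((# 1 ⊕ (x ⊕ c)) ⊕ r) ≐ l ⊕ (x ⊕ ((# 1 ⊕ c) ⊕ r))) (cnt l) (cnt x) (cnts cs) (cnts rest)
      inner-cnt (intoL {node _ _ cs} {x} {r} {rest} _ _ _) = cong suc (trans (cong (_+ (cnt r + cnts rest)) (kids-cnt v cs x))
        (linear 3 (λ x c r → x ⊕ c ⊕ r ≐ c ⊕ (x ⊕ r)) (cnt x) (cnts cs) (cnt r + cnts rest)))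
      inner-cnt (skip {l} inn) = cong (cnt l +_) (inner-cnt inn)

      link-cnt : ∀ {ts ts'} → Link ts ts' → cnts ts' ≡ cnts ts
      link-cnt (inner inn) = inner-cnt inn
      link-cnt (first {x} {node _ _ cs} {rest} _) = linear 3 (λ x c r → (# 1 ⊕ (x ⊕ c)) ⊕ r ≐ x ⊕ ((# 1 ⊕ c) ⊕ r)) (cnt x) (cnts cs) (cnts rest)

    -- A whole round of linking

    module Loop (Γ : ℕ) where
      open Linking Γ

      linkPair-left : ∀ w a b → leftSmaller a b ≡ false → linkPair w a b ≡ attachLeft b a
      linkPair-left slim a b e = cong (λ c → if c then attachLeft a b else attachLeft b a) e
      linkPair-left smooth a b e = cong (λ c → if c then attachRight a b else attachLeft b a) e

      linkPair-right' : ∀ w i k cs b → leftSmaller (node i k cs) b ≡ true → linkPair w (node i k cs) b ≡ node i k (kids w cs b)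
      linkPair-right' slim i k cs b e = cong (λ c → if c then attachLeft (node i k cs) b else attachLeft b (node i k cs)) e
      linkPair-right' smooth i k cs b e = cong (λ c → if c then attachRight (node i k cs) b else attachLeft b (node i k cs)) e

      linkPair-right : ∀ a b → leftSmaller a b ≡ true → linkPair v a b ≡ rightLink a b
      linkPair-right (node i k cs) b e = linkPair-right' v i k cs b e

      step'-inner : ∀ l x rest → leftSmaller l x ≡ true → Inner (l ∷ x ∷ rest) (step' v l x rest)
      step'-inner l x [] h = subst (λ t → Inner (l ∷ x ∷ []) (t ∷ [])) (sym (linkPair-right l x h)) (last h)
      step'-inner l x (r ∷ rest) h = by (leftSmaller x r) (leftSmaller l r) refl refl
        where
        by : ∀ p q → leftSmaller x r ≡ p → leftSmaller l r ≡ q →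
          Inner (l ∷ x ∷ r ∷ rest) (if not p then (if q then l ∷ linkPair v x r ∷ rest else linkPair v l x ∷ r ∷ rest) else l ∷ step' v x r rest)
        by true q e e' = skip (step'-inner x r rest e)
        by false true e e' = subst (λ t → Inner (l ∷ x ∷ r ∷ rest) (l ∷ t ∷ rest)) (sym (linkPair-left v x r e)) (intoR h e e')
        by false false e e' = subst (λ t → Inner (l ∷ x ∷ r ∷ rest) (t ∷ r ∷ rest)) (sym (linkPair-right l x h)) (intoL h e e')

      step-is-link : ∀ a b rest → Link (a ∷ b ∷ rest) (step v (a ∷ b ∷ rest))
      step-is-link a b rest = by (leftSmaller a b) refl
        where
        by : ∀ p → leftSmaller a b ≡ p → Link (a ∷ b ∷ rest) (if not p then linkPair v a b ∷ rest else step' v a b rest)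
        by false e = subst (λ t → Link (a ∷ b ∷ rest) (t ∷ rest)) (sym (linkPair-left v a b e)) (first e)
        by true e = inner (step'-inner a b rest e)

      inner-length : ∀ {ts ts'} → Inner ts ts' → length ts ≡ suc (length ts')
      inner-length (last _) = refl
      inner-length (intoR _ _ _) = refl
      inner-length (intoL _ _ _) = refl
      inner-length (skip i) = cong suc (inner-length i)

      link-length : ∀ {ts ts'} → Link ts ts' → length ts ≡ suc (length ts')
      link-length (first _) = refl
      link-length (inner i) = inner-length i

      Final : List Tree → List Tree → ℕ → Set
      Final ts ts' c = Σ[ t ∈ Tree ] ts' ≡ t ∷ [] × cnt t ≡ cnts ts × ((mt : Mark t) → Σ[ ms ∈ MR ts ] phantomR ms ≤ phantomT mt × (∀ {k e} (rs : RS ms k e) →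
        Σ[ e' ∈ El ] Σ[ x ∈ Elem Γ mt e' ] c + posE x + negR rs + price Γ * phantomR ms ≤ posR rs + negE x + price Γ * phantomT mt))

      final-one : ∀ t → Final (t ∷ []) (t ∷ []) 0
      final-one t = t , refl , sym (+-identityʳ _) , λ mt → mt ∷ [] , ≤-reflexive (+-identityʳ _) , λ { (one x) → _ , x ,
        ≤-reflexive (cong₂ _+_ {posE x + negE x} refl (cong (price Γ *_) (+-identityʳ _))) }

      final-step : ∀ {ts ts' ts'' c} → Link ts ts' → Final ts' ts'' c → Final ts ts'' (suc c)
      final-step {c = c} l (t , eq , ec , f) = t , eq , trans ec (link-cnt l) , λ mt → proj₁ (step-link l (proj₁ (f mt))) , ≤-trans (proj₁ (proj₂ (step-link l (proj₁ (f mt))))) (proj₁ (proj₂ (f mt))) , λ rs → go mt {rs = rs} (proj₂ (proj₂ (step-link l (proj₁ (f mt)))) rs)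
        where
        go : ∀ (mt : Mark t) {k e} {rs : RS (proj₁ (step-link l (proj₁ (f mt)))) k e} → Σ[ k' ∈ _ ] Σ[ e' ∈ El ] Σ[ rs' ∈ RS (proj₁ (f mt)) k' e' ] Pays rs rs' 1 →
             Σ[ e' ∈ El ] Σ[ x ∈ Elem Γ mt e' ] suc c + posE x + negR rs + price Γ * phantomR (proj₁ (step-link l (proj₁ (f mt)))) ≤ posR rs + negE x + price Γ * phantomT mt
        go mt {rs = rs} (k' , e' , rs' , pay) with proj₂ (proj₂ (f mt)) rs'
        ... | e'' , x , pay' = e'' , x ,
          linear 10 (λ c p' n Q p n' Q' px nx Q'' → # 1 ⊕ p' ⊕ n ⊕ Q ≲ p ⊕ n' ⊕ Q' ⇒ c ⊕ px ⊕ n' ⊕ Q' ≲ p' ⊕ nx ⊕ Q'' ⇒ # 1 ⊕ c ⊕ px ⊕ n ⊕ Q ≲ p ⊕ nx ⊕ Q'')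
            c (posR rs') (negR rs) (price Γ * phantomR (proj₁ (step-link l (proj₁ (f mt))))) (posR rs) (negR rs') (price Γ * phantomR (proj₁ (f mt))) (posE x) (negE x) (price Γ * phantomT mt)
            pay pay'

      fuel-final : ∀ f t ts → length ts ≤ f → Final (t ∷ ts) (linkFuel v f (t ∷ ts)) (length ts)
      fuel-final zero t [] _ = final-one t
      fuel-final (suc f) t [] _ = fuel-final f t [] z≤n
      fuel-final (suc f) a (b ∷ rest) (s≤s h) = by (step v (a ∷ b ∷ rest)) (step-is-link a b rest)
        where
        by : ∀ ts' → Link (a ∷ b ∷ rest) ts' → Final (a ∷ b ∷ rest) (linkFuel v f ts') (suc (length rest))
        by [] l with link-length l
        ... | ()
        by (t ∷ ts') l = subst (Final (a ∷ b ∷ rest) (linkFuel v f (t ∷ ts'))) (cong suc (sym eq)) (final-step l (fuel-final f t ts' (subst (_≤ f) eq h)))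
          where
          eq : length rest ≡ length ts'
          eq = suc-injective (suc-injective (link-length l))

      -- The last tree settles with sentinel 0. What remains of its debt, 3 ν + 12 R₀, is at most 15
      -- Γ.
      Ending : Tree → List Tree → Set
      Ending t ts = Σ[ t' ∈ Tree ] linkAll v (t ∷ ts) ≡ t' ∷ [] × linkCost v (t ∷ ts) ≡ length ts × cnt t' ≡ cnts (t ∷ ts) × ((mt : Mark t') → Σ[ ms ∈ MR (t ∷ ts) ] phantomR ms ≤ phantomT mt × (∀ {k e} (rs : RS ms k e) →
        Σ[ a ∈ Ann mt ] length ts + pos 0 a + negR rs + price Γ * phantomR ms ≤ posR rs + neg a + 15 * Γ + price Γ * phantomT mt))

      linkAll-final : ∀ t ts → Ending t ts
      linkAll-final t ts with fuel-final (suc (length ts)) t ts (n≤1+n _)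
      ... | t' , eq , ec , f = t' , eq , cong (λ z → suc (length ts) ∸ length z) eq , ec , λ mt → proj₁ (f mt) , proj₁ (proj₂ (f mt)) , λ rs → go mt {rs = rs} (proj₂ (proj₂ (f mt)) rs)
        where
        when-keep : ∀ b x → 12 * when b (x ⊔ 0) ≡ 12 * when b x
        when-keep b x = cong (λ z → 12 * when b z) (⊔-identityʳ x)
        when≤ : ∀ b x → when b x ≤ x
        when≤ true x = ≤-refl
        when≤ false x = z≤n
        go : ∀ mt {k e} {ms : MR (t ∷ ts)} {rs : RS ms k e} {Q} → Σ[ e' ∈ El ] Σ[ x ∈ Elem Γ mt e' ] length ts + posE x + negR rs + Q ≤ posR rs + negE x + price Γ * phantomT mt →
             Σ[ a ∈ Ann mt ] length ts + pos 0 a + negR rs + Q ≤ posR rs + neg a + 15 * Γ + price Γ * phantomT mt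
        go mt {rs = rs} {Q} (e' , x , pay) with settle x
        ... | a , p , n = a , linear 16 (λ c px nr Q pr nx Q' pa ve s s' na ν R wR G →
            c ⊕ px ⊕ nr ⊕ Q ≲ pr ⊕ nx ⊕ Q' ⇒ pa ⊕ ve ⊕ s ≲ px ⊕ s' ⇒ s' ≐ s ⇒ na ⊕ (3 ⊛ ν ⊕ 12 ⊛ wR) ≐ nx ⇒ wR ≲ R ⇒ ν ≲ R ⊖ # 1 ⇒ R ≲ G ⇒
            c ⊕ pa ⊕ nr ⊕ Q ≲ pr ⊕ na ⊕ 15 ⊛ G ⊕ Q')
          (length ts) (posE x) (negR rs) Q (posR rs) (negE x) (price Γ * phantomT mt) (pos 0 a) (value e') (12 * when (El.mort e') (El.R₀ e')) (12 * when (El.mort e') (El.R₀ e' ⊔ 0))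
          (neg a) (El.ν e') (El.R₀ e') (when (El.mort e') (El.R₀ e')) Γ
          pay (p 0) (when-keep (El.mort e') (El.R₀ e')) n (when≤ (El.mort e') (El.R₀ e')) (Inv.ν≤ (elem-inv x)) (Inv.R₀≤Γ (elem-inv x))

    -- The state at the start of a round

    mortal : ∀ {t} → Mark t → Bool
    mortal (mk b _) = b

    -- The state of a tree at the start of a round, hanging at level ρ between gaps
    -- of levels a and b.
    fresh : ∀ {t} → Mark t → ℕ → ℕ → ℕ → ℕ → El
    fresh mt ρ ν a b = el (mortal mt) false false a b o o (bits (ρ ∸ o)) ν (bits (ρ ∸ o) + δ) δ
      where
      o = bits (mass mt)
      δ = (a ⊔ b) ∸ ρ

    fresh-inv : ∀ {Γ t} (mt : Mark t) ρ ν a b → ν ≤ bits (ρ ∸ bits (mass mt)) ∸ 1 → ρ ≤ a → ρ ≤ b →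
                bits a ≤ Γ → bits b ≤ Γ → Inv Γ (fresh mt ρ ν a b)
    fresh-inv {Γ} mt ρ ν a b h ρ≤a ρ≤b a≤Γ b≤Γ = inv ≤-refl (λ _ _ → refl) (λ _ → bits-mono (∸-monoˡ-≤ o ρ≤a)) (λ _ → bits-mono (∸-monoˡ-≤ o ρ≤b)) h
      (≤-trans (bits≤n _) (linear 4 (λ a b r o → r ≲ a ⇒ r ≲ b ⇒ mx a b ⊖ mx (mn a b) o ≲ (mx a b ⊖ r) ⊕ (o ⊖ mn a b)) a b ρ o ρ≤a ρ≤b))
      (λ _ → ≤-trans (≤-reflexive (cong (bits (ρ ∸ o) +_) (n∸n≡0 o))) (+-monoʳ-≤ (bits (ρ ∸ o)) z≤n))
      (λ _ → level (linear 4 (λ a b r o → mn a b ⊖ o ≲ (r ⊖ o) ⊕ (mx a b ⊖ r)) a b ρ o))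
      (λ _ → ≤-trans (level (linear 4 (λ a b r o → mx a b ⊖ o ≲ (r ⊖ o) ⊕ (mx a b ⊖ r)) a b ρ o)) (m≤n+m (bits (ρ ∸ o) + δ) δ))
      a≤Γ b≤Γ (≤-trans (bits-mono (≤-trans (m∸n≤m ρ o) ρ≤a)) a≤Γ)
      where
      o = bits (mass mt)
      δ = (a ⊔ b) ∸ ρ
      level : ∀ {x} → x ≤ (ρ ∸ o) + δ → bits x ≤ bits (ρ ∸ o) + δ
      level h = ≤-trans (bits-sub (ρ ∸ o) δ h) (+-monoʳ-≤ (bits (ρ ∸ o)) (bits≤n δ))

    -- The amount 40 R₀ was stored on the edge and 12 R₀ is lent by `debt`. Everything else is
    -- bounded by the jump from ρ to the higher adjacent level and by the excess. If R₀ = 0, the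
    -- excess is positive and pays for the initial credit of 2.
    fresh-value : ∀ {t} (mt : Mark t) ρ ν a b → ρ ≤ a → ρ ≤ b → let R₀ = bits (ρ ∸ bits (mass mt)) in
      value (fresh mt ρ ν a b) ≤ 40 * R₀ + 12 * when (mortal mt) R₀ + 116 * ((a ⊔ b) ∸ ρ) + 130 * (suc (bits (mass mt)) ∸ ρ)
    fresh-value mt ρ ν a b ρ≤a ρ≤b = linear 11 (λ n₁ n₂ w F d ov c R wR δ x →
        n₁ ≲ R ⊕ δ ⇒ n₂ ≲ δ ⇒ w ≲ wR ⊕ δ ⇒ d ≲ δ ⇒ ov ≲ 2 ⊛ x ⇒ c ≲ 2 ⊛ x ⇒
        40 ⊛ (n₁ ⊕ n₂) ⊕ 12 ⊛ w ⊕ 12 ⊛ δ ⊕ 12 ⊛ d ⊕ 64 ⊛ ov ⊕ c ≲ 40 ⊛ R ⊕ 12 ⊛ wR ⊕ 116 ⊛ δ ⊕ 130 ⊛ x)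
      (bits ((a ∸ o) ⊓ (b ∸ o))) (bits (dist (a ∸ o) (b ∸ o))) (when (mortal mt) (R₀ + δ)) δ (dist a b) ((o ∸ a) + (o ∸ b))
      (credit (mortal mt) false false R₀ o o) R₀ (when (mortal mt) R₀) δ x
      (≤-trans (bits-sub (ρ ∸ o) δ (linear 4 (λ a b r o → mn (a ⊖ o) (b ⊖ o) ≲ (r ⊖ o) ⊕ (mx a b ⊖ r)) a b ρ o)) (+-monoʳ-≤ R₀ (bits≤n δ)))
      (≤-trans (bits≤n _) (linear 4 (λ a b r o → r ≲ a ⇒ r ≲ b ⇒ dst (a ⊖ o) (b ⊖ o) ≲ mx a b ⊖ r) a b ρ o ρ≤a ρ≤b))
      (rise (mortal mt)) (linear 3 (λ a b r → r ≲ a ⇒ r ≲ b ⇒ dst a b ≲ mx a b ⊖ r) a b ρ ρ≤a ρ≤b)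
      (linear 4 (λ a b r o → r ≲ a ⇒ r ≲ b ⇒ (o ⊖ a) ⊕ (o ⊖ b) ≲ 2 ⊛ ((# 1 ⊕ o) ⊖ r)) a b ρ o ρ≤a ρ≤b)
      (pre R₀ refl)
      where
      o = bits (mass mt)
      δ = (a ⊔ b) ∸ ρ
      R₀ = bits (ρ ∸ o)
      x = suc o ∸ ρ
      rise : ∀ m → when m (R₀ + δ) ≤ when m R₀ + δ
      rise true = ≤-refl
      rise false = z≤n
      pre : ∀ R → R ≡ R₀ → credit (mortal mt) false false R o o ≤ 2 * x
      pre zero e = linear 3 (λ r o z → z ≐ r ⊖ o ⇒ z ≲ # 0 ⇒ # 2 ≲ 2 ⊛ ((# 1 ⊕ o) ⊖ r)) ρ o (ρ ∸ o) refl (≤-reflexive (bits-zero (ρ ∸ o) (≤-reflexive (sym e))))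
      pre (suc R) e = z≤n

    startE : ∀ {Γ t} {mt : Mark t} (an : Ann mt) ρ ν a b → ν ≤ bits (ρ ∸ bits (mass mt)) ∸ 1 → ρ ≤ a → ρ ≤ b →
             bits a ≤ Γ → bits b ≤ Γ → let R₀ = bits (ρ ∸ bits (mass mt)) in
             Σ[ x ∈ Elem Γ mt (fresh mt ρ ν a b) ]
               posE x + (3 * ν + neg an) ≤ 40 * R₀ + pos R₀ an + negE x + (116 * ((a ⊔ b) ∸ ρ) + 130 * (suc (bits (mass mt)) ∸ ρ))
    startE {mt = mk {i} {k} m ms} (ann {fs = fs} af vl ex) ρ ν a b h ρ≤a ρ≤b a≤Γ b≤Γ =
      elem af (fresh-inv (mk {i} {k} m ms) ρ ν a b h ρ≤a ρ≤b a≤Γ b≤Γ) refl refl (bits-pos (s≤s z≤n)) vl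
        (≤-trans ex (m≤m+n _ _)) ,
      linear 10 (λ u pf ve ν bs nf R wR d x → ve ≲ R ⊕ wR ⊕ d ⊕ x ⇒ (u ⊕ pf ⊕ ve) ⊕ (3 ⊛ ν ⊕ (bs ⊕ nf)) ≲ R ⊕ (u ⊕ pf) ⊕ (bs ⊕ nf ⊕ (3 ⊛ ν ⊕ wR)) ⊕ (d ⊕ x))
        (6 * when m (up (bits (ρ ∸ bits (suc (masses ms)))) fs)) (posF af) (value (fresh (mk {i} {k} m ms) ρ ν a b)) ν (18 * when m (bits (suc (masses ms)))) (negF af)
        (40 * bits (ρ ∸ bits (suc (masses ms)))) (12 * when m (bits (ρ ∸ bits (suc (masses ms))))) (116 * ((a ⊔ b) ∸ ρ)) (130 * (suc (bits (suc (masses ms))) ∸ ρ))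
        (fresh-value (mk {i} {k} m ms) ρ ν a b ρ≤a ρ≤b)

    data Roots : ∀ {ts} → MR ts → Set where
      [] : Roots []
      _∷_ : ∀ {t ts} {mt : Mark t} {ms : MR ts} → Ann mt → Roots ms → Roots (mt ∷ ms)

    rootsP rootsN : ∀ {ts} {ms : MR ts} → Roots ms → ℕ
    rootsP [] = 0
    rootsP (a ∷ as) = pos 0 a + rootsP as
    rootsN [] = 0
    rootsN (a ∷ as) = neg a + rootsN as

    weigh : (ℕ → ℕ) → ∀ {ts} → MR ts → ℕ
    weigh f [] = 0
    weigh f (mt ∷ ms) = f (mass mt) + weigh f ms

    rank⁺ : ℕ → ℕ
    rank⁺ s = suc (bits s)

    -- All edges to the children of a deleted node are real.
    rootsOf : ∀ cs {rs} → MR (cs ++ rs) → MR rs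
    rootsOf [] ms = ms
    rootsOf (c ∷ cs) (mt ∷ ms) = rootsOf cs ms

    kidsOf : ∀ cs {rs} → MR (cs ++ rs) → Marks cs
    kidsOf [] ms = []
    kidsOf (c ∷ cs) (mt ∷ ms) = edge (mass mt) (mass≤cnt mt) mt (kidsOf cs ms)

    module Build (Γ : ℕ) where
      open Linking Γ

      -- A list at the start of a round, with left gap of level g and first charge
      -- ν; it takes over the potential P and the debt N of its trees at the price B.
      data Seq : ∀ {ts} → MR ts → ℕ → ℕ → ℕ → ℕ → ℕ → Set where
        none : ∀ {g P N B} → N ≤ P + B → Seq [] g 0 P N B
        some : ∀ {t ts} {mt : Mark t} {ms : MR ts} {e g ν P N B} → (El.a e ≡ g × El.fl e ≡ false × El.ν e ≡ ν) →
               (rs : RS (mt ∷ ms) (key t) e) → posR rs + N ≤ P + negR rs + B → Seq (mt ∷ ms) g ν P N B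

      extend : ∀ {t ts} {mt : Mark t} {ms : MR ts} {a ν g ν' P N B p n B'} ρ (x : Elem Γ mt (fresh mt ρ ν a g)) → posE x + n ≤ p + negE x + B' →
               Seq ms g ν' P N B → Seq (mt ∷ ms) a ν (p + P) (n + N) (B' + 3 * dist ν ν' + B)
      extend {mt = mt} {[]} {ν = ν} {P = P} {N} {B} {p} {n} {B'} ρ x h (none h') = some (refl , refl , refl) (one x) (
        linear 9 (λ px n p nx B' N P B d → px ⊕ n ≲ p ⊕ nx ⊕ B' ⇒ N ≲ P ⊕ B ⇒ px ⊕ (n ⊕ N) ≲ (p ⊕ P) ⊕ nx ⊕ (B' ⊕ d ⊕ B))
          (posE x) n p (negE x) B' N P B (3 * dist ν 0) h h')
      extend {mt = mt} {_ ∷ _} {a} {ν} {g} {ν'} {P = P} {N} {B} {p} {n} {B'} ρ x h (some {e = e} (refl , fl , refl) rs h') =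
        some (refl , refl , refl) (cons x (adj refl (λ ()) (λ q → clash q fl)) rs) (
        linear 12 (λ px n p nx B' N P B g pr nr g' → px ⊕ n ≲ p ⊕ nx ⊕ B' ⇒ pr ⊕ N ≲ P ⊕ nr ⊕ B ⇒ g' ≐ g ⇒
            (px ⊕ 3 ⊛ g' ⊕ pr) ⊕ (n ⊕ N) ≲ (p ⊕ P) ⊕ (nx ⊕ nr) ⊕ (B' ⊕ 3 ⊛ g ⊕ B))
          (posE x) n p (negE x) B' N P B (dist ν (El.ν e)) (posR rs) (negR rs) (gap (fresh mt ρ ν a g) e) h h' gap≡)
        where
        gap≡ : gap (fresh mt ρ ν a g) e ≡ dist ν (El.ν e)
        gap≡ = trans (cong (λ f → (El.ν e ∸ ν) + unless f (ν ∸ El.ν e)) fl) (+-comm (El.ν e ∸ ν) _)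

      seq-mono : ∀ {ts} {ms : MR ts} {g ν P N B P' N' B'} → P + B ≤ P' + B' → N' ≤ N → Seq ms g ν P N B → Seq ms g ν P' N' B'
      seq-mono h k (none h') = none (≤-trans k (≤-trans h' h))
      seq-mono {P = P} {N} {B} {P'} {N'} {B'} h k (some eqs rs h') = some eqs rs (linear 8 (λ P B P' B' N N' p n → P ⊕ B ≲ P' ⊕ B' ⇒ N' ≲ N ⇒ p ⊕ N ≲ P ⊕ n ⊕ B ⇒ p ⊕ N' ≲ P' ⊕ n ⊕ B')
          P B P' B' N N' (posR rs) (negR rs) h k h')

      -- A root is treated as a child at level 0 with charge 0. Its excess is then one more than its
      -- rank, which is why a heap holds 130 `rank⁺` for each root.
      seq-roots : ∀ {ts} {ms : MR ts} (as : Roots ms) g → bits g ≤ Γ → Seq ms g 0 (rootsP as) (rootsN as) (130 * weigh rank⁺ ms + 116 * g)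
      seq-roots [] g _ = none z≤n
      seq-roots {ms = mt ∷ ms} (a ∷ as) g h = seq-mono {P = 40 * bits (0 ∸ o) + pos (bits (0 ∸ o)) a + rootsP as} {N = 3 * 0 + neg a + rootsN as}
          (linear 7 (λ z z' p P B' x g → z ≲ # 0 ⇒ z' ≐ p ⇒ (40 ⊛ z ⊕ z' ⊕ P) ⊕ ((116 ⊛ g ⊕ 130 ⊛ x) ⊕ # 0 ⊕ (130 ⊛ B' ⊕ # 0)) ≲ (p ⊕ P) ⊕ (130 ⊛ (x ⊕ B') ⊕ 116 ⊛ g))
            (bits (0 ∸ o)) (pos (bits (0 ∸ o)) a) (pos 0 a) (rootsP as) (weigh rank⁺ ms) (suc o) g
            (≤-reflexive r0) (cong (λ z → pos z a) r0))
          ≤-refl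
          (subst (λ z → Seq (mt ∷ _) g 0 (40 * bits (0 ∸ o) + pos (bits (0 ∸ o)) a + rootsP as) (3 * 0 + neg a + rootsN as) (116 * z + 130 * suc o + 3 * dist 0 0 + (130 * weigh rank⁺ ms + 116 * 0))) (⊔-identityʳ g)
            (extend {p = 40 * bits (0 ∸ o) + pos (bits (0 ∸ o)) a} {n = 3 * 0 + neg a} {B' = 116 * ((g ⊔ 0) ∸ 0) + 130 * (suc o ∸ 0)} 0 (proj₁ st) (proj₂ st) (seq-roots as 0 (≤-trans (≤-reflexive bits0) z≤n))))
        where
        o = bits (mass mt)
        r0 : bits (0 ∸ o) ≡ 0
        r0 = trans (cong bits (0∸n≡0 o)) bits0
        st = startE a 0 0 g 0 z≤n z≤n z≤n h (≤-trans (≤-reflexive bits0) z≤n)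

      -- The level of the gap behind a child.
      after : ℕ → Bool → ℕ → List Lab → ℕ
      after top l ρ [] = ρ
      after top true ρ (lab true _ _ _ ∷ _) = ρ
      -- Between two children on the same side the gap takes the larger of their levels. At the
      -- bottom of the valley it takes `top`, which lies above both, so that no child's level
      -- exceeds those of its gaps.
      after top true ρ (lab false _ _ _ ∷ _) = top
      after top false ρ (lab _ ρ' _ _ ∷ _) = ρ'

      head-ν : List Lab → ℕ
      head-ν [] = 0
      head-ν (lab _ _ ν _ ∷ _) = ν

      module Kids (top : ℕ) where
        jumps final : ℕ → List Lab → ℕ
        jumps g [] = 0
        jumps g (lab l ρ _ _ ∷ fs) = ((g ⊔ after top l ρ fs) ∸ ρ) + jumps (after top l ρ fs) fs
        final g [] = g
        final g (lab l ρ _ _ ∷ fs) = final (after top l ρ fs) fs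

        tv : List Lab → ℕ
        tv [] = 0
        tv (lab _ _ ν _ ∷ fs) = dist ν (head-ν fs) + tv fs

        data Ok : ℕ → List Lab → Set where
          [] : ∀ {g} → Ok g []
          kid : ∀ {g l ρ ν m fs} → ρ ≤ g → g ≤ top → ρ ≤ after top l ρ fs → after top l ρ fs ≤ top → Ok (after top l ρ fs) fs → Ok g (lab l ρ ν m ∷ fs)

        seq-kids : bits top ≤ Γ → ∀ cs {rs} (ms : MR (cs ++ rs)) {fs} (af : Anns (kidsOf cs ms) fs) {g} → Ok g fs → ∀ {P N B} → Seq (rootsOf cs ms) (final g fs) 0 P N B →
                   Seq ms g (head-ν fs) (posF af + P) (negF af + N) (116 * jumps g fs + 130 * excess fs + 3 * tv fs + B)
        seq-kids h [] ms [] ok s = s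
        seq-kids h (c ∷ cs) (mt ∷ ms) {lab _ _ _ _ ∷ fs} (edge l ρ ν hν a af) {g} (kid ρ≤g g≤t ρ≤n n≤t ok) {P} {N} {B} s =
          seq-mono {P = 40 * R₀ + pos R₀ a + (posF af + P)} {N = 3 * ν + neg a + (negF af + N)} {B = 116 * ((g ⊔ b) ∸ ρ) + 130 * (suc (bits m) ∸ ρ) + 3 * dist ν (head-ν fs) + (116 * jumps b fs + 130 * excess fs + 3 * tv fs + B)}
            (linear 13 (λ R pa pf P sn pa' j x t j' x' t' B → sn ≐ R ⇒ pa' ≐ pa ⇒
               (40 ⊛ R ⊕ pa ⊕ (pf ⊕ P)) ⊕ ((116 ⊛ j ⊕ 130 ⊛ x) ⊕ 3 ⊛ t ⊕ (116 ⊛ j' ⊕ 130 ⊛ x' ⊕ 3 ⊛ t' ⊕ B)) ≲ (40 ⊛ sn ⊕ pa' ⊕ pf ⊕ P) ⊕ (116 ⊛ (j ⊕ j') ⊕ 130 ⊛ (x ⊕ x') ⊕ 3 ⊛ (t ⊕ t') ⊕ B))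
              R₀ (pos R₀ a) (posF af) P (sent ρ m m) (pos (sent ρ m m) a) ((g ⊔ b) ∸ ρ) (suc (bits m) ∸ ρ) (dist ν (head-ν fs)) (jumps b fs) (excess fs) (tv fs) B
              (sent-real {Γ} ρ m m refl-b) (cong (λ z → pos z a) (sent-real {Γ} ρ m m refl-b)))
            (linear 5 (λ ν c na nf N → c ≐ 3 ⊛ ν ⇒ (c ⊕ na ⊕ nf) ⊕ N ≲ (3 ⊛ ν ⊕ na) ⊕ (nf ⊕ N)) ν (charge ν m m) (neg a) (negF af) N (charge-real {Γ} ν m m refl-b))
            (extend {p = 40 * R₀ + pos R₀ a} {n = 3 * ν + neg a} {B' = 116 * ((g ⊔ b) ∸ ρ) + 130 * (suc (bits m) ∸ ρ)} ρ (proj₁ st) (proj₂ st) (seq-kids h cs ms af ok s))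
          where
          m = mass mt
          b = after top l ρ fs
          R₀ = bits (ρ ∸ bits m)
          refl-b : (m ≡ᵇ m) ≡ true
          refl-b = by (m ≡ᵇ m) (≡⇒≡ᵇ m m refl)
            where
            by : ∀ b → T b → b ≡ true
            by true _ = refl
          st = startE a ρ ν g b hν ρ≤g ρ≤n (≤-trans (bits-mono g≤t) h) (≤-trans (bits-mono n≤t) h)

        entry : ℕ → List Lab → ℕ
        entry hi [] = hi
        entry hi (lab true _ _ _ ∷ _) = hi
        entry hi (lab false _ _ _ ∷ _) = top

        after-left : ∀ ρ fs → after top true ρ fs ≡ entry ρ fs
        after-left ρ [] = refl
        after-left ρ (lab true _ _ _ ∷ _) = refl
        after-left ρ (lab false _ _ _ ∷ _) = refl

        entry-≥ : ∀ {ρ} fs → ρ ≤ top → ρ ≤ entry ρ fs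
        entry-≥ [] h = ≤-refl
        entry-≥ (lab true _ _ _ ∷ _) h = ≤-refl
        entry-≥ (lab false _ _ _ ∷ _) h = h

        entry-≤ : ∀ {ρ} fs → ρ ≤ top → entry ρ fs ≤ top
        entry-≤ [] h = h
        entry-≤ (lab true _ _ _ ∷ _) h = h
        entry-≤ (lab false _ _ _ ∷ _) h = ≤-refl

        head≤ : ℕ → List Lab → Set
        head≤ g [] = ⊤
        head≤ g (lab _ ρ _ _ ∷ _) = ρ ≤ g

        ok-asc : ∀ {lo fs g} → Asc top lo fs → head≤ g fs → g ≤ top → Ok g fs
        ok-asc [] h g≤ = []
        ok-asc {fs = lab false ρ _ _ ∷ []} (right p q []) h g≤ = kid h g≤ ≤-refl q []
        ok-asc {fs = lab false ρ _ _ ∷ lab _ ρ' _ _ ∷ fs} (right p q a@(right p' q' _)) h g≤ = kid h g≤ p' q' (ok-asc a ≤-refl q')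

        ok-valley : ∀ {hi fs} → hi ≤ top → Valley top hi fs → Ok (entry hi fs) fs
        ok-valley h (left {ρ = ρ} {fs = fs} p v) = kid p h (≤-trans (entry-≥ fs ρ≤) (≤-reflexive (sym (after-left ρ fs)))) (≤-trans (≤-reflexive (after-left ρ fs)) (entry-≤ fs ρ≤))
          (subst (λ g → Ok g fs) (sym (after-left ρ fs)) (ok-valley ρ≤ v))
          where
          ρ≤ : ρ ≤ top
          ρ≤ = ≤-trans p h
        ok-valley h (asc []) = []
        ok-valley h (asc a@(right p q _)) = ok-asc a q ≤-refl

        final≤ : ∀ {g fs} → g ≤ top → Ok g fs → final g fs ≤ top
        final≤ h [] = h
        final≤ h (kid _ _ _ n≤ ok) = final≤ n≤ ok

        -- Each gap between right children has the level of the child behind it. The jumps therefore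
        -- telescope, apart from the descent from the first gap.
        jumps-asc : ∀ {lo fs g} → Asc top lo fs → head≤ g fs → g ≤ top → jumps g fs ≤ 2 * top
        jumps-asc a h g≤ = ≤-trans (by a h g≤) (linear 2 (λ t g → g ≲ t ⇒ g ⊕ t ≲ 2 ⊛ t) top _ g≤)
          where
          by' : ∀ {lo fs ρ ν m g} → Asc top lo (lab false ρ ν m ∷ fs) → jumps g (lab false ρ ν m ∷ fs) ≤ (g ∸ ρ) + (top ∸ ρ)
          by' {fs = []} {ρ} {g = g} (right p q []) = linear 3 (λ g r t → (mx g r ⊖ r) ⊕ # 0 ≲ (g ⊖ r) ⊕ (t ⊖ r)) g ρ top
          by' {fs = lab false ρ' ν' m' ∷ fs} {ρ} {g = g} (right p q a@(right p' q' _)) =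
            linear 5 (λ g r r' t j → r ≲ r' ⇒ r' ≲ t ⇒ j ≲ (r' ⊖ r') ⊕ (t ⊖ r') ⇒ (mx g r' ⊖ r) ⊕ j ≲ (g ⊖ r) ⊕ (t ⊖ r)) g ρ ρ' top (jumps ρ' (lab false ρ' ν' m' ∷ fs)) p' q' (by' a)
          by : ∀ {lo fs g} → Asc top lo fs → head≤ g fs → g ≤ top → jumps g fs ≤ g + top
          by [] _ _ = z≤n
          by {fs = lab false ρ _ _ ∷ fs} {g} a@(right p q _) _ _ = ≤-trans (by' a) (+-mono-≤ (m∸n≤m g ρ) (m∸n≤m top ρ))

        jumps-valley : ∀ {hi fs} → hi ≤ top → Valley top hi fs → jumps (entry hi fs) fs ≤ hi + 3 * top
        jumps-valley h (asc []) = z≤n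
        jumps-valley {hi} h (asc a@(right p q _)) = ≤-trans (jumps-asc a q ≤-refl) (linear 2 (λ t h → 2 ⊛ t ≲ h ⊕ 3 ⊛ t) top hi)
        jumps-valley {hi} h (left {ρ = ρ} {fs = fs} p v) = subst (λ g → ((hi ⊔ g) ∸ ρ) + jumps g fs ≤ hi + 3 * top) (sym (after-left ρ fs)) (by fs v)
          where
          ρ≤ : ρ ≤ top
          ρ≤ = ≤-trans p h
          by : ∀ fs → Valley top ρ fs → ((hi ⊔ entry ρ fs) ∸ ρ) + jumps (entry ρ fs) fs ≤ hi + 3 * top
          by [] v = linear 3 (λ h r t → (mx h r ⊖ r) ⊕ # 0 ≲ h ⊕ 3 ⊛ t) hi ρ top
          by fs@(lab true _ _ _ ∷ _) v = linear 4 (λ h r t j → r ≲ h ⇒ j ≲ r ⊕ 3 ⊛ t ⇒ (mx h r ⊖ r) ⊕ j ≲ h ⊕ 3 ⊛ t) hi ρ top (jumps ρ fs) p (jumps-valley ρ≤ v)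
          by fs@(lab false _ _ _ ∷ _) (asc a@(right _ q _)) = linear 4 (λ h r t j → h ≲ t ⇒ j ≲ 2 ⊛ t ⇒ (mx h t ⊖ r) ⊕ j ≲ h ⊕ 3 ⊛ t) hi ρ top (jumps top fs) h (jumps-asc a q ≤-refl)

        data Small : List Lab → Set where
          [] : Small []
          _∷_ : ∀ {l ρ ν m fs} → ν ≤ bits top → Small fs → Small (lab l ρ ν m ∷ fs)

        small-ν : ∀ {ts} {ms : Marks ts} {hi fs} → hi ≤ top → Valley top hi fs → Anns ms fs → Small fs
        small-ν h v [] = []
        small-ν h (left p v) (edge {m = m} l ρ ν q _ af) = ≤-trans q (≤-trans (m∸n≤m _ 1) (bits-mono (≤-trans (m∸n≤m ρ (bits m)) (≤-trans p h)))) ∷ small-ν (≤-trans p h) v af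
        small-ν h (asc (right p r a)) (edge {m = m} l ρ ν q _ af) = ≤-trans q (≤-trans (m∸n≤m _ 1) (bits-mono (≤-trans (m∸n≤m ρ (bits m)) r))) ∷ small-ν {hi = 0} z≤n (asc (asc-lower z≤n a)) af

        tv-asc : ∀ {lo fs l ρ ν m} → Asc top lo fs → tv (lab l ρ ν m ∷ fs) ≤ 2 * upA 0 ν fs + ν
        tv-asc {ν = ν} [] = linear 1 (λ n → dst n (# 0) ⊕ # 0 ≲ 2 ⊛ (# 0 ⊖ n) ⊕ n) ν
        tv-asc {fs = lab false ρ' ν' m' ∷ fs} {ν = ν} (right p q a) =
          linear 4 (λ n n' t u → t ≲ 2 ⊛ u ⊕ n' ⇒ dst n n' ⊕ t ≲ 2 ⊛ ((n' ⊖ n) ⊕ u) ⊕ n) ν ν' (tv (lab false ρ' ν' m' ∷ fs)) (upA 0 ν' fs) (tv-asc {l = false} {ρ'} {ν'} {m'} a)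

        tv-valley : ∀ {hi fs l ρ ν m} → Valley top hi fs → Small (lab l ρ ν m ∷ fs) → tv (lab l ρ ν m ∷ fs) + ν ≤ 2 * upD 0 ν fs + 4 * bits top
        tv-valley {ν = ν} (asc []) (p ∷ []) = linear 2 (λ n G → n ≲ G ⇒ (dst n (# 0) ⊕ # 0) ⊕ n ≲ # 0 ⊕ 4 ⊛ G) ν (bits top) p
        tv-valley {fs = lab false ρ' ν' m' ∷ fs} {ν = ν} (asc (right _ _ a)) (p ∷ p' ∷ _) =
          linear 5 (λ n n' t u G → t ≲ 2 ⊛ u ⊕ n' ⇒ n ≲ G ⇒ n' ≲ G ⇒ (dst n n' ⊕ t) ⊕ n ≲ 2 ⊛ u ⊕ 4 ⊛ G) ν ν' (tv (lab false ρ' ν' m' ∷ fs)) (upA 0 ν' fs) (bits top) (tv-asc {l = false} {ρ'} {ν'} {m'} a) p p'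
        tv-valley {fs = lab true ρ' ν' m' ∷ fs} {ν = ν} (left _ v) (p ∷ q@(p' ∷ _)) =
          linear 5 (λ n n' t u G → t ⊕ n' ≲ 2 ⊛ u ⊕ 4 ⊛ G ⇒ (dst n n' ⊕ t) ⊕ n ≲ 2 ⊛ ((n ⊖ n') ⊕ u) ⊕ 4 ⊛ G) ν ν' (tv (lab true ρ' ν' m' ∷ fs)) (upD 0 ν' fs) (bits top) (tv-valley v q)

        -- On each side of the centre a total variation is at most twice its positive part, read
        -- outwards, plus a boundary value. The centre and the ends contribute boundary values of at
        -- most `bits top` each.
        tv-up : ∀ {hi fs} → Valley top hi fs → Small fs → tv fs ≤ 2 * up 0 fs + 4 * bits top
        tv-up {fs = []} v s = z≤n
        tv-up {fs = lab true ρ ν m ∷ fs} (left _ v) s = linear 4 (λ t n u G → t ⊕ n ≲ 2 ⊛ u ⊕ 4 ⊛ G ⇒ t ≲ 2 ⊛ ((# 0 ⊖ n) ⊕ u) ⊕ 4 ⊛ G) (tv (lab true ρ ν m ∷ fs)) ν (upD 0 ν fs) (bits top) (tv-valley v s)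
        tv-up {fs = lab false ρ ν m ∷ fs} (asc (right _ _ a)) (p ∷ s) = linear 4 (λ t n u G → t ≲ 2 ⊛ u ⊕ n ⇒ n ≲ G ⇒ t ≲ 2 ⊛ u ⊕ 4 ⊛ G) (tv (lab false ρ ν m ∷ fs)) ν (upA 0 ν fs) (bits top) (tv-asc {l = false} {ρ} {ν} {m} a) p

    -- Deleting a node: the round on its children

    module Rounds (Γ : ℕ) where
      open Linking Γ
      open Loop Γ
      open Build Γ

      linkAll-cnt : ∀ l → cnts (linkAll v l) ≡ cnts l
      linkAll-cnt [] = refl
      linkAll-cnt (t ∷ ts) = by (linkAll-final t ts)
        where
        by : Ending t ts → cnts (linkAll v (t ∷ ts)) ≡ cnts (t ∷ ts)
        by (t' , eq , _ , ec , _) = trans (cong cnts eq) (trans (+-identityʳ (cnt t')) ec)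

      LinkAll : ∀ l → List Tree → ℕ → Set
      LinkAll l l' c = (M' : MR l') → Σ[ ms ∈ MR l ] phantomR ms ≤ phantomR M' × (∀ {g ν P N B} → Seq ms g ν P N B →
        Σ[ as ∈ Roots M' ] c + rootsP as + N + price Γ * phantomR ms ≤ P + rootsN as + price Γ * phantomR M' + (B + 15 * Γ))

      link-all : ∀ l → LinkAll l (linkAll v l) (linkCost v l)
      link-all [] [] = [] , z≤n , λ { {P = P} {N} {B} (none h) → [] ,
        linear 5 (λ N P B Q G → N ≲ P ⊕ B ⇒ N ⊕ Q ≲ (P ⊕ # 0) ⊕ Q ⊕ (B ⊕ 15 ⊛ G)) N P B (price Γ * 0) Γ h }
      link-all (t ∷ ts) = start (linkAll-final t ts)
        where
        start : Ending t ts → LinkAll (t ∷ ts) (linkAll v (t ∷ ts)) (linkCost v (t ∷ ts))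
        start (t' , eq , lc , _ , f) = subst (LinkAll (t ∷ ts) (linkAll v (t ∷ ts))) (sym lc) (by (linkAll v (t ∷ ts)) eq)
          where
          by : ∀ l' → l' ≡ t' ∷ [] → LinkAll (t ∷ ts) l' (length ts)
          by _ refl (mt ∷ []) = proj₁ (f mt) , ≤-trans (proj₁ (proj₂ (f mt))) (m≤m+n _ 0) , λ s → go s (λ rs → proj₂ (proj₂ (f mt)) rs)
            where
            go : ∀ {ms : MR (t ∷ ts)} {g ν P N B} → Seq ms g ν P N B →
                 (∀ {k e} (rs : RS ms k e) → Σ[ a ∈ Ann mt ] length ts + pos 0 a + negR rs + price Γ * phantomR ms ≤ posR rs + neg a + 15 * Γ + price Γ * phantomT mt) →
                 Σ[ as ∈ Roots (mt ∷ []) ] length ts + rootsP as + N + price Γ * phantomR ms ≤ P + rootsN as + price Γ * (phantomT mt + 0) + (B + 15 * Γ)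
            go {ms} {P = P} {N} {B} (some _ rs h) f = proj₁ (f rs) ∷ [] ,
              linear 12 (λ c pa nr Q pr na G Q' N P B Q'' → c ⊕ pa ⊕ nr ⊕ Q ≲ pr ⊕ na ⊕ 15 ⊛ G ⊕ Q' ⇒ pr ⊕ N ≲ P ⊕ nr ⊕ B ⇒ Q'' ≐ Q' ⇒
                  c ⊕ (pa ⊕ # 0) ⊕ N ⊕ Q ≲ P ⊕ (na ⊕ # 0) ⊕ Q'' ⊕ (B ⊕ 15 ⊛ G))
                (length ts) (pos 0 (proj₁ (f rs))) (negR rs) (price Γ * phantomR ms) (posR rs) (neg (proj₁ (f rs))) Γ (price Γ * phantomT mt) N P B (price Γ * (phantomT mt + 0))
                (proj₂ (f rs)) h (cong (price Γ *_) (+-identityʳ _))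

      phantom-kids : ∀ cs {rs} (ms : MR (cs ++ rs)) → phantomF (kidsOf cs ms) + phantomR (rootsOf cs ms) ≡ phantomR ms
      phantom-kids [] ms = refl
      phantom-kids (c ∷ cs) (mt ∷ ms) = trans
        (linear 4 (λ z t f r → z ≲ # 0 ⇒ (z ⊕ t ⊕ f) ⊕ r ≐ t ⊕ (f ⊕ r)) (phantom (mass mt) (mass mt)) (phantomT mt) (phantomF (kidsOf cs ms)) (phantomR (rootsOf cs ms)) (≤-reflexive self))
        (cong (phantomT mt +_) (phantom-kids cs ms))
        where
        by : ∀ b → T b → (if b then 0 else 1) ≡ 0
        by true _ = refl
        self : phantom (mass mt) (mass mt) ≡ 0
        self = by (mass mt ≡ᵇ mass mt) (≡⇒≡ᵇ (mass mt) (mass mt) refl)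

      -- Here a mortal node is used up. Its 6 `up` pays for three times the total variation of the
      -- charges among its children, and the 18 units per unit of rank that it borrowed while
      -- growing are repaid from the allowance.
      DeleteRound : List Tree → List Tree → List Tree → ℕ → Set
      DeleteRound cs rs l' c = (M' : MR l') → Σ[ ms ∈ MR (cs ++ rs) ]
        phantomF (kidsOf cs ms) + phantomR (rootsOf cs ms) ≤ phantomR M' × (∀ {i k top} → bits top ≤ Γ → (ap : Ann (mk {i} {k} true (kidsOf cs ms))) (as : Roots (rootsOf cs ms)) →
          bits (suc (masses (kidsOf cs ms))) ≤ top → Σ[ as' ∈ Roots M' ]
            c + rootsP as' + (neg ap + rootsN as) + price Γ * (phantomF (kidsOf cs ms) + phantomR (rootsOf cs ms))
            ≤ (pos 0 ap + rootsP as) + rootsN as' + price Γ * phantomR M' + (130 * weigh rank⁺ (rootsOf cs ms) + (1200 * top + 30 * Γ)))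

      delete-round : ∀ cs rs → DeleteRound cs rs (linkAll v (cs ++ rs)) (linkCost v (cs ++ rs))
      delete-round cs rs M' = ms , ≤-trans (≤-reflexive (phantom-kids cs ms)) (proj₁ (proj₂ (link-all (cs ++ rs) M'))) , go
        where
        ms = proj₁ (link-all (cs ++ rs) M')
        s = suc (masses (kidsOf cs ms))
        go : ∀ {i k top} → bits top ≤ Γ → (ap : Ann (mk {i} {k} true (kidsOf cs ms))) (as : Roots (rootsOf cs ms)) → bits s ≤ top → Σ[ as' ∈ Roots M' ]
            linkCost v (cs ++ rs) + rootsP as' + (neg ap + rootsN as) + price Γ * (phantomF (kidsOf cs ms) + phantomR (rootsOf cs ms))
            ≤ (pos 0 ap + rootsP as) + rootsN as' + price Γ * phantomR M' + (130 * weigh rank⁺ (rootsOf cs ms) + (1200 * top + 30 * Γ))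
        go {top = top} tΓ (ann {fs = fs} af vl ex) as s≤ = proj₁ res ,
          subst (λ q → linkCost v (cs ++ rs) + rootsP (proj₁ res) + (18 * bits s + negF af + rootsN as) + price Γ * q
              ≤ (6 * up 0 fs + posF af + rootsP as) + rootsN (proj₁ res) + price Γ * phantomR M' + (130 * weigh rank⁺ (rootsOf cs ms) + (1200 * top + 30 * Γ)))
            (sym (phantom-kids cs ms))
            (linear 15 (λ L nf rn Q pf rp n' Q' W jx e u bs G b →
              L ⊕ (nf ⊕ rn) ⊕ Q ≲ (pf ⊕ rp) ⊕ n' ⊕ Q' ⊕ ((jx ⊕ (W ⊕ e)) ⊕ G) ⇒ jx ⊕ e ⊕ G ⊕ bs ≲ u ⊕ b ⇒
              L ⊕ ((bs ⊕ nf) ⊕ rn) ⊕ Q ≲ ((u ⊕ pf) ⊕ rp) ⊕ n' ⊕ Q' ⊕ (W ⊕ b))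
            (linkCost v (cs ++ rs) + rootsP (proj₁ res)) (negF af) (rootsN as) (price Γ * phantomR ms)
            (posF af) (rootsP as) (rootsN (proj₁ res)) (price Γ * phantomR M') (130 * weigh rank⁺ (rootsOf cs ms)) (116 * jumps g fs + 130 * excess fs + 3 * tv fs) (116 * final g fs) (6 * up 0 fs) (18 * bits s) (15 * Γ) (1200 * top + 30 * Γ)
            (proj₂ res) (budget (jumps g fs) (excess fs) (tv fs) (final g fs) (up 0 fs) (bits s) (bits top) (jumps-valley ≤-refl vt) ex (tv-up vt (small-ν ≤-refl vt af)) fin s≤ tΓ))
          where
          open Kids top
          g = entry top fs
          vt : V top fs
          vt = V-mono s≤ vl
          ok : Ok g fs
          ok = ok-valley ≤-refl vt
          fin : final g fs ≤ top
          fin = final≤ (entry-≤ fs ≤-refl) ok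
          res = proj₂ (proj₂ (link-all (cs ++ rs) M')) (seq-kids tΓ cs ms af ok (seq-roots as (final g fs) (≤-trans (bits-mono fin) tΓ)))
          budget : ∀ j x t e u bs bt → j ≤ top + 3 * top → x ≤ 4 * bs → t ≤ 2 * u + 4 * bt → e ≤ top → bs ≤ top → bt ≤ Γ →
                   116 * j + 130 * x + 3 * t + 116 * e + 15 * Γ + 18 * bs ≤ 6 * u + (1200 * top + 30 * Γ)
          budget j x t e u bs bt hj hx ht he hs hb = ≤-trans
            (+-mono-≤ (+-monoˡ-≤ (15 * Γ) (+-mono-≤ (+-mono-≤ (+-mono-≤ (*-monoʳ-≤ 116 hj) (*-monoʳ-≤ 130 (≤-trans hx (*-monoʳ-≤ 4 hs)))) (*-monoʳ-≤ 3 (≤-trans ht (+-monoʳ-≤ (2 * u) (*-monoʳ-≤ 4 hb))))) (*-monoʳ-≤ 116 he))) (*-monoʳ-≤ 18 hs))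
            (linear 3 (λ p u G → (((116 ⊛ (p ⊕ 3 ⊛ p) ⊕ 130 ⊛ (4 ⊛ p)) ⊕ 3 ⊛ (2 ⊛ u ⊕ 4 ⊛ G)) ⊕ 116 ⊛ p) ⊕ 15 ⊛ G ⊕ 18 ⊛ p ≲ 6 ⊛ u ⊕ (1200 ⊛ p ⊕ 30 ⊛ G)) top u Γ)

    -- Permuting and splitting root lists

    record Same {ts ts'} (ms : MR ts) (ms' : MR ts') : Set where
      field
        ph≡ : phantomR ms ≡ phantomR ms'
        weigh≡ : ∀ f → weigh f ms ≡ weigh f ms'
        roots⇒ : (as : Roots ms) → Σ[ as' ∈ Roots ms' ] rootsP as' ≡ rootsP as × rootsN as' ≡ rootsN as
    open Same public

    comm₃ : ∀ a b c → a + (b + c) ≡ b + (a + c)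
    comm₃ a b c = linear 3 (λ a b c → a ⊕ (b ⊕ c) ≐ b ⊕ (a ⊕ c)) a b c

    permute : ∀ {ts ts'} → ts ↭ ts' → (ms' : MR ts') → Σ[ ms ∈ MR ts ] Same ms ms'
    permute _↭_.refl ms = ms , record { ph≡ = refl ; weigh≡ = λ f → refl ; roots⇒ = λ as → as , refl , refl }
    permute (prep x p) (mt ∷ ms') with permute p ms'
    ... | ms , s = mt ∷ ms , record { ph≡ = cong (phantomT mt +_) (ph≡ s) ; weigh≡ = λ f → cong (f (mass mt) +_) (weigh≡ s f)
      ; roots⇒ = λ { (a ∷ as) → a ∷ proj₁ (roots⇒ s as) , cong (pos 0 a +_) (proj₁ (proj₂ (roots⇒ s as))) , cong (neg a +_) (proj₂ (proj₂ (roots⇒ s as))) } }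
    permute (swap x y p) (my ∷ mx' ∷ ms') with permute p ms'
    ... | ms , s = mx' ∷ my ∷ ms , record
      { ph≡ = trans (cong (λ z → phantomT mx' + (phantomT my + z)) (ph≡ s)) (comm₃ (phantomT mx') (phantomT my) _)
      ; weigh≡ = λ f → trans (cong (λ z → f (mass mx') + (f (mass my) + z)) (weigh≡ s f)) (comm₃ (f (mass mx')) (f (mass my)) _)
      ; roots⇒ = λ { (a ∷ b ∷ as) → b ∷ a ∷ proj₁ (roots⇒ s as) ,
          trans (comm₃ (pos 0 b) (pos 0 a) _) (cong (λ z → pos 0 a + (pos 0 b + z)) (proj₁ (proj₂ (roots⇒ s as)))) ,
          trans (comm₃ (neg b) (neg a) _) (cong (λ z → neg a + (neg b + z)) (proj₂ (proj₂ (roots⇒ s as)))) } }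
    permute (_↭_.trans p q) ms' with permute q ms'
    ... | m₁ , s₁ with permute p m₁
    ... | ms , s = ms , record { ph≡ = trans (ph≡ s) (ph≡ s₁) ; weigh≡ = λ f → trans (weigh≡ s f) (weigh≡ s₁ f)
      ; roots⇒ = λ as → proj₁ (roots⇒ s₁ (proj₁ (roots⇒ s as))) ,
          trans (proj₁ (proj₂ (roots⇒ s₁ (proj₁ (roots⇒ s as))))) (proj₁ (proj₂ (roots⇒ s as))) ,
          trans (proj₂ (proj₂ (roots⇒ s₁ (proj₁ (roots⇒ s as))))) (proj₂ (proj₂ (roots⇒ s as))) }

    record Split {as bs} (ms : MR (as ++ bs)) : Set where
      field
        l : MR as
        r : MR bs
        ph+ : phantomR ms ≡ phantomR l + phantomR r
        weigh+ : ∀ f → weigh f ms ≡ weigh f l + weigh f r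
        join : (al : Roots l) (ar : Roots r) → Σ[ as' ∈ Roots ms ] rootsP as' ≡ rootsP al + rootsP ar × rootsN as' ≡ rootsN al + rootsN ar
    open Split public

    split : ∀ as {bs} (ms : MR (as ++ bs)) → Split {as} ms
    split [] ms = record { l = [] ; r = ms ; ph+ = refl ; weigh+ = λ f → refl ; join = λ { [] ar → ar , refl , refl } }
    split (a ∷ as) (mt ∷ ms) = record { l = mt ∷ l s ; r = r s ; ph+ = trans (cong (phantomT mt +_) (ph+ s)) (sym (+-assoc (phantomT mt) _ _))
      ; weigh+ = λ f → trans (cong (f (mass mt) +_) (weigh+ s f)) (sym (+-assoc (f (mass mt)) _ _))
      ; join = λ { (a ∷ al) ar → a ∷ proj₁ (join s al ar) ,
          trans (cong (pos 0 a +_) (proj₁ (proj₂ (join s al ar)))) (sym (+-assoc (pos 0 a) _ _)) ,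
          trans (cong (neg a +_) (proj₂ (proj₂ (join s al ar)))) (sym (+-assoc (neg a) _ _)) } }
      where s = split as ms

    cnts-↭ : ∀ {ts ts'} → ts ↭ ts' → cnts ts ≡ cnts ts'
    cnts-↭ _↭_.refl = refl
    cnts-↭ (prep x p) = cong (cnt x +_) (cnts-↭ p)
    cnts-↭ (swap x y p) = trans (cong (λ z → cnt x + (cnt y + z)) (cnts-↭ p)) (comm₃ (cnt x) (cnt y) _)
    cnts-↭ (_↭_.trans p q) = trans (cnts-↭ p) (cnts-↭ q)

    -- Linking the sorted buffer

    rank₂ : ℕ → ℕ
    rank₂ s = suc (bits (bits s))

    -- In a sorted list every link is a left link at the front, and charging it
    -- nothing (ν = 0) costs the class of one gap of the winner's initial rank.
    attach : ∀ {i k cs b} {ms : Marks cs} {t} {m} {p : m ≤ cnt t} {mt : Mark t} (at : Ann mt) (ax : Ann (mk {i} {k} b ms)) →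
             Σ[ a' ∈ Ann (mk {i} {k} b (edge m p mt ms)) ] 1 + pos 0 a' + (neg at + neg ax) ≤ pos 0 at + pos 0 ax + neg a' + 53 * rank₂ (mass (mk {i} {k} b ms))
    attach {i} {k} {b = b} {ms} {t} {m} {p} {mt} at (ann {fs = fs} af vl ex) = ann (edge true o 0 z≤n at af) (V-mono o≤ (V-front ≤-refl vl)) exc ,
      -- 53 = 1 + 40 + 12: the link, the class stored on the new edge, and the raising of the
      -- loser's sentinel from 0 by `pos-σ`.
      linear 13 (λ σ ps pa u' u pf na nf c w w' C R → ps ≲ pa ⊕ 12 ⊛ σ ⇒ u' ≲ u ⇒ w ≲ w' ⇒ σ ≲ R ⇒
        # 1 ⊕ (6 ⊛ u' ⊕ (40 ⊛ σ ⊕ ps ⊕ pf)) ⊕ (na ⊕ (18 ⊛ w ⊕ nf)) ≲ pa ⊕ (6 ⊛ u ⊕ pf) ⊕ (18 ⊛ w' ⊕ (c ⊕ na ⊕ nf)) ⊕ 53 ⊛ (# 1 ⊕ R))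
        σ (pos σ at) (pos 0 at) (when b (up 0 (lab true o 0 m ∷ fs))) (when b (up 0 fs)) (posF af) (neg at) (negF af) (charge 0 m (mass mt)) (when b o) (when b (bits (suc (m + masses ms)))) 0 (bits o)
        (pos-σ σ at) (when-mono b (≤-trans (up-front 0 o 0 m fs z≤n) (≤-reflexive (+-identityʳ _)))) (when-mono b o≤) σ≤
      where
      s = suc (masses ms)
      o = bits s
      σ = sent o m (mass mt)
      o≤ : o ≤ bits (suc (m + masses ms))
      o≤ = bits-mono (s≤s (m≤n+m (masses ms) m))
      exc : (suc (bits m) ∸ o) + excess fs ≤ 4 * bits (suc (m + masses ms))
      exc = linear 4 (λ x e o o' → x ≲ 2 ⊛ (o' ⊖ o) ⇒ e ≲ 4 ⊛ o ⇒ o ≲ o' ⇒ x ⊕ e ≲ 4 ⊛ o') (suc (bits m) ∸ o) (excess fs) o (bits (suc (m + masses ms)))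
        (≤-trans (excess-new {o} {s} {m} {o} (bits-pos (s≤s z≤n)) ≤-refl ≤-refl) (≤-reflexive (cong (λ z → 2 * (bits z ∸ o)) (+-suc m (masses ms))))) ex o≤
      σ≤ : σ ≤ bits o
      σ≤ with m ≡ᵇ mass mt
      ... | true = bits-mono (m∸n≤m o (bits m))
      ... | false = z≤n

    module _ where
      open Loop 0

      leftSmaller-sorted : ∀ a b → DecTotalOrder._≤_ O (key b) (key a) → leftSmaller a b ≡ false
      leftSmaller-sorted a b h = cong not (dec-true (DecTotalOrder._≤?_ O (key b) (key a)) h)

      step-sorted : ∀ a b rest → leftSmaller a b ≡ false → step v (a ∷ b ∷ rest) ≡ attachLeft b a ∷ rest
      step-sorted a b rest h = trans (cong (λ c → if not c then linkPair v a b ∷ rest else step' v a b rest) h) (cong (_∷ rest) (linkPair-left v a b h))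

      Chained : ∀ a ts → List Tree → Set
      Chained a ts l' = Σ[ t ∈ Tree ] l' ≡ t ∷ [] × ((mt : Mark t) → Σ[ ma ∈ Mark a ] Σ[ ms ∈ MR ts ] phantomT ma + phantomR ms ≤ phantomT mt ×
        ((a₀ : Ann ma) (as : Roots ms) → Σ[ a' ∈ Ann mt ] length ts + pos 0 a' + (neg a₀ + rootsN as) ≤ pos 0 a₀ + rootsP as + neg a' + 53 * weigh rank₂ ms))

      -- The second tree wins and keeps its key, so the list is sorted again and the accumulated
      -- tree stays in front. Every later tree wins with the rank it had in the buffer.
      chained : ∀ f a ts → length ts ≤ f → NonIncreasing (a ∷ ts) → Chained a ts (linkFuel v f (a ∷ ts))
      chained zero a [] _ _ = a , refl , λ mt → mt , [] , ≤-reflexive (+-identityʳ _) , λ { a₀ [] → a₀ , linear 2 (λ p n → p ⊕ (n ⊕ # 0) ≲ p ⊕ # 0 ⊕ n ⊕ # 0) (pos 0 a₀) (neg a₀) }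
      chained (suc f) a [] _ h = chained f a [] z≤n h
      chained (suc f) a (node i k cs ∷ ts) (s≤s p) (h ∷ hs) =
        subst (λ l' → Chained a (node i k cs ∷ ts) (linkFuel v f l')) (sym (step-sorted a (node i k cs) ts (leftSmaller-sorted a (node i k cs) h))) (glue (chained f (node i k (a ∷ cs)) ts p (key-only hs)))
        where
        key-only : NonIncreasing (node i k cs ∷ ts) → NonIncreasing (node i k (a ∷ cs) ∷ ts)
        key-only [-] = [-]
        key-only (h ∷ hs) = h ∷ hs
        glue : ∀ {l'} → Chained (node i k (a ∷ cs)) ts l' → Chained a (node i k cs ∷ ts) l'
        glue (t , eq , f) = t , eq , λ mt → by mt (f mt)
          where
          by : ∀ (mt : Mark t) → Σ[ ma ∈ Mark (node i k (a ∷ cs)) ] Σ[ ms ∈ MR ts ] phantomT ma + phantomR ms ≤ phantomT mt ×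
                ((a₀ : Ann ma) (as : Roots ms) → Σ[ a' ∈ Ann mt ] length ts + pos 0 a' + (neg a₀ + rootsN as) ≤ pos 0 a₀ + rootsP as + neg a' + 53 * weigh rank₂ ms) →
                Σ[ ma ∈ Mark a ] Σ[ ms ∈ MR (node i k cs ∷ ts) ] phantomT ma + phantomR ms ≤ phantomT mt ×
                ((a₀ : Ann ma) (as : Roots ms) → Σ[ a' ∈ Ann mt ] suc (length ts) + pos 0 a' + (neg a₀ + rootsN as) ≤ pos 0 a₀ + rootsP as + neg a' + 53 * weigh rank₂ ms)
          by mt (mk b (edge m p ma mb) , ms , ph , g) = ma , mk b mb ∷ ms ,
            linear 5 (λ q ta fb r P → (q ⊕ ta ⊕ fb) ⊕ r ≲ P ⇒ ta ⊕ (fb ⊕ r) ≲ P) (phantom m (mass ma)) (phantomT ma) (phantomF mb) (phantomR ms) (phantomT mt) ph ,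
            λ { a₀ (b₀ ∷ as) → go a₀ b₀ as }
            where
            go : (a₀ : Ann ma) (b₀ : Ann (mk b mb)) (as : Roots ms) → Σ[ a' ∈ Ann mt ] suc (length ts) + pos 0 a' + (neg a₀ + (neg b₀ + rootsN as)) ≤ pos 0 a₀ + (pos 0 b₀ + rootsP as) + neg a' + 53 * (rank₂ (suc (masses mb)) + weigh rank₂ ms)
            go a₀ b₀ as with attach {m = m} {p = p} a₀ b₀
            ... | c , q with g c as
            ... | a' , q' = a' , linear 13 (λ pc na nb pa pb nc R l p' N P n' W → # 1 ⊕ pc ⊕ (na ⊕ nb) ≲ pa ⊕ pb ⊕ nc ⊕ 53 ⊛ R ⇒ l ⊕ p' ⊕ (nc ⊕ N) ≲ pc ⊕ P ⊕ n' ⊕ 53 ⊛ W ⇒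
                # 1 ⊕ l ⊕ p' ⊕ (na ⊕ (nb ⊕ N)) ≲ pa ⊕ (pb ⊕ P) ⊕ n' ⊕ 53 ⊛ (R ⊕ W))
              (pos 0 c) (neg a₀) (neg b₀) (pos 0 a₀) (pos 0 b₀) (neg c) (rank₂ (suc (masses mb))) (length ts) (pos 0 a') (rootsN as) (rootsP as) (neg a') (weigh rank₂ ms) q q'

    SortedLink : List Tree → List Tree → ℕ → Set
    SortedLink s l' c = (M' : MR l') → Σ[ ms ∈ MR s ] phantomR ms ≤ phantomR M' × weigh rank⁺ M' ≤ suc (bits (cnts s)) ×
      ((as : Roots ms) → Σ[ as' ∈ Roots M' ] c + rootsP as' + rootsN as ≤ rootsP as + rootsN as' + 53 * weigh rank₂ ms)

    sorted-link : ∀ s → NonIncreasing s → SortedLink s (linkAll v s) (linkCost v s)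
    sorted-link [] _ [] = [] , z≤n , z≤n , λ { [] → [] , z≤n }
    sorted-link (a ∷ ts) h = start (chained (suc (length ts)) a ts (n≤1+n _) h)
      where
      start : Chained a ts (linkAll v (a ∷ ts)) → SortedLink (a ∷ ts) (linkAll v (a ∷ ts)) (linkCost v (a ∷ ts))
      start (t , eq , f) = subst (SortedLink (a ∷ ts) (linkAll v (a ∷ ts))) (sym (cong (λ z → suc (length ts) ∸ length z) eq)) (by (linkAll v (a ∷ ts)) eq)
        where
        ct : cnt t ≡ cnts (a ∷ ts)
        ct = trans (sym (+-identityʳ (cnt t))) (trans (sym (cong cnts eq)) (Rounds.linkAll-cnt 0 (a ∷ ts)))
        by : ∀ l' → l' ≡ t ∷ [] → SortedLink (a ∷ ts) l' (length ts)
        by _ refl (mt ∷ []) = ma ∷ ms , ≤-trans (proj₁ (proj₂ (proj₂ (f mt)))) (m≤m+n _ 0) ,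
          ≤-trans (≤-reflexive (+-identityʳ _)) (s≤s (bits-mono (≤-trans (mass≤cnt mt) (≤-reflexive ct)))) , λ { (a₀ ∷ as) → go a₀ as (proj₂ (proj₂ (proj₂ (f mt))) a₀ as) }
          where
          ma = proj₁ (f mt)
          ms = proj₁ (proj₂ (f mt))
          go : ∀ a₀ (as : Roots ms) → Σ[ a' ∈ Ann mt ] length ts + pos 0 a' + (neg a₀ + rootsN as) ≤ pos 0 a₀ + rootsP as + neg a' + 53 * weigh rank₂ ms →
               Σ[ as' ∈ Roots (mt ∷ []) ] length ts + rootsP as' + (neg a₀ + rootsN as) ≤ (pos 0 a₀ + rootsP as) + rootsN as' + 53 * (rank₂ (mass ma) + weigh rank₂ ms)
          go a₀ as (a' , q) = a' ∷ [] , linear 7 (λ l p n P n' R W → l ⊕ p ⊕ n ≲ P ⊕ n' ⊕ 53 ⊛ W ⇒ l ⊕ (p ⊕ # 0) ⊕ n ≲ P ⊕ (n' ⊕ # 0) ⊕ 53 ⊛ (R ⊕ W))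
            (length ts) (pos 0 a') (neg a₀ + rootsN as) (pos 0 a₀ + rootsP as) (neg a') (rank₂ (mass ma)) (weigh rank₂ ms) q

    addRoot-↭ : ∀ y rs → addRoot y rs ↭ y ∷ rs
    addRoot-↭ y [] = ↭-refl
    addRoot-↭ y (r ∷ rs) = by (key y <ₖ key r)
      where
      by : ∀ c → (if c then y ∷ r ∷ rs else r ∷ y ∷ rs) ↭ y ∷ r ∷ rs
      by true = ↭-refl
      by false = swap r y ↭-refl

    meldRoots-↭ : ∀ l l' → meldRoots l l' ↭ l ++ l'
    meldRoots-↭ [] l' = ↭-refl
    meldRoots-↭ (r ∷ l) [] = prep r (subst (l ↭_) (sym (++-identityʳ l)) ↭-refl)
    meldRoots-↭ (r ∷ l) (r' ∷ l') = by (key r' <ₖ key r)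
      where
      by : ∀ c → (if c then r' ∷ (r ∷ l) ++ l' else r ∷ l ++ (r' ∷ l')) ↭ r ∷ l ++ r' ∷ l'
      by true = ↭-sym (shift r' (r ∷ l) l')
      by false = ↭-refl

    addAll-↭ : ∀ s rs → addAll (linkAll v s) rs ↭ linkAll v s ++ rs
    addAll-↭ [] rs = ↭-refl
    addAll-↭ (t ∷ ts) rs = by (Loop.linkAll-final 0 t ts)
      where
      by : Loop.Ending 0 t ts → addAll (linkAll v (t ∷ ts)) rs ↭ linkAll v (t ∷ ts) ++ rs
      by (t' , eq , _) = subst (λ l → addAll l rs ↭ l ++ rs) (sym eq) (addRoot-↭ t' rs)

    record Emptied (H : Heap) (R' : List Tree) (c : ℕ) (M' : MR R') : Set where
      field
        mr : MR (roots H)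
        mb : MR (buffer H)
        ph≤ : phantomR mr + phantomR mb ≤ phantomR M'
        weigh≤ : weigh rank⁺ M' ≤ weigh rank⁺ mr + suc (bits (cnts (buffer H)))
        pay : (ar : Roots mr) (ab : Roots mb) → Σ[ as ∈ Roots M' ]
          c + rootsP as + (rootsN ar + rootsN ab) ≤ (rootsP ar + rootsP ab) + rootsN as + (53 * weigh rank₂ mb + suc (sortCost (length (buffer H))))

    emptied-cnt : ∀ {H H' c} → Empties v H H' c → cnts (roots H') ≡ cnts (roots H) + cnts (buffer H)
    emptied-cnt {H} (empties s p _) = trans (cnts-↭ (addAll-↭ s (roots H))) (trans (Linking.cnts-++ 0 (linkAll v s) (roots H))
      (trans (+-comm _ (cnts (roots H))) (cong (cnts (roots H) +_) (trans (Rounds.linkAll-cnt 0 s) (cnts-↭ p)))))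

    emptied : ∀ {H H' c} → Empties v H H' c → (M' : MR (roots H')) → Emptied H (roots H') c M'
    emptied {H} (empties s p sorted) M' = record
      { mr = r sp ; mb = proj₁ pb
      ; ph≤ = linear 7 (λ r b M L S s₀ _ → M ≐ S ⇒ S ≐ L ⊕ r ⇒ s₀ ≲ L ⇒ b ≐ s₀ ⇒ r ⊕ b ≲ M) (phantomR (r sp)) (phantomR (proj₁ pb)) (phantomR M') (phantomR (l sp)) (phantomR (proj₁ pm)) (phantomR (proj₁ sl)) 0
          (sym (ph≡ (proj₂ pm))) (ph+ sp) (proj₁ (proj₂ sl)) (ph≡ (proj₂ pb))
      ; weigh≤ = linear 5 (λ M S L r b → M ≐ S ⇒ S ≐ L ⊕ r ⇒ L ≲ b ⇒ M ≲ r ⊕ b) (weigh rank⁺ M') (weigh rank⁺ (proj₁ pm)) (weigh rank⁺ (l sp)) (weigh rank⁺ (r sp)) (suc (bits (cnts (buffer H))))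
          (sym (weigh≡ (proj₂ pm) rank⁺)) (weigh+ sp rank⁺) (≤-trans (proj₁ (proj₂ (proj₂ sl))) (≤-reflexive (cong (λ z → suc (bits z)) (cnts-↭ p))))
      ; pay = go }
      where
      pm = permute (↭-sym (addAll-↭ s (roots H))) M'
      sp = split (linkAll v s) (proj₁ pm)
      sl = sorted-link s sorted (l sp)
      pb = permute (↭-sym p) (proj₁ sl)
      go : (ar : Roots (r sp)) (ab : Roots (proj₁ pb)) → Σ[ as ∈ Roots M' ]
          (1 + sortCost (length s) + linkCost v s) + rootsP as + (rootsN ar + rootsN ab) ≤ (rootsP ar + rootsP ab) + rootsN as + (53 * weigh rank₂ (proj₁ pb) + suc (sortCost (length (buffer H))))
      go ar ab with roots⇒ (proj₂ pb) ab
      ... | as₁ , e₁ , e₂ with proj₂ (proj₂ (proj₂ sl)) as₁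
      ... | as₂ , q with join sp as₂ ar
      ... | as₃ , e₃ , e₄ with roots⇒ (proj₂ pm) as₃
      ... | as₄ , e₅ , e₆ = as₄ , linear 18 (λ c S S' p₁ n₁ p₂ n₂ p₃ n₃ p₄ n₄ pr nr pb nb W W' _ →
          c ⊕ p₂ ⊕ n₁ ≲ p₁ ⊕ n₂ ⊕ 53 ⊛ W ⇒ p₁ ≐ pb ⇒ n₁ ≐ nb ⇒ p₃ ≐ p₂ ⊕ pr ⇒ n₃ ≐ n₂ ⊕ nr ⇒ p₄ ≐ p₃ ⇒ n₄ ≐ n₃ ⇒ W' ≐ W ⇒ S ≐ S' ⇒
          (# 1 ⊕ S ⊕ c) ⊕ p₄ ⊕ (nr ⊕ nb) ≲ (pr ⊕ pb) ⊕ n₄ ⊕ (53 ⊛ W' ⊕ (# 1 ⊕ S')))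
        (linkCost v s) (sortCost (length s)) (sortCost (length (buffer H))) (rootsP as₁) (rootsN as₁) (rootsP as₂) (rootsN as₂) (rootsP as₃) (rootsN as₃) (rootsP as₄) (rootsN as₄)
        (rootsP ar) (rootsN ar) (rootsP ab) (rootsN ab) (weigh rank₂ (proj₁ sl)) (weigh rank₂ (proj₁ pb)) 0
        q e₁ e₂ e₃ e₄ e₅ e₆ (weigh≡ (proj₂ pb) rank₂) (cong sortCost (↭-length p))

    -- Cuts and deletions below a node

    -- Removing a node somewhere below a list of siblings: es lists the tree cut
    -- off, c is the cost and d the number of nodes deleted.
    data Edit : List Tree → List Tree → List Tree → ℕ → ℕ → Set where
      cut₀ : ∀ {i k ts} → Edit (node i k [] ∷ ts) ts [ node i k [] ] 0 0
      cut₁ : ∀ {i k y cs ts} → Edit (node i k (y ∷ cs) ∷ ts) (y ∷ ts) [ node i k cs ] 0 0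
      del : ∀ {i k cs ts} → Edit (node i k cs ∷ ts) (linkAll v cs ++ ts) [] (linkCost v cs) 1
      inside : ∀ {i k cs cs' ts es c d} → Edit cs cs' es c d → Edit (node i k cs ∷ ts) (node i k cs' ∷ ts) es c d
      later : ∀ {t ts ts' es c d} → Edit ts ts' es c d → Edit (t ∷ ts) (t ∷ ts') es c d

    edit-cnt : ∀ {ts ts' es c d} → Edit ts ts' es c d → cnts ts' + cnts es + d ≡ cnts ts
    edit-cnt (cut₀ {ts = ts}) = trans (+-identityʳ _) (+-comm (cnts ts) 1)
    edit-cnt (cut₁ {y = y} {cs} {ts}) = linear 3 (λ y c t → ((y ⊕ t) ⊕ ((# 1 ⊕ c) ⊕ # 0)) ⊕ # 0 ≐ (# 1 ⊕ (y ⊕ c)) ⊕ t) (cnt y) (cnts cs) (cnts ts)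
    edit-cnt (del {cs = cs} {ts}) = trans (cong (λ z → z + 0 + 1) (trans (Linking.cnts-++ 0 (linkAll v cs) ts) (cong (_+ cnts ts) (Rounds.linkAll-cnt 0 cs))))
      (linear 2 (λ c t → ((c ⊕ t) ⊕ # 0) ⊕ # 1 ≐ (# 1 ⊕ c) ⊕ t) (cnts cs) (cnts ts))
    edit-cnt (inside {cs' = cs'} {ts} {es} {d = d} e) = trans (linear 4 (λ c t e d → (((# 1 ⊕ c) ⊕ t) ⊕ e) ⊕ d ≐ (# 1 ⊕ ((c ⊕ e) ⊕ d)) ⊕ t) (cnts cs') (cnts ts) (cnts es) d)
      (cong (λ z → suc z + cnts ts) (edit-cnt e))
    edit-cnt (later {t} {ts' = ts'} {es} {d = d} e) = trans (linear 4 (λ t c e d → ((t ⊕ c) ⊕ e) ⊕ d ≐ t ⊕ ((c ⊕ e) ⊕ d)) (cnt t) (cnts ts') (cnts es) d)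
      (cong (cnt t +_) (edit-cnt e))

    pos-0 : ∀ {t} {mt : Mark t} σ (a : Ann mt) → pos 0 a ≤ pos σ a
    pos-0 σ (ann {b = b} {fs = fs} af _ _) = +-monoˡ-≤ (posF af) (*-monoʳ-≤ 6 (when-mono b (≤-trans (up-σ σ 0 fs)
      (≤-reflexive (trans (cong (λ z → up σ fs + 2 * z) (0∸n≡0 σ)) (+-identityʳ _))))))

    sent≤ : ∀ ρ m s → sent ρ m s ≤ bits ρ
    sent≤ ρ m s with m ≡ᵇ s
    ... | true = bits-mono (m∸n≤m ρ (bits m))
    ... | false = z≤n

    charge≤ : ∀ ρ ν m s → ν ≤ bits (ρ ∸ bits m) ∸ 1 → charge ν m s ≤ 3 * bits ρ
    charge≤ ρ ν m s h with m ≡ᵇ s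
    ... | true = *-monoʳ-≤ 3 (≤-trans h (≤-trans (m∸n≤m _ 1) (bits-mono (m∸n≤m ρ (bits m)))))
    ... | false = z≤n

    head-level : ∀ {top l ρ ν m fs} → V top (lab l ρ ν m ∷ fs) → ρ ≤ top
    head-level (left p _) = p
    head-level (asc (right _ p _)) = p

    tail-level : ∀ {top l ρ ν m fs} → V top (lab l ρ ν m ∷ fs) → V top fs
    tail-level = sub-valley drop

    -- Since the mass of the sibling list is unchanged, so are the ranks of all ancestors, and the
    -- edit is paid for locally. Going back over it, the edge to the removed node and possibly one
    -- edge below it may become phantom, hence the 2.
    record Edited (Γ n : ℕ) {ts ts' es} (c d : ℕ) (ms' : Marks ts') (me : MR es) : Set where
      constructor edited
      field
        ms : Marks ts
        masses≡ : masses ms ≡ masses ms'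
        ph≤ : phantomF ms ≤ phantomF ms' + phantomR me + 2
        sim : ∀ {top fs} (af : Anns ms fs) → V top fs → top ≤ bits n →
          Σ[ fs' ∈ _ ] Σ[ _ ∈ Sub fs fs' ] Σ[ af' ∈ Anns ms' fs' ] Σ[ ae ∈ Roots me ]
            c + (posF af' + rootsP ae) + negF af + price Γ * phantomF ms ≤ posF af + (negF af' + rootsN ae) + price Γ * (phantomF ms' + phantomR me + 2) + (d * (1200 * bits n) + 100 * Γ)

    module _ (Γ n : ℕ) (bits≤Γ : bits (bits n) ≤ Γ) where
      private
        E : ℕ → ℕ
        E d = d * (1200 * bits n) + 100 * Γ

      level≤ : ∀ {ρ top} → ρ ≤ top → top ≤ bits n → bits ρ ≤ Γ
      level≤ p q = ≤-trans (bits-mono (≤-trans p q)) bits≤Γ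

      edit-later : ∀ {t ts ts' es c d} {ms' : Marks ts'} {me : MR es} m p (mt : Mark t) → Edited Γ n {ts} c d ms' me → Edited Γ n {t ∷ ts} c d (edge m p mt ms') me
      edit-later {c = c} {d} {ms' = ms'} {me} m p mt (edited ms m≡ ph≤ sim) = edited (edge m p mt ms) (cong (m +_) m≡)
        (linear 4 (λ x a b e → a ≲ b ⊕ e ⊕ # 2 ⇒ x ⊕ a ≲ (x ⊕ b) ⊕ e ⊕ # 2) (phantom m (mass mt) + phantomT mt) (phantomF ms) (phantomF ms') (phantomR me) ph≤)
        λ { (edge l ρ ν h a af) vl t≤ → go l ρ ν h a af (sim af (tail-level vl) t≤) }
        where
        x = phantom m (mass mt) + phantomT mt
        go : ∀ {fs} l ρ ν h (a : Ann mt) (af : Anns ms fs) →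
             Σ[ fs' ∈ _ ] Σ[ _ ∈ Sub fs fs' ] Σ[ af' ∈ Anns ms' fs' ] Σ[ ae ∈ Roots me ]
               c + (posF af' + rootsP ae) + negF af + price Γ * phantomF ms ≤ posF af + (negF af' + rootsN ae) + price Γ * (phantomF ms' + phantomR me + 2) + E d →
             Σ[ fs' ∈ _ ] Σ[ _ ∈ Sub (lab l ρ ν m ∷ fs) fs' ] Σ[ af' ∈ Anns (edge m p mt ms') fs' ] Σ[ ae ∈ Roots me ]
               c + (posF af' + rootsP ae) + negF (edge {p = p} l ρ ν h a af) + price Γ * (x + phantomF ms) ≤ posF (edge {p = p} l ρ ν h a af) + (negF af' + rootsN ae) + price Γ * (x + phantomF ms' + phantomR me + 2) + E d
        go l ρ ν h a af (fs' , s , af' , ae , q) = lab l ρ ν m ∷ fs' , keep s , edge l ρ ν h a af' , ae ,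
          linear 15 (λ c p' P n Q pf n' N Q' E A B X Q₀ Q₀' → c ⊕ (p' ⊕ P) ⊕ n ⊕ Q ≲ pf ⊕ (n' ⊕ N) ⊕ Q' ⊕ E ⇒ Q₀ ≐ X ⊕ Q ⇒ Q₀' ≐ X ⊕ Q' ⇒
              c ⊕ ((A ⊕ p') ⊕ P) ⊕ (B ⊕ n) ⊕ Q₀ ≲ (A ⊕ pf) ⊕ ((B ⊕ n') ⊕ N) ⊕ Q₀' ⊕ E)
            c (posF af') (rootsP ae) (negF af) (price Γ * phantomF ms) (posF af) (negF af') (rootsN ae) (price Γ * (phantomF ms' + phantomR me + 2)) (E d)
            (40 * sent ρ m (mass mt) + pos (sent ρ m (mass mt)) a) (charge ν m (mass mt) + neg a) (price Γ * x) (price Γ * (x + phantomF ms)) (price Γ * (x + phantomF ms' + phantomR me + 2))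
            q (Linking.spread Γ (price Γ) refl) (Linking.spread Γ (price Γ) (linear 3 (λ x a b → x ⊕ a ⊕ b ⊕ # 2 ≐ x ⊕ (a ⊕ b ⊕ # 2)) x (phantomF ms') (phantomR me)))

      edit-inside : ∀ {i k cs cs' ts es c d} {ms' : Marks cs'} {me : MR es} b m (p : m ≤ cnt (node i k cs)) p' (mr : Marks ts) → suc (cnts cs) ≤ n →
                    Edited Γ n {cs} c d ms' me → Edited Γ n {node i k cs ∷ ts} c d (edge {node i k cs'} m p' (mk b ms') mr) me
      edit-inside {i} {k} {cs} {cs'} {ts} {es} {c} {d} {ms'} {me} b m p p' mr n≥ (edited ms m≡ ph≤ sim) = edited (edge m p (mk b ms) mr) refl
        (linear 6 (λ x x' a b e r → x ≐ x' ⇒ a ≲ b ⊕ e ⊕ # 2 ⇒ x ⊕ a ⊕ r ≲ (x' ⊕ b ⊕ r) ⊕ e ⊕ # 2) (phantom m s) (phantom m s') (phantomF ms) (phantomF ms') (phantomR me) (phantomF mr) (cong (phantom m) s≡) ph≤)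
        λ { (edge l ρ ν h (ann af vl ex) ar) _ _ → go l ρ ν h af vl ex ar (sim af vl (bits-mono (≤-trans (s≤s (masses≤cnts ms)) n≥))) }
        where
        s = suc (masses ms)
        s' = suc (masses ms')
        s≡ : s ≡ s'
        s≡ = cong suc m≡
        go : ∀ {fs fr} l ρ ν h (af : Anns ms fs) (vl : V (bits s) fs) (ex : excess fs ≤ 4 * bits s) (ar : Anns mr fr) →
             Σ[ fs' ∈ _ ] Σ[ _ ∈ Sub fs fs' ] Σ[ af' ∈ Anns ms' fs' ] Σ[ ae ∈ Roots me ]
               c + (posF af' + rootsP ae) + negF af + price Γ * phantomF ms ≤ posF af + (negF af' + rootsN ae) + price Γ * (phantomF ms' + phantomR me + 2) + E d →
             Σ[ fs' ∈ _ ] Σ[ _ ∈ Sub (lab l ρ ν m ∷ fr) fs' ] Σ[ af' ∈ Anns (edge {node i k cs'} m p' (mk b ms') mr) fs' ] Σ[ ae ∈ Roots me ]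
               c + (posF af' + rootsP ae) + negF (edge {t = node i k cs} {p = p} {mt = mk b ms} l ρ ν h (ann af vl ex) ar) + price Γ * phantomF (edge {node i k cs} m p (mk b ms) mr)
               ≤ posF (edge {t = node i k cs} {p = p} {mt = mk b ms} l ρ ν h (ann af vl ex) ar) + (negF af' + rootsN ae) + price Γ * (phantomF (edge {node i k cs'} m p' (mk b ms') mr) + phantomR me + 2) + E d
        go {fs} {fr} l ρ ν h af vl ex ar (fs' , sb , af' , ae , q) = lab l ρ ν m ∷ fr , same ,
            edge l ρ ν h (ann af' (subst (λ z → V (bits z) fs') s≡ (sub-valley sb vl)) (subst (λ z → excess fs' ≤ 4 * bits z) s≡ (≤-trans (sub-excess sb) ex))) ar , ae ,
            subst (λ z → c + (40 * sent ρ m z + (6 * when b (up (sent ρ m z) fs') + posF af') + posF ar + rootsP ae) + (charge ν m s + (18 * when b (bits s) + negF af) + negF ar) + price Γ * (phantom m s + phantomF ms + phantomF mr)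
                 ≤ (40 * sent ρ m s + (6 * when b (up (sent ρ m s) fs) + posF af) + posF ar) + ((charge ν m z + (18 * when b (bits z) + negF af') + negF ar) + rootsN ae) + price Γ * (phantom m z + phantomF ms' + phantomF mr + phantomR me + 2) + E d) s≡
              (linear 20 (λ c p' P n Q pf n' N Q' E A B D X Q₀ Q₀' u u' pr nr → c ⊕ (p' ⊕ P) ⊕ n ⊕ Q ≲ pf ⊕ (n' ⊕ N) ⊕ Q' ⊕ E ⇒ Q₀ ≐ X ⊕ Q ⇒ Q₀' ≐ X ⊕ Q' ⇒ u' ≲ u ⇒
                c ⊕ ((A ⊕ (u' ⊕ p') ⊕ pr) ⊕ P) ⊕ (B ⊕ (D ⊕ n) ⊕ nr) ⊕ Q₀ ≲ (A ⊕ (u ⊕ pf) ⊕ pr) ⊕ ((B ⊕ (D ⊕ n') ⊕ nr) ⊕ N) ⊕ Q₀' ⊕ E)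
                 c (posF af') (rootsP ae) (negF af) (price Γ * phantomF ms) (posF af) (negF af') (rootsN ae) (price Γ * (phantomF ms' + phantomR me + 2)) (E d)
                 (40 * sent ρ m s) (charge ν m s) (18 * when b (bits s)) (price Γ * (phantom m s + phantomF mr)) (price Γ * (phantom m s + phantomF ms + phantomF mr)) (price Γ * (phantom m s + phantomF ms' + phantomF mr + phantomR me + 2))
                 (6 * when b (up (sent ρ m s) fs)) (6 * when b (up (sent ρ m s) fs')) (posF ar) (negF ar)
                 q (Linking.spread Γ (price Γ) (linear 3 (λ x a r → x ⊕ a ⊕ r ≐ (x ⊕ r) ⊕ a) (phantom m s) (phantomF ms) (phantomF mr)))
                 (Linking.spread Γ (price Γ) (linear 4 (λ x a r e → x ⊕ a ⊕ r ⊕ e ⊕ # 2 ≐ (x ⊕ r) ⊕ (a ⊕ e ⊕ # 2)) (phantom m s) (phantomF ms') (phantomF mr) (phantomR me)))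
                 (*-monoʳ-≤ 6 (when-mono b (sub-up (sent ρ m s) vl sb))))

      -- Nothing replaces the cut node, so its edge carries mass 0. The node itself has positive
      -- mass, so this edge is phantom.
      edit-cut₀ : ∀ {i k ts} (ms : Marks ts) (me : MR [ node i k [] ]) → Edited Γ n {node i k [] ∷ ts} 0 0 ms me
      edit-cut₀ ms (mk b [] ∷ []) = edited (edge 0 z≤n (mk b []) ms) refl
        (linear 1 (λ f → # 1 ⊕ # 0 ⊕ f ≲ f ⊕ # 0 ⊕ # 2) (phantomF ms))
        λ { (edge {fs = fs} l ρ ν h a ar) _ _ → fs , drop , ar , a ∷ [] ,
          linear 8 (λ pr pa na nr Q Q' E _ → Q ≲ Q' ⇒ # 0 ⊕ (pr ⊕ (pa ⊕ # 0)) ⊕ (# 0 ⊕ na ⊕ nr) ⊕ Q ≲ (# 0 ⊕ pa ⊕ pr) ⊕ (nr ⊕ (na ⊕ # 0)) ⊕ Q' ⊕ E)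
            (posF ar) (pos 0 a) (neg a) (negF ar) (price Γ * (1 + 0 + phantomF ms)) (price Γ * (phantomF ms + 0 + 2)) (E 0) 0
            (*-monoʳ-≤ (price Γ) (linear 1 (λ f → # 1 ⊕ # 0 ⊕ f ≲ f ⊕ # 0 ⊕ # 2) (phantomF ms))) }

      -- The edge to the cut node carries the mass m that its replacement y will contribute, and the
      -- edge from the cut node to y carries nothing. Thus neither the siblings nor the cut node
      -- lose mass, and at most these two edges become phantom.
      edit-cut₁ : ∀ {i k y cs ts} (ms' : Marks (y ∷ ts)) (me : MR [ node i k cs ]) → Edited Γ n {node i k (y ∷ cs) ∷ ts} 0 0 ms' me
      edit-cut₁ {i} {k} {node iy ky csy} {cs} (edge m p my@(mk by msy) mr) (mk b mxs ∷ []) =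
        edited (edge m p' (mk b (edge 0 z≤n my mxs)) mr) refl ph
          λ { (edge {fs = fs} l ρ ν h (ann (edge {fs = gs} l' ρ' ν' h' ay ax) vx ex) ar) vl t≤ → lab l ρ ν m ∷ fs , same , edge l ρ ν h ay ar , ann ax (sub-valley drop vx) (≤-trans (sub-excess {lab l' ρ' ν' 0 ∷ gs} {gs} drop) ex) ∷ [] ,
            linear 20 (λ σ₀ σ ps pa u u' px pr nr na nx c c' w G Q Q' B H E → ps ≲ pa ⊕ 12 ⊛ σ ⇒ σ ≲ B ⇒ c ≲ 3 ⊛ B ⇒ u' ≲ u ⇒ Q ≲ Q' ⇒ B ≲ G ⇒
                # 0 ⊕ ((40 ⊛ σ ⊕ ps ⊕ pr) ⊕ ((6 ⊛ u' ⊕ px) ⊕ # 0)) ⊕ (c ⊕ (w ⊕ (# 0 ⊕ na ⊕ nx)) ⊕ nr) ⊕ Q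
                ≲ (40 ⊛ σ₀ ⊕ (6 ⊛ u ⊕ (# 0 ⊕ pa ⊕ px)) ⊕ pr) ⊕ ((c' ⊕ na ⊕ nr) ⊕ ((w ⊕ nx) ⊕ # 0)) ⊕ Q' ⊕ (H ⊕ 100 ⊛ G))
              (sent ρ m sx) (sent ρ m sy) (pos (sent ρ m sy) ay) (pos 0 ay) (when b (up (sent ρ m sx) (lab l' ρ' ν' 0 ∷ gs))) (when b (up 0 gs)) (posF ax) (posF ar) (negF ar) (neg ay) (negF ax)
              (charge ν m sx) (charge ν m sy) (18 * when b (bits sx)) Γ (price Γ * phantomF (edge {node i k (node iy ky csy ∷ cs)} m p' (mk b (edge 0 z≤n my mxs)) mr)) (price Γ * (phantomF (edge m p my mr) + (phantomF mxs + 0) + 2))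
              (bits ρ) 0 0
              (pos-σ (sent ρ m sy) ay) (sent≤ ρ m sy) (charge≤ ρ ν m sx h) (when-mono b (≤-trans (sub-up 0 vx drop) (up-0 (sent ρ m sx) (lab l' ρ' ν' 0 ∷ gs)))) (*-monoʳ-≤ (price Γ) ph) (level≤ (head-level vl) t≤) }
        where
        sx = suc (masses mxs)
        sy = suc (masses msy)
        p' : m ≤ cnt (node i k (node iy ky csy ∷ cs))
        p' = ≤-trans p (≤-trans (m≤m+n _ (cnts cs)) (n≤1+n _))
        ph : phantomF (edge {node i k (node iy ky csy ∷ cs)} m p' (mk b (edge 0 z≤n my mxs)) mr) ≤ phantomF (edge m p my mr) + (phantomF mxs + 0) + 2
        ph = linear 5 (λ q q' y x r → q ≲ # 1 ⇒ q ⊕ (# 1 ⊕ y ⊕ x) ⊕ r ≲ (q' ⊕ y ⊕ r) ⊕ (x ⊕ # 0) ⊕ # 2) (phantom m sx) (phantom m sy) (phantomF msy) (phantomF mxs) (phantomF mr) (phantom≤1 m sx)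
        up-0 : ∀ σ fs → up 0 fs ≤ up σ fs
        up-0 σ fs = ≤-trans (up-σ σ 0 fs) (≤-reflexive (trans (cong (λ z → up σ fs + 2 * z) (0∸n≡0 σ)) (+-identityʳ _)))

      open Rounds Γ

      DeleteOne : List Tree → List Tree → ℕ → Set
      DeleteOne cs l' c = (M' : MR l') → Σ[ ms ∈ Marks cs ] phantomF ms ≤ phantomR M' × (∀ {i k} (ap : Ann (mk {i} {k} true ms)) → suc (masses ms) ≤ n →
        Σ[ as' ∈ Roots M' ] c + rootsP as' + neg ap + price Γ * phantomF ms ≤ pos 0 ap + rootsN as' + price Γ * phantomR M' + (1200 * bits n + 30 * Γ))

      delete-one : ∀ cs → DeleteOne cs (linkAll v cs) (linkCost v cs)
      delete-one cs = subst (λ l → DeleteOne cs (linkAll v l) (linkCost v l)) (++-identityʳ cs) λ M' → go M' (delete-round cs [] M')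
        where
        empty-P : (x : MR []) → phantomR x ≡ 0 × weigh rank⁺ x ≡ 0 × Σ[ r ∈ Roots x ] rootsP r ≡ 0 × rootsN r ≡ 0
        empty-P [] = refl , refl , [] , refl , refl
        Pre Post : (M' : MR (linkAll v (cs ++ []))) → Set
        Pre M' = Σ[ ms ∈ MR (cs ++ []) ]
          phantomF (kidsOf cs ms) + phantomR (rootsOf cs ms) ≤ phantomR M' × (∀ {i k top} → bits top ≤ Γ → (ap : Ann (mk {i} {k} true (kidsOf cs ms))) (as : Roots (rootsOf cs ms)) →
          bits (suc (masses (kidsOf cs ms))) ≤ top → Σ[ as' ∈ Roots M' ]
            linkCost v (cs ++ []) + rootsP as' + (neg ap + rootsN as) + price Γ * (phantomF (kidsOf cs ms) + phantomR (rootsOf cs ms))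
            ≤ (pos 0 ap + rootsP as) + rootsN as' + price Γ * phantomR M' + (130 * weigh rank⁺ (rootsOf cs ms) + (1200 * top + 30 * Γ)))
        Post M' = Σ[ ms ∈ Marks cs ] phantomF ms ≤ phantomR M' × (∀ {i k} (ap : Ann (mk {i} {k} true ms)) → suc (masses ms) ≤ n →
          Σ[ as' ∈ Roots M' ] linkCost v (cs ++ []) + rootsP as' + neg ap + price Γ * phantomF ms ≤ pos 0 ap + rootsN as' + price Γ * phantomR M' + (1200 * bits n + 30 * Γ))
        go : (M' : MR (linkAll v (cs ++ []))) → Pre M' → Post M'
        go M' (ms , ph , f) = kidsOf cs ms , ≤-trans (m≤m+n _ _) ph , λ ap h → finish ap (f bits≤Γ ap (proj₁ (proj₂ (proj₂ rz))) (bits-mono h))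
          where
          rz = empty-P (rootsOf cs ms)
          as₀ = proj₁ (proj₂ (proj₂ rz))
          finish : ∀ {i k} (ap : Ann (mk {i} {k} true (kidsOf cs ms))) → Σ[ as' ∈ Roots M' ]
            linkCost v (cs ++ []) + rootsP as' + (neg ap + rootsN as₀) + price Γ * (phantomF (kidsOf cs ms) + phantomR (rootsOf cs ms))
            ≤ (pos 0 ap + rootsP as₀) + rootsN as' + price Γ * phantomR M' + (130 * weigh rank⁺ (rootsOf cs ms) + (1200 * bits n + 30 * Γ)) →
            Σ[ as' ∈ Roots M' ] linkCost v (cs ++ []) + rootsP as' + neg ap + price Γ * phantomF (kidsOf cs ms) ≤ pos 0 ap + rootsN as' + price Γ * phantomR M' + (1200 * bits n + 30 * Γ)
          finish ap (as' , q) = as' , linear 12 (λ c p n Q Q₀ P n' Q' W H z z' → c ⊕ p ⊕ (n ⊕ z) ⊕ Q ≲ (P ⊕ z') ⊕ n' ⊕ Q' ⊕ (W ⊕ H) ⇒ Q₀ ≲ Q ⇒ z' ≐ # 0 ⇒ W ≐ # 0 ⇒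
              c ⊕ p ⊕ n ⊕ Q₀ ≲ P ⊕ n' ⊕ Q' ⊕ H)
            (linkCost v (cs ++ [])) (rootsP as') (neg ap) (price Γ * (phantomF (kidsOf cs ms) + phantomR (rootsOf cs ms))) (price Γ * phantomF (kidsOf cs ms)) (pos 0 ap) (rootsN as') (price Γ * phantomR M')
            (130 * weigh rank⁺ (rootsOf cs ms)) (1200 * bits n + 30 * Γ) (rootsN as₀) (rootsP as₀)
            q (*-monoʳ-≤ (price Γ) (m≤m+n _ _)) (proj₁ (proj₂ (proj₂ (proj₂ rz)))) (cong (130 *_) (proj₁ (proj₂ rz)))

      -- The deleted node is mortal, and its edge carries the mass that the survivor of its children
      -- will contribute in its place, or 0 if it has no child.
      edit-del : ∀ {i k} cs ts → suc (cnts cs) ≤ n → (ms' : Marks (linkAll v cs ++ ts)) (me : MR []) → Edited Γ n {node i k cs ∷ ts} (linkCost v cs) 1 ms' me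
      edit-del [] ts n≥ ms' [] = edited (edge 0 z≤n (mk true []) ms') refl (linear 1 (λ f → # 1 ⊕ # 0 ⊕ f ≲ f ⊕ # 0 ⊕ # 2) (phantomF ms'))
        λ { (edge {fs = fs} l ρ ν h a@(ann {fs = []} [] vl ex) ar) _ _ → fs , drop , ar , [] ,
          linear 8 (λ pr pa w nr Q Q' B G → Q ≲ Q' ⇒ w ≲ B ⇒ # 0 ⊕ (pr ⊕ # 0) ⊕ (# 0 ⊕ (18 ⊛ w ⊕ # 0) ⊕ nr) ⊕ Q ≲ (# 0 ⊕ pa ⊕ pr) ⊕ (nr ⊕ # 0) ⊕ Q' ⊕ ((1200 ⊛ B ⊕ # 0) ⊕ 100 ⊛ G))
            (posF ar) (pos {mt = mk true []} 0 a) (bits 1) (negF ar) (price Γ * (1 + 0 + phantomF ms')) (price Γ * (phantomF ms' + 0 + 2)) (bits n) Γ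
            (*-monoʳ-≤ (price Γ) (linear 1 (λ f → # 1 ⊕ # 0 ⊕ f ≲ f ⊕ # 0 ⊕ # 2) (phantomF ms'))) (bits-mono n≥) }
      edit-del {i} {k} cs@(c₀ ∷ cs₀) ts n≥ ms' [] = start (Loop.linkAll-final Γ c₀ cs₀) ms'
        where
        start : Loop.Ending Γ c₀ cs₀ → (ms' : Marks (linkAll v cs ++ ts)) → Edited Γ n {node i k cs ∷ ts} (linkCost v cs) 1 ms' []
        start (z , eq , _ , ec , _) = by (linkAll v cs) eq (linkCost v cs) (delete-one cs)
          where
          by : ∀ l' → l' ≡ z ∷ [] → ∀ c → DeleteOne cs l' c → (ms' : Marks (l' ++ ts)) → Edited Γ n {node i k cs ∷ ts} c 1 ms' []
          by _ refl c d1 (edge m p mz mr) = edited (edge m p' (mk true mk') mr) refl ph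
              λ { (edge {fs = fs} l ρ ν h ap ar) vl t≤ → go l ρ ν h ap ar (level≤ (head-level vl) t≤) (proj₂ (proj₂ (d1 (mz ∷ []))) ap (≤-trans (s≤s (masses≤cnts mk')) n≥)) }
            where
            mk' = proj₁ (d1 (mz ∷ []))
            sp = suc (masses mk')
            sz = mass mz
            p' : m ≤ cnt (node i k cs)
            p' = ≤-trans p (≤-trans (≤-reflexive ec) (n≤1+n _))
            ph : phantomF (edge {node i k cs} m p' (mk true mk') mr) ≤ phantomF (edge m p mz mr) + 0 + 2
            ph = linear 5 (λ q q' a b r → q ≲ # 1 ⇒ a ≲ b ⊕ # 0 ⇒ q ⊕ a ⊕ r ≲ (q' ⊕ b ⊕ r) ⊕ # 0 ⊕ # 2) (phantom m sp) (phantom m sz) (phantomF mk') (phantomT mz) (phantomF mr) (phantom≤1 m sp) (proj₁ (proj₂ (d1 (mz ∷ []))))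
            go : ∀ {fs} l ρ ν h (ap : Ann (mk {i} {k} true mk')) (ar : Anns mr fs) → bits ρ ≤ Γ →
                 Σ[ as' ∈ Roots (mz ∷ []) ] c + rootsP as' + neg ap + price Γ * phantomF mk' ≤ pos 0 ap + rootsN as' + price Γ * (phantomT mz + 0) + (1200 * bits n + 30 * Γ) →
                 Σ[ fs' ∈ _ ] Σ[ _ ∈ Sub (lab l ρ ν m ∷ fs) fs' ] Σ[ af' ∈ Anns (edge m p mz mr) fs' ] Σ[ ae ∈ Roots [] ]
                   c + (posF af' + rootsP ae) + negF (edge {t = node i k cs} {p = p'} l ρ ν h ap ar) + price Γ * phantomF (edge {node i k cs} m p' (mk true mk') mr)
                   ≤ posF (edge {t = node i k cs} {p = p'} l ρ ν h ap ar) + (negF af' + rootsN ae) + price Γ * (phantomF (edge m p mz mr) + 0 + 2) + E 1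
            go {fs} l ρ ν h ap ar B≤ (az ∷ [] , q) = lab l ρ ν m ∷ fs , same , edge l ρ ν h az ar , [] ,
              linear 20 (λ c pz np Q₁ p0 nz Q₂ H G σ ps c' c'' pr nr pa σ₀ Q Q' B → c ⊕ (pz ⊕ # 0) ⊕ np ⊕ Q₁ ≲ p0 ⊕ (nz ⊕ # 0) ⊕ Q₂ ⊕ (H ⊕ 30 ⊛ G) ⇒ ps ≲ pz ⊕ 12 ⊛ σ ⇒ σ ≲ B ⇒ c' ≲ 3 ⊛ B ⇒ B ≲ G ⇒ p0 ≲ pa ⇒ Q ⊕ Q₂ ≲ Q₁ ⊕ Q' ⇒
                  c ⊕ ((40 ⊛ σ ⊕ ps ⊕ pr) ⊕ # 0) ⊕ (c' ⊕ np ⊕ nr) ⊕ Q ≲ (40 ⊛ σ₀ ⊕ pa ⊕ pr) ⊕ ((c'' ⊕ nz ⊕ nr) ⊕ # 0) ⊕ Q' ⊕ ((H ⊕ # 0) ⊕ 100 ⊛ G))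
                c (pos 0 az) (neg ap) (price Γ * phantomF mk') (pos 0 ap) (neg az) (price Γ * (phantomT mz + 0)) (1200 * bits n) Γ (sent ρ m sz) (pos (sent ρ m sz) az) (charge ν m sp) (charge ν m sz) (posF ar) (negF ar) (pos (sent ρ m sp) ap) (sent ρ m sp)
                (price Γ * phantomF (edge {node i k cs} m p' (mk true mk') mr)) (price Γ * (phantomF (edge m p mz mr) + 0 + 2)) (bits ρ)
                q (pos-σ (sent ρ m sz) az) (sent≤ ρ m sz) (charge≤ ρ ν m sp h) B≤ (pos-0 (sent ρ m sp) ap)
                (subst₂ _≤_ (*-distribˡ-+ (price Γ) _ _) (*-distribˡ-+ (price Γ) _ _) (*-monoʳ-≤ (price Γ)
                  (linear 5 (λ q q' a b r → q ≲ # 1 ⇒ (q ⊕ a ⊕ r) ⊕ (b ⊕ # 0) ≲ a ⊕ ((q' ⊕ b ⊕ r) ⊕ # 0 ⊕ # 2)) (phantom m sp) (phantom m sz) (phantomF mk') (phantomT mz) (phantomF mr) (phantom≤1 m sp))))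

      edit : ∀ {ts ts' es c d} → Edit ts ts' es c d → cnts ts ≤ n → (ms' : Marks ts') (me : MR es) → Edited Γ n {ts} c d ms' me
      edit cut₀ h ms' me = edit-cut₀ ms' me
      edit cut₁ h ms' me = edit-cut₁ ms' me
      edit (del {cs = cs} {ts}) h ms' me = edit-del cs ts (≤-trans (m≤m+n _ _) h) ms' me
      edit (inside {i} {k} {cs} {cs'} {d = d} e) h (edge m p (mk b ms') mr) me =
        edit-inside b m (≤-trans p (s≤s (≤-trans (≤-trans (m≤m+n _ _) (m≤m+n _ d)) (≤-reflexive (edit-cnt e))))) p mr (≤-trans (m≤m+n _ _) h)
          (edit e (≤-trans (≤-trans (n≤1+n _) (m≤m+n _ _)) h) ms' me)
      edit (later e) h (edge m p mt ms') me = edit-later m p mt (edit e (≤-trans (m≤n+m _ _) h) ms' me)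

    -- Cuts and deletions in lists of roots

    -- The same in a list of roots, which itself loses a node only by deletion.
    data EditR : List Tree → List Tree → List Tree → ℕ → ℕ → Set where
      below : ∀ {i k cs cs' ts es c d} → Edit cs cs' es c d → EditR (node i k cs ∷ ts) (node i k cs' ∷ ts) es c d
      delR : ∀ {i k cs ts} → EditR (node i k cs ∷ ts) (linkAll v cs ++ ts) [] (linkCost v cs) 1
      laterR : ∀ {t ts ts' es c d} → EditR ts ts' es c d → EditR (t ∷ ts) (t ∷ ts') es c d

    editR-cnt : ∀ {ts ts' es c d} → EditR ts ts' es c d → cnts ts' + cnts es + d ≡ cnts ts
    editR-cnt (below {i} {k} {ts = ts} e) = edit-cnt (inside {i} {k} {ts = ts} e)
    editR-cnt (delR {i} {k} {cs} {ts}) = edit-cnt (del {i} {k} {cs} {ts})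
    editR-cnt (laterR {t} {ts' = ts'} {es} {d = d} e) = trans (linear 4 (λ t c e d → ((t ⊕ c) ⊕ e) ⊕ d ≐ t ⊕ ((c ⊕ e) ⊕ d)) (cnt t) (cnts ts') (cnts es) d)
      (cong (cnt t +_) (editR-cnt e))

    cutIn-edit : ∀ x ts {ts' t} → cutIn x ts ≡ just (ts' , t) → Edit ts ts' [ t ] 0 0
    cutIn-edit x (node i k cs ∷ ts) eq with i ≡ᵇ x
    cutIn-edit x (node i k [] ∷ ts) refl | true = cut₀
    cutIn-edit x (node i k (y ∷ cs) ∷ ts) refl | true = cut₁
    cutIn-edit x (node i k cs ∷ ts) eq | false with cutIn x cs in e
    cutIn-edit x (node i k cs ∷ ts) refl | false | just (cs' , t) = inside (cutIn-edit x cs e)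
    cutIn-edit x (node i k cs ∷ ts) eq | false | nothing with cutIn x ts in e'
    cutIn-edit x (node i k cs ∷ ts) refl | false | nothing | just (ts' , t) = later (cutIn-edit x ts e')

    cutBelow-edit : ∀ x ts {ts' t} → cutBelow x ts ≡ just (ts' , t) → EditR ts ts' [ t ] 0 0
    cutBelow-edit x (node i k cs ∷ ts) eq with cutIn x cs in e
    cutBelow-edit x (node i k cs ∷ ts) refl | just (cs' , t) = below (cutIn-edit x cs e)
    cutBelow-edit x (node i k cs ∷ ts) eq | nothing with cutBelow x ts in e'
    cutBelow-edit x (node i k cs ∷ ts) refl | nothing | just (ts' , t) = laterR (cutBelow-edit x ts e')

    delIn-edit : ∀ x ts {ts' c} → delIn v x ts ≡ just (ts' , c) → Edit ts ts' [] c 1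
    delIn-edit x (node i k cs ∷ ts) eq with i ≡ᵇ x
    delIn-edit x (node i k cs ∷ ts) refl | true = del
    delIn-edit x (node i k cs ∷ ts) eq | false with delIn v x cs in e
    delIn-edit x (node i k cs ∷ ts) refl | false | just (cs' , c) = inside (delIn-edit x cs e)
    delIn-edit x (node i k cs ∷ ts) eq | false | nothing with delIn v x ts in e'
    delIn-edit x (node i k cs ∷ ts) refl | false | nothing | just (ts' , c) = later (delIn-edit x ts e')

    delIn-editR : ∀ x ts {ts' c} → delIn v x ts ≡ just (ts' , c) → EditR ts ts' [] c 1
    delIn-editR x (node i k cs ∷ ts) eq with i ≡ᵇ x
    delIn-editR x (node i k cs ∷ ts) refl | true = delR
    delIn-editR x (node i k cs ∷ ts) eq | false with delIn v x cs in e
    delIn-editR x (node i k cs ∷ ts) refl | false | just (cs' , c) = below (delIn-edit x cs e)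
    delIn-editR x (node i k cs ∷ ts) eq | false | nothing with delIn v x ts in e'
    delIn-editR x (node i k cs ∷ ts) refl | false | nothing | just (ts' , c) = laterR (delIn-editR x ts e')

    -- A cut keeps the mass of every root. A deletion may put in place of a root a tree of larger
    -- marked mass, hence the term with f n for each deleted node.
    record EditedR (Γ n : ℕ) {ts ts' es} (c d : ℕ) (ms' : MR ts') (me : MR es) : Set where
      constructor editedR
      field
        ms : MR ts
        weigh≤ : ∀ {f} → (∀ {a b} → a ≤ b → f a ≤ f b) → weigh f ms' ≤ weigh f ms + d * f n
        ph≤ : phantomR ms ≤ phantomR ms' + phantomR me + 2
        sim : (as : Roots ms) → Σ[ as' ∈ Roots ms' ] Σ[ ae ∈ Roots me ]
            c + (rootsP as' + rootsP ae) + rootsN as + price Γ * phantomR ms ≤ rootsP as + (rootsN as' + rootsN ae) + price Γ * (phantomR ms' + phantomR me + 2) + (d * (1200 * bits n) + 100 * Γ)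

    weigh-linkAll : ∀ cs {n f} → (∀ {a b} → a ≤ b → f a ≤ f b) → cnts cs ≤ n → (ms : MR (linkAll v cs)) → weigh f ms ≤ f n
    weigh-linkAll [] mono h [] = z≤n
    weigh-linkAll (c ∷ cs) {n} {f} mono h = by (Loop.linkAll-final 0 c cs)
      where
      by : Loop.Ending 0 c cs → (ms : MR (linkAll v (c ∷ cs))) → weigh f ms ≤ f n
      by (t , eq , _ , ec , _) = subst (λ l → (ms : MR l) → weigh f ms ≤ f n) (sym eq)
        λ { (mt ∷ []) → ≤-trans (≤-reflexive (+-identityʳ _)) (mono (≤-trans (mass≤cnt mt) (≤-trans (≤-reflexive ec) h))) }

    module _ (Γ n : ℕ) (bits≤Γ : bits (bits n) ≤ Γ) where
      private
        budget : ℕ → ℕ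
        budget d = d * (1200 * bits n) + 100 * Γ

      editR-later : ∀ {t ts ts' es c d} {ms' : MR ts'} {me : MR es} (mt : Mark t) → EditedR Γ n {ts} c d ms' me → EditedR Γ n {t ∷ ts} c d (mt ∷ ms') me
      editR-later {c = c} {d} {ms' = ms'} {me} mt (editedR ms w ph≤ sim) = editedR (mt ∷ ms)
        (λ {f} mono → ≤-trans (+-monoʳ-≤ (f (mass mt)) (w mono)) (≤-reflexive (sym (+-assoc (f (mass mt)) _ _))))
        (linear 4 (λ x a b e → a ≲ b ⊕ e ⊕ # 2 ⇒ x ⊕ a ≲ (x ⊕ b) ⊕ e ⊕ # 2) (phantomT mt) (phantomR ms) (phantomR ms') (phantomR me) ph≤)
        λ { (a ∷ as) → go a as (sim as) }
        where
        go : ∀ (a : Ann mt) (as : Roots ms) → Σ[ as' ∈ Roots ms' ] Σ[ ae ∈ Roots me ]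
            c + (rootsP as' + rootsP ae) + rootsN as + price Γ * phantomR ms ≤ rootsP as + (rootsN as' + rootsN ae) + price Γ * (phantomR ms' + phantomR me + 2) + budget d →
            Σ[ as' ∈ Roots (mt ∷ ms') ] Σ[ ae ∈ Roots me ]
            c + (rootsP as' + rootsP ae) + (neg a + rootsN as) + price Γ * (phantomT mt + phantomR ms) ≤ (pos 0 a + rootsP as) + (rootsN as' + rootsN ae) + price Γ * (phantomT mt + phantomR ms' + phantomR me + 2) + budget d
        go a as (as' , ae , q) = a ∷ as' , ae ,
          linear 15 (λ c p' P n Q pf n' N Q' E A B X Q₀ Q₀' → c ⊕ (p' ⊕ P) ⊕ n ⊕ Q ≲ pf ⊕ (n' ⊕ N) ⊕ Q' ⊕ E ⇒ Q₀ ≐ X ⊕ Q ⇒ Q₀' ≐ X ⊕ Q' ⇒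
              c ⊕ ((A ⊕ p') ⊕ P) ⊕ (B ⊕ n) ⊕ Q₀ ≲ (A ⊕ pf) ⊕ ((B ⊕ n') ⊕ N) ⊕ Q₀' ⊕ E)
            c (rootsP as') (rootsP ae) (rootsN as) (price Γ * phantomR ms) (rootsP as) (rootsN as') (rootsN ae) (price Γ * (phantomR ms' + phantomR me + 2)) (budget d)
            (pos 0 a) (neg a) (price Γ * phantomT mt) (price Γ * (phantomT mt + phantomR ms)) (price Γ * (phantomT mt + phantomR ms' + phantomR me + 2))
            q (Linking.spread Γ (price Γ) refl) (Linking.spread Γ (price Γ) (linear 3 (λ x a b → x ⊕ a ⊕ b ⊕ # 2 ≐ x ⊕ (a ⊕ b ⊕ # 2)) (phantomT mt) (phantomR ms') (phantomR me)))

      editR-below : ∀ {i k cs cs' ts es c d} {ms' : Marks cs'} {me : MR es} b (mr : MR ts) → suc (cnts cs) ≤ n →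
                    Edited Γ n {cs} c d ms' me → EditedR Γ n {node i k cs ∷ ts} c d (mk {i} {k} b ms' ∷ mr) me
      editR-below {i} {k} {cs} {cs'} {ts} {es} {c} {d} {ms'} {me} b mr n≥ (edited ms m≡ ph≤ sim) = editedR (mk b ms ∷ mr)
        (λ {f} _ → ≤-trans (≤-reflexive (cong (λ z → f z + weigh f mr) (sym s≡))) (m≤m+n _ (d * f n)))
        (linear 4 (λ a b e r → a ≲ b ⊕ e ⊕ # 2 ⇒ a ⊕ r ≲ (b ⊕ r) ⊕ e ⊕ # 2) (phantomF ms) (phantomF ms') (phantomR me) (phantomR mr) ph≤)
        λ { (ann af vl ex ∷ ar) → go af vl ex ar (sim af vl (bits-mono (≤-trans (s≤s (masses≤cnts ms)) n≥))) }
        where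
        s = suc (masses ms)
        s' = suc (masses ms')
        s≡ : s ≡ s'
        s≡ = cong suc m≡
        go : ∀ {fs} (af : Anns ms fs) (vl : V (bits s) fs) (ex : excess fs ≤ 4 * bits s) (ar : Roots mr) →
             Σ[ fs' ∈ _ ] Σ[ _ ∈ Sub fs fs' ] Σ[ af' ∈ Anns ms' fs' ] Σ[ ae ∈ Roots me ]
               c + (posF af' + rootsP ae) + negF af + price Γ * phantomF ms ≤ posF af + (negF af' + rootsN ae) + price Γ * (phantomF ms' + phantomR me + 2) + budget d →
             Σ[ as' ∈ Roots (mk {i} {k} b ms' ∷ mr) ] Σ[ ae ∈ Roots me ]
               c + (rootsP as' + rootsP ae) + (18 * when b (bits s) + negF af + rootsN ar) + price Γ * (phantomF ms + phantomR mr)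
               ≤ (6 * when b (up 0 fs) + posF af + rootsP ar) + (rootsN as' + rootsN ae) + price Γ * (phantomF ms' + phantomR mr + phantomR me + 2) + budget d
        go {fs} af vl ex ar (fs' , sb , af' , ae , q) =
            ann af' (subst (λ z → V (bits z) fs') s≡ (sub-valley sb vl)) (subst (λ z → excess fs' ≤ 4 * bits z) s≡ (≤-trans (sub-excess sb) ex)) ∷ ar , ae ,
            subst (λ z → c + (6 * when b (up 0 fs') + posF af' + rootsP ar + rootsP ae) + (18 * when b (bits s) + negF af + rootsN ar) + price Γ * (phantomF ms + phantomR mr)
                 ≤ (6 * when b (up 0 fs) + posF af + rootsP ar) + (18 * when b (bits z) + negF af' + rootsN ar + rootsN ae) + price Γ * (phantomF ms' + phantomR mr + phantomR me + 2) + budget d) s≡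
              (linear 18 (λ c p' P n Q pf n' N Q' E D X Q₀ Q₀' u u' pr nr → c ⊕ (p' ⊕ P) ⊕ n ⊕ Q ≲ pf ⊕ (n' ⊕ N) ⊕ Q' ⊕ E ⇒ Q₀ ≐ X ⊕ Q ⇒ Q₀' ≐ X ⊕ Q' ⇒ u' ≲ u ⇒
                c ⊕ (((u' ⊕ p') ⊕ pr) ⊕ P) ⊕ ((D ⊕ n) ⊕ nr) ⊕ Q₀ ≲ ((u ⊕ pf) ⊕ pr) ⊕ (((D ⊕ n') ⊕ nr) ⊕ N) ⊕ Q₀' ⊕ E)
                 c (posF af') (rootsP ae) (negF af) (price Γ * phantomF ms) (posF af) (negF af') (rootsN ae) (price Γ * (phantomF ms' + phantomR me + 2)) (budget d)
                 (18 * when b (bits s)) (price Γ * phantomR mr) (price Γ * (phantomF ms + phantomR mr)) (price Γ * (phantomF ms' + phantomR mr + phantomR me + 2))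
                 (6 * when b (up 0 fs)) (6 * when b (up 0 fs')) (rootsP ar) (rootsN ar)
                 q (Linking.spread Γ (price Γ) (+-comm (phantomF ms) _))
                 (Linking.spread Γ (price Γ) (linear 3 (λ a r e → a ⊕ r ⊕ e ⊕ # 2 ≐ r ⊕ (a ⊕ e ⊕ # 2)) (phantomF ms') (phantomR mr) (phantomR me)))
                 (*-monoʳ-≤ 6 (when-mono b (sub-up 0 vl sb))))

      editR-del : ∀ {i k} cs ts → suc (cnts cs) ≤ n → (ms' : MR (linkAll v cs ++ ts)) (me : MR []) → EditedR Γ n {node i k cs ∷ ts} (linkCost v cs) 1 ms' me
      editR-del {i} {k} cs ts n≥ ms' [] = by (delete-one Γ n bits≤Γ cs (l sp))
        where
        sp = split (linkAll v cs) ms'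
        by : Σ[ ms ∈ Marks cs ] phantomF ms ≤ phantomR (l sp) × (∀ {i k} (ap : Ann (mk {i} {k} true ms)) → suc (masses ms) ≤ n →
             Σ[ as' ∈ Roots (l sp) ] linkCost v cs + rootsP as' + neg ap + price Γ * phantomF ms ≤ pos 0 ap + rootsN as' + price Γ * phantomR (l sp) + (1200 * bits n + 30 * Γ)) →
             EditedR Γ n {node i k cs ∷ ts} (linkCost v cs) 1 ms' []
        by (mk' , ph , f) = editedR (mk true mk' ∷ r sp)
          (λ {g} mono → ≤-trans (≤-reflexive (weigh+ sp g)) (linear 4 (λ L r m n → L ≲ n ⇒ L ⊕ r ≲ (m ⊕ r) ⊕ (n ⊕ # 0)) (weigh g (l sp)) (weigh g (r sp)) (g (suc (masses mk'))) (g n)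
             (weigh-linkAll cs mono (≤-trans (n≤1+n _) n≥) (l sp))))
          (linear 4 (λ a L r M → a ≲ L ⇒ M ≐ L ⊕ r ⇒ a ⊕ r ≲ M ⊕ # 0 ⊕ # 2) (phantomF mk') (phantomR (l sp)) (phantomR (r sp)) (phantomR ms') ph (ph+ sp))
          λ { (ap ∷ ar) → go ap ar (f ap (≤-trans (s≤s (masses≤cnts mk')) n≥)) }
          where
          go : ∀ (ap : Ann (mk {i} {k} true mk')) (ar : Roots (r sp)) →
               Σ[ as' ∈ Roots (l sp) ] linkCost v cs + rootsP as' + neg ap + price Γ * phantomF mk' ≤ pos 0 ap + rootsN as' + price Γ * phantomR (l sp) + (1200 * bits n + 30 * Γ) →
               Σ[ as' ∈ Roots ms' ] Σ[ ae ∈ Roots [] ]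
                 linkCost v cs + (rootsP as' + rootsP ae) + (neg ap + rootsN ar) + price Γ * (phantomF mk' + phantomR (r sp)) ≤ (pos 0 ap + rootsP ar) + (rootsN as' + rootsN ae) + price Γ * (phantomR ms' + 0 + 2) + budget 1
          go ap ar (al , q) = proj₁ j , [] ,
            linear 17 (λ c p n Q p0 n' Q' H G Q₀ Q₀' X pr nr pj nj Y → c ⊕ p ⊕ n ⊕ Q ≲ p0 ⊕ n' ⊕ Q' ⊕ (H ⊕ 30 ⊛ G) ⇒ Q₀ ≐ X ⊕ Q ⇒ Q' ⊕ X ≲ Q₀' ⇒ pj ≐ p ⊕ pr ⇒ nj ≐ n' ⊕ nr ⇒
                c ⊕ (pj ⊕ # 0) ⊕ (n ⊕ nr) ⊕ Q₀ ≲ (p0 ⊕ pr) ⊕ (nj ⊕ # 0) ⊕ Q₀' ⊕ ((H ⊕ # 0) ⊕ 100 ⊛ G))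
              (linkCost v cs) (rootsP al) (neg ap) (price Γ * phantomF mk') (pos 0 ap) (rootsN al) (price Γ * phantomR (l sp)) (1200 * bits n) Γ (price Γ * (phantomF mk' + phantomR (r sp))) (price Γ * (phantomR ms' + 0 + 2)) (price Γ * phantomR (r sp))
              (rootsP ar) (rootsN ar) (rootsP (proj₁ j)) (rootsN (proj₁ j)) 0
              q (Linking.spread Γ (price Γ) (+-comm (phantomF mk') _))
              (subst (_≤ price Γ * (phantomR ms' + 0 + 2)) (*-distribˡ-+ (price Γ) _ _) (*-monoʳ-≤ (price Γ) (≤-trans (≤-reflexive (sym (ph+ sp))) (≤-trans (m≤m+n _ 0) (m≤m+n _ 2)))))
              (proj₁ (proj₂ j)) (proj₂ (proj₂ j))
            where
            j = join sp al ar

      editR : ∀ {ts ts' es c d} → EditR ts ts' es c d → cnts ts ≤ n → (ms' : MR ts') (me : MR es) → EditedR Γ n {ts} c d ms' me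
      editR (below e) h (mk b ms' ∷ mr) me = editR-below b mr (≤-trans (m≤m+n _ _) h) (edit Γ n bits≤Γ e (≤-trans (≤-trans (n≤1+n _) (m≤m+n _ _)) h) ms' me)
      editR (delR {cs = cs} {ts}) h ms' me = editR-del cs ts (≤-trans (m≤m+n _ _) h) ms' me
      editR (laterR e) h (mt ∷ ms') me = editR-later mt (editR e (≤-trans (m≤n+m _ _) h) ms' me)

    -- The potential of a heap

    record MH (H : Heap) : Set where
      constructor mh
      field
        mr : MR (roots H)
        mb : MR (buffer H)
    open MH public

    record AH {H : Heap} (M : MH H) : Set where
      constructor ah
      field
        ar : Roots (mr M)
        ab : Roots (mb M)
    open AH public

    phH : ∀ {H} → MH H → ℕ
    phH M = phantomR (mr M) + phantomR (mb M)

    -- The factor 130 is the price of a root in `seq-roots`. Of the 200 units of Λ held by a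
    -- buffered root, 53 pay for a link in the sorted list and 147 are saved for the weight of the
    -- resulting root.
    weighH : ∀ {H} → MH H → ℕ
    weighH M = 130 * weigh rank⁺ (mr M) + 200 * weigh Λ (mb M)

    posH negH : ∀ {H} {M : MH H} → AH M → ℕ
    posH {H} {M} A = rootsP (ar A) + rootsP (ab A) + weighH M + 130 * bits (size H)
    negH {H} {M} A = rootsN (ar A) + rootsN (ab A) + 220 * G (size H) (phH M)

    Fits : Heap → Set
    Fits H = cnts (roots H) + cnts (buffer H) ≤ size H

    -- Marks are carried backwards and annotations forwards, whence the quantifiers.
    Tr : Heap → Heap → ℕ → ℕ → Set
    Tr H H' c e = (M' : MH H') → Σ[ M ∈ MH H ] ((A : AH M) → Σ[ A' ∈ AH M' ] c + posH A' + negH A ≤ posH A + negH A' + e)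

    tr-trans : ∀ {H H₁ H₂ c c' e e'} → Tr H H₁ c e → Tr H₁ H₂ c' e' → Tr H H₂ (c + c') (e + e')
    tr-trans {H} {H₁} {H₂} {c} {c'} {e} {e'} t t' M₂ = M , λ A → go A
      where
      M₁ = proj₁ (t' M₂)
      M = proj₁ (t M₁)
      go : (A : AH M) → Σ[ A₂ ∈ AH M₂ ] (c + c') + posH A₂ + negH A ≤ posH A + negH A₂ + (e + e')
      go A = A₂ , linear 10 (λ c c' e e' p n p₁ n₁ p₂ n₂ → c ⊕ p₁ ⊕ n ≲ p ⊕ n₁ ⊕ e ⇒ c' ⊕ p₂ ⊕ n₁ ≲ p₁ ⊕ n₂ ⊕ e' ⇒ (c ⊕ c') ⊕ p₂ ⊕ n ≲ p ⊕ n₂ ⊕ (e ⊕ e'))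
        c c' e e' (posH A) (negH A) (posH A₁) (negH A₁) (posH A₂) (negH A₂) (proj₂ (proj₂ (t M₁) A)) (proj₂ (proj₂ (t' M₂) A₁))
        where
        A₁ = proj₁ (proj₂ (t M₁) A)
        A₂ = proj₁ (proj₂ (t' M₂) A₁)

    phantomR≤ : ∀ {ts} (ms : MR ts) → phantomR ms ≤ cnts ts
    phantomR≤ [] = z≤n
    phantomR≤ (mt ∷ ms) = +-mono-≤ (≤-trans (n≤1+n _) (phantomT≤ mt)) (phantomR≤ ms)

    length≤weigh : ∀ {ts} (ms : MR ts) → length ts ≤ weigh Λ ms
    length≤weigh [] = z≤n
    length≤weigh (mt ∷ ms) = s≤s (≤-trans (length≤weigh ms) (m≤n+m _ _))

    -- As Λ n is at least 1, the price 200 Λ n + 20 of a phantom link is at most 220 Λ n. The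
    -- allowance 220 G grows at least this much with each phantom edge.
    charge-G : ∀ n u U → u ≤ U → 220 * G n u + price (Λ n) * U ≤ 220 * G n U + price (Λ n) * u
    charge-G n u U h = subst (λ z → 220 * G n u + price (Λ n) * z ≤ 220 * G n z + price (Λ n) * u) (m+[n∸m]≡n h)
      (linear 6 (λ g g' pU pu pq ql → pU ≐ pu ⊕ pq ⇒ pq ≲ 220 ⊛ ql ⇒ g ⊕ ql ≲ g' ⇒ 220 ⊛ g ⊕ pU ≲ 220 ⊛ g' ⊕ pu)
        (G n u) (G n (u + (U ∸ u))) (price (Λ n) * (u + (U ∸ u))) (price (Λ n) * u) (price (Λ n) * (U ∸ u)) ((U ∸ u) * Λ n)
        (*-distribˡ-+ (price (Λ n)) u (U ∸ u)) pq (G-step n u (U ∸ u)))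
      where
      pq : price (Λ n) * (U ∸ u) ≤ 220 * ((U ∸ u) * Λ n)
      pq = ≤-trans (*-monoˡ-≤ (U ∸ u) (≤-trans (≤-reflexive (price-def (Λ n))) (linear 1 (λ b → 200 ⊛ (# 1 ⊕ b) ⊕ # 20 ≲ 220 ⊛ (# 1 ⊕ b)) (bits (bits n)))))
             (≤-reflexive (trans (*-assoc 220 (Λ n) (U ∸ u)) (cong (220 *_) (*-comm (Λ n) (U ∸ u)))))

    edit-G : ∀ n u U → u ≤ U + 2 → U ≤ n → 1 ≤ n → 220 * G n u + price (Λ n) * (U + 2) ≤ 220 * G n U + price (Λ n) * u + 220 * (2 * Λ n + 4)
    edit-G n u U h k p = linear 6 (λ g pU g₂ pu g' e → 220 ⊛ g ⊕ pU ≲ 220 ⊛ g₂ ⊕ pu ⇒ g₂ ≲ g' ⊕ e ⇒ 220 ⊛ g ⊕ pU ≲ 220 ⊛ g' ⊕ pu ⊕ 220 ⊛ e)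
      (G n u) (price (Λ n) * (U + 2)) (G n (U + 2)) (price (Λ n) * u) (G n U) (2 * Λ n + 4) (charge-G n u (U + 2) h) (G-two n U k p)

    -- Changes of one heap

    -- The tree made from the buffer needs the weight of a new root. The saved 147 = 200 - 53 per
    -- buffered root covers it when the buffer is full; otherwise e₀ has to make up the difference.
    empty-tr : ∀ {H H' c} e₀ → Empties v H H' c → Fits H → 130 * bits (size H) ≤ 147 * length (buffer H) + e₀ → Tr H H' c (131 + sortCost (length (buffer H)) + e₀)
    empty-tr {H} {H'} {c} e₀ em fits h M' = by em M' (emptied em (mr M'))
      where
      n = size H
      b = length (buffer H)
      by : ∀ {H'} → Empties v H H' c → (M' : MH H') → Emptied H (roots H') c (mr M') → Σ[ M ∈ MH H ] ((A : AH M) → Σ[ A' ∈ AH M' ] c + posH A' + negH A ≤ posH A + negH A' + (131 + sortCost b + e₀))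
      by (empties s p sorted) (mh mr' []) E = mh E.mr E.mb , λ { (ah ar ab) → go ar ab (E.pay ar ab) }
        where
        module E = Emptied E
        go : (ar : Roots E.mr) (ab : Roots E.mb) → Σ[ as ∈ Roots mr' ] c + rootsP as + (rootsN ar + rootsN ab) ≤ (rootsP ar + rootsP ab) + rootsN as + (53 * weigh Λ E.mb + suc (sortCost b)) →
             Σ[ A' ∈ AH (mh mr' []) ] c + posH A' + negH (ah {H} {mh E.mr E.mb} ar ab) ≤ posH (ah {H} {mh E.mr E.mb} ar ab) + negH A' + (131 + sortCost b + e₀)
        go ar ab (as , q) = ah as [] ,
          linear 18 (λ c p n P m W S w w₁ bc bn b g g' e z nr _ → c ⊕ p ⊕ n ≲ P ⊕ m ⊕ (53 ⊛ W ⊕ (# 1 ⊕ S)) ⇒ w ≲ w₁ ⊕ (# 1 ⊕ bc) ⇒ bc ≲ bn ⇒ 130 ⊛ bn ≲ 147 ⊛ b ⊕ e ⇒ b ≲ W ⇒ g ≲ g' ⇒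
              c ⊕ (p ⊕ # 0 ⊕ (130 ⊛ w ⊕ # 0) ⊕ 130 ⊛ bn) ⊕ (n ⊕ 220 ⊛ g) ≲ (P ⊕ (130 ⊛ w₁ ⊕ 200 ⊛ W) ⊕ 130 ⊛ bn) ⊕ (m ⊕ # 0 ⊕ 220 ⊛ g') ⊕ (# 131 ⊕ S ⊕ e))
            c (rootsP as) (rootsN ar + rootsN ab) (rootsP ar + rootsP ab) (rootsN as) (weigh Λ E.mb) (sortCost b) (weigh rank⁺ mr') (weigh rank⁺ E.mr) (bits (cnts (buffer H))) (bits n) b
            (G n (phantomR E.mr + phantomR E.mb)) (G n (phantomR mr' + 0)) e₀ 0 0 0
            q E.weigh≤ (bits-mono (≤-trans (m≤n+m _ (cnts (roots H))) fits)) h (length≤weigh E.mb) (G-monoᵘ n (≤-trans E.ph≤ (m≤m+n _ 0)))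

    empty-fits : ∀ {H H' c} → Empties v H H' c → Fits H → Fits H'
    empty-fits em@(empties _ _ _) fits = ≤-trans (≤-reflexive (trans (+-identityʳ _) (emptied-cnt em))) fits

    delete-price : ℕ → ℕ
    delete-price n = 4000 * bits n + 4000 * Λ n

    root-tr : ∀ {x k} cs pre rest n → cnts (pre ++ node x k cs ∷ rest) ≤ n →
              Tr (mkHeap (pre ++ node x k cs ∷ rest) [] n) (mkHeap (linkAll v (cs ++ pre ++ rest)) [] (n ∸ 1)) (linkCost v (cs ++ pre ++ rest)) (delete-price n)
    root-tr {x} {k} cs pre rest n@zero h with ≤-trans (≤-reflexive (sym (cnts-↭ (shift (node x k cs) pre rest)))) h
    ... | ()
    root-tr {x} {k} cs pre rest n@(suc n₀) h (mh M' []) = by (Rounds.delete-round Γ cs (pre ++ rest) M')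
      where
      Γ = Λ n
      total : suc (cnts cs) + cnts (pre ++ rest) ≤ n
      total = ≤-trans (≤-reflexive (sym (cnts-↭ (shift (node x k cs) pre rest)))) h
      by : Σ[ ms ∈ MR (cs ++ pre ++ rest) ] phantomF (kidsOf cs ms) + phantomR (rootsOf cs ms) ≤ phantomR M' × (∀ {i k top} → bits top ≤ Γ → (ap : Ann (mk {i} {k} true (kidsOf cs ms))) (as : Roots (rootsOf cs ms)) →
          bits (suc (masses (kidsOf cs ms))) ≤ top → Σ[ as' ∈ Roots M' ]
            linkCost v (cs ++ pre ++ rest) + rootsP as' + (neg ap + rootsN as) + price Γ * (phantomF (kidsOf cs ms) + phantomR (rootsOf cs ms))
            ≤ (pos 0 ap + rootsP as) + rootsN as' + price Γ * phantomR M' + (130 * weigh rank⁺ (rootsOf cs ms) + (1200 * top + 30 * Γ))) →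
           Σ[ M ∈ MH (mkHeap (pre ++ node x k cs ∷ rest) [] n) ] ((A : AH M) → Σ[ A' ∈ AH (mh {mkHeap (linkAll v (cs ++ pre ++ rest)) [] n₀} M' []) ] linkCost v (cs ++ pre ++ rest) + posH A' + negH A ≤ posH A + negH A' + delete-price n)
      by (ms , ph , f) = mh (proj₁ pm) [] , λ { (ah ar []) → go ar (roots⇒ (proj₂ pm) ar) }
        where
        mk' = kidsOf cs ms
        mo = rootsOf cs ms
        pm = permute (shift (node x k cs) pre rest) (mk true mk' ∷ mo)
        go : (ar : Roots (proj₁ pm)) → Σ[ as ∈ Roots (mk {x} {k} true mk' ∷ mo) ] rootsP as ≡ rootsP ar × rootsN as ≡ rootsN ar →
             Σ[ A' ∈ AH (mh {mkHeap (linkAll v (cs ++ pre ++ rest)) [] n₀} M' []) ] linkCost v (cs ++ pre ++ rest) + posH A' + negH (ah {mkHeap (pre ++ node x k cs ∷ rest) [] n} {mh (proj₁ pm) []} ar [])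
               ≤ posH (ah {mkHeap (pre ++ node x k cs ∷ rest) [] n} {mh (proj₁ pm) []} ar []) + negH A' + delete-price n
        go ar (ap ∷ as , e₁ , e₂) = ah (proj₁ res) [] , subst₂ (λ u W → c + (p' + 0 + (130 * w' + 0) + 130 * bits n₀) + (nr + 0 + 220 * G n (u + 0)) ≤ (pr + 0 + (130 * W + 0) + 130 * bits n) + (n' + 0 + 220 * G n₀ (phantomR M' + 0)) + delete-price n)
            (sym (ph≡ (proj₂ pm))) (sym (weigh≡ (proj₂ pm) rank⁺))
            (numbers (proj₂ res) e₁ e₂)
          where
          res = f (n≤1+n _) ap as (bits-mono (≤-trans (s≤s (masses≤cnts mk')) (≤-trans (m≤m+n _ _) total)))
          c = linkCost v (cs ++ pre ++ rest)
          p' = rootsP (proj₁ res)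
          n' = rootsN (proj₁ res)
          w' = weigh rank⁺ M'
          pr = rootsP ar
          nr = rootsN ar
          u = phantomF mk' + phantomR mo
          W₀ = weigh rank⁺ mo
          rx = rank⁺ (suc (masses mk'))
          U = phantomR M'
          w≤ : w' ≤ rank⁺ n
          w≤ = weigh-linkAll (cs ++ pre ++ rest) {n} {rank⁺} (λ h → s≤s (bits-mono h)) (≤-trans (≤-reflexive (Linking.cnts-++ 0 cs (pre ++ rest))) (≤-trans (n≤1+n _) total)) M'
          U≤ : U ≤ n
          U≤ = ≤-trans (phantomR≤ M') (≤-trans (≤-reflexive (Rounds.linkAll-cnt 0 (cs ++ pre ++ rest))) (≤-trans (≤-reflexive (Linking.cnts-++ 0 cs (pre ++ rest))) (≤-trans (n≤1+n _) total)))
          numbers : c + p' + (neg ap + rootsN as) + price Γ * u ≤ (pos 0 ap + rootsP as) + n' + price Γ * U + (130 * W₀ + (1200 * bits n + 30 * Γ)) → pos 0 ap + rootsP as ≡ pr → neg ap + rootsN as ≡ nr →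
                    c + (p' + 0 + (130 * w' + 0) + 130 * bits n₀) + (nr + 0 + 220 * G n (u + 0)) ≤ (pr + 0 + (130 * (rx + W₀) + 0) + 130 * bits n) + (n' + 0 + 220 * G n₀ (U + 0)) + delete-price n
          numbers q e₁ e₂ = subst₂ (λ a b → c + (p' + 0 + (130 * w' + 0) + 130 * bits n₀) + (nr + 0 + 220 * G n a) ≤ (pr + 0 + (130 * (rx + W₀) + 0) + 130 * bits n) + (n' + 0 + 220 * G n₀ b) + delete-price n)
            (sym (+-identityʳ u)) (sym (+-identityʳ U))
            (
             linear 18 (λ c p nr pu pr n' pU W bn L w' b₀ gu gU gU' rx _ _ → c ⊕ p ⊕ nr ⊕ pu ≲ pr ⊕ n' ⊕ pU ⊕ (130 ⊛ W ⊕ (1200 ⊛ bn ⊕ 30 ⊛ (# 1 ⊕ L))) ⇒ w' ≲ # 1 ⊕ bn ⇒ b₀ ≲ bn ⇒ 220 ⊛ gu ⊕ pU ≲ 220 ⊛ gU ⊕ pu ⇒ gU ≲ # 1 ⊕ gU' ⇒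
              c ⊕ (p ⊕ # 0 ⊕ (130 ⊛ w' ⊕ # 0) ⊕ 130 ⊛ b₀) ⊕ (nr ⊕ # 0 ⊕ 220 ⊛ gu) ≲ (pr ⊕ # 0 ⊕ (130 ⊛ (rx ⊕ W) ⊕ # 0) ⊕ 130 ⊛ bn) ⊕ (n' ⊕ # 0 ⊕ 220 ⊛ gU') ⊕ (4000 ⊛ bn ⊕ 4000 ⊛ (# 1 ⊕ L)))
              c p' nr (price Γ * u) pr n' (price Γ * U) W₀ (bits n) (bits (bits n)) w' (bits n₀) (G n u) (G n U) (G n₀ U) rx 0 0
              (subst₂ (λ a b → c + p' + b + price Γ * u ≤ a + n' + price Γ * U + (130 * W₀ + (1200 * bits n + 30 * Γ))) e₁ e₂ q) w≤ (bits-mono (n≤1+n n₀)) (charge-G n u U ph) (G-pred n₀ U U≤))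

    SimS : List Tree → List Tree → Set
    SimS R R' = (ms' : MR R') → Σ[ ms ∈ MR R ] Same ms ms'

    sim-trans : ∀ {R R₁ R₂} → SimS R R₁ → SimS R₁ R₂ → SimS R R₂
    sim-trans f g m₂ = proj₁ (f m₁) , record
      { ph≡ = trans (ph≡ s₁) (ph≡ s₂) ; weigh≡ = λ h → trans (weigh≡ s₁ h) (weigh≡ s₂ h)
      ; roots⇒ = λ as → proj₁ (roots⇒ s₂ (proj₁ (roots⇒ s₁ as))) ,
          trans (proj₁ (proj₂ (roots⇒ s₂ (proj₁ (roots⇒ s₁ as))))) (proj₁ (proj₂ (roots⇒ s₁ as))) ,
          trans (proj₂ (proj₂ (roots⇒ s₂ (proj₁ (roots⇒ s₁ as))))) (proj₂ (proj₂ (roots⇒ s₁ as))) }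
      where
      m₁ = proj₁ (g m₂)
      s₁ = proj₂ (f m₁)
      s₂ = proj₂ (g m₂)

    sim-refl : ∀ {R} → SimS R R
    sim-refl = permute ↭-refl

    rekey : ∀ {x k k' cs ts} → SimS (node x k cs ∷ ts) (node x k' cs ∷ ts)
    rekey (mk b ms ∷ mr) = mk b ms ∷ mr , record { ph≡ = refl ; weigh≡ = λ _ → refl ; roots⇒ = λ { (ann af vl ex ∷ as) → ann af vl ex ∷ as , refl , refl } }

    same-tr : ∀ {R R' B B' n} → SimS R R' → SimS B B' → Tr (mkHeap R B n) (mkHeap R' B' n) 0 0
    same-tr {n = n} f g (mh mr' mb') = mh (proj₁ (f mr')) (proj₁ (g mb')) , λ { (ah ar ab) → go ar ab (roots⇒ (proj₂ (f mr')) ar) (roots⇒ (proj₂ (g mb')) ab) }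
      where
      go : ∀ ar ab → Σ[ ar' ∈ Roots mr' ] rootsP ar' ≡ rootsP ar × rootsN ar' ≡ rootsN ar → Σ[ ab' ∈ Roots mb' ] rootsP ab' ≡ rootsP ab × rootsN ab' ≡ rootsN ab →
           Σ[ A' ∈ AH (mh mr' mb') ] posH A' + negH (ah {mkHeap _ _ n} {mh (proj₁ (f mr')) (proj₁ (g mb'))} ar ab) ≤ posH (ah {mkHeap _ _ n} {mh (proj₁ (f mr')) (proj₁ (g mb'))} ar ab) + negH A' + 0
      go ar ab (ar' , p , q) (ab' , p' , q') = ah ar' ab' , ≤-reflexive (trans (cong₂ _+_
          (cong₂ _+_ (cong₂ _+_ (cong₂ _+_ p p') (cong₂ (λ a b → 130 * a + 200 * b) (sym (weigh≡ (proj₂ (f mr')) rank⁺)) (sym (weigh≡ (proj₂ (g mb')) Λ)))) refl)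
          (cong₂ _+_ (cong₂ _+_ (sym q) (sym q')) (cong₂ (λ a b → 220 * G n (a + b)) (ph≡ (proj₂ (f mr'))) (ph≡ (proj₂ (g mb'))))))
        (sym (+-identityʳ _)))

    edit-price : ℕ → ℕ → ℕ
    edit-price d n = d * (2000 * bits n + 1000) + 3000 * Λ n

    -- The bookkeeping common to edits in the root list and in the buffer: p, n, w
    -- and f stand for potential, debt, weight and phantom edges of the list
    -- concerned, pe, ne, we and fe for those of the trees cut off, and fo for the
    -- phantom edges of the other list.
    edit-numbers : ∀ n d → d ≤ 1 → 1 ≤ n → ∀ {c p p' pe m m' me w w' we f f' fe} fo →
      c + (p' + pe) + m + price (Λ n) * f ≤ p + (m' + me) + price (Λ n) * (f' + fe + 2) + (d * (1200 * bits n) + 100 * Λ n) →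
      w' ≤ w + d * (200 * suc (bits n)) → we ≤ Λ n → f ≤ f' + fe + 2 → (f' + fe) + fo ≤ n →
      c + ((p' + pe) + (w' + 200 * we) + 130 * bits (n ∸ d)) + (m + 220 * G n (f + fo)) ≤ (p + w + 130 * bits n) + ((m' + me) + 220 * G (n ∸ d) ((f' + fe) + fo)) + edit-price d n
    edit-numbers n d d≤1 1≤n {c} {p} {p'} {pe} {m} {m'} {me} {w} {w'} {we} {f} {f'} {fe} fo q hw he hf hU =
      linear 25 (λ c P m pf p M pF w w' we Y Z D dd bn b' g gU gU' L pg pgU e _ _ → c ⊕ P ⊕ m ⊕ pf ≲ p ⊕ M ⊕ pF ⊕ (Y ⊕ 100 ⊛ L) ⇒ w' ≲ w ⊕ Z ⇒ we ≲ L ⇒ b' ≲ bn ⇒ 220 ⊛ g ⊕ pgU ≲ 220 ⊛ gU ⊕ pg ⊕ 220 ⊛ (2 ⊛ L ⊕ # 4) ⇒ pg ⊕ pF ≐ pgU ⊕ pf ⇒ gU ≲ dd ⊕ gU' ⇒ Y ⊕ Z ⊕ 220 ⊛ dd ≲ D ⇒ # 1 ≲ L ⇒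
          c ⊕ (P ⊕ (w' ⊕ 200 ⊛ we) ⊕ 130 ⊛ b') ⊕ (m ⊕ 220 ⊛ g) ≲ (p ⊕ w ⊕ 130 ⊛ bn) ⊕ (M ⊕ 220 ⊛ gU') ⊕ (D ⊕ 3000 ⊛ L))
        c (p' + pe) m (price (Λ n) * f) p (m' + me) (price (Λ n) * (f' + fe + 2)) w w' we (d * (1200 * bits n)) (d * (200 * suc (bits n))) (d * (2000 * bits n + 1000)) d (bits n) (bits (n ∸ d)) (G n (f + fo)) (G n U) (G (n ∸ d) U) (Λ n)
        (price (Λ n) * (f + fo)) (price (Λ n) * (U + 2)) 0 0 0
        q hw he (bits-mono (m∸n≤m n d)) (edit-G n (f + fo) U (linear 4 (λ f f' fe o → f ≲ f' ⊕ fe ⊕ # 2 ⇒ f ⊕ o ≲ ((f' ⊕ fe) ⊕ o) ⊕ # 2) f f' fe fo hf) hU 1≤n)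
        (trans (sym (*-distribˡ-+ (price (Λ n)) (f + fo) (f' + fe + 2))) (trans (cong (price (Λ n) *_) (linear 4 (λ f o f' fe → (f ⊕ o) ⊕ (f' ⊕ fe ⊕ # 2) ≐ ((f' ⊕ fe) ⊕ o ⊕ # 2) ⊕ f) f fo f' fe)) (*-distribˡ-+ (price (Λ n)) (U + 2) f)))
        (shrink d n d≤1 hU) (split-d d) (s≤s z≤n)
      where
      U = (f' + fe) + fo
      shrink : ∀ d n → d ≤ 1 → U ≤ n → G n U ≤ d + G (n ∸ d) U
      shrink zero n _ _ = ≤-refl
      shrink (suc zero) zero _ h = n≤1+n _
      shrink (suc zero) (suc n) _ h = G-pred n U h
      shrink (suc (suc d)) n (s≤s ()) _
      split-d : ∀ d → d * (1200 * bits n) + d * (200 * suc (bits n)) + 220 * d ≤ d * (2000 * bits n + 1000)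
      split-d d = ≤-trans (≤-reflexive (trans (cong₂ _+_ (sym (*-distribˡ-+ d (1200 * bits n) (200 * suc (bits n)))) (*-comm 220 d)) (sym (*-distribˡ-+ d (1200 * bits n + 200 * suc (bits n)) 220))))
        (*-monoʳ-≤ d (linear 1 (λ b → 1200 ⊛ b ⊕ 200 ⊛ (# 1 ⊕ b) ⊕ # 220 ≲ 2000 ⊛ b ⊕ # 1000) (bits n)))

    weigh-cut : ∀ {es n} (me : MR es) → length es ≤ 1 → cnts es ≤ n → weigh Λ me ≤ Λ n
    weigh-cut [] _ _ = z≤n
    weigh-cut (mt ∷ []) _ h = ≤-trans (≤-reflexive (+-identityʳ _)) (Λ-mono (≤-trans (mass≤cnt mt) (≤-trans (m≤m+n _ _) h)))
    weigh-cut (mt ∷ _ ∷ _) (s≤s ()) _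

    positive : ∀ {R R' es c d} → EditR R R' es c d → 1 ≤ cnts R
    positive (below _) = s≤s z≤n
    positive delR = s≤s z≤n
    positive (laterR {node _ _ _} e) = s≤s z≤n

    roots-edit-tr : ∀ {R R' B es n c d} → EditR R R' es c d → d ≤ 1 → length es ≤ 1 → cnts R + cnts B ≤ n →
                    Tr (mkHeap R B n) (mkHeap R' (es ++ B) (n ∸ d)) c (edit-price d n)
    roots-edit-tr {R} {R'} {B} {es} {n} {c} {d} ed d≤1 l≤1 fits (mh mr' meb) = by (editR (Λ n) n (n≤1+n _) ed R≤ mr' (l sp))
      where
      sp = split es meb
      R≤ : cnts R ≤ n
      R≤ = ≤-trans (m≤m+n _ _) fits
      by : EditedR (Λ n) n {R} c d mr' (l sp) → Σ[ M ∈ MH (mkHeap R B n) ] ((A : AH M) → Σ[ A' ∈ AH (mh {mkHeap R' (es ++ B) (n ∸ d)} mr' meb) ] c + posH A' + negH A ≤ posH A + negH A' + edit-price d n)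
      by E = mh E.ms (r sp) , λ { (ah ar ab) → go ar ab (E.sim ar) }
        where
        module E = EditedR E
        go : ∀ (ar : Roots E.ms) (ab : Roots (r sp)) → Σ[ as' ∈ Roots mr' ] Σ[ ae ∈ Roots (l sp) ]
             c + (rootsP as' + rootsP ae) + rootsN ar + price (Λ n) * phantomR E.ms ≤ rootsP ar + (rootsN as' + rootsN ae) + price (Λ n) * (phantomR mr' + phantomR (l sp) + 2) + (d * (1200 * bits n) + 100 * Λ n) →
             Σ[ A' ∈ AH (mh {mkHeap R' (es ++ B) (n ∸ d)} mr' meb) ] c + posH A' + negH (ah {mkHeap R B n} {mh E.ms (r sp)} ar ab) ≤ posH (ah {mkHeap R B n} {mh E.ms (r sp)} ar ab) + negH A' + edit-price d n
        go ar ab (as' , ae , q) = ah as' (proj₁ j) ,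
          subst₂ (λ a b → c + (rootsP as' + rootsP (proj₁ j) + (130 * weigh rank⁺ mr' + 200 * weigh Λ meb) + 130 * bits (n ∸ d)) + (rootsN ar + rootsN ab + 220 * G n (phantomR E.ms + phantomR (r sp)))
                 ≤ (rootsP ar + rootsP ab + (130 * weigh rank⁺ E.ms + 200 * weigh Λ (r sp)) + 130 * bits n) + (a + 220 * G (n ∸ d) b) + edit-price d n)
                 (trans (+-assoc (rootsN as') (rootsN ae) (rootsN ab)) (cong (rootsN as' +_) (sym (proj₂ (proj₂ j)))))
                 (trans (+-assoc (phantomR mr') (phantomR (l sp)) (phantomR (r sp))) (cong (phantomR mr' +_) (sym (ph+ sp))))
          (linear 20 (λ c p pe X' we b' m g p₀ X bn M G' E pj nj wj pb nb wb → c ⊕ ((p ⊕ pe) ⊕ (X' ⊕ 200 ⊛ we) ⊕ 130 ⊛ b') ⊕ (m ⊕ 220 ⊛ g) ≲ (p₀ ⊕ X ⊕ 130 ⊛ bn) ⊕ (M ⊕ 220 ⊛ G') ⊕ E ⇒ pj ≐ pe ⊕ pb ⇒ wj ≐ we ⊕ wb ⇒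
              c ⊕ ((p ⊕ pj) ⊕ (X' ⊕ 200 ⊛ wj) ⊕ 130 ⊛ b') ⊕ ((m ⊕ nb) ⊕ 220 ⊛ g) ≲ ((p₀ ⊕ pb) ⊕ (X ⊕ 200 ⊛ wb) ⊕ 130 ⊛ bn) ⊕ ((M ⊕ nb) ⊕ 220 ⊛ G') ⊕ E)
            c (rootsP as') (rootsP ae) (130 * weigh rank⁺ mr') (weigh Λ (l sp)) (bits (n ∸ d)) (rootsN ar) (G n (phantomR E.ms + phantomR (r sp))) (rootsP ar) (130 * weigh rank⁺ E.ms) (bits n) (rootsN as' + rootsN ae)
            (G (n ∸ d) ((phantomR mr' + phantomR (l sp)) + phantomR (r sp))) (edit-price d n) (rootsP (proj₁ j)) (rootsN (proj₁ j)) (weigh Λ meb) (rootsP ab) (rootsN ab) (weigh Λ (r sp))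
            (edit-numbers n d d≤1 (≤-trans (positive ed) R≤) {c} {rootsP ar} {rootsP as'} {rootsP ae} {rootsN ar} {rootsN as'} {rootsN ae} {130 * weigh rank⁺ E.ms} {130 * weigh rank⁺ mr'} {weigh Λ (l sp)} {phantomR E.ms} {phantomR mr'} {phantomR (l sp)} (phantomR (r sp)) q
              (≤-trans (*-monoʳ-≤ 130 (E.weigh≤ {rank⁺} (λ h → s≤s (bits-mono h)))) (≤-trans (≤-reflexive (*-distribˡ-+ 130 (weigh rank⁺ E.ms) (d * rank⁺ n))) (+-monoʳ-≤ (130 * weigh rank⁺ E.ms) scale)))
              (weigh-cut (l sp) l≤1 (≤-trans (≤-trans (m≤n+m _ (cnts R')) (m≤m+n _ d)) (≤-trans (≤-reflexive (editR-cnt ed)) R≤)))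
              E.ph≤ U≤)
            (proj₁ (proj₂ j)) (weigh+ sp Λ))
          where
          j = join sp ae ab
          scale : 130 * (d * rank⁺ n) ≤ d * (200 * suc (bits n))
          scale = ≤-trans (≤-reflexive (trans (sym (*-assoc 130 d (rank⁺ n))) (trans (cong (_* rank⁺ n) (*-comm 130 d)) (*-assoc d 130 (rank⁺ n))))) (*-monoʳ-≤ d (*-monoˡ-≤ (rank⁺ n) (linear 0 (# 130 ≲ # 200))))
          U≤ : (phantomR mr' + phantomR (l sp)) + phantomR (r sp) ≤ n
          U≤ = ≤-trans (+-mono-≤ (+-mono-≤ (phantomR≤ mr') (phantomR≤ (l sp))) (phantomR≤ (r sp))) (≤-trans (+-monoˡ-≤ (cnts B) (≤-trans (m≤m+n _ d) (≤-reflexive (editR-cnt ed)))) fits)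

    buffer-edit-tr : ∀ {R B B' es n c d} → EditR B B' es c d → d ≤ 1 → length es ≤ 1 → cnts R + cnts B ≤ n →
                    Tr (mkHeap R B n) (mkHeap R (es ++ B') (n ∸ d)) c (edit-price d n)
    buffer-edit-tr {R} {B} {B'} {es} {n} {c} {d} ed d≤1 l≤1 fits (mh mr meb) = by (editR (Λ n) n (n≤1+n _) ed B≤ (r sp) (l sp))
      where
      sp = split es meb
      B≤ : cnts B ≤ n
      B≤ = ≤-trans (m≤n+m _ (cnts R)) fits
      by : EditedR (Λ n) n {B} c d (r sp) (l sp) → Σ[ M ∈ MH (mkHeap R B n) ] ((A : AH M) → Σ[ A' ∈ AH (mh {mkHeap R (es ++ B') (n ∸ d)} mr meb) ] c + posH A' + negH A ≤ posH A + negH A' + edit-price d n)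
      by E = mh mr E.ms , λ { (ah ar ab) → go ar ab (E.sim ab) }
        where
        module E = EditedR E
        go : ∀ (ar : Roots mr) (ab : Roots E.ms) → Σ[ as' ∈ Roots (r sp) ] Σ[ ae ∈ Roots (l sp) ]
             c + (rootsP as' + rootsP ae) + rootsN ab + price (Λ n) * phantomR E.ms ≤ rootsP ab + (rootsN as' + rootsN ae) + price (Λ n) * (phantomR (r sp) + phantomR (l sp) + 2) + (d * (1200 * bits n) + 100 * Λ n) →
             Σ[ A' ∈ AH (mh {mkHeap R (es ++ B') (n ∸ d)} mr meb) ] c + posH A' + negH (ah {mkHeap R B n} {mh mr E.ms} ar ab) ≤ posH (ah {mkHeap R B n} {mh mr E.ms} ar ab) + negH A' + edit-price d n
        go ar ab (as' , ae , q) = ah ar (proj₁ j) ,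
          linear 24 (λ c p pe X' we b' m g p₀ X bn M Me G' E pj nj wj pr nr wr g₀ G₀ _ → c ⊕ ((p ⊕ pe) ⊕ (200 ⊛ X' ⊕ 200 ⊛ we) ⊕ 130 ⊛ b') ⊕ (m ⊕ 220 ⊛ g) ≲ (p₀ ⊕ 200 ⊛ X ⊕ 130 ⊛ bn) ⊕ ((M ⊕ Me) ⊕ 220 ⊛ G') ⊕ E ⇒ pj ≐ pe ⊕ p ⇒ nj ≐ Me ⊕ M ⇒ wj ≐ we ⊕ X' ⇒ g₀ ≐ g ⇒ G₀ ≐ G' ⇒
              c ⊕ ((pr ⊕ pj) ⊕ (130 ⊛ wr ⊕ 200 ⊛ wj) ⊕ 130 ⊛ b') ⊕ ((nr ⊕ m) ⊕ 220 ⊛ g₀) ≲ ((pr ⊕ p₀) ⊕ (130 ⊛ wr ⊕ 200 ⊛ X) ⊕ 130 ⊛ bn) ⊕ ((nr ⊕ nj) ⊕ 220 ⊛ G₀) ⊕ E)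
            c (rootsP as') (rootsP ae) (weigh Λ (r sp)) (weigh Λ (l sp)) (bits (n ∸ d)) (rootsN ab) (G n (phantomR E.ms + phantomR mr)) (rootsP ab) (weigh Λ E.ms) (bits n) (rootsN as') (rootsN ae)
            (G (n ∸ d) ((phantomR (r sp) + phantomR (l sp)) + phantomR mr)) (edit-price d n) (rootsP (proj₁ j)) (rootsN (proj₁ j)) (weigh Λ meb) (rootsP ar) (rootsN ar) (weigh rank⁺ mr)
            (G n (phantomR mr + phantomR E.ms)) (G (n ∸ d) (phantomR mr + phantomR meb)) 0
            (edit-numbers n d d≤1 (≤-trans (positive ed) B≤) {c} {rootsP ab} {rootsP as'} {rootsP ae} {rootsN ab} {rootsN as'} {rootsN ae} {200 * weigh Λ E.ms} {200 * weigh Λ (r sp)} {weigh Λ (l sp)} {phantomR E.ms} {phantomR (r sp)} {phantomR (l sp)} (phantomR mr) q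
              (≤-trans (*-monoʳ-≤ 200 (E.weigh≤ {Λ} Λ-mono)) (≤-trans (≤-reflexive (*-distribˡ-+ 200 (weigh Λ E.ms) (d * Λ n))) (+-monoʳ-≤ (200 * weigh Λ E.ms) scale)))
              (weigh-cut (l sp) l≤1 (≤-trans (≤-trans (m≤n+m _ (cnts B')) (m≤m+n _ d)) (≤-trans (≤-reflexive (editR-cnt ed)) B≤)))
              E.ph≤ U≤)
            (proj₁ (proj₂ j)) (proj₂ (proj₂ j)) (weigh+ sp Λ) (cong (G n) (+-comm (phantomR mr) (phantomR E.ms)))
            (cong (G (n ∸ d)) (trans (cong (phantomR mr +_) (trans (ph+ sp) (+-comm (phantomR (l sp)) (phantomR (r sp))))) (+-comm (phantomR mr) _)))
          where
          j = join sp ae as'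
          scale : 200 * (d * Λ n) ≤ d * (200 * suc (bits n))
          scale = ≤-trans (≤-reflexive (trans (sym (*-assoc 200 d (Λ n))) (trans (cong (_* Λ n) (*-comm 200 d)) (*-assoc d 200 (Λ n))))) (*-monoʳ-≤ d (*-monoʳ-≤ 200 (s≤s (bits≤n (bits n)))))
          U≤ : (phantomR (r sp) + phantomR (l sp)) + phantomR mr ≤ n
          U≤ = ≤-trans (+-mono-≤ (+-mono-≤ (phantomR≤ (r sp)) (phantomR≤ (l sp))) (phantomR≤ mr)) (≤-trans (+-monoˡ-≤ (cnts R) (≤-trans (m≤m+n _ d) (≤-reflexive (editR-cnt ed)))) (≤-trans (≤-reflexive (+-comm (cnts B) (cnts R))) fits))

    insert-tr : ∀ {R B n i k} → Tr (mkHeap R B n) (mkHeap (addRoot (node i k []) R) B (suc n)) 0 390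
    insert-tr {R} {B} {n} {i} {k} (mh mr' mb) = by (permute (↭-sym (addRoot-↭ (node i k []) R)) mr')
      where
      by : Σ[ ms ∈ MR (node i k [] ∷ R) ] Same ms mr' → Σ[ M ∈ MH (mkHeap R B n) ] ((A : AH M) → Σ[ A' ∈ AH (mh {mkHeap (addRoot (node i k []) R) B (suc n)} mr' mb) ] posH A' + negH A ≤ posH A + negH A' + 390)
      by (mk b [] ∷ ms , s) = mh ms mb , λ { (ah ar ab) → go ar ab (roots⇒ s (ann {fs = []} [] (asc []) z≤n ∷ ar)) }
        where
        a₀ : Ann (mk {i} {k} b [])
        a₀ = ann {fs = []} [] (asc []) z≤n
        up≡ : ∀ b → when b 0 ≡ 0
        up≡ true = refl
        up≡ false = refl
        go : ∀ (ar : Roots ms) (ab : Roots mb) → Σ[ as ∈ Roots mr' ] rootsP as ≡ pos 0 a₀ + rootsP ar × rootsN as ≡ neg a₀ + rootsN ar →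
             Σ[ A' ∈ AH (mh {mkHeap (addRoot (node i k []) R) B (suc n)} mr' mb) ] posH A' + negH (ah {mkHeap R B n} {mh ms mb} ar ab) ≤ posH (ah {mkHeap R B n} {mh ms mb} ar ab) + negH A' + 390
        go ar ab (as , e₁ , e₂) = ah as ab , linear 17 (λ p' p z pb w' w r wb b' bn n₀ n' nb g g' n₁ _ → p' ≐ (6 ⊛ z ⊕ # 0) ⊕ p ⇒ z ≐ # 0 ⇒ n' ≐ n₁ ⊕ n₀ ⇒ w' ≐ r ⊕ w ⇒ r ≐ # 2 ⇒ b' ≲ # 1 ⊕ bn ⇒ g ≲ g' ⇒
            (p' ⊕ pb ⊕ (130 ⊛ w' ⊕ 200 ⊛ wb) ⊕ 130 ⊛ b') ⊕ (n₀ ⊕ nb ⊕ 220 ⊛ g) ≲ (p ⊕ pb ⊕ (130 ⊛ w ⊕ 200 ⊛ wb) ⊕ 130 ⊛ bn) ⊕ (n' ⊕ nb ⊕ 220 ⊛ g') ⊕ # 390)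
          (rootsP as) (rootsP ar) (when b 0) (rootsP ab) (weigh rank⁺ mr') (weigh rank⁺ ms) (rank⁺ 1) (weigh Λ mb) (bits (suc n)) (bits n) (rootsN ar) (rootsN as) (rootsN ab) (G n (phantomR ms + phantomR mb)) (G (suc n) (phantomR mr' + phantomR mb)) (neg a₀) 0
          e₁ (up≡ b) e₂ (sym (weigh≡ s rank⁺)) (cong suc bits1) (bits-suc n)
          (subst (λ u → G n (phantomR ms + phantomR mb) ≤ G (suc n) (u + phantomR mb)) (ph≡ s) (G-mono (phantomR ms + phantomR mb) (n≤1+n n)))

    -- Amortized cost of operations on one heap

    -- The amount is one root ahead, so it already pays for sorting when the next decrease-key fills
    -- the buffer.
    stored : Heap → ℕ
    stored H = Sort (suc (length (buffer H)))

    TrS : Heap → Heap → ℕ → ℕ → Set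
    TrS H H' c e = (M' : MH H') → Σ[ M ∈ MH H ] ((A : AH M) → Σ[ A' ∈ AH M' ] c + (posH A' + stored H') + negH A ≤ (posH A + stored H) + negH A' + e)

    tr-sort : ∀ {H H' c e e'} k → Tr H H' c e → stored H' + e + k ≤ stored H + e' → TrS H H' (k + c) e'
    tr-sort {H} {H'} {c} {e} {e'} k t h M' = proj₁ (t M') , λ A → proj₁ (proj₂ (t M') A) ,
      linear 10 (λ c e e' k s s' p' n p n' → s' ⊕ e ⊕ k ≲ s ⊕ e' ⇒ c ⊕ p' ⊕ n ≲ p ⊕ n' ⊕ e ⇒ (k ⊕ c) ⊕ (p' ⊕ s') ⊕ n ≲ (p ⊕ s) ⊕ n' ⊕ e')
        c e e' k (stored H) (stored H') (posH (proj₁ (proj₂ (t M') A))) (negH A) (posH A) (negH (proj₁ (proj₂ (t M') A))) h (proj₂ (proj₂ (t M') A))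

    Sort1 : Sort 1 ≡ 4
    Sort1 = cong (3 +_) bits1

    chargeDK≥1 : ∀ n → 1 ≤ chargeDK n
    chargeDK≥1 n = m≤m⊔n 1 ⌈log₂ ⌈log₂ n ⌉ ⌉

    delete-trS : ∀ {H H' x c} → Fits H → DelRoot v x H H' c → TrS H H' c (K * chargeDel (size H)) × Fits H'
    delete-trS {H} {x = x} fits (delRoot {H₁ = H₁} {e} pre k cs rest em eq _) = by em eq (empty-fits em fits)
      where
      n = size H
      b = length (buffer H)
      by : ∀ {H₁ e} → Empties v H H₁ e → roots H₁ ≡ pre ++ node x k cs ∷ rest → Fits H₁ →
           TrS H (mkHeap (linkAll v (cs ++ pre ++ rest)) [] (n ∸ 1)) (1 + e + linkCost v (cs ++ pre ++ rest)) (K * chargeDel n) × Fits (mkHeap (linkAll v (cs ++ pre ++ rest)) [] (n ∸ 1))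
      by {H₁} {e} em@(empties s _ _) eq fits₁ =
        tr-sort {H} {H'} {e + lc} {131 + sortCost b + 130 * bits n + delete-price n} {K * chargeDel n} 1 (tr-trans {H} {H₁} {H'} {e} {lc} {131 + sortCost b + 130 * bits n} {delete-price n} (empty-tr {H} (130 * bits n) em fits (m≤n+m _ (147 * b)))
                    (subst (λ R → Tr (mkHeap R [] n) (mkHeap (linkAll v (cs ++ pre ++ rest)) [] (n ∸ 1)) (linkCost v (cs ++ pre ++ rest)) (delete-price n)) (sym eq) (root-tr {x} {k} cs pre rest n total)))
          (linear 7 (λ s₁ sc s' bn L d t → s₁ ≐ # 4 ⇒ sc ≲ t ⇒ t ≲ s' ⇒ bn ≲ d ⇒ L ≲ # 1 ⊕ d ⇒ # 1 ≲ d ⇒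
              s₁ ⊕ (((# 131 ⊕ sc) ⊕ 130 ⊛ bn) ⊕ (4000 ⊛ bn ⊕ 4000 ⊛ L)) ⊕ # 1 ≲ s' ⊕ 20000 ⊛ d)
            (Sort 1) (sortCost b) (Sort (suc b)) (bits n) (Λ n) (chargeDel n) (Sort b) Sort1 (sortCost≤Sort b) (m≤m+n _ _) (bits≤⌈log₂⌉ n) (Λ≤chargeDel n) (s≤s z≤n)) ,
        count
        where
        lc = linkCost v (cs ++ pre ++ rest)
        H' = mkHeap (linkAll v (cs ++ pre ++ rest)) [] (n ∸ 1)
        total : cnts (pre ++ node x k cs ∷ rest) ≤ n
        total = ≤-trans (≤-reflexive (cong cnts (sym eq))) (m+n≤o⇒m≤o (cnts (roots H₁)) fits₁)
        count : cnts (linkAll v (cs ++ pre ++ rest)) + 0 ≤ n ∸ 1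
        count = ≤-trans (≤-reflexive (trans (+-identityʳ _) (trans (Rounds.linkAll-cnt 0 (cs ++ pre ++ rest)) (Linking.cnts-++ 0 cs (pre ++ rest)))))
          (∸-monoˡ-≤ 1 (≤-trans (≤-reflexive (sym (cnts-↭ (shift (node x k cs) pre rest)))) total))

    buffer-trS : ∀ {H R' B' x kx k cs H' c} → Fits (mkHeap R' (node x k cs ∷ B') (size H)) → length B' ≡ length (buffer H) →
                 Tr H (mkHeap R' (node x kx cs ∷ B') (size H)) 0 (edit-price 0 (size H)) →
                 MaybeEmpty v (mkHeap R' (node x k cs ∷ B') (size H)) H' c → TrS H H' (1 + c) (K * chargeDK (size H)) × Fits H'
    buffer-trS {H} {R'} {B'} {x} {kx} {k} {cs} {H'} {c} fits lb t me = by me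
      where
      n = size H
      b = length (buffer H)
      H₁ = mkHeap R' (node x k cs ∷ B') n
      t' : Tr H (mkHeap R' (node x k cs ∷ B') n) 0 (edit-price 0 n + 0)
      t' = tr-trans {H} {mkHeap R' (node x kx cs ∷ B') n} {H₁} {0} {0} {edit-price 0 n} {0} t (same-tr {n = n} sim-refl (rekey {x} {kx} {k} {cs} {B'}))
      by : ∀ {H' c} → MaybeEmpty v (mkHeap R' (node x k cs ∷ B') n) H' c → TrS H H' (1 + c) (K * chargeDK n) × Fits H'
      -- A buffer of 1 + length B' roots is full, so `bits n` is at most 2 + length B'. The saving
      -- of 147 per root then covers 130 `bits n` up to the constant 130.
      by {H'} {c} (full n≤ em@(empties _ _ _)) = tr-sort {H} {H'} {c} {edit-price 0 n + 0 + (131 + sortCost (suc (length B')) + 130)} {K * chargeDK n} 1 (tr-trans {H} {H₁} {H'} {0} {c} {edit-price 0 n + 0} {131 + sortCost (suc (length B')) + 130} t' (empty-tr {H₁} 130 em fits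
            (linear 2 (λ bn b → bn ≲ # 2 ⊕ b ⇒ 130 ⊛ bn ≲ 147 ⊛ (# 1 ⊕ b) ⊕ # 130) (bits n) (length B') (≤-trans (bits-mono n≤) (≤-reflexive (bits-2^ (suc (length B'))))))))
          (linear 6 (λ s₁ L sc s' d z → s₁ ≐ # 4 ⇒ L ≲ 4 ⊛ d ⇒ sc ≲ s' ⇒ # 1 ≲ d ⇒ s₁ ⊕ (((3000 ⊛ L) ⊕ # 0) ⊕ ((# 131 ⊕ sc) ⊕ # 130)) ⊕ # 1 ≲ s' ⊕ 20000 ⊛ d)
            (Sort 1) (Λ n) (sortCost (suc (length B'))) (Sort (suc b)) (chargeDK n) 0 Sort1 (Λ≤chargeDK n)
            (≤-trans (sortCost≤Sort (suc (length B'))) (≤-reflexive (cong (λ z → Sort (suc z)) lb))) (chargeDK≥1 n)) ,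
        empty-fits em fits
      -- Sorting is prepaid by one more summand of `Sort`. As 2 to the power 1 + length B' is below
      -- n, the bit length in this summand is at most `bits (bits n)`, so the summand is of order Λ
      -- n.
      by (notFull <n) = tr-sort {H} {H₁} {0} {edit-price 0 n + 0} {K * chargeDK n} 1 t'
          (linear 5 (λ s s' L bb d → s' ≐ s ⊕ (# 3 ⊕ bb) ⇒ # 1 ⊕ bb ≲ L ⇒ L ≲ 4 ⊛ d ⇒ # 1 ≲ d ⇒ s' ⊕ (3000 ⊛ L ⊕ # 0) ⊕ # 1 ≲ s ⊕ 20000 ⊛ d)
            (Sort (suc b)) (Sort (suc (suc (length B')))) (Λ n) (bits (suc (suc b))) (chargeDK n)
            (cong (λ z → Sort (suc (suc z))) lb)
            (s≤s (bits-mono (≤-trans (≤-reflexive (trans (cong (λ z → suc (suc z)) (sym lb)) (sym (bits-2^ (suc (length B')))))) (bits-mono (<⇒≤ <n)))))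
            (Λ≤chargeDK n) (chargeDK≥1 n)) ,
        fits

    cutR-trS : ∀ {H x kx k cs rs' H' c} → Fits H → cutBelow x (roots H) ≡ just (rs' , node x kx cs) →
               MaybeEmpty v (mkHeap rs' (node x k cs ∷ buffer H) (size H)) H' c → TrS H H' (1 + c) (K * chargeDK (size H)) × Fits H'
    cutR-trS {H} {x} {kx} {k} {cs} {rs'} fits eq me = buffer-trS {H} {kx = kx} fits' refl (roots-edit-tr ed z≤n ≤-refl fits) me
      where
      ed : EditR (roots H) rs' [ node x kx cs ] 0 0
      ed = cutBelow-edit x (roots H) eq
      fits' : cnts rs' + (suc (cnts cs) + cnts (buffer H)) ≤ size H
      fits' = linear 5 (λ r c b R n → (r ⊕ ((# 1 ⊕ c) ⊕ # 0)) ⊕ # 0 ≐ R ⇒ R ⊕ b ≲ n ⇒ r ⊕ ((# 1 ⊕ c) ⊕ b) ≲ n) (cnts rs') (cnts cs) (cnts (buffer H)) (cnts (roots H)) (size H) (editR-cnt ed) fits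

    editR-length : ∀ {ts ts' es c d} → EditR ts ts' es c d → length ts' ≤ length ts
    editR-length (below _) = ≤-refl
    editR-length (delR {cs = []}) = n≤1+n _
    editR-length (delR {cs = c ∷ cs} {ts}) = by (Loop.linkAll-final 0 c cs)
      where
      by : Loop.Ending 0 c cs → length (linkAll v (c ∷ cs) ++ ts) ≤ suc (length ts)
      by (t , eq , _) = ≤-reflexive (cong (λ l → length (l ++ ts)) eq)
    editR-length (laterR e) = s≤s (editR-length e)

    cut-length : ∀ {ts ts' t c} → EditR ts ts' [ t ] c 0 → length ts' ≡ length ts
    cut-length (below _) = refl
    cut-length (laterR e) = cong suc (cut-length e)

    cutB-trS : ∀ {H x kx k cs bs' H' c} → Fits H → cutBelow x (buffer H) ≡ just (bs' , node x kx cs) →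
               MaybeEmpty v (mkHeap (roots H) (node x k cs ∷ bs') (size H)) H' c → TrS H H' (1 + c) (K * chargeDK (size H)) × Fits H'
    cutB-trS {H} {x} {kx} {k} {cs} {bs'} fits eq me = buffer-trS {H} {kx = kx} fits' (cut-length ed) (buffer-edit-tr {roots H} ed z≤n ≤-refl fits) me
      where
      ed : EditR (buffer H) bs' [ node x kx cs ] 0 0
      ed = cutBelow-edit x (buffer H) eq
      fits' : cnts (roots H) + (suc (cnts cs) + cnts bs') ≤ size H
      fits' = linear 5 (λ r c b B n → (b ⊕ ((# 1 ⊕ c) ⊕ # 0)) ⊕ # 0 ≐ B ⇒ r ⊕ B ≲ n ⇒ r ⊕ ((# 1 ⊕ c) ⊕ b) ≲ n) (cnts (roots H)) (cnts cs) (cnts bs') (cnts (buffer H)) (size H) (editR-cnt ed) fits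

    Sort-mono : ∀ {a b} → a ≤ b → Sort a ≤ Sort b
    Sort-mono {zero} h = z≤n
    Sort-mono {suc a} {suc b} (s≤s h) = +-mono-≤ (Sort-mono h) (+-monoʳ-≤ 3 (bits-mono (s≤s h)))

    del-numbers : ∀ n s s' → s' ≤ s → s' + edit-price 1 n + 1 ≤ s + K * chargeDel n
    del-numbers n s s' h = linear 5 (λ s s' bn L d → s' ≲ s ⇒ bn ≲ d ⇒ L ≲ # 1 ⊕ d ⇒ # 1 ≲ d ⇒ s' ⊕ (((2000 ⊛ bn ⊕ # 1000) ⊕ # 0) ⊕ 3000 ⊛ L) ⊕ # 1 ≲ s ⊕ 20000 ⊛ d)
      s s' (bits n) (Λ n) (chargeDel n) h (bits≤⌈log₂⌉ n) (Λ≤chargeDel n) (s≤s z≤n)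

    delR-trS : ∀ {H x rs' c} → Fits H → delIn v x (roots H) ≡ just (rs' , c) →
               TrS H (mkHeap rs' (buffer H) (size H ∸ 1)) (1 + c) (K * chargeDel (size H)) × Fits (mkHeap rs' (buffer H) (size H ∸ 1))
    delR-trS {H} {x} {rs'} {c} fits eq = tr-sort {H} {mkHeap rs' (buffer H) (size H ∸ 1)} {c} {edit-price 1 (size H)} {K * chargeDel (size H)} 1 (roots-edit-tr {B = buffer H} ed ≤-refl z≤n fits) (del-numbers (size H) (stored H) (stored H) ≤-refl) ,
      linear 4 (λ r R b n → (r ⊕ # 0) ⊕ # 1 ≐ R ⇒ R ⊕ b ≲ n ⇒ r ⊕ b ≲ n ⊖ # 1) (cnts rs') (cnts (roots H)) (cnts (buffer H)) (size H) (editR-cnt ed) fits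
      where
      ed = delIn-editR x (roots H) eq

    delB-trS : ∀ {H x bs' c} → Fits H → delIn v x (buffer H) ≡ just (bs' , c) →
               TrS H (mkHeap (roots H) bs' (size H ∸ 1)) (1 + c) (K * chargeDel (size H)) × Fits (mkHeap (roots H) bs' (size H ∸ 1))
    delB-trS {H} {x} {bs'} {c} fits eq = tr-sort {H} {mkHeap (roots H) bs' (size H ∸ 1)} {c} {edit-price 1 (size H)} {K * chargeDel (size H)} 1 (buffer-edit-tr {roots H} ed ≤-refl z≤n fits)
        (del-numbers (size H) (stored H) (Sort (suc (length bs'))) (Sort-mono (s≤s (editR-length ed)))) ,
      linear 4 (λ r B b n → (b ⊕ # 0) ⊕ # 1 ≐ B ⇒ r ⊕ B ≲ n ⇒ r ⊕ b ≲ n ⊖ # 1) (cnts (roots H)) (cnts (buffer H)) (cnts bs') (size H) (editR-cnt ed) fits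
      where
      ed = delIn-editR x (buffer H) eq

    same-trS : ∀ {R R' B B' n} → SimS R R' → SimS B B' → length B' ≡ length B → TrS (mkHeap R B n) (mkHeap R' B' n) 1 (K * chargeDK n)
    same-trS {R} {R'} {B} {B'} {n} f g lb = tr-sort {mkHeap R B n} {mkHeap R' B' n} {0} {0} {K * chargeDK n} 1 (same-tr {n = n} f g)
      (linear 3 (λ s s' d → s' ≐ s ⇒ # 1 ≲ d ⇒ s' ⊕ # 0 ⊕ # 1 ≲ s ⊕ 20000 ⊛ d) (Sort (suc (length B))) (Sort (suc (length B'))) (chargeDK n) (cong (λ z → Sort (suc z)) lb) (chargeDK≥1 n))

    insert-trS : ∀ {H i k} → TrS H (mkHeap (addRoot (node i k []) (roots H)) (buffer H) (suc (size H))) 1 (K * 1)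
    insert-trS {H} {i} {k} = tr-sort {H} {mkHeap (addRoot (node i k []) (roots H)) (buffer H) (suc (size H))} {0} {390} {K * 1} 1 (insert-tr {roots H} {buffer H} {size H} {i} {k}) (linear 1 (λ s → s ⊕ # 390 ⊕ # 1 ≲ s ⊕ # 20000) (stored H))

    rekey-root : ∀ {x k kx cs} pre post → SimS (pre ++ node x kx cs ∷ post) (node x k cs ∷ pre ++ post)
    rekey-root {x} {k} {kx} {cs} pre post = sim-trans (permute (shift (node x kx cs) pre post)) rekey

    rekey-cnt : ∀ {x k kx cs} pre post → cnts (pre ++ node x kx cs ∷ post) ≡ cnts (node x k cs ∷ pre ++ post)
    rekey-cnt {x} {k} {kx} {cs} pre post = cnts-↭ (shift (node x kx cs) pre post)

    rekey-there : ∀ {x k kx cs} pre post → SimS (pre ++ node x kx cs ∷ post) (pre ++ node x k cs ∷ post)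
    rekey-there {x} {k} {kx} {cs} pre post = sim-trans (rekey-root {x} {k} {kx} pre post) (permute (↭-sym (shift (node x k cs) pre post)))

    -- Meld

    -- Match the summands of G n a, followed by those of G m b, with the a + b summands on the
    -- right: every argument there is at least as large. So the union may carry the debts of both
    -- heaps.
    G-add : ∀ n m a b → G n a + G m b ≤ G (n + m) (a + b)
    G-add n m a zero = ≤-trans (≤-reflexive (+-identityʳ _)) (≤-trans (G-mono a (m≤m+n n m)) (≤-reflexive (cong (G (n + m)) (sym (+-identityʳ a)))))
    G-add n m a (suc b) = subst (λ z → G n a + G m (suc b) ≤ G (n + m) z) (sym (+-suc a b))
      (linear 5 (λ g h i l l' → g ⊕ h ≲ i ⇒ l ≲ l' ⇒ g ⊕ (h ⊕ l) ≲ i ⊕ l') (G n a) (G m b) (G (n + m) (a + b)) (Λ (m + suc b)) (Λ (n + m + suc (a + b))) (G-add n m a b)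
        (Λ-mono (+-mono-≤ (m≤n+m m n) (s≤s (m≤n+m b a)))))

    bits-larger : ∀ n m → m ≤ n → bits (n + m) ≤ suc (bits n)
    bits-larger zero zero _ = n≤1+n _
    bits-larger n@(suc _) m h = ≤-trans (bits-mono (linear 2 (λ n m → m ≲ n ⇒ n ⊕ m ≲ 2 ⊛ n) n m h)) (≤-reflexive (bits-double n))

    Meld : Heap → Heap → Heap → ℕ → ℕ → Set
    Meld H₁ H₂ H' c e = (M' : MH H') → Σ[ M₁ ∈ MH H₁ ] Σ[ M₂ ∈ MH H₂ ] ((A₁ : AH M₁) (A₂ : AH M₂) →
      Σ[ A' ∈ AH M' ] c + (posH A' + stored H') + (negH A₁ + negH A₂) ≤ ((posH A₁ + stored H₁) + (posH A₂ + stored H₂)) + negH A' + e)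

    -- The heap H₂ has fewer nodes, so the rank of its size pays for emptying its
    -- buffer.
    meld-tr : ∀ {H₁ H₂ H₂' c R n} → Fits H₂ → size H₂ ≤ size H₁ → Empties v H₂ H₂' c → R ↭ roots H₁ ++ roots H₂' → n ≡ size H₁ + size H₂ →
              Meld H₁ H₂ (mkHeap R (buffer H₁) n) (1 + c) (K * 1)
    meld-tr {H₁} {H₂} {H₂'} {c} {R} fits le em perm refl (mh M' mb') = by em perm
      where
      n₁ = size H₁
      n₂ = size H₂
      b₂ = length (buffer H₂)
      by : ∀ {H₂'} → Empties v H₂ H₂' c → R ↭ roots H₁ ++ roots H₂' → Σ[ M₁ ∈ MH H₁ ] Σ[ M₂ ∈ MH H₂ ] ((A₁ : AH M₁) (A₂ : AH M₂) →
           Σ[ A' ∈ AH (mh {mkHeap R (buffer H₁) (n₁ + n₂)} M' mb') ] (1 + c) + (posH A' + stored H₁) + (negH A₁ + negH A₂) ≤ ((posH A₁ + stored H₁) + (posH A₂ + stored H₂)) + negH A' + K * 1)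
      by {H₂'} em@(empties s _ _) perm = mh (l sp) mb' , proj₁ tr , λ A₁ A₂ → go A₁ A₂ (proj₂ tr A₂)
        where
        pm = permute (↭-sym perm) M'
        sp = split (roots H₁) {roots H₂'} (proj₁ (permute (↭-sym perm) M'))
        tr = empty-tr {H₂} {H₂'} (130 * bits n₂) em fits (m≤n+m _ (147 * b₂)) (mh (r sp) [])
        go : (A₁ : AH (mh {H₁} (l sp) mb')) (A₂ : AH (proj₁ tr)) → Σ[ A ∈ AH (mh {H₂'} (r sp) []) ] c + posH A + negH A₂ ≤ posH A₂ + negH A + (131 + sortCost b₂ + 130 * bits n₂) →
             Σ[ A' ∈ AH (mh {mkHeap R (buffer H₁) (n₁ + n₂)} M' mb') ] (1 + c) + (posH A' + stored H₁) + (negH A₁ + negH A₂) ≤ ((posH A₁ + stored H₁) + (posH A₂ + stored H₂)) + negH A' + K * 1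
        go (ah ar₁ ab₁) A₂ (ah ar [] , q) with join sp ar₁ ar
        ... | as , e₁ , e₂ with roots⇒ (proj₂ pm) as
        ... | as' , e₃ , e₄ = ah as' ab₁ , linear 24 (λ c p m P₂ N₂ w bn₂ g s₂ p₁ pb₁ w₁ wb₁ bn₁ m₁ mb₁ g₁ s₁ p' m' w' bn g' sc →
            c ⊕ (p ⊕ # 0 ⊕ (130 ⊛ w ⊕ # 0) ⊕ 130 ⊛ bn₂) ⊕ N₂ ≲ P₂ ⊕ (m ⊕ # 0 ⊕ 220 ⊛ g) ⊕ ((# 131 ⊕ sc) ⊕ 130 ⊛ bn₂) ⇒ p' ≲ p₁ ⊕ p ⇒ m₁ ⊕ m ≲ m' ⇒ w' ≲ w₁ ⊕ w ⇒ bn ≲ # 1 ⊕ bn₁ ⇒ g₁ ⊕ g ≲ g' ⇒ sc ≲ s₂ ⇒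
            (# 1 ⊕ c) ⊕ ((p' ⊕ pb₁ ⊕ (130 ⊛ w' ⊕ wb₁) ⊕ 130 ⊛ bn) ⊕ s₁) ⊕ ((m₁ ⊕ mb₁ ⊕ 220 ⊛ g₁) ⊕ N₂) ≲ (((p₁ ⊕ pb₁ ⊕ (130 ⊛ w₁ ⊕ wb₁) ⊕ 130 ⊛ bn₁) ⊕ s₁) ⊕ (P₂ ⊕ s₂)) ⊕ (m' ⊕ mb₁ ⊕ 220 ⊛ g') ⊕ # 20000)
          c (rootsP ar) (rootsN ar) (posH A₂) (negH A₂) (weigh rank⁺ (r sp)) (bits n₂) (G n₂ (phantomR (r sp) + 0)) (stored H₂)
          (rootsP ar₁) (rootsP ab₁) (weigh rank⁺ (l sp)) (200 * weigh Λ mb') (bits n₁) (rootsN ar₁) (rootsN ab₁) (G n₁ (phantomR (l sp) + phantomR mb')) (stored H₁)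
          (rootsP as') (rootsN as') (weigh rank⁺ M') (bits (n₁ + n₂)) (G (n₁ + n₂) (phantomR M' + phantomR mb')) (sortCost b₂)
          q (≤-reflexive (trans e₃ e₁)) (≤-reflexive (sym (trans e₄ e₂))) (≤-reflexive (trans (sym (weigh≡ (proj₂ pm) rank⁺)) (weigh+ sp rank⁺))) (bits-larger n₁ n₂ le)
          (≤-trans (G-add n₁ n₂ (phantomR (l sp) + phantomR mb') (phantomR (r sp) + 0)) (≤-reflexive (cong (G (n₁ + n₂)) (trans
            (linear 3 (λ a b c → (a ⊕ b) ⊕ (c ⊕ # 0) ≐ (a ⊕ c) ⊕ b) (phantomR (l sp)) (phantomR mb') (phantomR (r sp)))
            (cong (_+ phantomR mb') (trans (sym (ph+ sp)) (ph≡ (proj₂ pm))))))))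
          (≤-trans (sortCost≤Sort b₂) (m≤m+n _ _))

    -- The potential of all heaps

    HM : Maybe Heap → Set
    HM nothing = ⊤
    HM (just H) = MH H

    HA : ∀ m → HM m → Set
    HA nothing _ = ⊤
    HA (just H) M = AH M

    PA NA : ∀ m (M : HM m) → HA m M → ℕ
    PA nothing _ _ = 0
    PA (just H) _ A = posH A + stored H
    NA nothing _ _ = 0
    NA (just H) _ A = negH A

    -- Meld changes two handles at once, so every operation is put into this form; the other
    -- operations leave the second handle as it is.
    Act : Maybe Heap → Maybe Heap → Maybe Heap → Maybe Heap → ℕ → ℕ → Set
    Act m₁ m₂ m₁' m₂' c e = (M₁' : HM m₁') (M₂' : HM m₂') → Σ[ M₁ ∈ HM m₁ ] Σ[ M₂ ∈ HM m₂ ] ((A₁ : HA m₁ M₁) (A₂ : HA m₂ M₂) →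
      Σ[ A₁' ∈ HA m₁' M₁' ] Σ[ A₂' ∈ HA m₂' M₂' ]
        c + (PA m₁' M₁' A₁' + PA m₂' M₂' A₂') + (NA m₁ M₁ A₁ + NA m₂ M₂ A₂) ≤ (PA m₁ M₁ A₁ + PA m₂ M₂ A₂) + (NA m₁' M₁' A₁' + NA m₂' M₂' A₂') + e)

    sumTo : ℕ → (ℕ → ℕ) → ℕ
    sumTo zero g = 0
    sumTo (suc n) g = g n + sumTo n g

    omit : ℕ → (ℕ → ℕ) → ℕ → ℕ
    omit h g j with j ≟ h
    ... | yes _ = 0
    ... | no _ = g j

    omit-other : ∀ h g j → j ≢ h → omit h g j ≡ g j
    omit-other h g j ne with j ≟ h
    ... | yes e = ⊥-elim (ne e)
    ... | no _ = refl

    omit-self : ∀ h g → omit h g h ≡ 0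
    omit-self h g with h ≟ h
    ... | yes _ = refl
    ... | no ne = ⊥-elim (ne refl)

    sum-cong : ∀ n {g g'} → (∀ j → j < n → g j ≡ g' j) → sumTo n g ≡ sumTo n g'
    sum-cong zero h = refl
    sum-cong (suc n) h = cong₂ _+_ (h n ≤-refl) (sum-cong n (λ j q → h j (m≤n⇒m≤1+n q)))

    sum-omit : ∀ n h g → h < n → sumTo n g ≡ g h + sumTo n (omit h g)
    sum-omit (suc n) h g (s≤s q) with h ≟ n
    ... | yes refl = cong (g n +_) (trans (sum-cong n (λ j q → sym (omit-other n g j (<⇒≢ q)))) (cong (_+ sumTo n (omit n g)) (sym (omit-self n g))))
    ... | no ne = trans (cong (g n +_) (sum-omit n h g (≤∧≢⇒< q ne))) (trans (comm₃ (g n) (g h) _)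
          (cong (λ z → g h + (z + sumTo n (omit h g))) (sym (omit-other h g n (λ e → ne (sym e))))))

    sum-+ : ∀ n g g' → sumTo n (λ j → g j + g' j) ≡ sumTo n g + sumTo n g'
    sum-+ zero g g' = refl
    sum-+ (suc n) g g' = trans (cong (g n + g' n +_) (sum-+ n g g')) (linear 4 (λ a b c d → (a ⊕ b) ⊕ (c ⊕ d) ≐ (a ⊕ c) ⊕ (b ⊕ d)) (g n) (g' n) (sumTo n g) (sumTo n g'))

    sum-two : ∀ n h h' {a b c e} → h < n → h' < n → h ≢ h' → (∀ j → j ≢ h → j ≢ h' → a j ≡ b j) → c + (a h + a h') ≤ (b h + b h') + e →
              c + sumTo n a ≤ sumTo n b + e
    sum-two n h h' {a} {b} {c} {e} p q ne eq le = subst₂ (λ x y → c + x ≤ y + e) (sym (out a)) (sym (out b))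
      (subst (λ r → c + (a h + (a h' + r)) ≤ b h + (b h' + sumTo n (omit h' (omit h b))) + e) (sym (sum-cong n (λ j _ → rest j (j ≟ h) (j ≟ h'))))
        (linear 7 (λ c x y x' y' r e → c ⊕ (x ⊕ y) ≲ (x' ⊕ y') ⊕ e ⇒ c ⊕ (x ⊕ (y ⊕ r)) ≲ (x' ⊕ (y' ⊕ r)) ⊕ e) c (a h) (a h') (b h) (b h') (sumTo n (omit h' (omit h b))) e le))
      where
      out : ∀ g → sumTo n g ≡ g h + (g h' + sumTo n (omit h' (omit h g)))
      out g = trans (sum-omit n h g p) (cong (g h +_) (trans (sum-omit n h' (omit h g) q) (cong (_+ sumTo n (omit h' (omit h g))) (omit-other h g h' (λ e → ne (sym e))))))
      rest : ∀ j → Dec (j ≡ h) → Dec (j ≡ h') → omit h' (omit h a) j ≡ omit h' (omit h b) j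
      rest j _ (yes refl) = trans (omit-self h' (omit h a)) (sym (omit-self h' (omit h b)))
      rest j (yes refl) (no q) = trans (omit-other h' (omit h a) h q) (trans (omit-self h a) (sym (trans (omit-other h' (omit h b) h q) (omit-self h b))))
      rest j (no p) (no q) = trans (omit-other h' (omit h a) j q) (trans (omit-other h a j p) (trans (eq j p q) (sym (trans (omit-other h' (omit h b) j q) (omit-other h b j p)))))

    castM : ∀ {m m'} → m' ≡ m → HM m' → HM m
    castM refl M = M

    castA : ∀ {m m'} (e : m' ≡ m) (M : HM m') → HA m (castM e M) → HA m' M
    castA refl M A = A

    castPA : ∀ {m m'} (e : m' ≡ m) (M : HM m') (A : HA m (castM e M)) → PA m' M (castA e M A) + NA m (castM e M) A ≡ PA m (castM e M) A + NA m' M (castA e M A)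
    castPA refl M A = refl

    record Update (f f' : ℕ → Maybe Heap) (n c e : ℕ) : Set where
      field
        h h' : ℕ
        h< : h < n
        h'< : h' < n
        h≢h' : h ≢ h'
        others : ∀ j → j ≢ h → j ≢ h' → f' j ≡ f j
        act : Act (f h) (f h') (f' h) (f' h') c e

    WM : (ℕ → Maybe Heap) → Set
    WM f = ∀ j → HM (f j)

    WA : ∀ f → WM f → Set
    WA f M = ∀ j → HA (f j) (M j)

    sumP sumN : ∀ {f} {M : WM f} → ℕ → WA f M → ℕ
    sumP {f} {M} n A = sumTo n (λ j → PA (f j) (M j) (A j))
    sumN {f} {M} n A = sumTo n (λ j → NA (f j) (M j) (A j))

    Sim : (f f' : ℕ → Maybe Heap) → ℕ → ℕ → ℕ → Set
    Sim f f' n c e = (M' : WM f') → Σ[ M ∈ WM f ] ((A : WA f M) → Σ[ A' ∈ WA f' M' ] c + sumP n A' + sumN n A ≤ sumP n A + sumN n A' + e)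

    sim-act : ∀ {f f' n c e} → Update f f' n c e → Sim f f' n c e
    sim-act {f} {f'} {n} {c} {e} U M' = M , λ A → (λ j → fwd A j (j ≟ h) (j ≟ h') (A j)) , total A
      where
      open Update U
      a₀ = act (M' h) (M' h')
      M₁ = proj₁ a₀
      M₂ = proj₁ (proj₂ a₀)
      -- The decisions are explicit arguments here and in `fwd`, so that the values at h and h' can
      -- be computed by matching on them.
      back : ∀ j → Dec (j ≡ h) → Dec (j ≡ h') → HM (f j)
      back j (yes refl) _ = M₁
      back j (no _) (yes refl) = M₂
      back j (no p) (no q) = castM (others j p q) (M' j)
      M : WM f
      M j = back j (j ≟ h) (j ≟ h')
      at₁ : ∀ d d' (A : HA (f h) (back h d d')) → Σ[ A₁ ∈ HA (f h) M₁ ] PA (f h) M₁ A₁ ≡ PA (f h) (back h d d') A × NA (f h) M₁ A₁ ≡ NA (f h) (back h d d') A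
      at₁ (yes refl) _ A = A , refl , refl
      at₁ (no p) _ A = ⊥-elim (p refl)
      at₂ : ∀ d d' (A : HA (f h') (back h' d d')) → Σ[ A₂ ∈ HA (f h') M₂ ] PA (f h') M₂ A₂ ≡ PA (f h') (back h' d d') A × NA (f h') M₂ A₂ ≡ NA (f h') (back h' d d') A
      at₂ (yes e) _ A = ⊥-elim (h≢h' (sym e))
      at₂ (no p) (yes refl) A = A , refl , refl
      at₂ (no p) (no q) A = ⊥-elim (q refl)
      module _ (A : WA f M) where
        t₁ = at₁ (h ≟ h) (h ≟ h') (A h)
        t₂ = at₂ (h' ≟ h) (h' ≟ h') (A h')
        res = proj₂ (proj₂ a₀) (proj₁ t₁) (proj₁ t₂)
        A₁' = proj₁ res
        A₂' = proj₁ (proj₂ res)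
        fwd : ∀ j d d' → HA (f j) (back j d d') → HA (f' j) (M' j)
        fwd j (yes refl) _ _ = A₁'
        fwd j (no _) (yes refl) _ = A₂'
        fwd j (no p) (no q) A = castA (others j p q) (M' j) A
        A' : WA f' M'
        A' j = fwd j (j ≟ h) (j ≟ h') (A j)
        fwd₁ : ∀ d d' x → PA (f' h) (M' h) (fwd h d d' x) ≡ PA (f' h) (M' h) A₁' × NA (f' h) (M' h) (fwd h d d' x) ≡ NA (f' h) (M' h) A₁'
        fwd₁ (yes refl) _ x = refl , refl
        fwd₁ (no p) _ x = ⊥-elim (p refl)
        fwd₂ : ∀ d d' x → PA (f' h') (M' h') (fwd h' d d' x) ≡ PA (f' h') (M' h') A₂' × NA (f' h') (M' h') (fwd h' d d' x) ≡ NA (f' h') (M' h') A₂'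
        fwd₂ (yes e) _ x = ⊥-elim (h≢h' (sym e))
        fwd₂ (no p) (yes refl) x = refl , refl
        fwd₂ (no p) (no q) x = ⊥-elim (q refl)
        fwd₀ : ∀ j d d' x → j ≢ h → j ≢ h' → PA (f' j) (M' j) (fwd j d d' x) + NA (f j) (back j d d') x ≡ PA (f j) (back j d d') x + NA (f' j) (M' j) (fwd j d d' x)
        fwd₀ j (yes e) _ x p q = ⊥-elim (p e)
        fwd₀ j (no _) (yes e) x p q = ⊥-elim (q e)
        fwd₀ j (no p) (no q) x _ _ = castPA (others j p q) (M' j) x
        total : c + sumP n A' + sumN n A ≤ sumP n A + sumN n A' + e
        total = subst₂ _≤_ (trans (cong (c +_) (sum-+ n _ _)) (sym (+-assoc c _ _))) (cong (_+ e) (sum-+ n _ _))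
          (sum-two n h h' {λ j → PA (f' j) (M' j) (A' j) + NA (f j) (M j) (A j)} {λ j → PA (f j) (M j) (A j) + NA (f' j) (M' j) (A' j)} h< h'< h≢h'
            (λ j p q → fwd₀ j (j ≟ h) (j ≟ h') (A j) p q)
            (linear 18 (λ c e p₁ p₂ n₁ n₂ q₁ q₂ m₁ m₂ P₁ P₂ N₁ N₂ Q₁ Q₂ M₁ M₂ → c ⊕ (p₁ ⊕ p₂) ⊕ (n₁ ⊕ n₂) ≲ (q₁ ⊕ q₂) ⊕ (m₁ ⊕ m₂) ⊕ e ⇒ P₁ ≲ p₁ ⇒ P₂ ≲ p₂ ⇒ N₁ ≲ n₁ ⇒ N₂ ≲ n₂ ⇒ q₁ ≲ Q₁ ⇒ q₂ ≲ Q₂ ⇒ m₁ ≲ M₁ ⇒ m₂ ≲ M₂ ⇒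
                c ⊕ ((P₁ ⊕ N₁) ⊕ (P₂ ⊕ N₂)) ≲ ((Q₁ ⊕ M₁) ⊕ (Q₂ ⊕ M₂)) ⊕ e)
              c e (PA (f' h) (M' h) A₁') (PA (f' h') (M' h') A₂') (NA (f h) M₁ (proj₁ t₁)) (NA (f h') M₂ (proj₁ t₂)) (PA (f h) M₁ (proj₁ t₁)) (PA (f h') M₂ (proj₁ t₂)) (NA (f' h) (M' h) A₁') (NA (f' h') (M' h') A₂')
              (PA (f' h) (M' h) (A' h)) (PA (f' h') (M' h') (A' h')) (NA (f h) (M h) (A h)) (NA (f h') (M h') (A h')) (PA (f h) (M h) (A h)) (PA (f h') (M h') (A h')) (NA (f' h) (M' h) (A' h)) (NA (f' h') (M' h') (A' h'))
              (proj₂ (proj₂ res)) (≤-reflexive (proj₁ (fwd₁ (h ≟ h) (h ≟ h') (A h)))) (≤-reflexive (proj₁ (fwd₂ (h' ≟ h) (h' ≟ h') (A h')))) (≤-reflexive (sym (proj₂ (proj₂ t₁)))) (≤-reflexive (sym (proj₂ (proj₂ t₂))))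
              (≤-reflexive (proj₁ (proj₂ t₁))) (≤-reflexive (proj₁ (proj₂ t₂))) (≤-reflexive (sym (proj₂ (fwd₁ (h ≟ h) (h ≟ h') (A h))))) (≤-reflexive (sym (proj₂ (fwd₂ (h' ≟ h) (h' ≟ h') (A h')))))))

    -- Single operations and whole runs

    Fit : Maybe Heap → Set
    Fit nothing = ⊤
    Fit (just H) = Fits H

    record Ok (W : World) : Set where
      field
        unused : ∀ j → nextH W ≤ j → heaps W j ≡ nothing
        fit : ∀ j → Fit (heaps W j)
    open Ok

    fit-at : ∀ {W h H} → Ok W → heaps W h ≡ just H → Fits H
    fit-at {h = h} ok eq = subst Fit eq (fit ok h)

    used : ∀ {W h H} → Ok W → heaps W h ≡ just H → h < nextH W
    used {W} {h} ok eq with h <? nextH W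
    ... | yes p = p
    ... | no p with trans (sym eq) (unused ok h (≮⇒≥ p))
    ... | ()

    upd-same : ∀ f h m → upd f h m h ≡ m
    upd-same f h m = by (h ≡ᵇ h) (≡⇒≡ᵇ h h refl)
      where
      by : ∀ b → T b → (if b then m else f h) ≡ m
      by true _ = refl

    upd-other : ∀ f h m j → j ≢ h → upd f h m j ≡ f j
    upd-other f h m j ne = by (j ≡ᵇ h) (λ t → ≡ᵇ⇒≡ j h t)
      where
      by : ∀ b → (T b → j ≡ h) → (if b then m else f j) ≡ f j
      by false _ = refl
      by true t = ⊥-elim (ne (t tt))

    fit-upd : ∀ f h m → Fit m → (∀ j → Fit (f j)) → ∀ j → Fit (upd f h m j)
    fit-upd f h m p q j with j ≡ᵇ h
    ... | true = p
    ... | false = q j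

    act-single : ∀ {m₁ m₂ m₁' m₂' H H' c e} → m₁ ≡ just H → m₁' ≡ just H' → m₂' ≡ m₂ → TrS H H' c e → Act m₁ m₂ m₁' m₂' c e
    act-single {m₂ = m₂} {c = c} {e} refl refl refl t M₁' M₂' = proj₁ (t M₁') , M₂' , λ A₁ A₂ → proj₁ (proj₂ (t M₁') A₁) , A₂ ,
      linear 8 (λ c e p' n p n' P N → c ⊕ p' ⊕ n ≲ p ⊕ n' ⊕ e ⇒ c ⊕ (p' ⊕ P) ⊕ (n ⊕ N) ≲ (p ⊕ P) ⊕ (n' ⊕ N) ⊕ e)
        c e (PA (just _) M₁' (proj₁ (proj₂ (t M₁') A₁))) (negH A₁) (PA (just _) (proj₁ (t M₁')) A₁) (negH (proj₁ (proj₂ (t M₁') A₁))) (PA m₂ M₂' A₂) (NA m₂ M₂' A₂) (proj₂ (proj₂ (t M₁') A₁))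

    act-new : ∀ {m₁ m₂ m₁' m₂'} → m₁ ≡ nothing → m₁' ≡ just emptyHeap → m₂' ≡ m₂ → Act m₁ m₂ m₁' m₂' 1 (K * 1)
    act-new {m₂ = m₂} refl refl refl (mh [] []) M₂' = tt , M₂' , λ _ A₂ → ah [] [] , A₂ ,
      linear 4 (λ b s P N → b ≐ # 0 ⇒ s ≐ # 4 ⇒ # 1 ⊕ ((# 0 ⊕ 130 ⊛ b ⊕ s) ⊕ P) ⊕ (# 0 ⊕ N) ≲ (# 0 ⊕ P) ⊕ (# 0 ⊕ N) ⊕ # 20000)
        (bits 0) (Sort 1) (PA m₂ M₂' A₂) (NA m₂ M₂' A₂) bits0 Sort1

    act-id : ∀ {m₁ m₂} → Act m₁ m₂ m₁ m₂ 1 (K * 1)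
    act-id {m₁} {m₂} M₁ M₂ = M₁ , M₂ , λ A₁ A₂ → A₁ , A₂ ,
      linear 2 (λ p n → # 1 ⊕ p ⊕ n ≲ p ⊕ n ⊕ # 20000) (PA m₁ M₁ A₁ + PA m₂ M₂ A₂) (NA m₁ M₁ A₁ + NA m₂ M₂ A₂)

    act-meld : ∀ {m₁ m₂ m₁' m₂' H₁ H₂ H' c e} → m₁ ≡ just H₁ → m₂ ≡ just H₂ → m₁' ≡ just H' → m₂' ≡ nothing → Meld H₁ H₂ H' c e → Act m₁ m₂ m₁' m₂' c e
    act-meld {H₁ = H₁} {H₂} {H'} {c} {e} refl refl refl refl t M' _ = proj₁ (t M') , proj₁ (proj₂ (t M')) , λ A₁ A₂ → proj₁ (proj₂ (proj₂ (t M')) A₁ A₂) , tt ,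
      linear 6 (λ c e p n q m → c ⊕ p ⊕ n ≲ q ⊕ m ⊕ e ⇒ c ⊕ (p ⊕ # 0) ⊕ n ≲ q ⊕ (m ⊕ # 0) ⊕ e)
        c e (PA (just H') M' (proj₁ (proj₂ (proj₂ (t M')) A₁ A₂))) (negH A₁ + negH A₂) (PA (just H₁) (proj₁ (t M')) A₁ + PA (just H₂) (proj₁ (proj₂ (t M'))) A₂) (negH (proj₁ (proj₂ (proj₂ (t M')) A₁ A₂))) (proj₂ (proj₂ (proj₂ (t M')) A₁ A₂))

    meld-comm : ∀ {H₁ H₂ H' c e} → Meld H₁ H₂ H' c e → Meld H₂ H₁ H' c e
    meld-comm {H₁} {H₂} {H'} {c} {e} t M' = proj₁ (proj₂ (t M')) , proj₁ (t M') , λ A₂ A₁ → proj₁ (proj₂ (proj₂ (t M')) A₁ A₂) ,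
      linear 8 (λ c e p n₁ n₂ q₁ q₂ m → c ⊕ p ⊕ (n₁ ⊕ n₂) ≲ (q₁ ⊕ q₂) ⊕ m ⊕ e ⇒ c ⊕ p ⊕ (n₂ ⊕ n₁) ≲ (q₂ ⊕ q₁) ⊕ m ⊕ e)
        c e (PA (just H') M' (proj₁ (proj₂ (proj₂ (t M')) A₁ A₂))) (negH A₁) (negH A₂) (PA (just H₁) (proj₁ (t M')) A₁) (PA (just H₂) (proj₁ (proj₂ (t M'))) A₂) (negH (proj₁ (proj₂ (proj₂ (t M')) A₁ A₂))) (proj₂ (proj₂ (proj₂ (t M')) A₁ A₂))

    -- One operation; the sums range over the handles up to s + 1, of which the
    -- last is not in use.
    record Good (W W' : World) (c e : ℕ) : Set where
      field
        next≤ : nextH W ≤ nextH W'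
        ok : Ok W'
        update : ∀ s → nextH W' ≤ s → Update (heaps W) (heaps W') (suc (suc s)) c e
    open Good

    single-update : ∀ {f h m s c e} → h < suc s → Act (f h) (f (suc s)) (upd f h m h) (upd f h m (suc s)) c e → Update f (upd f h m) (suc (suc s)) c e
    single-update {f} {h} {m} {s} p act = record { h = h ; h' = suc s ; h< = ≤-trans p (n≤1+n _) ; h'< = ≤-refl ; h≢h' = <⇒≢ p
      ; others = λ j q _ → upd-other f h m j q ; act = act }

    single : ∀ {W h H H' nN c e} → Ok W → heaps W h ≡ just H → TrS H H' c e → Fits H' →
             Good W (mkWorld (upd (heaps W) h (just H')) (nextH W) nN) c e
    single {W} {h} {H} {H'} {c = c} {e} okW eq t fits = record { next≤ = ≤-refl
      ; ok = record { unused = λ j p → trans (upd-other (heaps W) h (just H') j (λ q → <⇒≢ (≤-trans (used okW eq) p) (sym q))) (unused okW j p) ; fit = fit-upd (heaps W) h (just H') fits (fit okW) }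
      ; update = λ s p → single-update (≤-trans (used okW eq) (≤-trans p (n≤1+n s)))
          (act-single {H = H} {H'} {c} {e} eq (upd-same (heaps W) h (just H')) (upd-other (heaps W) h (just H') (suc s) (λ q → <⇒≢ (≤-trans (used okW eq) (≤-trans p (n≤1+n s))) (sym q))) t) }

    melded : ∀ {W h h' H H' Hm c e} → Ok W → h ≢ h' → heaps W h ≡ just H → heaps W h' ≡ just H' → Meld H H' Hm c e → Fits Hm →
             Good W (setHeap (setHeap W h' nothing) h (just Hm)) c e
    melded {W} {h} {h'} {H} {H'} {Hm} {c} {e} okW ne eq eq' t fits = record { next≤ = ≤-refl
      ; ok = record { unused = λ j p → trans (others j (λ q → <⇒≢ (≤-trans (used okW eq) p) (sym q)) (λ q → <⇒≢ (≤-trans (used okW eq') p) (sym q))) (unused okW j p)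
                    ; fit = fit-upd f₁ h (just Hm) fits (fit-upd (heaps W) h' nothing tt (fit okW)) }
      ; update = λ s p → record { h = h ; h' = h' ; h< = ≤-trans (used okW eq) (≤-trans p (≤-trans (n≤1+n s) (n≤1+n _))) ; h'< = ≤-trans (used okW eq') (≤-trans p (≤-trans (n≤1+n s) (n≤1+n _))) ; h≢h' = ne
          ; others = others
          ; act = act-meld {H₁ = H} {H'} {Hm} {c} {e} eq eq' (upd-same f₁ h (just Hm)) (trans (upd-other f₁ h (just Hm) h' (λ q → ne (sym q))) (upd-same (heaps W) h' nothing)) t } }
      where
      f₁ = upd (heaps W) h' nothing
      others : ∀ j → j ≢ h → j ≢ h' → upd f₁ h (just Hm) j ≡ heaps W j
      others j p q = trans (upd-other f₁ h (just Hm) j p) (upd-other (heaps W) h' nothing j q)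

    moved : ∀ {R R' B n} → cnts R' ≡ cnts R → Fits (mkHeap R B n) → Fits (mkHeap R' B n)
    moved {B = B} eq h = ≤-trans (≤-reflexive (cong (_+ cnts B) eq)) h

    meld-fits : ∀ {H H' H'' c R} → Fits H → Fits H' → Empties v H' H'' c → R ↭ roots H ++ roots H'' → cnts R + cnts (buffer H) ≤ size H + size H'
    meld-fits {H} {H'} {H''} {R = R} p q em perm = linear 8 (λ R r b r' b' r'' n n' → R ≐ r ⊕ r'' ⇒ r'' ≐ r' ⊕ b' ⇒ r ⊕ b ≲ n ⇒ r' ⊕ b' ≲ n' ⇒ R ⊕ b ≲ n ⊕ n')
      (cnts R) (cnts (roots H)) (cnts (buffer H)) (cnts (roots H')) (cnts (buffer H')) (cnts (roots H'')) (size H) (size H')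
      (trans (cnts-↭ perm) (Linking.cnts-++ 0 (roots H) (roots H''))) (emptied-cnt em) p q

    step-good : ∀ {W op W' c a} → Ok W → Step v W op W' c a → Good W W' c (K * a)
    step-good {W} okW s-make = record { next≤ = n≤1+n _
      ; ok = record { unused = λ j p → trans (upd-other (heaps W) (nextH W) (just emptyHeap) j (λ q → <⇒≢ p (sym q))) (unused okW j (≤-trans (n≤1+n _) p))
                    ; fit = fit-upd (heaps W) (nextH W) (just emptyHeap) z≤n (fit okW) }
      ; update = λ s p → single-update (≤-trans p (n≤1+n s))
          (act-new (unused okW (nextH W) ≤-refl) (upd-same (heaps W) (nextH W) (just emptyHeap)) (upd-other (heaps W) (nextH W) (just emptyHeap) (suc s) (λ q → <⇒≢ (≤-trans p (n≤1+n s)) (sym q)))) }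
    -- No heap changes, so any two distinct handles will do; 0 and 1 are always within the range of
    -- summation.
    step-good {W} okW (s-find eq) = record { next≤ = ≤-refl ; ok = okW
      ; update = λ s p → record { h = 0 ; h' = 1 ; h< = s≤s z≤n ; h'< = s≤s (s≤s z≤n) ; h≢h' = λ () ; others = λ _ _ _ → refl ; act = act-id {heaps W 0} {heaps W 1} } }
    step-good {W} okW (s-insert {H = H} {k} eq) = single okW eq (insert-trS {H} {nextN W} {k})
      (≤-trans (≤-reflexive (cong (_+ cnts (buffer H)) (cnts-↭ (addRoot-↭ (node (nextN W) k []) (roots H))))) (s≤s (fit-at okW eq)))
    step-good okW (s-meld₁ {H = H} {H'} {H''} ne eq eq' le em) = melded okW ne eq eq' (meld-tr {H} {H'} (fit-at okW eq') le em (meldRoots-↭ (roots H) (roots H'')) refl)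
      (meld-fits {H} {H'} (fit-at okW eq) (fit-at okW eq') em (meldRoots-↭ (roots H) (roots H'')))
    step-good okW (s-meld₂ {H = H} {H'} {H''} {e} ne eq eq' le em) = melded okW ne eq eq'
      (meld-comm {H'} {H} {mkHeap (meldRoots (roots H'') (roots H')) (buffer H') (size H + size H')} {1 + e} {K * 1} (meld-tr {H'} {H} (fit-at okW eq) le em perm (+-comm (size H) (size H'))))
      (≤-trans (meld-fits {H'} {H} (fit-at okW eq') (fit-at okW eq) em perm) (≤-reflexive (+-comm (size H') (size H))))
      where
      perm : meldRoots (roots H'') (roots H') ↭ roots H' ++ roots H''
      perm = ↭-trans (meldRoots-↭ (roots H'') (roots H')) (++-comm (roots H'') (roots H'))
    step-good okW (s-delmin {H = H} {x = x} {k} {cs} {rs} eq em e) = single okW eq (proj₁ d) (proj₂ d)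
      where
      d = delete-trS {H} {x = x} (fit-at okW eq) (delRoot [] k cs rs em e z≤n)
    step-good okW (s-dk-min {H = mkHeap _ B n} {x} {kx} {k} {cs} {rs} eq refl _) = single okW eq (same-trS {B = B} {n = n} (rekey {x} {kx} {k} {cs} {rs}) sim-refl refl) (fit-at okW eq)
    step-good okW (s-dk-root {H = mkHeap _ B n} {x} {kx} {k} {cs} {r} {pre} {post} eq refl _) = by (k <ₖ key r)
      where
      R = r ∷ pre ++ node x kx cs ∷ post
      by : ∀ b → Good _ (setHeap _ _ (just (mkHeap (if b then node x k cs ∷ r ∷ pre ++ post else r ∷ pre ++ node x k cs ∷ post) B n))) 1 (K * chargeDK n)
      by true = single okW eq (same-trS {B = B} {n = n} (rekey-root {x} {k} {kx} {cs} (r ∷ pre) post) sim-refl refl)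
        (moved {R} {node x k cs ∷ r ∷ pre ++ post} {B} {n} (sym (rekey-cnt {x} {k} {kx} {cs} (r ∷ pre) post)) (fit-at okW eq))
      by false = single okW eq (same-trS {B = B} {n = n} (rekey-there {x} {k} {kx} {cs} (r ∷ pre) post) sim-refl refl)
        (moved {R} {r ∷ pre ++ node x k cs ∷ post} {B} {n} (trans (cnts-↭ (shift (node x k cs) (r ∷ pre) post)) (sym (rekey-cnt {x} {k} {kx} {cs} (r ∷ pre) post))) (fit-at okW eq))
    step-good okW (s-dk-buf {H = mkHeap R _ n} {x} {kx} {k} {cs} {pre} {post} eq refl _) = single okW eq
      (same-trS {R} {n = n} sim-refl (rekey-there {x} {k} {kx} {cs} pre post) (trans (↭-length (shift (node x k cs) pre post)) (sym (↭-length (shift (node x kx cs) pre post)))))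
      (≤-trans (≤-reflexive (cong (cnts R +_) (trans (cnts-↭ (shift (node x k cs) pre post)) (sym (cnts-↭ (shift (node x kx cs) pre post)))))) (fit-at okW eq))
    step-good okW (s-dk-cutR {H = H} {x = x} {kx} {k} {cs} eq c _ me) = single okW eq (proj₁ d) (proj₂ d)
      where
      d = cutR-trS {H} {x} {kx} {k} {cs} (fit-at okW eq) c me
    step-good okW (s-dk-cutB {H = H} {x = x} {kx} {k} {cs} eq c _ me) = single okW eq (proj₁ d) (proj₂ d)
      where
      d = cutB-trS {H} {x} {kx} {k} {cs} (fit-at okW eq) c me
    step-good okW (s-del-min {H = H} {H'} eq _ dr) = single okW eq (proj₁ d) (proj₂ d)
      where
      d = delete-trS {H} {H'} (fit-at okW eq) dr
    step-good okW (s-del-roots {H = H} {x} eq _ _ e) = single okW eq (proj₁ d) (proj₂ d)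
      where
      d = delR-trS {H} {x} (fit-at okW eq) e
    step-good okW (s-del-buf {H = H} {x} eq e) = single okW eq (proj₁ d) (proj₂ d)
      where
      d = delB-trS {H} {x} (fit-at okW eq) e

    run-next : ∀ {W ops W' c a} → Ok W → Run v W ops W' c a → nextH W ≤ nextH W'
    run-next okW done = ≤-refl
    run-next okW (next st r) = ≤-trans (next≤ (step-good okW st)) (run-next (ok (step-good okW st)) r)

    -- The final marks are pulled back through the rest of the run before they are pulled back
    -- through the present operation; only then does the annotation move forward. The bound s serves
    -- the whole run, so all sums have the same range.
    run-sim : ∀ {W ops W' c a} s → Ok W → Run v W ops W' c a → nextH W' ≤ s → Sim (heaps W) (heaps W') (suc (suc s)) c (K * a)
    run-sim s okW done p M = M , λ A → A , ≤-trans (≤-reflexive refl) (m≤m+n _ _)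
    run-sim {W} {W' = W'} s okW (next {W₁ = W₁} {c = c} {a} {cs} {as} st r) p M₂ = proj₁ (f M₁) , λ A →
        let A₁ = proj₁ (proj₂ (f M₁) A)
            A₂ = proj₁ (proj₂ (g M₂) A₁)
        in A₂ , linear 11 (λ c c' e e' p n p₁ n₁ p₂ n₂ E → c ⊕ p₁ ⊕ n ≲ p ⊕ n₁ ⊕ e ⇒ c' ⊕ p₂ ⊕ n₁ ≲ p₁ ⊕ n₂ ⊕ e' ⇒ e ⊕ e' ≲ E ⇒ (c ⊕ c') ⊕ p₂ ⊕ n ≲ p ⊕ n₂ ⊕ E)
          c cs (K * a) (K * as) (sumP bound A) (sumN bound A) (sumP bound A₁) (sumN bound A₁) (sumP bound A₂) (sumN bound A₂) (K * (a + as))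
          (proj₂ (proj₂ (f M₁) A)) (proj₂ (proj₂ (g M₂) A₁)) (≤-reflexive (sym (*-distribˡ-+ K a as)))
      where
      bound = suc (suc s)
      gd = step-good okW st
      f : Sim (heaps W) (heaps W₁) bound c (K * a)
      f = sim-act (update gd s (≤-trans (run-next (ok gd) r) p))
      g : Sim (heaps W₁) (heaps W') bound cs (K * as)
      g = run-sim s (ok gd) r p
      M₁ = proj₁ (g M₂)

    -- The end of the run

    -- Marks at the end of the run: nothing is going to be deleted or cut.
    fullT : ∀ t → Mark t
    fullF : ∀ ts → Marks ts
    fullT (node i k cs) = mk false (fullF cs)
    fullF [] = []
    fullF (t ∷ ts) = edge (mass (fullT t)) (mass≤cnt (fullT t)) (fullT t) (fullF ts)

    self : ∀ m → (m ≡ᵇ m) ≡ true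
    self m = by (m ≡ᵇ m) (≡⇒≡ᵇ m m refl)
      where
      by : ∀ b → T b → b ≡ true
      by true _ = refl

    full-phantomT : ∀ t → phantomT (fullT t) ≡ 0
    full-phantomF : ∀ ts → phantomF (fullF ts) ≡ 0
    full-phantomT (node _ _ cs) = full-phantomF cs
    full-phantomF [] = refl
    full-phantomF (t ∷ ts) = cong₂ _+_ (cong₂ _+_ (cong (λ b → if b then 0 else 1) (self (mass (fullT t)))) (full-phantomT t)) (full-phantomF ts)

    -- With no mortal node and no phantom edge, the only debts left are the charges 3 ν, and each is
    -- below the 40 units per unit of class stored on the same edge.
    full-neg : ∀ t σ (a : Ann (fullT t)) → neg a ≤ pos σ a
    full-negF : ∀ ts {fs} (af : Anns (fullF ts) fs) → negF af ≤ posF af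
    full-neg (node _ _ cs) σ (ann af _ _) = full-negF cs af
    full-negF [] [] = z≤n
    full-negF (t ∷ ts) (edge l ρ ν h a af) = +-mono-≤ (+-mono-≤
      (≤-trans (≤-reflexive (cong (λ b → if b then 3 * ν else 0) (self m)))
        (≤-trans (*-mono-≤ {3} {40} {ν} {bits (ρ ∸ bits m)} (linear 0 (# 3 ≲ # 40)) (≤-trans h (m∸n≤m (bits (ρ ∸ bits m)) 1))) (≤-reflexive (cong (λ b → 40 * (if b then bits (ρ ∸ bits m) else 0)) (sym (self m))))))
      (full-neg t (sent ρ m m) a)) (full-negF ts af)
      where m = mass (fullT t)

    fullR : ∀ ts → MR ts
    fullR [] = []
    fullR (t ∷ ts) = fullT t ∷ fullR ts

    full-phantomR : ∀ ts → phantomR (fullR ts) ≡ 0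
    full-phantomR [] = refl
    full-phantomR (t ∷ ts) = cong₂ _+_ (full-phantomT t) (full-phantomR ts)

    full-negR : ∀ ts (as : Roots (fullR ts)) → rootsN as ≤ rootsP as
    full-negR [] [] = z≤n
    full-negR (t ∷ ts) (a ∷ as) = +-mono-≤ (full-neg t 0 a) (full-negR ts as)

    fullM : ∀ m → HM m
    fullM nothing = tt
    fullM (just H) = mh (fullR (roots H)) (fullR (buffer H))

    full-NA : ∀ m (A : HA m (fullM m)) → NA m (fullM m) A ≤ PA m (fullM m) A
    full-NA nothing _ = z≤n
    full-NA (just H) (ah ar ab) = linear 8 (λ nr nb g pr pb w b s → nr ≲ pr ⇒ nb ≲ pb ⇒ g ≐ # 0 ⇒ nr ⊕ nb ⊕ 220 ⊛ g ≲ (pr ⊕ pb ⊕ w ⊕ b) ⊕ s)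
      (rootsN ar) (rootsN ab) (G (size H) (phantomR (fullR (roots H)) + phantomR (fullR (buffer H)))) (rootsP ar) (rootsP ab) (weighH (fullM (just H))) (130 * bits (size H)) (stored H)
      (full-negR (roots H) ar) (full-negR (buffer H) ab) (cong (G (size H)) (cong₂ _+_ (full-phantomR (roots H)) (full-phantomR (buffer H))))

    sum-mono : ∀ n {g g'} → (∀ j → g j ≤ g' j) → sumTo n g ≤ sumTo n g'
    sum-mono zero h = z≤n
    sum-mono (suc n) h = +-mono-≤ (h n) (sum-mono n h)

    sum-0 : ∀ n → sumTo n (λ _ → 0) ≡ 0
    sum-0 zero = refl
    sum-0 (suc n) = sum-0 n

    -- Initially there is no heap, so the potential starts at 0; under the final marks debt does not
    -- exceed potential. The costs are therefore covered by the allowances alone.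
    run-cost : ∀ {ops W cost charge} → Run v initWorld ops W cost charge → cost ≤ K * charge
    run-cost {W = W} {cost} {charge} r = linear 6 (λ c p n p₀ n' e → c ⊕ p ⊕ n ≲ p₀ ⊕ n' ⊕ e ⇒ p₀ ≐ # 0 ⇒ n' ≲ p ⇒ c ≲ e)
      cost (sumP bound A') (sumN bound A) (sumP bound A) (sumN bound A') (K * charge) (proj₂ (proj₂ sim A)) (sum-0 bound) (sum-mono bound (λ j → full-NA (heaps W j) (A' j)))
      where
      bound = suc (suc (nextH W))
      M' : WM (heaps W)
      M' j = fullM (heaps W j)
      sim = run-sim (nextH W) (record { unused = λ _ _ → refl ; fit = λ _ → tt }) r ≤-refl M'
      A : WA (heaps initWorld) (proj₁ sim)
      A _ = tt
      A' = proj₁ (proj₂ sim A)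

theorem1 : Σ ℕ λ C → (O : DecTotalOrder 0ℓ 0ℓ 0ℓ) → (v : Variant) →
    (ops : List (Heaps.Op O)) → (W : Heaps.World O) → (cost charge : ℕ) →
    Heaps.Run O v (Heaps.initWorld O) ops W cost charge → cost ≤ C * charge
theorem1 = K , λ O v ops W cost charge r → Analysis.Amortized.run-cost O v r
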